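{- Let $p$ and $q$ be distinct odd primes and let $E_{p,q}: y^2=x^3-pqx$, with $2$-isogenous curve $\widehat{E_{p,q}}: y^2=x^3+4pqx$, $2$-isogeny $\phi:E_{p,q}\to\widehat{E_{p,q}}$ and dual isogeny $\widehat\phi$. Then $$S^{(\phi)}(E_{p,q}/\mathbb{Q})=\{1,pq\}\quad\text{and}\quad S^{(\widehat\phi)}(\widehat{E_{p,q}}/\mathbb{Q})=\{1,-pq\}$$ (as subsets of $\mathbb{Q}^*/(\mathbb{Q}^*)^2$) if and only if one of the following conditions holds: (i) $p\equiv 1 \pmod 4$, $q\equiv 1\pmod 4$, $pq\equiv 13\pmod{16}$ and $\left(\frac{p}{q}\right)=-1$; (ii) $p\not\equiv q\pmod 4$, $pq\equiv 3\pmod 8$ and $\left(\frac{p}{q}\right)=-1$; (iii) $p\equiv q\equiv 3\pmod 4$, $\left(\frac{p}{q}\right)=1$, $q\equiv 3\pmod 8$, and $p-q\equiv 8$ or $12\pmod{16}$; (iv) $p\equiv q\equiv 3\pmod 4$, $\left(\frac{p}{q}\right)=-1$, $p\equiv 3\pmod 8$, and $q-p\equiv 8$ or $12\pmod{16}$.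
   Context: $\left(\frac{\cdot}{\cdot}\right)$ is the Legendre symbol. The isogeny $\phi$ is given by $\phi(x,y)=\left(\frac{y^2}{x^2},\frac{y(x^2+pq)}{x^2}\right)$ for $x\neq 0$ and $\phi(0,0)=\phi(O)=O$. Let $S=\{\infty,2,p,q\}$ and let $\mathbb{Q}(S,2)=\{d\in\mathbb{Q}^*/(\mathbb{Q}^*)^2:\operatorname{ord}_\ell(d)\equiv 0\pmod 2\text{ for all primes }\ell\notin S\}$, which is represented by $\{\pm1,\pm2,\pm p,\pm q,\pm2p,\pm2q,\pm pq,\pm2pq\}$. The Selmer groups are $$S^{(\phi)}(E_{p,q}/\mathbb{Q})=\{d\in\mathbb{Q}(S,2): w^2=du^4+\tfrac{4pq}{d}z^4 \text{ has a solution } (u,w,z)\ne(0,0,0) \text{ in } \mathbb{Q}_v \text{ for all } v\in S\},$$ $$S^{(\widehat\phi)}(\widehat{E_{p,q}}/\mathbb{Q})=\{d\in\mathbb{Q}(S,2): w^2=du^4-\tfrac{16pq}{d}z^4 \text{ has a solution } (u,w,z)\ne(0,0,0) \text{ in } \mathbb{Q}_v \text{ for all } v\in S\},$$ where $\mathbb{Q}_\infty=\mathbb{R}$. These are the usual Selmer groups attached to the isogenies $\phi$ and $\widehat\phi$, viewed inside $\mathbb{Q}^*/(\mathbb{Q}^*)^2$. -}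

module Defs where

open import Data.Bool.Base using (if_then_else_)
open import Data.Fin.Base using (toℕ)
open import Data.Fin.Properties using (any?)
open import Data.Integer.Base as ℤ using (ℤ; +_; -[1+_])
open import Data.Integer.Divisibility as ℤ using ()
open import Data.Integer.Properties as ℤ using ()
open import Data.List.Base using (List; []; _∷_)
open import Data.List.Membership.Propositional using (_∈_; _∉_)
open import Data.Nat.Base as ℕ using (ℕ; zero; suc; _≥_)
open import Data.Nat.Divisibility using (_∣?_; divides)
open import Data.Nat.Primality using (Prime; prime⇒nonZero; prime[2])
open import Data.Nat.Properties using (m^n≢0)
open import Data.Product.Base using (_×_; ∃-syntax)
open import Data.Rational.Base as ℚ
  using (ℚ; 0ℚ; 1ℚ; _+_; _-_; _*_; _÷_; _/_; _<_; ↥_; ↧ₙ_)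
open import Data.Rational.Literals using (fromℤ)
open import Data.Rational.Properties using (_≟_)
open import Data.Sum.Base using (_⊎_)
open import Level using (0ℓ)
open import Relation.Binary.PropositionalEquality using (_≡_; sym; subst)
open import Relation.Nullary using (¬_; yes; no; does)
open import Relation.Unary using (Pred)

open import Algebra.Definitions.RawSemiring ℚ.+-*-rawSemiring using (_^_)

infix 4 _≡[mod_]_ _≢[mod_]_

_≡[mod_]_ : ℤ → ℕ → ℤ → Set
a ≡[mod m ] b = + m ℤ.∣ (a ℤ.- b)

_≢[mod_]_ : ℤ → ℕ → ℤ → Set
a ≢[mod m ] b = ¬ (a ≡[mod m ] b)

-- The Legendre symbol (a/ℓ), meaningful for ℓ an odd prime.
legendre : ℤ → ℕ → ℤ
legendre a ℓ =
  if does (ℓ ∣? ℤ.∣ a ∣) then + 0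
  else if does (any? {n = ℓ} λ x → ℓ ∣? ℤ.∣ (+ toℕ x) ℤ.* (+ toℕ x) ℤ.- a ∣)
    then + 1
    else -[1+ 0 ]

divisionCount : (fuel ℓ n : ℕ) → ℕ
divisionCount zero       ℓ n = 0
divisionCount (suc fuel) ℓ n with ℓ ∣? n
... | yes (divides n/ℓ _) = suc (divisionCount fuel ℓ n/ℓ)
... | no _                = 0

-- The exponent of ℓ in n, for ℓ ≥ 2 and n ≥ 1: since ℓ ^ k ∣ n forces k < n,
-- n is enough fuel.  The value at n = 0 is junk.
ordℕ : ℕ → ℕ → ℕ
ordℕ ℓ n = divisionCount n ℓ n

-- ord_ℓ on ℚ; the value at 0ℚ is junk.
ord : ℕ → ℚ → ℤ
ord ℓ x = + ordℕ ℓ ℤ.∣ ↥ x ∣ ℤ.- + ordℕ ℓ (↧ₙ x)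

data Place : Set where
  ∞   : Place
  fin : (ℓ : ℕ) → .(Prime ℓ) → Place

-- The normalised absolute values: ∣ x ∣[ fin ℓ _ ] = ℓ ^ (- ord ℓ x) for x ≠ 0.
∣_∣[_] : ℚ → Place → ℚ
∣ x ∣[ ∞ ] = ℚ.∣ x ∣
∣ x ∣[ fin ℓ ℓ-prime ] with x ≟ 0ℚ
... | yes _ = 0ℚ
... | no  _ = + (ℓ ℕ.^ ordℕ ℓ (↧ₙ x)) / ℓ ℕ.^ k
  where
  k = ordℕ ℓ ℤ.∣ ↥ x ∣
  instance
    ℓ^k≢0 : ℕ.NonZero (ℓ ℕ.^ k)
    ℓ^k≢0 = m^n≢0 ℓ k {{prime⇒nonZero ℓ-prime}}

Cauchy : Place → (ℕ → ℚ) → Set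
Cauchy v x = ∀ ε → 0ℚ < ε → ∃[ N ] ∀ i j → i ≥ N → j ≥ N → ∣ x i - x j ∣[ v ] < ε

infix 4 _≈[_]_

_≈[_]_ : (ℕ → ℚ) → Place → (ℕ → ℚ) → Set
x ≈[ v ] y = ∀ ε → 0ℚ < ε → ∃[ N ] ∀ i → i ≥ N → ∣ x i - y i ∣[ v ] < ε

-- The completion ℚ_v (ℝ for v = ∞, the ℓ-adic numbers for v = fin ℓ _) is the
-- ring of v-Cauchy sequences modulo null sequences: its equality is ≈[ v ] of
-- representatives, its ring operations are pointwise, and rationals embed as
-- constant sequences.
record Completion (v : Place) : Set where
  field
    seq    : ℕ → ℚ
    cauchy : Cauchy v seq

open Completion public

IsZero : ∀ {v} → Completion v → Set
IsZero {v} x = seq x ≈[ v ] λ _ → 0ℚ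

-- w² = a u⁴ + b z⁴ has a solution (u , w , z) ≠ (0 , 0 , 0) over ℚ_v.
Soluble : ℚ → ℚ → Place → Set
Soluble a b v =
  ∃[ u ] ∃[ w ] ∃[ z ]
    ¬ (IsZero {v} u × IsZero {v} w × IsZero {v} z) ×
    (λ n → seq w n ^ 2) ≈[ v ] (λ n → a * seq u n ^ 4 + b * seq z n ^ 4)

record ℚ* : Set where
  constructor mkℚ*
  field
    value        : ℚ
    .{{nonZero}} : ℚ.NonZero value

open ℚ* public using (value)

infix 4 _∼_

-- Equality in ℚ* / (ℚ*)².  A subset of this quotient is represented by its
-- preimage, a predicate on ℚ*.
_∼_ : ℚ* → ℚ* → Set
d ∼ e = ∃[ r ] value d ≡ value e * value r ^ 2

1* : ℚ*
1* = mkℚ* 1ℚ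

｛_,_｝ : ℚ* → ℚ* → Pred ℚ* 0ℓ
｛ a , b ｝ d = d ∼ a ⊎ d ∼ b

-- E : y² = x³ - pqx,  Ê : y² = x³ + 4pqx,  and φ : E → Ê is the 2-isogeny
-- φ (x , y) = (y² / x² , y (x² + pq) / x²)  with kernel {O , (0 , 0)}.
module TwoIsogeny (p q : ℕ) (p-prime : Prime p) (q-prime : Prime q) where

  pq : ℤ
  pq = + p ℤ.* + q

  private instance
    ∣pq∣≢0 : ℕ.NonZero ℤ.∣ pq ∣
    ∣pq∣≢0 = ℤ.i*j≢0 (+ p) (+ q) {{prime⇒nonZero p-prime}} {{prime⇒nonZero q-prime}}

    ∣-pq∣≢0 : ℕ.NonZero ℤ.∣ ℤ.- pq ∣
    ∣-pq∣≢0 = subst ℕ.NonZero (sym (ℤ.∣-i∣≡∣i∣ pq)) ∣pq∣≢0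

  pq* -pq* : ℚ*
  pq*  = mkℚ* (fromℤ pq)
  -pq* = mkℚ* (fromℤ (ℤ.- pq))

  S : List Place
  S = ∞ ∷ fin 2 prime[2] ∷ fin p p-prime ∷ fin q q-prime ∷ []

  ℚ⟨S,2⟩ : Pred ℚ* 0ℓ
  ℚ⟨S,2⟩ d =
    ∀ ℓ (ℓ-prime : Prime ℓ) → fin ℓ ℓ-prime ∉ S → ord ℓ (value d) ≡[mod 2 ] + 0

  SelmerSet : ℤ → Pred ℚ* 0ℓ
  SelmerSet c d@(mkℚ* _) =
    ℚ⟨S,2⟩ d × (∀ {v} → v ∈ S → Soluble (value d) (fromℤ c ÷ value d) v)

  -- S^(φ)(E/ℚ), cut out by the torsors  w² = d u⁴ + (4pq / d) z⁴.
  Selmer-φ : Pred ℚ* 0ℓ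
  Selmer-φ = SelmerSet (+ 4 ℤ.* pq)

  -- S^(φ̂)(Ê/ℚ), cut out by the torsors  w² = d u⁴ - (16pq / d) z⁴.
  Selmer-φ̂ : Pred ℚ* 0ℓ
  Selmer-φ̂ = SelmerSet (ℤ.- (+ 16 ℤ.* pq))

{-# OPTIONS --safe #-}

-- At each place of S a torsor w² = a u⁴ + b z⁴ is either soluble or anisotropic, in the strong
-- sense that u, w and z tend to 0 whenever w² − (a u⁴ + b z⁴) does. Which alternative holds is
-- decided at an odd prime exactly dividing one coefficient by the Legendre symbol of the other,
-- at 2 by the coefficients modulo 16 (the fourth powers of 2-adic units are 1 + 16 ℤ₂), and at ∞
-- by signs. Exchanging the coefficients up to fourth powers, and discarding the classes that are
-- insoluble at ∞ or (for φ̂ and even d) at 2, leaves six torsors, with d = 2, p, 2p for φ and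
-- d = −1, p, −p for φ̂. Quadratic reciprocity and its supplements express their solubility through
-- p mod 16, q mod 16 and (p/q), and a table compares the outcome with the four conditions.
--
-- Reciprocity is proved by counting modulo 2. With H = {1,…,(ℓ−1)/2}, a unit c is a square modulo ℓ
-- iff the number of pairs (x , y) ∈ H² with x y ≡ c is odd; this gives Gauss's lemma, and Gauss's
-- lemma turns the product of the two Legendre symbols into a lattice point count in a rectangle
-- that is symmetric under a point reflection.

module Submission where

open import Data.Bool.Base using (Bool; _xor_; _∧_; _∨_; false; if_then_else_; not; true)
open import Data.Bool.Properties as Bool using (not-involutive; xor-assoc; xor-comm; xor-identityʳ; xor-same; ∧-comm; ∧-distribˡ-xor; ∧-zeroʳ)
open import Data.Empty using (⊥; ⊥-elim)
open import Data.Fin.Base using (Fin; fromℕ<; toℕ)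
open import Data.Fin.Properties using (all?; any?; toℕ-fromℕ<)
open import Data.Integer.Base as ℤ using (+_; -[1+_]; 0ℤ; 1ℤ; ℤ)
open import Data.Integer.DivMod using (_%ℕ_; _/ℕ_; a≡a%ℕn+[a/ℕn]*n; n%ℕd<d)
import Data.Integer.Divisibility as ∣ᵤ
open import Data.Integer.Divisibility.Signed as Signed using (*-cancelˡ-∣; *-monoʳ-∣; ∣-trans; ∣m⇒∣m*n; ∣m∣n⇒∣m+n; ∣ᵤ⇒∣; ∣⇒∣ᵤ)
import Data.Integer.Properties as ℤ
open import Data.Integer.Tactic.RingSolver using (solve-∀)
open import Data.List.Membership.Propositional using (_∈_; _∉_)
open import Data.List.Relation.Unary.Any using (here; there)
open import Data.Nat.Base as ℕ using (_%_; suc; s≤s; zero; z≤n; ℕ; ⌊_/2⌋)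
import Data.Nat.Coprimality as Coprime
open import Data.Nat.DivMod using (m%n<n; m≡m%n+[m/n]*n)
open import Data.Nat.Divisibility as ℕ using (∣1⇒≡1; ∣m+n∣m⇒∣n; ∣⇒≤)
open import Data.Nat.Primality using (Prime; euclidsLemma; prime?; prime[2]; prime⇒irreducible; prime⇒nonTrivial; prime⇒nonZero)
open import Data.Nat.Primality.Factorisation using (factorise)
import Data.Nat.Properties as ℕ
open import Data.Product.Base as Product using (_,_; _×_; proj₁; proj₂; ∃-syntax)
open import Data.Rational.Base as ℚ using (0ℚ; 1/_; 1ℚ; ½; ℚ; ↥_; ↧_; ↧ₙ_)
open import Data.Rational.Literals using (fromℤ)
import Data.Rational.Properties as ℚ
import Data.Rational.Unnormalised.Base as ℚᵘ
import Data.Rational.Unnormalised.Properties as ℚᵘ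
open import Data.Sum.Base as Sum using ([_,_]′; _⊎_; inj₁; inj₂)
open import Function.Base using (_∘_; case_of_; id)
open import Function.Bundles using (_⇔_; mk⇔)
open import Relation.Binary.Definitions using (tri<; tri>; tri≈)
open import Relation.Nullary using (Dec; contradiction; does; no; yes; ¬_)
open import Relation.Nullary.Decidable using (_×-dec_; _⊎-dec_; dec-false; dec-true; does-⇔; from-yes; recompute; ¬?)
open import Relation.Unary using (_≐_)
open import Relation.Binary.PropositionalEquality
open import Defs

-- The classes {1, pq} and {1, -pq} are the images of the points (0 , 0) of the two curves, so they
-- belong to the Selmer sets in every case. Multiplying d by pq, respectively -pq, passes to the
-- partner class with the two coefficients of the torsor interchanged; the remaining classes
-- therefore come in pairs, and the theorem says when no further pair survives. The obstacle is the
-- constructive meaning of solubility. A solution is a triple of Cauchy sequences that are not all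
-- null, and no procedure tells which of them fails to be null. To refute it, all three have to be
-- shown null starting from an approximate equation. At a prime ℓ this is achieved by one congruence
-- modulo ℓ^M forcing ℓ, ℓ², ℓ to divide u, w, z: the quartic is homogeneous of degree 4 for the
-- weights 1, 2, 1, so the congruence can be iterated, and high divisibility of the quartic becomes
-- high divisibility of the coordinates. In the other direction an everywhere soluble torsor puts
-- its class into a Selmer set, where parities of orders at 2, p and q, and the sign for d = -1,
-- separate it from the two classes that are allowed.

-- Parities of counts over {1,...,n}.

module ParitySums where

  open import Data.Nat.Base using (_≤_)

  -- ⊕ n f is the parity of the number of x ∈ {1,…,n} with f x.
  ⊕ : ℕ → (ℕ → Bool) → Bool
  ⊕ zero f = false
  ⊕ (suc n) f = f (suc n) xor ⊕ n f

  parity : ℕ → Bool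
  parity n = ⊕ n λ _ → true

  _∈[1,_] : ℕ → ℕ → Set
  x ∈[1, n ] = 1 ≤ x × x ≤ n

  xor-interchange : ∀ a b c d → (a xor b) xor (c xor d) ≡ (a xor c) xor (b xor d)
  xor-interchange a b c d = begin
    (a xor b) xor (c xor d) ≡⟨ xor-assoc a b (c xor d) ⟩
    a xor (b xor (c xor d)) ≡⟨ cong (a xor_) (sym (xor-assoc b c d)) ⟩
    a xor ((b xor c) xor d) ≡⟨ cong (λ t → a xor (t xor d)) (xor-comm b c) ⟩
    a xor ((c xor b) xor d) ≡⟨ cong (a xor_) (xor-assoc c b d) ⟩
    a xor (c xor (b xor d)) ≡⟨ sym (xor-assoc a c (b xor d)) ⟩
    (a xor c) xor (b xor d) ∎
    where open ≡-Reasoning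

  ⊕-cong : ∀ n {f g} → (∀ x → x ∈[1, n ] → f x ≡ g x) → ⊕ n f ≡ ⊕ n g
  ⊕-cong zero eq = refl
  ⊕-cong (suc n) eq = cong₂ _xor_ (eq (suc n) (s≤s z≤n , ℕ.≤-refl))
    (⊕-cong n λ x (1≤x , x≤n) → eq x (1≤x , ℕ.m≤n⇒m≤1+n x≤n))

  ⊕-ext : ∀ n {f g} → (∀ x → f x ≡ g x) → ⊕ n f ≡ ⊕ n g
  ⊕-ext n eq = ⊕-cong n λ x _ → eq x

  ⊕-xor : ∀ n f g → ⊕ n (λ x → f x xor g x) ≡ ⊕ n f xor ⊕ n g
  ⊕-xor zero f g = refl
  ⊕-xor (suc n) f g = trans (cong ((f (suc n) xor g (suc n)) xor_) (⊕-xor n f g))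
    (xor-interchange (f (suc n)) (g (suc n)) (⊕ n f) (⊕ n g))

  ⊕-false : ∀ n {f} → (∀ x → x ∈[1, n ] → f x ≡ false) → ⊕ n f ≡ false
  ⊕-false zero eq = refl
  ⊕-false (suc n) eq rewrite eq (suc n) (s≤s z≤n , ℕ.≤-refl) =
    ⊕-false n λ x (1≤x , x≤n) → eq x (1≤x , ℕ.m≤n⇒m≤1+n x≤n)

  ⊕-not : ∀ n f → ⊕ n (not ∘ f) ≡ parity n xor ⊕ n f
  ⊕-not n f = ⊕-xor n (λ _ → true) f

  ⊕-∧ˡ : ∀ n c f → ⊕ n (λ x → c ∧ f x) ≡ c ∧ ⊕ n f
  ⊕-∧ˡ zero c f = sym (∧-zeroʳ c)
  ⊕-∧ˡ (suc n) c f = trans (cong (c ∧ f (suc n) xor_) (⊕-∧ˡ n c f)) (sym (∧-distribˡ-xor c (f (suc n)) (⊕ n f)))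

  ⊕-∧ʳ : ∀ n c f → ⊕ n (λ x → f x ∧ c) ≡ ⊕ n f ∧ c
  ⊕-∧ʳ n c f = trans (⊕-ext n λ x → ∧-comm (f x) c) (trans (⊕-∧ˡ n c f) (∧-comm c _))

  ⊕-swap : ∀ m n (f : ℕ → ℕ → Bool) → ⊕ m (λ x → ⊕ n (f x)) ≡ ⊕ n (λ y → ⊕ m λ x → f x y)
  ⊕-swap zero n f = sym (⊕-false n λ _ _ → refl)
  ⊕-swap (suc m) n f = trans (cong (⊕ n (f (suc m)) xor_) (⊕-swap m n f)) (sym (⊕-xor n _ _))

  -- Off the diagonal (x , y) and (y , x) contribute equally and cancel modulo 2.
  ⊕-symmetric : ∀ n (f : ℕ → ℕ → Bool) → (∀ x y → f x y ≡ f y x) →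
    ⊕ n (λ x → ⊕ n (f x)) ≡ ⊕ n λ x → f x x
  ⊕-symmetric zero f f-sym = refl
  ⊕-symmetric (suc n) f f-sym = begin
    (d xor r) xor ⊕ n (λ x → f x (suc n) xor ⊕ n (f x)) ≡⟨ cong ((d xor r) xor_) (⊕-xor n _ _) ⟩
    (d xor r) xor (⊕ n (λ x → f x (suc n)) xor ⊕ n λ x → ⊕ n (f x)) ≡⟨ cong (λ t → (d xor r) xor (t xor ⊕ n λ x → ⊕ n (f x))) (⊕-ext n λ x → f-sym x (suc n)) ⟩
    (d xor r) xor (r xor ⊕ n λ x → ⊕ n (f x)) ≡⟨ xor-assoc d r _ ⟩
    d xor (r xor (r xor ⊕ n λ x → ⊕ n (f x))) ≡⟨ cong (d xor_) (sym (xor-assoc r r _)) ⟩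
    d xor ((r xor r) xor ⊕ n λ x → ⊕ n (f x)) ≡⟨ cong (λ t → d xor (t xor ⊕ n λ x → ⊕ n (f x))) (xor-same r) ⟩
    d xor (⊕ n λ x → ⊕ n (f x)) ≡⟨ cong (d xor_) (⊕-symmetric n f f-sym) ⟩
    d xor (⊕ n λ x → f x x) ∎
    where
    open ≡-Reasoning
    d r : Bool
    d = f (suc n) (suc n)
    r = ⊕ n (f (suc n))

  ⊕-point : ∀ n f x₀ → x₀ ∈[1, n ] → (∀ x → x ∈[1, n ] → x ≢ x₀ → f x ≡ false) → ⊕ n f ≡ f x₀
  ⊕-point zero f (suc _) (_ , ()) others
  ⊕-point (suc n) f x₀ (1≤x₀ , x₀≤1+n) others with x₀ ℕ.≟ suc n
  ... | yes refl = trans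
          (cong (f x₀ xor_) (⊕-false n λ x (1≤x , x≤n) → others x (1≤x , ℕ.m≤n⇒m≤1+n x≤n) (ℕ.<⇒≢ (s≤s x≤n))))
          (xor-identityʳ (f x₀))
  ... | no x₀≢ = cong₂ _xor_
          (others (suc n) (s≤s z≤n , ℕ.≤-refl) (≢-sym x₀≢))
          (⊕-point n f x₀ (1≤x₀ , ℕ.s≤s⁻¹ (ℕ.≤∧≢⇒< x₀≤1+n x₀≢))
            λ x (1≤x , x≤n) → others x (1≤x , ℕ.m≤n⇒m≤1+n x≤n))

  ⊕-suc : ∀ n f → ⊕ (suc n) f ≡ f 1 xor ⊕ n (f ∘ suc)
  ⊕-suc zero f = refl
  ⊕-suc (suc n) f = begin
    f (2 ℕ.+ n) xor ⊕ (suc n) f ≡⟨ cong (f (2 ℕ.+ n) xor_) (⊕-suc n f) ⟩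
    f (2 ℕ.+ n) xor (f 1 xor ⊕ n (f ∘ suc)) ≡⟨ xor-assoc (f (2 ℕ.+ n)) (f 1) _ ⟨
    (f (2 ℕ.+ n) xor f 1) xor ⊕ n (f ∘ suc) ≡⟨ cong (_xor ⊕ n (f ∘ suc)) (xor-comm (f (2 ℕ.+ n)) (f 1)) ⟩
    (f 1 xor f (2 ℕ.+ n)) xor ⊕ n (f ∘ suc) ≡⟨ xor-assoc (f 1) (f (2 ℕ.+ n)) _ ⟩
    f 1 xor (f (2 ℕ.+ n) xor ⊕ n (f ∘ suc)) ∎
    where open ≡-Reasoning

  ⊕-reverse : ∀ n f → ⊕ n (λ x → f (suc n ℕ.∸ x)) ≡ ⊕ n f
  ⊕-reverse zero f = refl
  ⊕-reverse (suc n) f = trans (⊕-suc n λ x → f (suc (suc n) ℕ.∸ x)) (cong (f (suc n) xor_) (⊕-reverse n f))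

  ⊕-interval : ∀ k n → k ≤ n → ⊕ n (λ x → does (x ℕ.≤? k)) ≡ parity k
  ⊕-interval k zero z≤n = refl
  ⊕-interval k (suc n) k≤1+n with k ℕ.≟ suc n
  ... | yes refl = ⊕-cong (suc n) λ x (_ , x≤k) → dec-true (x ℕ.≤? k) x≤k
  ... | no k≢ = trans (cong (_xor ⊕ n λ x → does (x ℕ.≤? k)) (dec-false (suc n ℕ.≤? k) (ℕ.<⇒≱ (ℕ.≤∧≢⇒< k≤1+n k≢))))
                         (⊕-interval k n (ℕ.s≤s⁻¹ (ℕ.≤∧≢⇒< k≤1+n k≢)))

  parity-+ : ∀ m n → parity (m ℕ.+ n) ≡ parity m xor parity n
  parity-+ zero n = refl
  parity-+ (suc m) n = trans (cong not (parity-+ m n)) (not-xor (parity m) (parity n))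
    where
    not-xor : ∀ a b → not (a xor b) ≡ (not a) xor b
    not-xor false b = refl
    not-xor true false = refl
    not-xor true true = refl

  ⊕-const : ∀ n c → ⊕ n (λ _ → c) ≡ parity n ∧ c
  ⊕-const n c = ⊕-∧ʳ n c λ _ → true

-- Quadratic residues modulo an odd prime and Gauss's lemma.

module QuadraticResidues where

  open ParitySums
  open import Data.Nat.GCD using (module Bézout)
  open import Data.Integer.Base using (_+_; _-_; -_; _*_) renaming (∣_∣ to abs)
  open import Data.Integer.Divisibility.Signed

  -- The device behind many congruences below: a number is displayed as an explicit combination of
  -- known multiples, which leaves a polynomial identity to the ring solver.
  ∣-comb : ∀ {d a b} f g {x} → d ∣ a → d ∣ b → x ≡ f * a + g * b → d ∣ x
  ∣-comb f g d∣a d∣b refl = ∣m∣n⇒∣m+n (∣n⇒∣m*n f d∣a) (∣n⇒∣m*n g d∣b)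

  ∣-resp : ∀ {d x y} → x ≡ y → d ∣ x → d ∣ y
  ∣-resp refl d∣x = d∣x

  prime∣* : ∀ {ℓ} → Prime ℓ → ∀ a b → + ℓ ∣ a * b → + ℓ ∣ a ⊎ + ℓ ∣ b
  prime∣* {ℓ} ℓ-prime a b ℓ∣ab with euclidsLemma (abs a) (abs b) ℓ-prime (subst (ℓ ℕ.∣_) (ℤ.abs-* a b) (∣⇒∣ᵤ ℓ∣ab))
  ... | inj₁ ℓ∣a = inj₁ (∣ᵤ⇒∣ ℓ∣a)
  ... | inj₂ ℓ∣b = inj₂ (∣ᵤ⇒∣ ℓ∣b)

  prime∤1 : ∀ {ℓ} → Prime ℓ → ¬ + ℓ ∣ 1ℤ
  prime∤1 ℓ-prime ℓ∣1 = ℕ.nonTrivial⇒≢1 {{prime⇒nonTrivial ℓ-prime}} (ℕ.∣1⇒≡1 (∣⇒∣ᵤ ℓ∣1))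

  prime∣prime : ∀ {p q} → Prime p → Prime q → p ℕ.∣ q → p ≡ q
  prime∣prime p-prime q-prime p∣q with prime⇒irreducible q-prime p∣q
  ... | inj₁ refl = contradiction refl (ℕ.nonTrivial⇒≢1 {{prime⇒nonTrivial p-prime}})
  ... | inj₂ p≡q = p≡q

  ∣small⇒0 : ∀ {ℓ} x → abs x ℕ.< ℓ → + ℓ ∣ x → abs x ≡ 0
  ∣small⇒0 x x<ℓ ℓ∣x with abs x in eq
  ... | zero = refl
  ... | suc _ = contradiction (ℕ.∣⇒≤ {{subst ℕ.NonZero (sym eq) _}} (∣⇒∣ᵤ ℓ∣x)) (ℕ.<⇒≱ (subst (ℕ._< _) (sym eq) x<ℓ))

  inverse : ∀ {ℓ} → Prime ℓ → ∀ x → ¬ + ℓ ∣ x → ∃[ y ] + ℓ ∣ x * y - 1ℤ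
  inverse {ℓ} ℓ-prime x ℓ∤x with x %ℕ ℓ in r≡
    where instance _ = prime⇒nonZero ℓ-prime
  ... | zero = contradiction (divides (x /ℕ ℓ) (trans (a≡a%ℕn+[a/ℕn]*n x ℓ) (trans (cong (λ r → + r + (x /ℕ ℓ) * + ℓ) r≡) (ℤ.+-identityˡ _)))) ℓ∤x
    where instance _ = prime⇒nonZero ℓ-prime
  ... | suc r = bezout (Coprime.coprime-Bézout
                  (Coprime.prime⇒coprime ℓ-prime (subst (ℕ._< ℓ) r≡ (n%ℕd<d x ℓ))))
    where
    instance _ = prime⇒nonZero ℓ-prime
    k : ℤ
    k = x /ℕ ℓ
    x≡ : x ≡ + suc r + k * + ℓ
    x≡ = trans (a≡a%ℕn+[a/ℕn]*n x ℓ) (cong (λ r → + r + k * + ℓ) r≡)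
    bezout : Bézout.Identity 1 ℓ (suc r) → ∃[ y ] + ℓ ∣ x * y - 1ℤ
    -- The Bézout identity lives in ℕ and so comes in two sign patterns. In this one 1 + b (x mod ℓ)
    -- = a ℓ, hence the inverse is - b.
    bezout (Bézout.+- a b eq) = - + b , divides (- + a - k * + b) (begin
      x * (- + b) - 1ℤ ≡⟨ cong (λ x → x * (- + b) - 1ℤ) x≡ ⟩
      (+ suc r + k * + ℓ) * (- + b) - 1ℤ ≡⟨ lemma (+ suc r) k (+ ℓ) (+ b) ⟩
      - (1ℤ + + b * + suc r) - k * + b * + ℓ ≡⟨ cong (λ t → - (1ℤ + t) - k * + b * + ℓ) (sym (ℤ.pos-* b (suc r))) ⟩
      - (+ (1 ℕ.+ b ℕ.* suc r)) - k * + b * + ℓ ≡⟨ cong (λ t → - (+ t) - k * + b * + ℓ) eq ⟩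
      - (+ (a ℕ.* ℓ)) - k * + b * + ℓ ≡⟨ cong (λ t → - t - k * + b * + ℓ) (ℤ.pos-* a ℓ) ⟩
      - (+ a * + ℓ) - k * + b * + ℓ ≡⟨ lemma′ (+ a) k (+ ℓ) (+ b) ⟩
      (- + a - k * + b) * + ℓ ∎)
      where
      open ≡-Reasoning
      lemma : ∀ r k l b → (r + k * l) * (- b) - 1ℤ ≡ - (1ℤ + b * r) - k * b * l
      lemma = solve-∀
      lemma′ : ∀ a k l b → - (a * l) - k * b * l ≡ (- a - k * b) * l
      lemma′ = solve-∀
    bezout (Bézout.-+ a b eq) = + b , divides (+ a + k * + b) (begin
      x * + b - 1ℤ ≡⟨ cong (λ x → x * + b - 1ℤ) x≡ ⟩
      (+ suc r + k * + ℓ) * + b - 1ℤ ≡⟨ lemma (+ suc r) k (+ ℓ) (+ b) ⟩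
      + b * + suc r - 1ℤ + k * + b * + ℓ ≡⟨ cong (λ t → t - 1ℤ + k * + b * + ℓ) (sym (ℤ.pos-* b (suc r))) ⟩
      + (b ℕ.* suc r) - 1ℤ + k * + b * + ℓ ≡⟨ cong (λ t → + t - 1ℤ + k * + b * + ℓ) (sym eq) ⟩
      + (1 ℕ.+ a ℕ.* ℓ) - 1ℤ + k * + b * + ℓ ≡⟨ cong (λ t → 1ℤ + t - 1ℤ + k * + b * + ℓ) (ℤ.pos-* a ℓ) ⟩
      1ℤ + + a * + ℓ - 1ℤ + k * + b * + ℓ ≡⟨ lemma′ (+ a) k (+ ℓ) (+ b) ⟩
      (+ a + k * + b) * + ℓ ∎)
      where
      open ≡-Reasoning
      lemma : ∀ r k l b → (r + k * l) * b - 1ℤ ≡ b * r - 1ℤ + k * b * l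
      lemma = solve-∀
      lemma′ : ∀ a k l b → 1ℤ + a * l - 1ℤ + k * b * l ≡ (a + k * b) * l
      lemma′ = solve-∀

  -- The Legendre symbol as a Boolean, for a prime to ℓ.
  isSquare : ℕ → ℤ → Bool
  isSquare ℓ a = does (any? {n = ℓ} λ x → ℓ ℕ.∣? abs (+ toℕ x * + toℕ x - a))

  IsRoot : ∀ ℓ → ℤ → Fin ℓ → Set
  IsRoot ℓ a x = ℓ ℕ.∣ abs (+ toℕ x * + toℕ x - a)

  module OddPrime (ℓ h : ℕ) (ℓ-prime : Prime ℓ) (ℓ≡1+2h : ℓ ≡ suc (h ℕ.+ h)) where

    instance
      ℓ≢0 : ℕ.NonZero ℓ
      ℓ≢0 = prime⇒nonZero ℓ-prime

    Unit : ℤ → Set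
    Unit a = ¬ + ℓ ∣ a

    unit-* : ∀ {a b} → Unit a → Unit b → Unit (a * b)
    unit-* {a} {b} ℓ∤a ℓ∤b ℓ∣ab = [ ℓ∤a , ℓ∤b ]′ (prime∣* ℓ-prime a b ℓ∣ab)

    2h<ℓ : h ℕ.+ h ℕ.< ℓ
    2h<ℓ = ℕ.≤-reflexive (sym ℓ≡1+2h)

    unit-H : ∀ {y} → y ∈[1, h ] → Unit (+ y)
    unit-H {y} (1≤y , y≤h) ℓ∣y = ℕ.<⇒≢ 1≤y (sym (∣small⇒0 (+ y) (ℕ.≤-<-trans (ℕ.≤-trans y≤h (ℕ.m≤m+n h h)) 2h<ℓ) ℓ∣y))

    H-sum : ∀ {x y} → x ∈[1, h ] → y ∈[1, h ] → Unit (+ x + + y)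
    H-sum {x} {y} (1≤x , x≤h) (1≤y , y≤h) ℓ∣x+y =
      ℕ.<⇒≢ (ℕ.≤-trans 1≤x (ℕ.m≤m+n x y)) (sym (∣small⇒0 (+ (x ℕ.+ y)) (ℕ.≤-<-trans (ℕ.+-mono-≤ x≤h y≤h) 2h<ℓ) ℓ∣x+y))

    H-difference : ∀ {x y} → x ∈[1, h ] → y ∈[1, h ] → + ℓ ∣ + x - + y → x ≡ y
    H-difference {x} {y} (1≤x , x≤h) (1≤y , y≤h) ℓ∣x-y = ℤ.+-injective (ℤ.i-j≡0⇒i≡j (+ x) (+ y) (ℤ.∣i∣≡0⇒i≡0
      (∣small⇒0 (+ x - + y) (ℕ.≤-<-trans (ℕ.≤-trans (ℤ.∣i-j∣≤∣i∣+∣j∣ (+ x) (+ y)) (ℕ.+-mono-≤ x≤h y≤h)) 2h<ℓ) ℓ∣x-y)))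

    infix 4 _≋_ _≋?_

    _≋_ : ℤ → ℤ → Set
    a ≋ b = + ℓ ∣ a - b

    _≋?_ : ∀ a b → Dec (a ≋ b)
    a ≋? b = + ℓ ∣? a - b

    ≋-trans : ∀ {a b c} → a ≋ b → b ≋ c → a ≋ c
    ≋-trans {a} {b} {c} p q = ∣-comb 1ℤ 1ℤ p q (lemma a b c)
      where
      lemma : ∀ a b c → a - c ≡ 1ℤ * (a - b) + 1ℤ * (b - c)
      lemma = solve-∀

    ≋-sym : ∀ {a b} → a ≋ b → b ≋ a
    ≋-sym {a} {b} p = ∣-resp (ℤ.neg-distrib-+ a (- b) ⟨ trans ⟩ trans (cong (_+_ (- a)) (ℤ.neg-involutive b)) (ℤ.+-comm (- a) b)) (∣m⇒∣-m p)
      where open import Function.Base using (_⟨_⟩_)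

    ≋-neg : ∀ {a b} → - a ≋ b → a ≋ - b
    ≋-neg {a} {b} p = ∣-resp (lemma a b) (∣m⇒∣-m p)
      where
      lemma : ∀ a b → - (- a - b) ≡ a - (- b)
      lemma = solve-∀

    ≋-*ˡ : ∀ c {a b} → a ≋ b → c * a ≋ c * b
    ≋-*ˡ c {a} {b} p = ∣-resp (lemma c a b) (∣n⇒∣m*n c p)
      where
      lemma : ∀ c a b → c * (a - b) ≡ c * a - c * b
      lemma = solve-∀

    ≋-reflexive : ∀ {a b} → a ≡ b → a ≋ b
    ≋-reflexive {a} refl = divides 0ℤ (ℤ.+-inverseʳ a)

    unit-≋ : ∀ {a b} → a ≋ b → Unit a → Unit b
    unit-≋ {a} {b} p ℓ∤a ℓ∣b = ℓ∤a (∣-resp (lemma a b) (∣m∣n⇒∣m+n p ℓ∣b))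
      where
      lemma : ∀ a b → a - b + b ≡ a
      lemma = solve-∀

    unit-neg : ∀ {a} → Unit a → Unit (- a)
    unit-neg {a} ℓ∤a ℓ∣-a = ℓ∤a (∣-resp (ℤ.neg-involutive a) (∣m⇒∣-m ℓ∣-a))

    half-system : ∀ n → Unit n → ∃[ y ] y ∈[1, h ] × (n ≋ + y ⊎ - n ≋ + y)
    half-system n ℓ∤n with n %ℕ ℓ in r≡
    ... | r = case r ℕ.≤? h of λ where
        (yes r≤h) → r , (1≤r , r≤h) , inj₁ n≋r
        (no r≰h) → ℓ ℕ.∸ r , (ℕ.m<n⇒0<n∸m r<ℓ , ℓ∸r≤h r≰h) , inj₂ (∣-comb (- 1ℤ) (- 1ℤ) n≋r ∣-refl
          (trans (cong (λ t → - n - t) (trans (sym (ℤ.⊖-≥ (ℕ.<⇒≤ r<ℓ))) (sym (ℤ.m-n≡m⊖n ℓ r)))) (lemma n (+ r) (+ ℓ))))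
      where
      lemma : ∀ n r l → - n - (l - r) ≡ - 1ℤ * (n - r) + - 1ℤ * l
      lemma = solve-∀
      lemma′ : ∀ r k l → r + k * l - r ≡ k * l
      lemma′ = solve-∀
      n≋r : n ≋ + r
      n≋r = divides (n /ℕ ℓ) (trans (cong (_- + r) (trans (a≡a%ℕn+[a/ℕn]*n n ℓ) (cong (λ r → + r + (n /ℕ ℓ) * + ℓ) r≡))) (lemma′ (+ r) (n /ℕ ℓ) (+ ℓ)))
      r<ℓ : r ℕ.< ℓ
      r<ℓ = subst (ℕ._< ℓ) r≡ (n%ℕd<d n ℓ)
      1≤r : 1 ℕ.≤ r
      1≤r = ℕ.n≢0⇒n>0 λ where refl → ℓ∤n (∣-resp (ℤ.+-identityʳ n) n≋r)
      ℓ∸r≤h : ¬ r ℕ.≤ h → ℓ ℕ.∸ r ℕ.≤ h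
      ℓ∸r≤h r≰h = ℕ.m≤n+o⇒m∸n≤o ℓ r (ℕ.≤-trans (ℕ.≤-reflexive ℓ≡1+2h) (ℕ.+-monoˡ-≤ h (ℕ.≰⇒> r≰h)))

    -- At most one y in H is congruent to n, so the parity of the count is the truth value. Written
    -- as a sum it can be split and reordered with other sums over H.
    inH : ℤ → Bool
    inH n = ⊕ h λ y → does (n ≋? + y)

    inH-cong : ∀ {m n} → m ≋ n → inH m ≡ inH n
    inH-cong {m} {n} m≋n = ⊕-ext h λ y →
      does-⇔ (mk⇔ (≋-trans {n} {m} {+ y} (≋-sym {m} {n} m≋n)) (≋-trans {m} {n} {+ y} m≋n)) (m ≋? + y) (n ≋? + y)

    ≋H-unique : ∀ {n x y} → x ∈[1, h ] → y ∈[1, h ] → n ≋ + x → n ≋ + y → x ≡ y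
    ≋H-unique {n} {x} {y} x∈H y∈H n≋x n≋y = H-difference x∈H y∈H (≋-trans {+ x} {n} {+ y} (≋-sym {n} {+ x} n≋x) n≋y)

    ≋H-opposite : ∀ {n x y} → x ∈[1, h ] → y ∈[1, h ] → n ≋ + x → ¬ - n ≋ + y
    ≋H-opposite {n} {x} {y} x∈H y∈H n≋x -n≋y = H-sum x∈H y∈H (∣-comb (- 1ℤ) (- 1ℤ) n≋x -n≋y (lemma n (+ x) (+ y)))
      where
      lemma : ∀ n x y → x + y ≡ - 1ℤ * (n - x) + - 1ℤ * (- n - y)
      lemma = solve-∀

    inH-true : ∀ {n y} → y ∈[1, h ] → n ≋ + y → inH n ≡ true
    inH-true {n} {y} y∈H n≋y = trans
      (⊕-point h _ y y∈H λ x x∈H x≢y → dec-false (n ≋? + x) λ n≋x → x≢y (≋H-unique {n} x∈H y∈H n≋x n≋y))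
      (dec-true (n ≋? + y) n≋y)

    inH-false : ∀ {n y} → y ∈[1, h ] → n ≋ + y → inH (- n) ≡ false
    inH-false {n} y∈H n≋y = ⊕-false h λ x x∈H → dec-false (- n ≋? + x) (≋H-opposite {n} y∈H x∈H n≋y)

    inH-neg : ∀ n → Unit n → inH (- n) ≡ not (inH n)
    inH-neg n ℓ∤n with half-system n ℓ∤n
    ... | y , y∈H , inj₁ n≋y = trans (inH-false {n} y∈H n≋y) (cong not (sym (inH-true {n} y∈H n≋y)))
    ... | y , y∈H , inj₂ -n≋y = trans (inH-true { - n} y∈H -n≋y)
            (cong not (sym (trans (cong inH (sym (ℤ.neg-involutive n))) (inH-false { - n} y∈H -n≋y))))

    -- For n prime to ℓ this singles out the y in H with n ≡ ± y. The two signs exclude each other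
    -- on H, so `xor` acts as a disjunction.
    ±≋ : ℤ → ℕ → Bool
    ±≋ n y = does (n ≋? + y) xor does (- n ≋? + y)

    -- If n ≡ y then a n ≡ a y; if n ≡ - y the value flips, which `inH (- n)` records. Spreading
    -- `inH (a * + y)` over all y with the weight `±≋ n y` makes the formula linear, ready for an
    -- exchange of sums.
    inH-* : ∀ a n → Unit a → Unit n → inH (a * n) ≡ ⊕ h (λ y → ±≋ n y ∧ inH (a * + y)) xor inH (- n)
    inH-* a n ℓ∤a ℓ∤n with half-system n ℓ∤n
    ... | y , y∈H , inj₁ n≋y = begin
      inH (a * n) ≡⟨ inH-cong {a * n} {a * + y} (≋-*ˡ a {n} {+ y} n≋y) ⟩
      inH (a * + y) ≡⟨ cong (_∧ inH (a * + y)) (cong₂ _xor_ (dec-true (n ≋? + y) n≋y) (dec-false (- n ≋? + y) (≋H-opposite {n} y∈H y∈H n≋y))) ⟨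
      ±≋ n y ∧ inH (a * + y) ≡⟨ ⊕-point h _ y y∈H (λ x x∈H x≢y → cong (_∧ inH (a * + x)) (cong₂ _xor_
                                                                 (dec-false (n ≋? + x) λ n≋x → x≢y (≋H-unique {n} x∈H y∈H n≋x n≋y))
                                                                 (dec-false (- n ≋? + x) (≋H-opposite {n} y∈H x∈H n≋y)))) ⟨
      ⊕ h (λ y → ±≋ n y ∧ inH (a * + y)) ≡⟨ xor-identityʳ _ ⟨
      ⊕ h (λ y → ±≋ n y ∧ inH (a * + y)) xor false ≡⟨ cong (⊕ h (λ y → ±≋ n y ∧ inH (a * + y)) xor_) (inH-false {n} y∈H n≋y) ⟨
      ⊕ h (λ y → ±≋ n y ∧ inH (a * + y)) xor inH (- n) ∎
      where open ≡-Reasoning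
    ... | y , y∈H , inj₂ -n≋y = begin
      inH (a * n) ≡⟨ inH-cong {a * n} { - (a * + y)} (∣-resp (lemma a n (+ y)) (∣n⇒∣m*n (- a) -n≋y)) ⟩
      inH (- (a * + y)) ≡⟨ inH-neg (a * + y) (unit-* {a} ℓ∤a (unit-H y∈H)) ⟩
      true xor inH (a * + y) ≡⟨ xor-comm true (inH (a * + y)) ⟩
      inH (a * + y) xor true ≡⟨ cong (λ t → (t ∧ inH (a * + y)) xor true) (cong₂ _xor_ (dec-false (n ≋? + y) (opp y∈H)) (dec-true (- n ≋? + y) -n≋y)) ⟨
      (±≋ n y ∧ inH (a * + y)) xor true ≡⟨ cong (_xor true) (⊕-point h (λ y → ±≋ n y ∧ inH (a * + y)) y y∈H (λ x x∈H x≢y → cong (_∧ inH (a * + x)) (cong₂ _xor_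
                                                                 (dec-false (n ≋? + x) (opp x∈H))
                                                                 (dec-false (- n ≋? + x) λ -n≋x → x≢y (≋H-unique { - n} x∈H y∈H -n≋x -n≋y))))) ⟨
      ⊕ h (λ y → ±≋ n y ∧ inH (a * + y)) xor true ≡⟨ cong (⊕ h (λ y → ±≋ n y ∧ inH (a * + y)) xor_) (inH-true { - n} y∈H -n≋y) ⟨
      ⊕ h (λ y → ±≋ n y ∧ inH (a * + y)) xor inH (- n) ∎
      where
      open ≡-Reasoning
      lemma : ∀ a n y → - a * (- n - y) ≡ a * n - - (a * y)
      lemma = solve-∀
      opp : ∀ {x} → x ∈[1, h ] → ¬ n ≋ + x
      opp {x} x∈H n≋x = ≋H-opposite {n} x∈H y∈H n≋x -n≋y

    -- Up to sign g permutes H, so summing inH-* over H leaves only the sign changes of g.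
    ⊕-inH-twist : ∀ a (g g⁻¹ : ℕ → ℤ) → Unit a → (∀ {x} → x ∈[1, h ] → Unit (g x)) → (∀ {y} → y ∈[1, h ] → Unit (g⁻¹ y)) →
      (∀ x y → x ∈[1, h ] → y ∈[1, h ] → ±≋ (g x) y ≡ ±≋ (g⁻¹ y) x) →
      ⊕ h (λ x → inH (a * g x)) ≡ ⊕ h (λ y → inH (a * + y)) xor ⊕ h λ x → inH (- g x)
    ⊕-inH-twist a g g⁻¹ ℓ∤a unit-g unit-g⁻¹ adjoint = begin
      ⊕ h (λ x → inH (a * g x))
        ≡⟨ ⊕-cong h (λ x x∈H → inH-* a (g x) ℓ∤a (unit-g x∈H)) ⟩
      ⊕ h (λ x → ⊕ h (λ y → ±≋ (g x) y ∧ inH (a * + y)) xor inH (- g x))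
        ≡⟨ ⊕-xor h _ _ ⟩
      ⊕ h (λ x → ⊕ h (λ y → ±≋ (g x) y ∧ inH (a * + y))) xor N
        ≡⟨ cong (_xor N) (⊕-swap h h (λ x y → ±≋ (g x) y ∧ inH (a * + y))) ⟩
      ⊕ h (λ y → ⊕ h (λ x → ±≋ (g x) y ∧ inH (a * + y))) xor N
        ≡⟨ cong (_xor N) (⊕-cong h λ y y∈H → trans (⊕-∧ʳ h (inH (a * + y)) (λ x → ±≋ (g x) y)) (cong (_∧ inH (a * + y)) (⊕-±≋ y y∈H))) ⟩
      ⊕ h (λ y → inH (a * + y)) xor N
        ∎
      where
      open ≡-Reasoning
      N : Bool
      N = ⊕ h λ x → inH (- g x)
      xor-not : ∀ b → b xor not b ≡ true
      xor-not false = refl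
      xor-not true = refl
      -- By adjointness the sum over x counts the x in H with `g⁻¹ y` ≡ ± x, and there is exactly
      -- one.
      ⊕-±≋ : ∀ y → y ∈[1, h ] → ⊕ h (λ x → ±≋ (g x) y) ≡ true
      ⊕-±≋ y y∈H = trans (⊕-cong h λ x x∈H → adjoint x y x∈H y∈H)
        (trans (⊕-xor h _ _) (trans (cong (inH (g⁻¹ y) xor_) (inH-neg (g⁻¹ y) (unit-g⁻¹ y∈H))) (xor-not (inH (g⁻¹ y)))))

    -- The default 0 at multiples of ℓ makes the inverse a total function on ℤ.
    inv : ℤ → ℤ
    inv x with + ℓ ∣? x
    ... | yes _ = 0ℤ
    ... | no ℓ∤x = proj₁ (inverse ℓ-prime x ℓ∤x)

    *-inv : ∀ x → Unit x → x * inv x ≋ 1ℤ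
    *-inv x ℓ∤x with + ℓ ∣? x
    ... | yes ℓ∣x = contradiction ℓ∣x ℓ∤x
    ... | no ℓ∤x′ = proj₂ (inverse ℓ-prime x ℓ∤x′)

    unit-inv : ∀ {x} → Unit x → Unit (inv x)
    unit-inv {x} ℓ∤x ℓ∣inv = prime∤1 ℓ-prime (∣-comb x (- 1ℤ) ℓ∣inv (*-inv x ℓ∤x) (lemma x (inv x)))
      where
      lemma : ∀ x y → 1ℤ ≡ x * y + - 1ℤ * (x * y - 1ℤ)
      lemma = solve-∀

    ≋-divide : ∀ b m n → Unit b → b * m ≋ n → inv b * n ≋ m
    ≋-divide b m n ℓ∤b bm≋n = ∣-comb m (- inv b) (*-inv b ℓ∤b) bm≋n (lemma b m n (inv b))
      where
      lemma : ∀ b m n c → c * n - m ≡ m * (b * c - 1ℤ) + - c * (b * m - n)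
      lemma = solve-∀

    ≋-multiply : ∀ b m n → Unit b → inv b * n ≋ m → b * m ≋ n
    ≋-multiply b m n ℓ∤b n/b≋m = ∣-comb n (- b) (*-inv b ℓ∤b) n/b≋m (lemma b m n (inv b))
      where
      lemma : ∀ b m n c → b * m - n ≡ n * (b * c - 1ℤ) + - b * (c * n - m)
      lemma = solve-∀

    -- The twist by multiplication by b, whose adjoint is multiplication by 1/b. It is the source of
    -- the multiplicativity of the residue symbol.
    ⊕-inH-* : ∀ a b → Unit a → Unit b →
      ⊕ h (λ x → inH (a * (b * + x))) ≡ ⊕ h (λ y → inH (a * + y)) xor ⊕ h λ x → inH (- (b * + x))
    ⊕-inH-* a b ℓ∤a ℓ∤b = ⊕-inH-twist a (λ x → b * + x) (λ y → inv b * + y) ℓ∤a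
      (λ x∈H → unit-* {b} ℓ∤b (unit-H x∈H)) (λ y∈H → unit-* {inv b} (unit-inv ℓ∤b) (unit-H y∈H))
      λ x y _ _ → cong₂ _xor_
        (does-⇔ (mk⇔ (≋-divide b (+ x) (+ y) ℓ∤b) (≋-multiply b (+ x) (+ y) ℓ∤b)) (b * + x ≋? + y) (inv b * + y ≋? + x))
        (does-⇔ (mk⇔
          (λ p → ≋-neg′ {inv b * + y} {+ x} (≋-divide b (- + x) (+ y) ℓ∤b (∣-resp (cong (_- + y) (ℤ.neg-distribʳ-* b (+ x))) p)))
          (λ p → ∣-resp (cong (_- + y) (sym (ℤ.neg-distribʳ-* b (+ x)))) (≋-multiply b (- + x) (+ y) ℓ∤b (≋-neg {inv b * + y} {+ x} p))))
          (- (b * + x) ≋? + y) (- (inv b * + y) ≋? + x))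
      where
      ≋-neg′ : ∀ {a b} → a ≋ - b → - a ≋ b
      ≋-neg′ {a} {b} p = ∣-resp (lemma a b) (∣m⇒∣-m p)
        where
        lemma : ∀ a b → - (a - (- b)) ≡ - a - b
        lemma = solve-∀

    -- Inversion is its own adjoint, because x y ≡ ± 1 is symmetric in x and y.
    ⊕-inH-inv : ∀ a → Unit a →
      ⊕ h (λ x → inH (a * inv (+ x))) ≡ ⊕ h (λ y → inH (a * + y)) xor ⊕ h λ x → inH (- inv (+ x))
    ⊕-inH-inv a ℓ∤a = ⊕-inH-twist a (inv ∘ +_) (inv ∘ +_) ℓ∤a (unit-inv ∘ unit-H) (unit-inv ∘ unit-H)
      λ x y x∈H y∈H → cong₂ _xor_
        (does-⇔ (mk⇔ (swap x y x∈H y∈H) (swap y x y∈H x∈H)) (inv (+ x) ≋? + y) (inv (+ y) ≋? + x))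
        (does-⇔ (mk⇔ (swap′ x y x∈H y∈H) (swap′ y x y∈H x∈H)) (- inv (+ x) ≋? + y) (- inv (+ y) ≋? + x))
      where
      lemma : ∀ x y y' → y' - x ≡ x * (y * y' - 1ℤ) + (- y') * (x * y - 1ℤ)
      lemma = solve-∀
      lemma₁ : ∀ x y x' → x * y - 1ℤ ≡ 1ℤ * (x * x' - 1ℤ) + (- x) * (x' - y)
      lemma₁ = solve-∀
      lemma₂ : ∀ x y x' → x * y + 1ℤ ≡ (- 1ℤ) * (x * x' - 1ℤ) + (- x) * (- x' - y)
      lemma₂ = solve-∀
      lemma₃ : ∀ x y y' → - y' - x ≡ x * (y * y' - 1ℤ) + (- y') * (x * y + 1ℤ)
      lemma₃ = solve-∀
      swap : ∀ x y → x ∈[1, h ] → y ∈[1, h ] → inv (+ x) ≋ + y → inv (+ y) ≋ + x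
      swap x y x∈H y∈H p = ∣-comb (+ x) (- inv (+ y)) (*-inv (+ y) (unit-H y∈H))
        (∣-comb 1ℤ (- + x) (*-inv (+ x) (unit-H x∈H)) p (lemma₁ (+ x) (+ y) (inv (+ x)))) (lemma (+ x) (+ y) (inv (+ y)))
      swap′ : ∀ x y → x ∈[1, h ] → y ∈[1, h ] → - inv (+ x) ≋ + y → - inv (+ y) ≋ + x
      swap′ x y x∈H y∈H p = ∣-comb (+ x) (- inv (+ y)) (*-inv (+ y) (unit-H y∈H))
        (∣-comb (- 1ℤ) (- + x) (*-inv (+ x) (unit-H x∈H)) p (lemma₂ (+ x) (+ y) (inv (+ x)))) (lemma₃ (+ x) (+ y) (inv (+ y)))

    square : ∀ {t x} → t ≋ x ⊎ - t ≋ x → x * x ≋ t * t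
    square {t} {x} (inj₁ p) = ∣-comb (- (x + t)) 0ℤ p p (lemma t x)
      where
      lemma : ∀ t x → x * x - t * t ≡ (- (x + t)) * (t - x) + 0ℤ * (t - x)
      lemma = solve-∀
    square {t} {x} (inj₂ p) = ∣-comb (t - x) 0ℤ p p (lemma t x)
      where
      lemma : ∀ t x → x * x - t * t ≡ (t - x) * (- t - x) + 0ℤ * (- t - x)
      lemma = solve-∀

    isSquare-witness : ∀ {c} → isSquare ℓ c ≡ true → ∃[ t ] t * t ≋ c
    isSquare-witness {c} eq with any? {n = ℓ} (λ x → ℓ ℕ.∣? abs (+ toℕ x * + toℕ x - c))
    ... | yes (x , ℓ∣x²-c) = + toℕ x , ∣ᵤ⇒∣ ℓ∣x²-c

    isSquare-true : ∀ c t → t * t ≋ c → isSquare ℓ c ≡ true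
    isSquare-true c t t²≋c = dec-true {A = ∃[ x ] IsRoot ℓ c x} (any? λ x → ℓ ℕ.∣? abs (+ toℕ x * + toℕ x - c)) (fromℕ< (n%ℕd<d t ℓ) , ∣⇒∣ᵤ (∣-resp
      (cong (λ n → + n * + n - c) (sym (toℕ-fromℕ< (n%ℕd<d t ℓ))))
      (∣-comb (- (t /ℕ ℓ) * (+ r + t)) 1ℤ ∣-refl t²≋c
        (trans (lemma (+ r) (t /ℕ ℓ) (+ ℓ) c) (cong (λ t → - (s /ℕ ℓ) * (+ r + t) * + ℓ + 1ℤ * (t * t - c)) (sym (a≡a%ℕn+[a/ℕn]*n t ℓ)))))))
      where
      s : ℤ
      s = t
      r : ℕ
      r = t %ℕ ℓ
      lemma : ∀ r k l c → r * r - c ≡ - k * (r + (r + k * l)) * l + 1ℤ * ((r + k * l) * (r + k * l) - c)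
      lemma = solve-∀

    -- Distinct elements of H have distinct squares modulo ℓ: x² - y² = (x - y)(x + y), and neither
    -- factor vanishes there. The count is thus 0 or 1.
    isSquare-parity : ∀ c → Unit c → isSquare ℓ c ≡ ⊕ h λ x → does (+ x * + x ≋? c)
    isSquare-parity c ℓ∤c with isSquare ℓ c in eq
    ... | true = let t , t²≋c = isSquare-witness eq in from-root t t²≋c
      where
      lemma : ∀ x y → x * x - y * y ≡ (x - y) * (x + y)
      lemma = solve-∀
      from-root : ∀ t → t * t ≋ c → true ≡ ⊕ h λ x → does (+ x * + x ≋? c)
      from-root t t²≋c with half-system t (λ ℓ∣t → unit-≋ {c} {t * t} (≋-sym {t * t} {c} t²≋c) ℓ∤c (∣m⇒∣m*n t ℓ∣t))
      ... | y , y∈H , ±t≋y = sym (trans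
              (⊕-point h _ y y∈H λ x x∈H x≢y → dec-false (+ x * + x ≋? c) λ x²≋c →
                [ (λ ℓ∣x-y → x≢y (H-difference x∈H y∈H ℓ∣x-y)) , H-sum x∈H y∈H ]′
                  (prime∣* ℓ-prime (+ x - + y) (+ x + + y)
                    (∣-resp (lemma (+ x) (+ y)) (≋-trans {+ x * + x} {c} {+ y * + y} x²≋c (≋-sym {+ y * + y} {c} y²≋c)))))
              (dec-true (+ y * + y ≋? c) y²≋c))
        where
        y²≋c : + y * + y ≋ c
        y²≋c = ≋-trans {+ y * + y} {t * t} {c} (square {t} {+ y} ±t≋y) t²≋c
    ... | false = sym (⊕-false h λ x _ → dec-false (+ x * + x ≋? c) λ x²≋c →
            case trans (sym eq) (isSquare-true c (+ x) x²≋c) of λ ())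

    -- Gauss's lemma. The pairs (x , y) ∈ H² with x y ≋ c form a symmetric relation, so their
    -- number has the parity of its diagonal x² ≋ c; summing over y first gives inH (c / x).
    isSquare-⊕ : ∀ c → Unit c → isSquare ℓ c ≡ not (parity h) xor ⊕ h λ x → inH (c * + x)
    isSquare-⊕ c ℓ∤c = begin
      isSquare ℓ c ≡⟨ unnormalised c ℓ∤c ⟩
      ⊕ h (λ x → inH (c * + x)) xor κ ≡⟨ cong (⊕ h (λ x → inH (c * + x)) xor_) κ≡ ⟩
      ⊕ h (λ x → inH (c * + x)) xor not (parity h) ≡⟨ xor-comm (⊕ h λ x → inH (c * + x)) _ ⟩
      not (parity h) xor ⊕ h (λ x → inH (c * + x)) ∎
      where
      open ≡-Reasoning
      κ : Bool
      κ = ⊕ h λ x → inH (- inv (+ x))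
      unnormalised : ∀ c → Unit c → isSquare ℓ c ≡ ⊕ h (λ x → inH (c * + x)) xor κ
      unnormalised c ℓ∤c = begin
        isSquare ℓ c
          ≡⟨ isSquare-parity c ℓ∤c ⟩
        ⊕ h (λ x → does (+ x * + x ≋? c))
          ≡⟨ ⊕-symmetric h (λ x y → does (+ x * + y ≋? c)) (λ x y → cong (λ t → does (t ≋? c)) (ℤ.*-comm (+ x) (+ y))) ⟨
        ⊕ h (λ x → ⊕ h λ y → does (+ x * + y ≋? c))
          ≡⟨ ⊕-cong h (λ x x∈H → ⊕-ext h λ y → does-⇔ (mk⇔
               (λ p → ∣-resp (cong (_- + y) (ℤ.*-comm (inv (+ x)) c)) (≋-divide (+ x) (+ y) c (unit-H x∈H) p))
               (λ p → ≋-multiply (+ x) (+ y) c (unit-H x∈H) (∣-resp (cong (_- + y) (ℤ.*-comm c (inv (+ x)))) p)))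
               (+ x * + y ≋? c) (c * inv (+ x) ≋? + y)) ⟩
        ⊕ h (λ x → inH (c * inv (+ x)))
          ≡⟨ ⊕-inH-inv c ℓ∤c ⟩
        ⊕ h (λ x → inH (c * + x)) xor κ
          ∎
      unit-1 : Unit 1ℤ
      unit-1 = prime∤1 ℓ-prime
      xor-solve : ∀ a b → true ≡ a xor b → b ≡ not a
      xor-solve false b eq = sym eq
      xor-solve true false eq = refl
      xor-solve true true ()
      -- `κ` is independent of c and is read off at c = 1, which is a square and for which all h
      -- summands are true.
      κ≡ : κ ≡ not (parity h)
      κ≡ = xor-solve (parity h) κ (begin
        true ≡⟨ isSquare-true 1ℤ 1ℤ (divides 0ℤ refl) ⟨
        isSquare ℓ 1ℤ ≡⟨ unnormalised 1ℤ unit-1 ⟩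
        ⊕ h (λ x → inH (1ℤ * + x)) xor κ ≡⟨ cong (_xor κ) (⊕-cong h λ x x∈H → inH-true {1ℤ * + x} x∈H (≋-reflexive (ℤ.*-identityˡ (+ x)))) ⟩
        parity h xor κ ∎)

    -- Gauss's lemma in its usual form, counting the x in H whose multiple c x falls into - H. This
    -- count and the one in `isSquare-⊕` add up to h.
    isSquare-⊕-neg : ∀ c → Unit c → isSquare ℓ c ≡ not (⊕ h λ x → inH (- (c * + x)))
    isSquare-⊕-neg c ℓ∤c = trans (isSquare-⊕ c ℓ∤c) (trans (sym (not-xorˡ (parity h) (⊕ h λ x → inH (c * + x))))
      (cong not (sym (trans (⊕-cong h λ x x∈H → inH-neg (c * + x) (unit-* {c} ℓ∤c (unit-H x∈H))) (⊕-not h λ x → inH (c * + x))))))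
      where
      not-xorˡ : ∀ a b → not (a xor b) ≡ not a xor b
      not-xorˡ false b = refl
      not-xorˡ true b = not-involutive b

    -- Gauss's lemma for a b, for a and for b, linked by the twist. With true standing for +1,
    -- `not (x xor y)` is the product of two signs.
    isSquare-* : ∀ a b → Unit a → Unit b → isSquare ℓ (a * b) ≡ not (isSquare ℓ a xor isSquare ℓ b)
    isSquare-* a b ℓ∤a ℓ∤b = begin
      isSquare ℓ (a * b)
        ≡⟨ isSquare-⊕ (a * b) (unit-* {a} ℓ∤a ℓ∤b) ⟩
      c xor ⊕ h (λ x → inH (a * b * + x))
        ≡⟨ cong (c xor_) (⊕-ext h λ x → cong inH (ℤ.*-assoc a b (+ x))) ⟩
      c xor ⊕ h (λ x → inH (a * (b * + x)))
        ≡⟨ cong (c xor_) (⊕-inH-* a b ℓ∤a ℓ∤b) ⟩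
      c xor (ν xor μ)
        ≡⟨ lemma c ν μ ⟩
      not ((c xor ν) xor not μ)
        ≡⟨ cong₂ (λ s t → not (s xor t)) (isSquare-⊕ a ℓ∤a) (isSquare-⊕-neg b ℓ∤b) ⟨
      not (isSquare ℓ a xor isSquare ℓ b)
        ∎
      where
      open ≡-Reasoning
      c ν μ : Bool
      c = not (parity h)
      ν = ⊕ h λ x → inH (a * + x)
      μ = ⊕ h λ x → inH (- (b * + x))
      lemma : ∀ a b c → a xor (b xor c) ≡ not ((a xor b) xor not c)
      lemma false false c = sym (not-involutive c)
      lemma false true c = sym (not-involutive (not c))
      lemma true false c = cong not (sym (not-involutive c))
      lemma true true c = refl

    isSquare-neg : ∀ a → Unit a → isSquare ℓ (- a) ≡ not (isSquare ℓ a xor isSquare ℓ (- 1ℤ))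
    isSquare-neg a ℓ∤a = trans (cong (isSquare ℓ) (trans (sym (ℤ.-1*i≡-i a)) (ℤ.*-comm (- 1ℤ) a))) (isSquare-* a (- 1ℤ) ℓ∤a (unit-neg {1ℤ} (prime∤1 ℓ-prime)))

    -- No multiple - x with x in H lies in H, so only the constant of Gauss's lemma is left.
    isSquare-−1 : isSquare ℓ (- 1ℤ) ≡ not (parity h)
    isSquare-−1 = trans (isSquare-⊕ (- 1ℤ) (unit-neg {1ℤ} (prime∤1 ℓ-prime)))
      (trans (cong (not (parity h) xor_) (⊕-false h λ x x∈H → trans (cong inH (ℤ.-1*i≡-i (+ x))) (inH-false {+ x} x∈H (≋-reflexive {+ x} refl))))
        (xor-identityʳ _))

    -- Here k is ⌊ h /2⌋, given by its two inequalities. For x ≤ k the multiple 2 x stays in H;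
    -- beyond that ℓ - 2 x lies in H instead.
    isSquare-2 : ∀ k → k ℕ.+ k ℕ.≤ h → h ℕ.≤ suc (k ℕ.+ k) → isSquare ℓ (+ 2) ≡ not (parity h) xor parity k
    isSquare-2 k 2k≤h h≤1+2k = trans (isSquare-⊕ (+ 2) unit-2) (cong (not (parity h) xor_)
      (trans (⊕-cong h inH-2x) (⊕-interval k h (ℕ.≤-trans (ℕ.m≤m+n k k) 2k≤h))))
      where
      double : ∀ x → + (x ℕ.+ x) ≡ + 2 * + x
      double x = trans (cong (λ t → + (x ℕ.+ t)) (sym (ℕ.+-identityʳ x))) (ℤ.pos-* 2 x)
      unit-2 : Unit (+ 2)
      unit-2 = unit-2x-1 (1≤h , ℕ.≤-refl)
        where
        unit-2x-1 : ∀ {x} → x ∈[1, h ] → Unit (+ 2)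
        unit-2x-1 {x} x∈H ℓ∣2 = H-sum x∈H x∈H (∣-resp (sym (double x)) (∣m⇒∣m*n (+ x) ℓ∣2))
        1≤h : 1 ℕ.≤ h
        1≤h = ℕ.n≢0⇒n>0 λ h≡0 → ℕ.nonTrivial⇒≢1 {{prime⇒nonTrivial ℓ-prime}} (trans ℓ≡1+2h (cong (λ h → suc (h ℕ.+ h)) h≡0))
      complement : ∀ x → x ∈[1, h ] → - (+ 2 * + x) ≋ + (ℓ ℕ.∸ (x ℕ.+ x))
      complement x (_ , x≤h) = divides (- 1ℤ) (begin
        - (+ 2 * + x) - + (ℓ ℕ.∸ (x ℕ.+ x)) ≡⟨ cong₂ (λ s t → - s - t) (sym (double x)) (trans (sym (ℤ.⊖-≥ (ℕ.<⇒≤ (ℕ.≤-<-trans (ℕ.+-mono-≤ x≤h x≤h) 2h<ℓ)))) (sym (ℤ.m-n≡m⊖n ℓ (x ℕ.+ x)))) ⟩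
        - + (x ℕ.+ x) - (+ ℓ - + (x ℕ.+ x)) ≡⟨ lemma (+ (x ℕ.+ x)) (+ ℓ) ⟩
        - 1ℤ * + ℓ ∎)
        where
        open ≡-Reasoning
        lemma : ∀ x l → - x - (l - x) ≡ - 1ℤ * l
        lemma = solve-∀
      inH-2x : ∀ x → x ∈[1, h ] → inH (+ 2 * + x) ≡ does (x ℕ.≤? k)
      inH-2x x (1≤x , x≤h) = case x ℕ.≤? k of λ where
          (yes x≤k) → trans (inH-true {+ 2 * + x} {x ℕ.+ x} (ℕ.≤-trans 1≤x (ℕ.m≤m+n x x) , ℕ.≤-trans (ℕ.+-mono-≤ x≤k x≤k) 2k≤h)
                               (≋-reflexive (sym (double x))))
                             (sym (dec-true (x ℕ.≤? k) x≤k))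
          (no x≰k) → trans (cong inH (sym (ℤ.neg-involutive (+ 2 * + x))))
                     (trans (inH-false { - (+ 2 * + x)} {ℓ ℕ.∸ (x ℕ.+ x)}
                               (ℕ.m<n⇒0<n∸m (ℕ.≤-<-trans (ℕ.+-mono-≤ x≤h x≤h) 2h<ℓ) ,
                                ℕ.m≤n+o⇒m∸n≤o ℓ (x ℕ.+ x) (ℕ.≤-trans (ℕ.≤-reflexive ℓ≡1+2h) (ℕ.+-monoˡ-≤ h (h<2x x≰k))))
                               (complement x (1≤x , x≤h)))
                             (sym (dec-false (x ℕ.≤? k) x≰k)))
        where
        h<2x : ¬ x ℕ.≤ k → h ℕ.< x ℕ.+ x
        h<2x x≰k = ℕ.≤-<-trans h≤1+2k (ℕ.<-≤-trans (s≤s (ℕ.+-monoʳ-< k (ℕ.n<1+n k))) (ℕ.+-mono-≤ (ℕ.≰⇒> x≰k) (ℕ.≰⇒> x≰k)))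

-- Quadratic reciprocity by counting lattice points.

module Reciprocity where

  open ParitySums
  open QuadraticResidues
  open import Data.Nat.Tactic.RingSolver using () renaming (solve-∀ to solveℕ-∀)
  open import Data.Integer.Base using (_+_; _-_; -_; _*_)
  open import Data.Integer.Divisibility.Signed

  -- Only t = n - m can contribute, and it lies in {1,...,h} exactly when m < n ≤ m + h.
  ⊕-translates : ∀ h m n → ⊕ h (λ t → does (m ℕ.+ t ℕ.≟ n)) ≡ does (m ℕ.<? n) xor does (m ℕ.+ h ℕ.<? n)
  ⊕-translates zero m n = sym (trans (cong (λ m+0 → does (m ℕ.<? n) xor does (m+0 ℕ.<? n)) (ℕ.+-identityʳ m)) (xor-same (does (m ℕ.<? n))))
  ⊕-translates (suc h) m n = begin
    E xor ⊕ h (λ t → does (m ℕ.+ t ℕ.≟ n)) ≡⟨ cong (E xor_) (⊕-translates h m n) ⟩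
    E xor (L xor does (m ℕ.+ h ℕ.<? n)) ≡⟨ cong (λ t → E xor (L xor t)) step ⟩
    E xor (L xor (E xor R)) ≡⟨ lemma E L R ⟩
    L xor R ∎
    where
    open ≡-Reasoning
    E L R : Bool
    E = does (m ℕ.+ suc h ℕ.≟ n)
    L = does (m ℕ.<? n)
    R = does (m ℕ.+ suc h ℕ.<? n)
    lemma : ∀ a b c → a xor (b xor (a xor c)) ≡ b xor c
    lemma false b c = refl
    lemma true false c = not-involutive c
    lemma true true c = cong not (not-involutive c)
    step : does (m ℕ.+ h ℕ.<? n) ≡ E xor R
    step = case m ℕ.+ suc h ℕ.≟ n of λ where
      (yes eq) → trans (dec-true (m ℕ.+ h ℕ.<? n) (ℕ.≤-reflexive (trans (sym (ℕ.+-suc m h)) eq)))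
        (sym (cong₂ _xor_ (dec-true (m ℕ.+ suc h ℕ.≟ n) eq) (dec-false (m ℕ.+ suc h ℕ.<? n) (ℕ.<-irrefl eq))))
      (no neq) → trans
        (does-⇔ (mk⇔ (λ lt → ℕ.≤∧≢⇒< (subst (ℕ._≤ n) (sym (ℕ.+-suc m h)) lt) neq)
                     (λ lt → ℕ.<-trans (ℕ.+-monoʳ-< m (ℕ.n<1+n h)) lt))
           (m ℕ.+ h ℕ.<? n) (m ℕ.+ suc h ℕ.<? n))
        (sym (cong (_xor R) (dec-false (m ℕ.+ suc h ℕ.≟ n) neq)))

  -- q x + h < p y becomes p y + k < q x under the point reflection of the rectangle.
  module Lattice (p q h k : ℕ) (p≡ : p ≡ suc (h ℕ.+ h)) (q≡ : q ≡ suc (k ℕ.+ k)) where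

    above below : ℕ → ℕ → Bool
    above x y = does (q ℕ.* x ℕ.+ h ℕ.<? p ℕ.* y)
    below x y = does (p ℕ.* y ℕ.+ k ℕ.<? q ℕ.* x)

    reflect : ∀ x y → x ∈[1, h ] → y ∈[1, k ] → above (suc h ℕ.∸ x) (suc k ℕ.∸ y) ≡ below x y
    reflect x y (_ , x≤h) (_ , y≤k) = go (suc h ℕ.∸ x) (suc k ℕ.∸ y) (ℕ.m∸n+n≡m (ℕ.m≤n⇒m≤1+n x≤h)) (ℕ.m∸n+n≡m (ℕ.m≤n⇒m≤1+n y≤k))
      where
      -- Adding q x + p y to both sides of the inequality for the reflected point gives c + (p y +
      -- k) and c + q x, once x′ + x = h + 1 and y′ + y = k + 1 are used.
      c : ℕ
      c = 2 ℕ.* (k ℕ.* h) ℕ.+ 2 ℕ.* h ℕ.+ k ℕ.+ 1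
      go : ∀ x′ y′ → x′ ℕ.+ x ≡ suc h → y′ ℕ.+ y ≡ suc k → above x′ y′ ≡ below x y
      go x′ y′ x′+x y′+y = does-⇔ (mk⇔
          (λ lt → ℕ.+-cancelˡ-< c _ _ (subst₂ ℕ._<_ left right (ℕ.+-monoˡ-< (q ℕ.* x ℕ.+ p ℕ.* y) lt)))
          (λ lt → ℕ.+-cancelʳ-< (q ℕ.* x ℕ.+ p ℕ.* y) _ _ (subst₂ ℕ._<_ (sym left) (sym right) (ℕ.+-monoʳ-< c lt))))
        (q ℕ.* x′ ℕ.+ h ℕ.<? p ℕ.* y′) (p ℕ.* y ℕ.+ k ℕ.<? q ℕ.* x)
        where
        open ≡-Reasoning
        lemma₁ : ∀ q x′ x h s → q ℕ.* x′ ℕ.+ h ℕ.+ (q ℕ.* x ℕ.+ s) ≡ q ℕ.* (x′ ℕ.+ x) ℕ.+ h ℕ.+ s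
        lemma₁ = solveℕ-∀
        lemma₂ : ∀ k h s → suc (k ℕ.+ k) ℕ.* suc h ℕ.+ h ℕ.+ s ≡ 2 ℕ.* (k ℕ.* h) ℕ.+ 2 ℕ.* h ℕ.+ k ℕ.+ 1 ℕ.+ (s ℕ.+ k)
        lemma₂ = solveℕ-∀
        lemma₃ : ∀ p y′ y s → p ℕ.* y′ ℕ.+ (s ℕ.+ p ℕ.* y) ≡ p ℕ.* (y′ ℕ.+ y) ℕ.+ s
        lemma₃ = solveℕ-∀
        lemma₄ : ∀ k h s → suc (h ℕ.+ h) ℕ.* suc k ℕ.+ s ≡ 2 ℕ.* (k ℕ.* h) ℕ.+ 2 ℕ.* h ℕ.+ k ℕ.+ 1 ℕ.+ s
        lemma₄ = solveℕ-∀
        left : q ℕ.* x′ ℕ.+ h ℕ.+ (q ℕ.* x ℕ.+ p ℕ.* y) ≡ c ℕ.+ (p ℕ.* y ℕ.+ k)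
        left = trans (lemma₁ q x′ x h (p ℕ.* y)) (trans (cong₂ (λ q m → q ℕ.* m ℕ.+ h ℕ.+ p ℕ.* y) q≡ x′+x) (lemma₂ k h (p ℕ.* y)))
        right : p ℕ.* y′ ℕ.+ (q ℕ.* x ℕ.+ p ℕ.* y) ≡ c ℕ.+ q ℕ.* x
        right = trans (lemma₃ p y′ y (q ℕ.* x)) (trans (cong₂ (λ p m → p ℕ.* m ℕ.+ q ℕ.* x) p≡ y′+y) (lemma₄ k h (q ℕ.* x)))

    ⊕-above≡⊕-below : ⊕ h (λ x → ⊕ k (above x)) ≡ ⊕ h λ x → ⊕ k (below x)
    ⊕-above≡⊕-below = trans (sym (⊕-reverse h λ x → ⊕ k (above x)))
      (⊕-cong h λ x x∈ → trans (sym (⊕-reverse k (above (suc h ℕ.∸ x)))) (⊕-cong k λ y y∈ → reflect x y x∈ y∈))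

    -- In Gauss's lemma for q modulo p, - q x ≡ t with t in H means q x + t = p y, where 1 ≤ y ≤ k
    -- for reasons of size. For given (x , y) such a t exists iff q x < p y ≤ q x + h; the `xor` is
    -- this difference of two half-planes.
    isSquare-lattice : (p-prime : Prime p) → ¬ p ℕ.∣ q →
      isSquare p (+ q) ≡ not (⊕ h λ x → ⊕ k λ y → does (q ℕ.* x ℕ.<? p ℕ.* y) xor above x y)
    isSquare-lattice p-prime p∤q = trans (isSquare-⊕-neg (+ q) (p∤q ∘ ∣⇒∣ᵤ)) (cong not (⊕-cong h λ x x∈H →
        trans (⊕-cong h λ t t∈H → sym (multiples x t x∈H t∈H))
        (trans (⊕-swap h k λ t y → does (q ℕ.* x ℕ.+ t ℕ.≟ p ℕ.* y))
        (⊕-ext k λ y → ⊕-translates h (q ℕ.* x) (p ℕ.* y)))))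
      where
      open OddPrime p h p-prime p≡
      open ℕ.≤-Reasoning
      neg-sum : ∀ x t → - (+ q * + x) - + t ≡ - + (q ℕ.* x ℕ.+ t)
      neg-sum x t = trans (sym (ℤ.neg-distrib-+ (+ q * + x) (+ t))) (cong (λ m → - (m + + t)) (sym (ℤ.pos-* q x)))
      to∣ : ∀ x t → p ℕ.∣ q ℕ.* x ℕ.+ t → - (+ q * + x) ≋ + t
      to∣ x t p∣ = ∣-resp (sym (neg-sum x t)) (∣m⇒∣-m {m = + (q ℕ.* x ℕ.+ t)} (∣ᵤ⇒∣ p∣))
      from∣ : ∀ x t → - (+ q * + x) ≋ + t → p ℕ.∣ q ℕ.* x ℕ.+ t
      from∣ x t p∣ = ∣⇒∣ᵤ (∣-resp (ℤ.neg-involutive (+ (q ℕ.* x ℕ.+ t))) (∣m⇒∣-m (∣-resp (neg-sum x t) p∣)))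
      bound : ∀ {x t} → x ℕ.≤ h → t ℕ.≤ h → q ℕ.* x ℕ.+ t ℕ.< p ℕ.* suc k
      bound {x} {t} x≤h t≤h = begin-strict
        q ℕ.* x ℕ.+ t ≤⟨ ℕ.+-mono-≤ (ℕ.*-monoʳ-≤ q x≤h) t≤h ⟩
        q ℕ.* h ℕ.+ h ≡⟨ cong (λ q → q ℕ.* h ℕ.+ h) q≡ ⟩
        suc (k ℕ.+ k) ℕ.* h ℕ.+ h <⟨ ℕ.m<m+n _ (s≤s z≤n) ⟩
        suc (k ℕ.+ k) ℕ.* h ℕ.+ h ℕ.+ suc k ≡⟨ lemma k h ⟩
        suc (h ℕ.+ h) ℕ.* suc k ≡⟨ cong (ℕ._* suc k) p≡ ⟨
        p ℕ.* suc k ∎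
        where
        lemma : ∀ k h → suc (k ℕ.+ k) ℕ.* h ℕ.+ h ℕ.+ suc k ≡ suc (h ℕ.+ h) ℕ.* suc k
        lemma = solveℕ-∀
      multiples : ∀ x t → x ∈[1, h ] → t ∈[1, h ] →
        ⊕ k (λ y → does (q ℕ.* x ℕ.+ t ℕ.≟ p ℕ.* y)) ≡ does (- (+ q * + x) ≋? + t)
      multiples x t (_ , x≤h) (1≤t , t≤h) = case p ℕ.∣? q ℕ.* x ℕ.+ t of λ where
        (yes (ℕ.divides y eq)) → let eq′ = trans eq (ℕ.*-comm y p) in
          trans (⊕-point k _ y
              ( ℕ.n≢0⇒n>0 (λ { refl → ℕ.<⇒≢ (ℕ.<-≤-trans 1≤t (ℕ.m≤n+m t (q ℕ.* x))) (sym eq) })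
              , ℕ.s≤s⁻¹ (ℕ.*-cancelˡ-< p y (suc k) (subst (ℕ._< p ℕ.* suc k) eq′ (bound x≤h t≤h))))
              λ y′ _ y′≢y → dec-false (q ℕ.* x ℕ.+ t ℕ.≟ p ℕ.* y′) λ eq″ → y′≢y (ℕ.*-cancelˡ-≡ y′ y p (trans (sym eq″) eq′)))
          (trans (dec-true (q ℕ.* x ℕ.+ t ℕ.≟ p ℕ.* y) eq′)
            (sym (dec-true (- (+ q * + x) ≋? + t) (to∣ x t (ℕ.divides y eq)))))
        (no p∤) → trans
          (⊕-false k λ y _ → dec-false (q ℕ.* x ℕ.+ t ℕ.≟ p ℕ.* y) λ eq → p∤ (ℕ.divides y (trans eq (ℕ.*-comm p y))))
          (sym (dec-false (- (+ q * + x) ≋? + t) (p∤ ∘ from∣ x t)))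

  -- The two symbols count points in strips on either side of the diagonal q x = p y. The corners
  -- `above` and `below` outside the strips correspond under the reflection and cancel. What remains
  -- is the whole h by k rectangle, since it has no point on the diagonal.
  reciprocity : ∀ {p q h k} → Prime p → Prime q → p ≢ q → p ≡ suc (h ℕ.+ h) → q ≡ suc (k ℕ.+ k) →
    isSquare p (+ q) xor isSquare q (+ p) ≡ parity h ∧ parity k
  reciprocity {p} {q} {h} {k} p-prime q-prime p≢q p≡ q≡ = begin
    isSquare p (+ q) xor isSquare q (+ p)
      ≡⟨ cong₂ _xor_ (PQ.isSquare-lattice p-prime (p≢q ∘ prime∣prime p-prime q-prime))
                     (QP.isSquare-lattice q-prime (p≢q ∘ sym ∘ prime∣prime q-prime p-prime)) ⟩
    not (⊕ h λ x → ⊕ k λ y → L x y xor PQ.above x y) xor not (⊕ k λ y → ⊕ h λ x → R x y xor PQ.below x y)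
      ≡⟨ xor-nots (⊕ h λ x → ⊕ k λ y → L x y xor PQ.above x y) (⊕ k λ y → ⊕ h λ x → R x y xor PQ.below x y) ⟩
    ⊕ h (λ x → ⊕ k λ y → L x y xor PQ.above x y) xor ⊕ k (λ y → ⊕ h λ x → R x y xor PQ.below x y)
      ≡⟨ cong₂ _xor_ (split L PQ.above) (trans (⊕-swap k h λ y x → R x y xor PQ.below x y) (split R PQ.below)) ⟩
    (⊕⊕ L xor ⊕⊕ PQ.above) xor (⊕⊕ R xor ⊕⊕ PQ.below)
      ≡⟨ cong (λ t → (⊕⊕ L xor t) xor (⊕⊕ R xor ⊕⊕ PQ.below)) PQ.⊕-above≡⊕-below ⟩
    (⊕⊕ L xor ⊕⊕ PQ.below) xor (⊕⊕ R xor ⊕⊕ PQ.below)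
      ≡⟨ xor-interchange (⊕⊕ L) (⊕⊕ PQ.below) (⊕⊕ R) (⊕⊕ PQ.below) ⟩
    (⊕⊕ L xor ⊕⊕ R) xor (⊕⊕ PQ.below xor ⊕⊕ PQ.below)
      ≡⟨ cong ((⊕⊕ L xor ⊕⊕ R) xor_) (xor-same (⊕⊕ PQ.below)) ⟩
    (⊕⊕ L xor ⊕⊕ R) xor false
      ≡⟨ xor-identityʳ (⊕⊕ L xor ⊕⊕ R) ⟩
    ⊕⊕ L xor ⊕⊕ R
      ≡⟨ split L R ⟨
    ⊕⊕ (λ x y → L x y xor R x y)
      ≡⟨ ⊕-cong h (λ x x∈ → ⊕-cong k λ y y∈ → comparable x y x∈) ⟩
    ⊕ h (λ _ → parity k)
      ≡⟨ ⊕-const h (parity k) ⟩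
    parity h ∧ parity k
      ∎
    where
    open ≡-Reasoning
    module PQ = Lattice p q h k p≡ q≡
    module QP = Lattice q p k h q≡ p≡
    L R : ℕ → ℕ → Bool
    L x y = does (q ℕ.* x ℕ.<? p ℕ.* y)
    R x y = does (p ℕ.* y ℕ.<? q ℕ.* x)
    ⊕⊕ : (ℕ → ℕ → Bool) → Bool
    ⊕⊕ f = ⊕ h λ x → ⊕ k (f x)
    split : ∀ f g → ⊕⊕ (λ x y → f x y xor g x y) ≡ ⊕⊕ f xor ⊕⊕ g
    split f g = trans (⊕-ext h λ x → ⊕-xor k (f x) (g x)) (⊕-xor h _ _)
    xor-nots : ∀ a b → not a xor not b ≡ a xor b
    xor-nots false b = not-involutive b
    xor-nots true b = refl
    comparable : ∀ x y → x ∈[1, h ] → L x y xor R x y ≡ true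
    comparable x y (1≤x , x≤h) = case ℕ.<-cmp (q ℕ.* x) (p ℕ.* y) of λ where
      (tri< lt _ gt) → cong₂ _xor_ (dec-true (q ℕ.* x ℕ.<? p ℕ.* y) lt) (dec-false (p ℕ.* y ℕ.<? q ℕ.* x) gt)
      (tri> lt _ gt) → cong₂ _xor_ (dec-false (q ℕ.* x ℕ.<? p ℕ.* y) lt) (dec-true (p ℕ.* y ℕ.<? q ℕ.* x) gt)
      -- A point on the diagonal would make p divide q or x, but q is another prime and 1 ≤ x ≤ h <
      -- p.
      (tri≈ _ eq _) → contradiction (euclidsLemma q x p-prime (ℕ.divides y (trans eq (ℕ.*-comm p y)))) λ where
        (inj₁ p∣q) → p≢q (prime∣prime p-prime q-prime p∣q)
        (inj₂ p∣x) → ℕ.<⇒≱ (ℕ.≤-<-trans (ℕ.m≤m+n x x) (ℕ.≤-<-trans (ℕ.+-mono-≤ x≤h x≤h) (ℕ.≤-reflexive (sym p≡))))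
                       (ℕ.∣⇒≤ {{ℕ.>-nonZero 1≤x}} p∣x)

-- The supplementary laws as functions of residues modulo 16.

module SupplementaryLaws where

  open ParitySums
  open QuadraticResidues
  open Reciprocity
  open import Data.Nat.Base using (_/_)
  open import Data.Integer.Base using (-_)

  odd≡1+2⌊/2⌋ : ∀ n → ¬ 2 ℕ.∣ n → n ≡ suc (⌊ n /2⌋ ℕ.+ ⌊ n /2⌋)
  odd≡1+2⌊/2⌋ zero 2∤n = contradiction (ℕ.divides 0 refl) 2∤n
  odd≡1+2⌊/2⌋ (suc zero) 2∤n = refl
  odd≡1+2⌊/2⌋ (suc (suc n)) 2∤n = cong suc (trans (cong suc (odd≡1+2⌊/2⌋ n λ 2∣n → 2∤n (ℕ.∣m∣n⇒∣m+n ℕ.∣-refl 2∣n)))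
    (cong suc (sym (ℕ.+-suc ⌊ n /2⌋ ⌊ n /2⌋))))

  -- The symbols (-1/ℓ) and (2/ℓ): for odd ℓ one halving gives h and a second one gives the k of
  -- `isSquare-2`. Their periods are 4 and 8; the modulus 16 used below is that of the dyadic
  -- conditions.
  minusOneSquare twoSquare : ℕ → Bool
  minusOneSquare r = not (parity ⌊ r /2⌋)
  twoSquare r = minusOneSquare r xor parity ⌊ ⌊ r /2⌋ /2⌋

  residue-invariant : (f : ℕ → Bool) → (∀ n → f (16 ℕ.+ n) ≡ f n) → ∀ n → f n ≡ f (n % 16)
  residue-invariant f periodic n = trans (cong f (trans (m≡m%n+[m/n]*n n 16) (ℕ.+-comm (n % 16) _))) (go (n / 16))
    where
    go : ∀ m → f (m ℕ.* 16 ℕ.+ n % 16) ≡ f (n % 16)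
    go zero = refl
    go (suc m) = trans (periodic (m ℕ.* 16 ℕ.+ n % 16)) (go m)

  minusOneSquare-%16 : ∀ n → minusOneSquare n ≡ minusOneSquare (n % 16)
  minusOneSquare-%16 = residue-invariant minusOneSquare λ n → cong not (parity-+ 8 ⌊ n /2⌋)

  twoSquare-%16 : ∀ n → twoSquare n ≡ twoSquare (n % 16)
  twoSquare-%16 = residue-invariant twoSquare λ n →
    cong₂ (λ a b → not a xor b) (parity-+ 8 ⌊ n /2⌋) (parity-+ 4 ⌊ ⌊ n /2⌋ /2⌋)

  module Supplements (ℓ : ℕ) (ℓ-prime : Prime ℓ) (2∤ℓ : ¬ 2 ℕ.∣ ℓ) where
    open OddPrime ℓ ⌊ ℓ /2⌋ ℓ-prime (odd≡1+2⌊/2⌋ ℓ 2∤ℓ) public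

    first-supplement : isSquare ℓ (- 1ℤ) ≡ minusOneSquare (ℓ % 16)
    first-supplement = trans isSquare-−1 (minusOneSquare-%16 ℓ)

    second-supplement : isSquare ℓ (+ 2) ≡ twoSquare (ℓ % 16)
    second-supplement = trans (isSquare-2 ⌊ ⌊ ℓ /2⌋ /2⌋ (lower ⌊ ℓ /2⌋) (upper ⌊ ℓ /2⌋)) (twoSquare-%16 ℓ)
      where
      lower : ∀ n → ⌊ n /2⌋ ℕ.+ ⌊ n /2⌋ ℕ.≤ n
      lower zero = z≤n
      lower (suc zero) = z≤n
      lower (suc (suc n)) = s≤s (ℕ.≤-trans (ℕ.≤-reflexive (ℕ.+-suc ⌊ n /2⌋ ⌊ n /2⌋)) (s≤s (lower n)))
      upper : ∀ n → n ℕ.≤ suc (⌊ n /2⌋ ℕ.+ ⌊ n /2⌋)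
      upper zero = z≤n
      upper (suc zero) = s≤s z≤n
      upper (suc (suc n)) = s≤s (ℕ.≤-trans (s≤s (upper n)) (ℕ.≤-reflexive (cong suc (sym (ℕ.+-suc ⌊ n /2⌋ ⌊ n /2⌋)))))

  quadratic-reciprocity : ∀ {p q} → Prime p → Prime q → ¬ 2 ℕ.∣ p → ¬ 2 ℕ.∣ q → p ≢ q →
    isSquare p (+ q) xor isSquare q (+ p) ≡ not (minusOneSquare (p % 16)) ∧ not (minusOneSquare (q % 16))
  quadratic-reciprocity {p} {q} p-prime q-prime 2∤p 2∤q p≢q = trans
    (reciprocity {h = ⌊ p /2⌋} {k = ⌊ q /2⌋} p-prime q-prime p≢q (odd≡1+2⌊/2⌋ p 2∤p) (odd≡1+2⌊/2⌋ q 2∤q))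
    (cong₂ _∧_ (parity-%16 p) (parity-%16 q))
    where
    parity-%16 : ∀ n → parity ⌊ n /2⌋ ≡ not (minusOneSquare (n % 16))
    parity-%16 n = trans (sym (not-involutive _)) (cong not (minusOneSquare-%16 n))

-- Arithmetic and estimates for rational numbers.

module Rationals where

  open import Data.Rational.Base using (_+_; _-_; _*_; -_; _/_; _<_; _≤_)
  open import Algebra.Definitions.RawSemiring ℚ.+-*-rawSemiring using (_^_)

  fromℤ-+ : ∀ a b → fromℤ (a ℤ.+ b) ≡ fromℤ a + fromℤ b
  fromℤ-+ a b = ℚ.toℚᵘ-injective (ℚᵘ.≃-trans
    (ℚᵘ.*≡* (cong (ℤ._* 1ℤ) (sym (cong₂ ℤ._+_ (ℤ.*-identityʳ a) (ℤ.*-identityʳ b)))))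
    (ℚᵘ.≃-sym (ℚ.toℚᵘ-homo-+ (fromℤ a) (fromℤ b))))

  fromℤ-* : ∀ a b → fromℤ (a ℤ.* b) ≡ fromℤ a * fromℤ b
  fromℤ-* a b = ℚ.toℚᵘ-injective (ℚᵘ.≃-trans (ℚᵘ.*≡* refl) (ℚᵘ.≃-sym (ℚ.toℚᵘ-homo-* (fromℤ a) (fromℤ b))))

  fromℤ-neg : ∀ a → fromℤ (ℤ.- a) ≡ - fromℤ a
  fromℤ-neg (+ zero) = refl
  fromℤ-neg (+ suc n) = refl
  fromℤ-neg -[1+ n ] = refl

  fromℤ-- : ∀ a b → fromℤ (a ℤ.- b) ≡ fromℤ a - fromℤ b
  fromℤ-- a b = trans (fromℤ-+ a (ℤ.- b)) (cong (λ t → fromℤ a + t) (fromℤ-neg b))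

  fromℤ-^ : ∀ a n → fromℤ (a ℤ.^ n) ≡ fromℤ a ^ n
  fromℤ-^ a zero = refl
  fromℤ-^ a (suc n) = trans (fromℤ-* a (a ℤ.^ n)) (cong (fromℤ a *_) (fromℤ-^ a n))

  fromℤ-injective : ∀ {a b} → fromℤ a ≡ fromℤ b → a ≡ b
  fromℤ-injective = cong ↥_

  fromℤ-mono-≤ : ∀ {a b} → a ℤ.≤ b → fromℤ a ≤ fromℤ b
  fromℤ-mono-≤ a≤b = ℚ.*≤* (ℤ.*-monoʳ-≤-nonNeg 1ℤ a≤b)

  fromℤ-mono-< : ∀ {a b} → a ℤ.< b → fromℤ a < fromℤ b
  fromℤ-mono-< a<b = ℚ.*<* (ℤ.*-monoʳ-<-pos 1ℤ a<b)

  *↧≡↥ : ∀ x → x * fromℤ (↧ x) ≡ fromℤ (↥ x)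
  *↧≡↥ x@record{} = ℚ.toℚᵘ-injective (ℚᵘ.≃-trans (ℚ.toℚᵘ-homo-* x (fromℤ (↧ x)))
    (ℚᵘ.*≡* (trans (ℤ.*-identityʳ (↥ x ℤ.* ↧ x)) (cong (↥ x ℤ.*_) (sym (ℤ.*-identityʳ (↧ x)))))))

  *-cancelˡ : ∀ c {x y} → c ≢ 0ℚ → c * x ≡ c * y → x ≡ y
  *-cancelˡ c {x} {y} c≢0 eq = begin
    x ≡⟨ undo x ⟩
    1/ c * (c * x) ≡⟨ cong (1/ c *_) eq ⟩
    1/ c * (c * y) ≡⟨ undo y ⟨
    y ∎
    where
    open ≡-Reasoning
    instance _ = ℚ.≢-nonZero c≢0
    undo : ∀ x → x ≡ 1/ c * (c * x)
    undo x = trans (sym (ℚ.*-identityˡ x)) (trans (cong (_* x) (sym (ℚ.*-inverseˡ c))) (ℚ.*-assoc (1/ c) c x))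

  /-mono-< : ∀ {a b c d} .{{_ : ℕ.NonZero b}} .{{_ : ℕ.NonZero d}} → a ℕ.* d ℕ.< c ℕ.* b → + a / b < + c / d
  /-mono-< {a} {suc b} {c} {suc d} ad<cb = ℚ.toℚᵘ-cancel-<
    (ℚᵘ.<-respˡ-≃ (ℚᵘ.≃-sym (ℚ.toℚᵘ-fromℚᵘ (ℚᵘ.mkℚᵘ (+ a) b)))
    (ℚᵘ.<-respʳ-≃ (ℚᵘ.≃-sym (ℚ.toℚᵘ-fromℚᵘ (ℚᵘ.mkℚᵘ (+ c) d)))
    (ℚᵘ.*<* (subst₂ ℤ._<_ (ℤ.pos-* a (suc d)) (ℤ.pos-* c (suc b)) (ℤ.+<+ ad<cb)))))

  /-cancel-< : ∀ {a b c d} .{{_ : ℕ.NonZero b}} .{{_ : ℕ.NonZero d}} → + a / b < + c / d → a ℕ.* d ℕ.< c ℕ.* b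
  /-cancel-< {a} {suc b} {c} {suc d} lt = ℤ.drop‿+<+ (subst₂ ℤ._<_ (sym (ℤ.pos-* a (suc d))) (sym (ℤ.pos-* c (suc b)))
    (ℚᵘ.drop-*<* (ℚᵘ.<-respˡ-≃ (ℚ.toℚᵘ-fromℚᵘ (ℚᵘ.mkℚᵘ (+ a) b))
    (ℚᵘ.<-respʳ-≃ (ℚ.toℚᵘ-fromℚᵘ (ℚᵘ.mkℚᵘ (+ c) d)) (ℚ.toℚᵘ-mono-< lt)))))

  -- Makes the denominator of ε a usable precision: together with `n<ℓ^n` it puts the power of 1/ℓ
  -- with exponent `↧ₙ ε` below ε.
  1/↧≤ : ∀ ε → 0ℚ < ε → + 1 / ↧ₙ ε ≤ ε
  1/↧≤ (ℚ.mkℚ (+ zero) d c) (ℚ.*<* (ℤ.+<+ ()))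
  1/↧≤ (ℚ.mkℚ -[1+ n ] d c) (ℚ.*<* ())
  1/↧≤ ε@(ℚ.mkℚ (+ suc n) d c) _ = ℚ.toℚᵘ-cancel-≤ (ℚᵘ.≤-respˡ-≃ (ℚᵘ.≃-sym (ℚ.toℚᵘ-fromℚᵘ (ℚᵘ.mkℚᵘ (+ 1) d)))
    (ℚᵘ.*≤* (ℤ.*-monoʳ-≤-nonNeg (+ suc d) (ℤ.+≤+ (s≤s (z≤n {n}))))))

  n<ℓ^n : ∀ ℓ n → 2 ℕ.≤ ℓ → n ℕ.< ℓ ℕ.^ n
  n<ℓ^n ℓ zero 2≤ℓ = s≤s z≤n
  n<ℓ^n ℓ (suc n) 2≤ℓ = begin
    suc (suc n) ≤⟨ s≤s (n<ℓ^n ℓ n 2≤ℓ) ⟩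
    1 ℕ.+ ℓ ℕ.^ n ≤⟨ ℕ.+-monoˡ-≤ (ℓ ℕ.^ n) (ℕ.≤-trans (s≤s z≤n) (n<ℓ^n ℓ n 2≤ℓ)) ⟩
    ℓ ℕ.^ n ℕ.+ ℓ ℕ.^ n ≡⟨ cong (ℓ ℕ.^ n ℕ.+_) (ℕ.+-identityʳ (ℓ ℕ.^ n)) ⟨
    2 ℕ.* ℓ ℕ.^ n ≤⟨ ℕ.*-monoˡ-≤ (ℓ ℕ.^ n) 2≤ℓ ⟩
    ℓ ℕ.* ℓ ℕ.^ n ∎
    where open ℕ.≤-Reasoning

-- Divisibility in the ℓ-adic sense and infinite descent on the quartic.

module AdicValuations where

  open Rationals
  open QuadraticResidues using (∣-resp; prime∣*; prime∤1)
  open import Data.Integer.Divisibility.Signed using (_∣_; divides)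
  open import Data.Integer.Solver using () renaming (module +-*-Solver to ℤ-Solver)
  open import Data.Rational.Base using (_+_; _-_; _*_; -_; _/_; _<_; _≤_)
  open import Data.Rational.Solver using () renaming (module +-*-Solver to ℚ-Solver)
  open import Algebra.Definitions.RawSemiring ℚ.+-*-rawSemiring using (_^_)

  -- x ≈[ v ] λ _ → 0ℚ, without the subtraction of 0ℚ.
  Null : Place → (ℕ → ℚ) → Set
  Null v x = ∀ ε → 0ℚ < ε → ∃[ N ] ∀ i → i ℕ.≥ N → ∣ x i ∣[ v ] < ε

  quarticℤ : (a b u w z : ℤ) → ℤ
  quarticℤ a b u w z = w ℤ.^ 2 ℤ.- (a ℤ.* u ℤ.^ 4 ℤ.+ b ℤ.* z ℤ.^ 4)

  quartic : (a b u w z : ℚ) → ℚ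
  quartic a b u w z = w ^ 2 - (a * u ^ 4 + b * z ^ 4)

  fromℤ-quartic : ∀ a b u w z → fromℤ (quarticℤ a b u w z) ≡ quartic (fromℤ a) (fromℤ b) (fromℤ u) (fromℤ w) (fromℤ z)
  fromℤ-quartic a b u w z = trans (fromℤ-- (w ℤ.^ 2) _) (cong₂ _-_ (fromℤ-^ w 2)
    (trans (fromℤ-+ (a ℤ.* u ℤ.^ 4) (b ℤ.* z ℤ.^ 4)) (cong₂ _+_
      (trans (fromℤ-* a (u ℤ.^ 4)) (cong (fromℤ a *_) (fromℤ-^ u 4)))
      (trans (fromℤ-* b (z ℤ.^ 4)) (cong (fromℤ b *_) (fromℤ-^ z 4))))))

  common-denominator : ∀ u w z → ∃[ d ] ∃[ u′ ] ∃[ w′ ] ∃[ z′ ] 1 ℕ.≤ d ×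
    fromℤ (+ d) * u ≡ fromℤ u′ × fromℤ (+ d) * w ≡ fromℤ w′ × fromℤ (+ d) * z ≡ fromℤ z′
  common-denominator u@record{} w@record{} z@record{} =
    ↧ₙ u ℕ.* (↧ₙ w ℕ.* ↧ₙ z) , ↥ u ℤ.* (↧ w ℤ.* ↧ z) , ↥ w ℤ.* (↧ u ℤ.* ↧ z) , ↥ z ℤ.* (↧ u ℤ.* ↧ w) , s≤s z≤n ,
    clear u (↧ w ℤ.* ↧ z) d≡ , clear w (↧ u ℤ.* ↧ z) (trans d≡ (swap₁ (↧ u) (↧ w) (↧ z))) , clear z (↧ u ℤ.* ↧ w) (trans d≡ (swap₂ (↧ u) (↧ w) (↧ z)))
    where
    d≡ : + (↧ₙ u ℕ.* (↧ₙ w ℕ.* ↧ₙ z)) ≡ ↧ u ℤ.* (↧ w ℤ.* ↧ z)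
    d≡ = trans (ℤ.pos-* (↧ₙ u) (↧ₙ w ℕ.* ↧ₙ z)) (cong (↧ u ℤ.*_) (ℤ.pos-* (↧ₙ w) (↧ₙ z)))
    swap₁ : ∀ a b c → a ℤ.* (b ℤ.* c) ≡ b ℤ.* (a ℤ.* c)
    swap₁ = solve 3 (λ a b c → a :* (b :* c) := b :* (a :* c)) refl where open ℤ-Solver
    swap₂ : ∀ a b c → a ℤ.* (b ℤ.* c) ≡ c ℤ.* (a ℤ.* b)
    swap₂ = solve 3 (λ a b c → a :* (b :* c) := c :* (a :* b)) refl where open ℤ-Solver
    clear : ∀ x e {d} → d ≡ ↧ x ℤ.* e → fromℤ d * x ≡ fromℤ (↥ x ℤ.* e)
    clear x e refl = begin
      fromℤ (↧ x ℤ.* e) * x ≡⟨ cong (_* x) (fromℤ-* (↧ x) e) ⟩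
      fromℤ (↧ x) * fromℤ e * x ≡⟨ solve 3 (λ a b c → a :* b :* c := (c :* a) :* b) refl (fromℤ (↧ x)) (fromℤ e) x ⟩
      (x * fromℤ (↧ x)) * fromℤ e ≡⟨ cong (_* fromℤ e) (*↧≡↥ x) ⟩
      fromℤ (↥ x) * fromℤ e ≡⟨ fromℤ-* (↥ x) e ⟨
      fromℤ (↥ x ℤ.* e) ∎
      where
      open ≡-Reasoning
      open ℚ-Solver

  -- Homogeneity of degree 4, where u and z have weight 1 and w has weight 2.
  quarticℤ-scale : ∀ p a b u w z → quarticℤ a b (u ℤ.* p) (w ℤ.* p ℤ.^ 2) (z ℤ.* p) ≡ p ℤ.^ 4 ℤ.* quarticℤ a b u w z
  quarticℤ-scale = solve 6 (λ p a b u w z → (w :* p :^ 2) :^ 2 :- (a :* (u :* p) :^ 4 :+ b :* (z :* p) :^ 4) := p :^ 4 :* (w :^ 2 :- (a :* u :^ 4 :+ b :* z :^ 4))) refl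
    where open ℤ-Solver

  quartic-scale : ∀ d a b u w z → quartic a b (d * u) (d * (d * w)) (d * z) ≡ d ^ 4 * quartic a b u w z
  quartic-scale = solve 6 (λ d a b u w z → (d :* (d :* w)) :^ 2 :- (a :* (d :* u) :^ 4 :+ b :* (d :* z) :^ 4) := d :^ 4 :* (w :^ 2 :- (a :* u :^ 4 :+ b :* z :^ 4))) refl
    where open ℚ-Solver

  module Adic (ℓ : ℕ) (ℓ-prime : Prime ℓ) where

    private instance
      ℓ-nonZero : ℕ.NonZero ℓ
      ℓ-nonZero = prime⇒nonZero ℓ-prime

    2≤ℓ : 2 ℕ.≤ ℓ
    2≤ℓ = ℕ.nonTrivial⇒n>1 ℓ {{prime⇒nonTrivial ℓ-prime}}

    -- The fuel suffices because the quotient by ℓ ≥ 2 is smaller than n.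
    divisionCount-spec : ∀ fuel n → 1 ℕ.≤ n → n ℕ.≤ fuel → ∃[ n′ ] n ≡ ℓ ℕ.^ divisionCount fuel ℓ n ℕ.* n′ × ¬ ℓ ℕ.∣ n′
    divisionCount-spec zero n 1≤n n≤0 = contradiction (ℕ.≤-trans 1≤n n≤0) λ ()
    divisionCount-spec (suc fuel) n 1≤n n≤1+fuel with ℓ ℕ.∣? n
    ... | no ℓ∤n = n , sym (ℕ.+-identityʳ n) , ℓ∤n
    ... | yes (ℕ.divides zero refl) = contradiction 1≤n λ ()
    ... | yes (ℕ.divides n₀@(suc _) refl) with divisionCount-spec fuel n₀ (s≤s z≤n)
            (ℕ.s≤s⁻¹ (ℕ.≤-trans (ℕ.m<m*n n₀ ℓ 2≤ℓ) n≤1+fuel))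
    ... | n′ , eq , ℓ∤n′ = n′ , trans (cong (ℕ._* ℓ) eq) (trans (ℕ.*-comm _ ℓ) (sym (ℕ.*-assoc ℓ _ n′))) , ℓ∤n′

    ordℕ-spec : ∀ n → 1 ℕ.≤ n → ∃[ n′ ] n ≡ ℓ ℕ.^ ordℕ ℓ n ℕ.* n′ × ¬ ℓ ℕ.∣ n′
    ordℕ-spec n 1≤n = divisionCount-spec n n 1≤n ℕ.≤-refl

    ∤-* : ∀ {m n} → ¬ ℓ ℕ.∣ m → ¬ ℓ ℕ.∣ n → ¬ ℓ ℕ.∣ m ℕ.* n
    ∤-* {m} {n} ℓ∤m ℓ∤n ℓ∣mn = [ ℓ∤m , ℓ∤n ]′ (euclidsLemma m n ℓ-prime ℓ∣mn)

    ^-∣⇒≤ : ∀ c b {n} → ¬ ℓ ℕ.∣ n → ℓ ℕ.^ c ℕ.∣ ℓ ℕ.^ b ℕ.* n → c ℕ.≤ b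
    ^-∣⇒≤ zero b ℓ∤n _ = z≤n
    ^-∣⇒≤ (suc c) zero {n} ℓ∤n ℓ^∣ = contradiction (subst (ℓ ℕ.∣_) (ℕ.+-identityʳ n) (ℕ.∣-trans (ℕ.m∣m*n (ℓ ℕ.^ c)) ℓ^∣)) ℓ∤n
    ^-∣⇒≤ (suc c) (suc b) {n} ℓ∤n ℓ^∣ = s≤s (^-∣⇒≤ c b ℓ∤n (ℕ.*-cancelˡ-∣ ℓ (subst (ℓ ℕ.* ℓ ℕ.^ c ℕ.∣_) (ℕ.*-assoc ℓ (ℓ ℕ.^ b) n) ℓ^∣)))

    ^-mono-∣ : ∀ {b c} → c ℕ.≤ b → ℓ ℕ.^ c ℕ.∣ ℓ ℕ.^ b
    ^-mono-∣ {b} {c} c≤b = ℕ.divides (ℓ ℕ.^ (b ℕ.∸ c)) (trans (cong (ℓ ℕ.^_) (sym (ℕ.m∸n+n≡m c≤b))) (ℕ.^-distribˡ-+-* ℓ (b ℕ.∸ c) c))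

    ordℕ-unique : ∀ k n → ¬ ℓ ℕ.∣ n → ordℕ ℓ (ℓ ℕ.^ k ℕ.* n) ≡ k
    ordℕ-unique k n ℓ∤n with ordℕ-spec (ℓ ℕ.^ k ℕ.* n) (ℕ.*-mono-≤ (ℕ.m^n>0 ℓ k) (ℕ.n≢0⇒n>0 λ { refl → ℓ∤n (ℕ.divides 0 refl) }))
    ... | n′ , eq , ℓ∤n′ = ℕ.≤-antisym
      (^-∣⇒≤ _ k ℓ∤n (ℕ.divides n′ (trans eq (ℕ.*-comm _ n′))))
      (^-∣⇒≤ k _ ℓ∤n′ (ℕ.divides n (trans (sym eq) (ℕ.*-comm _ n))))

    π : ℤ
    π = + ℓ

    pos-^ : ∀ k → + (ℓ ℕ.^ k) ≡ π ℤ.^ k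
    pos-^ zero = refl
    pos-^ (suc k) = trans (ℤ.pos-* ℓ (ℓ ℕ.^ k)) (cong (π ℤ.*_) (pos-^ k))

    π^-nonZero : ∀ k → ℤ.NonZero (π ℤ.^ k)
    π^-nonZero k = subst ℤ.NonZero (pos-^ k) (ℕ.m^n≢0 ℓ k)

    π^≢0 : ∀ k → fromℤ (π ℤ.^ k) ≢ 0ℚ
    π^≢0 k eq = ℕ.≢-nonZero⁻¹ ℤ.∣ π ℤ.^ k ∣ {{π^-nonZero k}} (cong (λ x → ℤ.∣ ↥ x ∣) eq)

    π^-+ : ∀ j k → π ℤ.^ (j ℕ.+ k) ≡ π ℤ.^ j ℤ.* π ℤ.^ k
    π^-+ j k = ℤ.^-distribˡ-+-* π j k

    ∤ᵤ : ∀ {s} → ¬ π ∣ s → ¬ ℓ ℕ.∣ ℤ.∣ s ∣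
    ∤ᵤ ℓ∤s = ℓ∤s ∘ ∣ᵤ⇒∣

    π^∣-cancel : ∀ k s n → ¬ π ∣ s → π ℤ.^ k ∣ s ℤ.* n → π ℤ.^ k ∣ n
    π^∣-cancel zero s n π∤s _ = divides n (sym (ℤ.*-identityʳ n))
    π^∣-cancel (suc k) s n π∤s (divides c eq) with prime∣* ℓ-prime s n (divides (c ℤ.* π ℤ.^ k) (trans eq (lemma c π (π ℤ.^ k))))
      where
      lemma : ∀ a b c → a ℤ.* (b ℤ.* c) ≡ a ℤ.* c ℤ.* b
      lemma = solve 3 (λ a b c → a :* (b :* c) := a :* c :* b) refl where open ℤ-Solver
    ... | inj₁ π∣s = contradiction π∣s π∤s
    ... | inj₂ (divides n′ refl) = ∣-resp (ℤ.*-comm π n′) (*-monoʳ-∣ π (π^∣-cancel k s n′ π∤s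
            (*-cancelˡ-∣ π {{subst ℤ.NonZero (ℤ.*-identityʳ π) (π^-nonZero 1)}} (∣-resp (lemma s n′ π) (divides c eq)))))
      where
      lemma : ∀ s n p → s ℤ.* (n ℤ.* p) ≡ p ℤ.* (s ℤ.* n)
      lemma = solve 3 (λ s n p → s :* (n :* p) := p :* (s :* n)) refl where open ℤ-Solver

    -- x ∈ ℓᵏ ℤ₍ℓ₎.
    record Divisible (k : ℕ) (x : ℚ) : Set where
      constructor witness
      field
        s m : ℤ
        π∤s : ¬ π ∣ s
        equality : fromℤ s * x ≡ fromℤ (π ℤ.^ k) * fromℤ m

    fromℤ-divisible : ∀ {k n} → π ℤ.^ k ∣ n → Divisible k (fromℤ n)
    fromℤ-divisible {k} {n} (divides m eq) = witness 1ℤ m (prime∤1 ℓ-prime)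
      (trans (ℚ.*-identityˡ (fromℤ n)) (trans (cong fromℤ (trans eq (ℤ.*-comm m _))) (fromℤ-* (π ℤ.^ k) m)))

    -- The loss of precision t is the order of the denominator of r, uniformly in x.
    divisible-scale : ∀ r → ∃[ t ] ∀ k x → Divisible (k ℕ.+ t) x → Divisible k (r * x)
    divisible-scale r@record{} with ordℕ-spec (↧ₙ r) (s≤s z≤n)
    ... | d′ , ↧r≡ , ℓ∤d′ = t , λ k x (witness s m π∤s eq) →
        witness (s ℤ.* + d′) (↥ r ℤ.* m) (λ π∣sd′ → [ π∤s , ℓ∤d′ ∘ ∣⇒∣ᵤ ]′ (prime∣* ℓ-prime s (+ d′) π∣sd′))
        (*-cancelˡ (fromℤ (π ℤ.^ t)) (π^≢0 t) (begin
          T * (fromℤ (s ℤ.* + d′) * (r * x)) ≡⟨ cong (λ y → T * (y * (r * x))) (fromℤ-* s (+ d′)) ⟩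
          T * ((fromℤ s * fromℤ (+ d′)) * (r * x)) ≡⟨ solve 5 (λ T s d r x → T :* ((s :* d) :* (r :* x)) := (r :* (T :* d)) :* (s :* x)) refl T (fromℤ s) (fromℤ (+ d′)) r x ⟩
          (r * (T * fromℤ (+ d′))) * (fromℤ s * x) ≡⟨ cong₂ (λ a b → (r * a) * b) Td′ eq ⟩
          (r * fromℤ (↧ r)) * (fromℤ (π ℤ.^ (k ℕ.+ t)) * fromℤ m) ≡⟨ cong₂ (λ a b → a * (b * fromℤ m)) (*↧≡↥ r) (trans (cong fromℤ (π^-+ k t)) (fromℤ-* (π ℤ.^ k) (π ℤ.^ t))) ⟩
          fromℤ (↥ r) * ((fromℤ (π ℤ.^ k) * T) * fromℤ m) ≡⟨ solve 4 (λ r K T m → r :* ((K :* T) :* m) := T :* (K :* (r :* m))) refl (fromℤ (↥ r)) (fromℤ (π ℤ.^ k)) T (fromℤ m) ⟩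
          T * (fromℤ (π ℤ.^ k) * (fromℤ (↥ r) * fromℤ m)) ≡⟨ cong (λ y → T * (fromℤ (π ℤ.^ k) * y)) (fromℤ-* (↥ r) m) ⟨
          T * (fromℤ (π ℤ.^ k) * fromℤ (↥ r ℤ.* m)) ∎))
      where
      open ≡-Reasoning
      open ℚ-Solver
      t : ℕ
      t = ordℕ ℓ (↧ₙ r)
      T : ℚ
      T = fromℤ (π ℤ.^ t)
      Td′ : T * fromℤ (+ d′) ≡ fromℤ (↧ r)
      Td′ = trans (sym (fromℤ-* (π ℤ.^ t) (+ d′))) (cong fromℤ (trans (cong (ℤ._* + d′) (sym (pos-^ t)))
              (trans (sym (ℤ.pos-* (ℓ ℕ.^ t) d′)) (cong +_ (sym ↧r≡)))))

    1≤∣↥∣ : ∀ x → x ≢ 0ℚ → 1 ℕ.≤ ℤ.∣ ↥ x ∣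
    1≤∣↥∣ x x≢0 = ℕ.n≢0⇒n>0 λ eq → x≢0 (ℚ.↥p≡0⇒p≡0 x (ℤ.∣i∣≡0⇒i≡0 eq))

    infix 7 _/ℓ^_

    _/ℓ^_ : ℕ → ℕ → ℚ
    n /ℓ^ k = _/_ (+ n) (ℓ ℕ.^ k) {{ℕ.m^n≢0 ℓ k}}

    norm-0 : ∀ x → x ≡ 0ℚ → ∣ x ∣[ fin ℓ ℓ-prime ] ≡ 0ℚ
    norm-0 x x≡0 with x ℚ.≟ 0ℚ
    ... | yes _ = refl
    ... | no x≢0 = contradiction x≡0 x≢0

    norm-≢0 : ∀ x → x ≢ 0ℚ → ∣ x ∣[ fin ℓ ℓ-prime ] ≡ ℓ ℕ.^ ordℕ ℓ (↧ₙ x) /ℓ^ ordℕ ℓ ℤ.∣ ↥ x ∣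
    norm-≢0 x x≢0 with x ℚ.≟ 0ℚ
    ... | yes x≡0 = contradiction x≡0 x≢0
    ... | no _ = refl

    small⇒divisible : ∀ k x → ∣ x ∣[ fin ℓ ℓ-prime ] < 1 /ℓ^ k → Divisible k x
    small⇒divisible k x small = case x ℚ.≟ 0ℚ of λ where
        (yes refl) → witness 1ℤ 0ℤ (prime∤1 ℓ-prime) (sym (ℚ.*-zeroʳ (fromℤ (π ℤ.^ k))))
        (no x≢0) → nonzero (ordℕ-spec ℤ.∣ ↥ x ∣ (1≤∣↥∣ x x≢0)) (ordℕ-spec (↧ₙ x) (s≤s z≤n)) (subst (_< 1 /ℓ^ k) (norm-≢0 x x≢0) small)
      where
      a b : ℕ
      a = ordℕ ℓ (↧ₙ x)
      b = ordℕ ℓ ℤ.∣ ↥ x ∣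
      nonzero : (∃[ n′ ] ℤ.∣ ↥ x ∣ ≡ ℓ ℕ.^ b ℕ.* n′ × ¬ ℓ ℕ.∣ n′) → (∃[ d′ ] ↧ₙ x ≡ ℓ ℕ.^ a ℕ.* d′ × ¬ ℓ ℕ.∣ d′) →
        ℓ ℕ.^ a /ℓ^ b < 1 /ℓ^ k → Divisible k x
      nonzero (n′ , ↥≡ , _) (d′ , ↧≡ , ℓ∤d′) small =
        witness (+ d′) (proj₁ factor) (ℓ∤d′ ∘ ∣⇒∣ᵤ) (*-cancelˡ (fromℤ (π ℤ.^ a)) (π^≢0 a) (begin
          A * (fromℤ (+ d′) * x) ≡⟨ solve 3 (λ A d x → A :* (d :* x) := x :* (A :* d)) refl A (fromℤ (+ d′)) x ⟩
          x * (A * fromℤ (+ d′)) ≡⟨ cong (x *_) Ad′ ⟩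
          x * fromℤ (↧ x) ≡⟨ *↧≡↥ x ⟩
          fromℤ (↥ x) ≡⟨ cong fromℤ (proj₂ factor) ⟩
          fromℤ (π ℤ.^ a ℤ.* (π ℤ.^ k ℤ.* proj₁ factor)) ≡⟨ fromℤ-* (π ℤ.^ a) _ ⟩
          A * fromℤ (π ℤ.^ k ℤ.* proj₁ factor) ≡⟨ cong (A *_) (fromℤ-* (π ℤ.^ k) (proj₁ factor)) ⟩
          A * (fromℤ (π ℤ.^ k) * fromℤ (proj₁ factor)) ∎))
        where
        open ≡-Reasoning
        open ℚ-Solver
        A : ℚ
        A = fromℤ (π ℤ.^ a)
        -- The bound ℓ^a / ℓ^b < 1 / ℓ^k cross-multiplies to ℓ^(a + k) < ℓ^b.
        a+k<b : a ℕ.+ k ℕ.< b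
        a+k<b = ℕ.≰⇒> λ b≤a+k → ℕ.<⇒≱ (subst₂ ℕ._<_ (sym (ℕ.^-distribˡ-+-* ℓ a k)) (ℕ.*-identityˡ (ℓ ℕ.^ b)) (/-cancel-< {ℓ ℕ.^ a} {ℓ ℕ.^ b} {1} {ℓ ℕ.^ k} {{ℕ.m^n≢0 ℓ b}} {{ℕ.m^n≢0 ℓ k}} small)) (ℕ.^-monoʳ-≤ ℓ b≤a+k)
        Ad′ : A * fromℤ (+ d′) ≡ fromℤ (↧ x)
        Ad′ = trans (sym (fromℤ-* (π ℤ.^ a) (+ d′))) (cong fromℤ (trans (cong (ℤ._* + d′) (sym (pos-^ a)))
                (trans (sym (ℤ.pos-* (ℓ ℕ.^ a) d′)) (cong +_ (sym ↧≡)))))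
        ℓ^∣↥ : ℓ ℕ.^ (a ℕ.+ k) ℕ.∣ ℤ.∣ ↥ x ∣
        ℓ^∣↥ = ℕ.∣-trans (^-mono-∣ (ℕ.<⇒≤ a+k<b)) (ℕ.divides n′ (trans ↥≡ (ℕ.*-comm (ℓ ℕ.^ b) n′)))
        factor : ∃[ m ] ↥ x ≡ π ℤ.^ a ℤ.* (π ℤ.^ k ℤ.* m)
        factor with ∣ᵤ⇒∣ {+ (ℓ ℕ.^ (a ℕ.+ k))} {↥ x} ℓ^∣↥
        ... | divides m eq = m , trans eq (trans (ℤ.*-comm m _) (trans (cong (ℤ._* m) (trans (pos-^ (a ℕ.+ k)) (π^-+ a k))) (ℤ.*-assoc (π ℤ.^ a) (π ℤ.^ k) m)))

    divisible⇒small : ∀ ε x → 0ℚ < ε → Divisible (↧ₙ ε) x → ∣ x ∣[ fin ℓ ℓ-prime ] < ε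
    divisible⇒small ε x 0<ε (witness s m π∤s eq) = case x ℚ.≟ 0ℚ of λ where
        (yes x≡0) → subst (_< ε) (sym (norm-0 x x≡0)) 0<ε
        (no x≢0) → subst (_< ε) (sym (norm-≢0 x x≢0)) (nonzero (ordℕ-spec ℤ.∣ ↥ x ∣ (1≤∣↥∣ x x≢0)) (ordℕ-spec (↧ₙ x) (s≤s z≤n)))
      where
      a b k : ℕ
      a = ordℕ ℓ (↧ₙ x)
      b = ordℕ ℓ ℤ.∣ ↥ x ∣
      k = ↧ₙ ε
      nonzero : (∃[ n′ ] ℤ.∣ ↥ x ∣ ≡ ℓ ℕ.^ b ℕ.* n′ × ¬ ℓ ℕ.∣ n′) → (∃[ d′ ] ↧ₙ x ≡ ℓ ℕ.^ a ℕ.* d′ × ¬ ℓ ℕ.∣ d′) →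
        ℓ ℕ.^ a /ℓ^ b < ε
      nonzero (n′ , ↥≡ , ℓ∤n′) (d′ , ↧≡ , _) = ℚ.<-≤-trans (/-mono-< {ℓ ℕ.^ a} {ℓ ℕ.^ b} {1} {k} {{ℕ.m^n≢0 ℓ b}} (begin-strict
        ℓ ℕ.^ a ℕ.* k <⟨ ℕ.*-monoʳ-< (ℓ ℕ.^ a) {{ℕ.m^n≢0 ℓ a}} (n<ℓ^n ℓ k 2≤ℓ) ⟩
        ℓ ℕ.^ a ℕ.* ℓ ℕ.^ k ≡⟨ ℕ.^-distribˡ-+-* ℓ a k ⟨
        ℓ ℕ.^ (a ℕ.+ k) ≤⟨ ℕ.^-monoʳ-≤ ℓ a+k≤b ⟩
        ℓ ℕ.^ b ≡⟨ ℕ.*-identityˡ (ℓ ℕ.^ b) ⟨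
        1 ℕ.* ℓ ℕ.^ b ∎)) (1/↧≤ ε 0<ε)
        where
        open ℕ.≤-Reasoning
        open ℚ-Solver
        cross : s ℤ.* ↥ x ≡ π ℤ.^ k ℤ.* m ℤ.* ↧ x
        cross = fromℤ-injective (trans (fromℤ-* s (↥ x)) (trans (cong (fromℤ s *_) (sym (*↧≡↥ x)))
          (trans (sym (ℚ.*-assoc (fromℤ s) x (fromℤ (↧ x)))) (trans (cong (_* fromℤ (↧ x)) (trans eq (sym (fromℤ-* (π ℤ.^ k) m))))
          (sym (fromℤ-* (π ℤ.^ k ℤ.* m) (↧ x)))))))
        crossℕ : ℤ.∣ s ∣ ℕ.* ℤ.∣ ↥ x ∣ ≡ ℓ ℕ.^ k ℕ.* ℤ.∣ m ∣ ℕ.* ↧ₙ x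
        crossℕ = trans (sym (ℤ.abs-* s (↥ x))) (trans (cong ℤ.∣_∣ cross) (trans (ℤ.abs-* (π ℤ.^ k ℤ.* m) (↧ x))
          (cong (ℕ._* ↧ₙ x) (trans (ℤ.abs-* (π ℤ.^ k) m) (cong (ℕ._* ℤ.∣ m ∣) (cong ℤ.∣_∣ (sym (pos-^ k))))))))
        a+k≤b : a ℕ.+ k ℕ.≤ b
        a+k≤b = ^-∣⇒≤ (a ℕ.+ k) b (∤-* (∤ᵤ π∤s) ℓ∤n′) (ℕ.divides (ℤ.∣ m ∣ ℕ.* d′) (E.begin
          ℓ ℕ.^ b ℕ.* (ℤ.∣ s ∣ ℕ.* n′) E.≡⟨ N.solve 3 (λ B S N → B N.:* (S N.:* N) N.:= S N.:* (B N.:* N)) refl (ℓ ℕ.^ b) ℤ.∣ s ∣ n′ ⟩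
          ℤ.∣ s ∣ ℕ.* (ℓ ℕ.^ b ℕ.* n′) E.≡⟨ cong (ℤ.∣ s ∣ ℕ.*_) ↥≡ ⟨
          ℤ.∣ s ∣ ℕ.* ℤ.∣ ↥ x ∣ E.≡⟨ crossℕ ⟩
          ℓ ℕ.^ k ℕ.* ℤ.∣ m ∣ ℕ.* ↧ₙ x E.≡⟨ cong (ℓ ℕ.^ k ℕ.* ℤ.∣ m ∣ ℕ.*_) ↧≡ ⟩
          ℓ ℕ.^ k ℕ.* ℤ.∣ m ∣ ℕ.* (ℓ ℕ.^ a ℕ.* d′) E.≡⟨ N.solve 4 (λ K M A D → K N.:* M N.:* (A N.:* D) N.:= M N.:* D N.:* (A N.:* K)) refl (ℓ ℕ.^ k) ℤ.∣ m ∣ (ℓ ℕ.^ a) d′ ⟩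
          ℤ.∣ m ∣ ℕ.* d′ ℕ.* (ℓ ℕ.^ a ℕ.* ℓ ℕ.^ k) E.≡⟨ cong (ℤ.∣ m ∣ ℕ.* d′ ℕ.*_) (ℕ.^-distribˡ-+-* ℓ a k) ⟨
          ℤ.∣ m ∣ ℕ.* d′ ℕ.* ℓ ℕ.^ (a ℕ.+ k) E.∎))
          where
          module E = ≡-Reasoning
          import Data.Nat.Solver
          module N = Data.Nat.Solver.+-*-Solver

    norm-positive : ∀ x → x ≢ 0ℚ → 0ℚ < ∣ x ∣[ fin ℓ ℓ-prime ]
    norm-positive x x≢0 = subst (0ℚ <_) (sym (norm-≢0 x x≢0))
      (/-mono-< {0} {1} {ℓ ℕ.^ a} {ℓ ℕ.^ b} {{_}} {{ℕ.m^n≢0 ℓ b}} (ℕ.≤-trans (ℕ.m^n>0 ℓ a) (ℕ.≤-reflexive (sym (ℕ.*-identityʳ (ℓ ℕ.^ a))))))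
      where
      a b : ℕ
      a = ordℕ ℓ (↧ₙ x)
      b = ordℕ ℓ ℤ.∣ ↥ x ∣

    -- Convergence to 0 measured by exponents of ℓ in place of rational bounds, the form in which
    -- descent operates.
    Null′ : (ℕ → ℚ) → Set
    Null′ x = ∀ k → ∃[ N ] ∀ i → i ℕ.≥ N → Divisible k (x i)

    0<1/ℓ^ : ∀ k → 0ℚ < 1 /ℓ^ k
    0<1/ℓ^ k = /-mono-< {0} {1} {1} {ℓ ℕ.^ k} {{_}} {{ℕ.m^n≢0 ℓ k}} (s≤s z≤n)

    Null⇒Null′ : ∀ {x} → Null (fin ℓ ℓ-prime) x → Null′ x
    Null⇒Null′ {x} null k with null (1 /ℓ^ k) (0<1/ℓ^ k)
    ... | N , small = N , λ i i≥N → small⇒divisible k (x i) (small i i≥N)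

    Null′⇒Null : ∀ {x} → Null′ x → Null (fin ℓ ℓ-prime) x
    Null′⇒Null {x} null ε 0<ε with null (↧ₙ ε)
    ... | N , small = N , λ i i≥N → divisible⇒small ε (x i) 0<ε (small i i≥N)

    Null′-scale : ∀ r {x} → Null′ x → Null′ λ i → r * x i
    Null′-scale r {x} null k with divisible-scale r
    ... | t , scale with null (k ℕ.+ t)
    ... | N , small = N , λ i i≥N → scale k (x i) (small i i≥N)

    -- A certificate of anisotropy by a single congruence. It allows u, w, z to be divided by ℓ, ℓ²,
    -- ℓ, and hence the quartic by ℓ⁴.
    Anisotropic-mod : ℕ → ℤ → ℤ → Set
    Anisotropic-mod M a b = ∀ u w z → π ℤ.^ M ∣ quarticℤ a b u w z → π ∣ u × π ℤ.^ 2 ∣ w × π ∣ z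

    -- Each round spends ℓ⁴ of the given divisibility, while ℓ^M is kept in reserve for the
    -- certificate.
    descent : ∀ M a b → Anisotropic-mod M a b → ∀ k u w z → π ℤ.^ (M ℕ.+ 4 ℕ.* k) ∣ quarticℤ a b u w z →
      π ℤ.^ k ∣ u × π ℤ.^ (2 ℕ.* k) ∣ w × π ℤ.^ k ∣ z
    descent M a b aniso zero u w z _ = 1∣ u , 1∣ w , 1∣ z
      where
      1∣ : ∀ x → 1ℤ ∣ x
      1∣ x = divides x (sym (ℤ.*-identityʳ x))
    descent M a b aniso (suc k) u w z π^∣F = step (aniso u w z (weaken π^∣F))
      where
      weaken : ∀ {x} → π ℤ.^ (M ℕ.+ 4 ℕ.* suc k) ∣ x → π ℤ.^ M ∣ x
      weaken (divides c eq) = divides (c ℤ.* π ℤ.^ (4 ℕ.* suc k)) (trans eq (trans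
        (cong (c ℤ.*_) (trans (π^-+ M (4 ℕ.* suc k)) (ℤ.*-comm (π ℤ.^ M) (π ℤ.^ (4 ℕ.* suc k)))))
        (sym (ℤ.*-assoc c (π ℤ.^ (4 ℕ.* suc k)) (π ℤ.^ M)))))
      split : π ℤ.^ (M ℕ.+ 4 ℕ.* suc k) ≡ π ℤ.^ 4 ℤ.* π ℤ.^ (M ℕ.+ 4 ℕ.* k)
      split = trans (cong (π ℤ.^_) (lemma M k)) (π^-+ 4 (M ℕ.+ 4 ℕ.* k))
        where
        lemma : ∀ M k → M ℕ.+ 4 ℕ.* suc k ≡ 4 ℕ.+ (M ℕ.+ 4 ℕ.* k)
        lemma M k = trans (cong (M ℕ.+_) (ℕ.*-suc 4 k)) (trans (sym (ℕ.+-assoc M 4 (4 ℕ.* k))) (trans (cong (ℕ._+ 4 ℕ.* k) (ℕ.+-comm M 4)) (ℕ.+-assoc 4 M (4 ℕ.* k))))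
      Result : ℤ → ℤ → ℤ → Set
      Result u w z = π ℤ.^ suc k ∣ u × π ℤ.^ (2 ℕ.* suc k) ∣ w × π ℤ.^ suc k ∣ z
      combine : ∀ u′ w′ z′ → π ℤ.^ k ∣ u′ × π ℤ.^ (2 ℕ.* k) ∣ w′ × π ℤ.^ k ∣ z′ → Result (u′ ℤ.* π) (w′ ℤ.* π ℤ.^ 2) (z′ ℤ.* π)
      combine u′ w′ z′ (π^∣u , π^∣w , π^∣z) =
        ∣-resp (ℤ.*-comm π u′) (*-monoʳ-∣ π π^∣u) ,
        subst₂ _∣_ (trans (sym (π^-+ 2 (2 ℕ.* k))) (cong (π ℤ.^_) (sym (ℕ.*-suc 2 k)))) (ℤ.*-comm (π ℤ.^ 2) w′) (*-monoʳ-∣ (π ℤ.^ 2) π^∣w) ,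
        ∣-resp (ℤ.*-comm π z′) (*-monoʳ-∣ π π^∣z)
      step : π ∣ u × π ℤ.^ 2 ∣ w × π ∣ z → Result u w z
      step (divides u′ u≡ , divides w′ w≡ , divides z′ z≡) =
        subst (λ u → Result u w z) (sym u≡) (subst (λ w → Result (u′ ℤ.* π) w z) (sym w≡) (subst (Result (u′ ℤ.* π) (w′ ℤ.* π ℤ.^ 2)) (sym z≡)
          (combine u′ w′ z′ (descent M a b aniso k u′ w′ z′ (*-cancelˡ-∣ (π ℤ.^ 4) {{π^-nonZero 4}} (subst₂ _∣_ split F≡ π^∣F))))))
        where
        F≡ : quarticℤ a b u w z ≡ π ℤ.^ 4 ℤ.* quarticℤ a b u′ w′ z′
        F≡ = trans (cong₂ (λ u w → quarticℤ a b u w z) u≡ w≡) (trans (cong (quarticℤ a b (u′ ℤ.* π) (w′ ℤ.* π ℤ.^ 2)) z≡) (quarticℤ-scale π a b u′ w′ z′))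

    -- Multiplying u and z by d = ℓ^e d′ and w by d² makes them integral and multiplies the quartic
    -- by d⁴. The 4 e powers of ℓ gained in this way pay for the e, 2 e, e powers that have to be
    -- given back in u, w, z.
    descent-cleared : ∀ M a b → Anisotropic-mod M a b → ∀ k u w z → Divisible (M ℕ.+ 4 ℕ.* k) (quartic (fromℤ a) (fromℤ b) u w z) →
      ∀ {d d′ u′ w′ z′} e → + d ≡ π ℤ.^ e ℤ.* + d′ → ¬ π ∣ + d′ →
      fromℤ (+ d) * u ≡ fromℤ u′ → fromℤ (+ d) * w ≡ fromℤ w′ → fromℤ (+ d) * z ≡ fromℤ z′ →
      Divisible k u × Divisible (2 ℕ.* k) w × Divisible k z
    descent-cleared M a b aniso k u w z (witness s m π∤s eq) {d} {d′} {u′} {w′} {z′} e +d≡ π∤d′ du dw dz =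
      extract (proj₁ parts) , w-part (proj₁ (proj₂ parts)) , extract′ (proj₂ (proj₂ parts))
      where
      E : ℤ
      E = π ℤ.^ e
      F : ℚ
      F = quartic (fromℤ a) (fromℤ b) u w z
      F′ : ℤ
      F′ = quarticℤ a b u′ (+ d ℤ.* w′) z′
      fromℤF′ : fromℤ F′ ≡ fromℤ (+ d) ^ 4 * F
      fromℤF′ = begin
        fromℤ F′ ≡⟨ fromℤ-quartic a b u′ (+ d ℤ.* w′) z′ ⟩
        quartic (fromℤ a) (fromℤ b) (fromℤ u′) (fromℤ (+ d ℤ.* w′)) (fromℤ z′) ≡⟨ cong (λ x → quartic (fromℤ a) (fromℤ b) (fromℤ u′) x (fromℤ z′)) (trans (fromℤ-* (+ d) w′) (cong (fromℤ (+ d) *_) (sym dw))) ⟩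
        quartic (fromℤ a) (fromℤ b) (fromℤ u′) (fromℤ (+ d) * (fromℤ (+ d) * w)) (fromℤ z′) ≡⟨ cong₂ (λ x y → quartic (fromℤ a) (fromℤ b) x (fromℤ (+ d) * (fromℤ (+ d) * w)) y) (sym du) (sym dz) ⟩
        quartic (fromℤ a) (fromℤ b) (fromℤ (+ d) * u) (fromℤ (+ d) * (fromℤ (+ d) * w)) (fromℤ (+ d) * z)
          ≡⟨ quartic-scale (fromℤ (+ d)) (fromℤ a) (fromℤ b) u w z ⟩
        fromℤ (+ d) ^ 4 * F ∎
        where
        open ≡-Reasoning
        open ℚ-Solver
      sF′ : s ℤ.* F′ ≡ ((+ d′) ℤ.^ 4 ℤ.* m) ℤ.* π ℤ.^ (M ℕ.+ 4 ℕ.* (k ℕ.+ e))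
      sF′ = begin
        s ℤ.* F′ ≡⟨ fromℤ-injective (Q.begin
            fromℤ (s ℤ.* F′) Q.≡⟨ trans (fromℤ-* s F′) (cong (fromℤ s *_) fromℤF′) ⟩
            fromℤ s * (fromℤ (+ d) ^ 4 * F) Q.≡⟨ S.solve 3 (λ s d F → s S.:* (d S.:* F) S.:= d S.:* (s S.:* F)) refl (fromℤ s) (fromℤ (+ d) ^ 4) F ⟩
            fromℤ (+ d) ^ 4 * (fromℤ s * F) Q.≡⟨ cong₂ _*_ (sym (fromℤ-^ (+ d) 4)) eq ⟩
            fromℤ ((+ d) ℤ.^ 4) * (fromℤ P * fromℤ m) Q.≡⟨ cong (fromℤ ((+ d) ℤ.^ 4) *_) (sym (fromℤ-* P m)) ⟩
            fromℤ ((+ d) ℤ.^ 4) * fromℤ (P ℤ.* m) Q.≡⟨ fromℤ-* ((+ d) ℤ.^ 4) (P ℤ.* m) ⟨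
            fromℤ ((+ d) ℤ.^ 4 ℤ.* (P ℤ.* m)) Q.∎) ⟩
        (+ d) ℤ.^ 4 ℤ.* (P ℤ.* m) ≡⟨ cong (λ x → x ℤ.^ 4 ℤ.* (P ℤ.* m)) +d≡ ⟩
        (E ℤ.* + d′) ℤ.^ 4 ℤ.* (P ℤ.* m) ≡⟨ solve 4 (λ E d P m → (E :* d) :^ 4 :* (P :* m) := (d :^ 4 :* m) :* (P :* E :^ 4)) refl E (+ d′) P m ⟩
        ((+ d′) ℤ.^ 4 ℤ.* m) ℤ.* (P ℤ.* E ℤ.^ 4) ≡⟨ cong (λ x → ((+ d′) ℤ.^ 4 ℤ.* m) ℤ.* (P ℤ.* x)) (trans (ℤ.^-*-assoc π e 4) (cong (π ℤ.^_) (ℕ.*-comm e 4))) ⟩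
        ((+ d′) ℤ.^ 4 ℤ.* m) ℤ.* (P ℤ.* π ℤ.^ (4 ℕ.* e)) ≡⟨ cong (((+ d′) ℤ.^ 4 ℤ.* m) ℤ.*_) (trans (sym (π^-+ (M ℕ.+ 4 ℕ.* k) (4 ℕ.* e))) (cong (π ℤ.^_) (trans (ℕ.+-assoc M (4 ℕ.* k) (4 ℕ.* e)) (cong (M ℕ.+_) (sym (ℕ.*-distribˡ-+ 4 k e)))))) ⟩
        ((+ d′) ℤ.^ 4 ℤ.* m) ℤ.* π ℤ.^ (M ℕ.+ 4 ℕ.* (k ℕ.+ e)) ∎
        where
        open ≡-Reasoning
        open ℤ-Solver
        module Q = ≡-Reasoning
        module S = ℚ-Solver
        P : ℤ
        P = π ℤ.^ (M ℕ.+ 4 ℕ.* k)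
      parts : π ℤ.^ (k ℕ.+ e) ∣ u′ × π ℤ.^ (2 ℕ.* (k ℕ.+ e)) ∣ + d ℤ.* w′ × π ℤ.^ (k ℕ.+ e) ∣ z′
      parts = descent M a b aniso (k ℕ.+ e) u′ (+ d ℤ.* w′) z′ (π^∣-cancel (M ℕ.+ 4 ℕ.* (k ℕ.+ e)) s F′ π∤s (divides ((+ d′) ℤ.^ 4 ℤ.* m) sF′))
      cancel-E : ∀ {j x x′} f → ¬ π ∣ f → (c : ℤ) → fromℤ (c ℤ.* f) * x ≡ fromℤ x′ → ∀ t → c ≡ π ℤ.^ t → π ℤ.^ (j ℕ.+ t) ∣ x′ → Divisible j x
      cancel-E {j} {x} f π∤f .(π ℤ.^ t) fx t refl (divides q refl) = witness f q π∤f (*-cancelˡ (fromℤ (π ℤ.^ t)) (π^≢0 t) (begin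
        fromℤ (π ℤ.^ t) * (fromℤ f * x) ≡⟨ ℚ.*-assoc (fromℤ (π ℤ.^ t)) (fromℤ f) x ⟨
        fromℤ (π ℤ.^ t) * fromℤ f * x ≡⟨ cong (_* x) (fromℤ-* (π ℤ.^ t) f) ⟨
        fromℤ (π ℤ.^ t ℤ.* f) * x ≡⟨ fx ⟩
        fromℤ (q ℤ.* π ℤ.^ (j ℕ.+ t)) ≡⟨ cong (λ y → fromℤ (q ℤ.* y)) (π^-+ j t) ⟩
        fromℤ (q ℤ.* (π ℤ.^ j ℤ.* π ℤ.^ t)) ≡⟨ cong fromℤ (solve 3 (λ q J T → q :* (J :* T) := T :* (J :* q)) refl q (π ℤ.^ j) (π ℤ.^ t)) ⟩
        fromℤ (π ℤ.^ t ℤ.* (π ℤ.^ j ℤ.* q)) ≡⟨ trans (fromℤ-* (π ℤ.^ t) _) (cong (fromℤ (π ℤ.^ t) *_) (fromℤ-* (π ℤ.^ j) q)) ⟩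
        fromℤ (π ℤ.^ t) * (fromℤ (π ℤ.^ j) * fromℤ q) ∎))
        where
        open ≡-Reasoning
        open ℤ-Solver
      extract : π ℤ.^ (k ℕ.+ e) ∣ u′ → Divisible k u
      extract = cancel-E {k} {u} (+ d′) π∤d′ E (trans (cong (λ y → fromℤ y * u) (sym +d≡)) du) e refl
      extract′ : π ℤ.^ (k ℕ.+ e) ∣ z′ → Divisible k z
      extract′ = cancel-E {k} {z} (+ d′) π∤d′ E (trans (cong (λ y → fromℤ y * z) (sym +d≡)) dz) e refl
      w-part : π ℤ.^ (2 ℕ.* (k ℕ.+ e)) ∣ + d ℤ.* w′ → Divisible (2 ℕ.* k) w
      w-part π^∣ = cancel-E {2 ℕ.* k} {w} (+ d′ ℤ.* + d′) (λ π∣ → [ π∤d′ , π∤d′ ]′ (prime∣* ℓ-prime (+ d′) (+ d′) π∣)) (π ℤ.^ (2 ℕ.* e))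
        (begin
          fromℤ (π ℤ.^ (2 ℕ.* e) ℤ.* (+ d′ ℤ.* + d′)) * w ≡⟨ cong (λ y → fromℤ (y ℤ.* (+ d′ ℤ.* + d′)) * w) (trans (cong (π ℤ.^_) (ℕ.*-comm 2 e)) (sym (ℤ.^-*-assoc π e 2))) ⟩
          fromℤ (E ℤ.^ 2 ℤ.* (+ d′ ℤ.* + d′)) * w ≡⟨ cong (λ y → fromℤ y * w) (trans (solve 2 (λ E d → E :^ 2 :* (d :* d) := (E :* d) :* (E :* d)) refl E (+ d′)) (cong₂ ℤ._*_ (sym +d≡) (sym +d≡))) ⟩
          fromℤ (+ d ℤ.* + d) * w ≡⟨ trans (cong (_* w) (fromℤ-* (+ d) (+ d))) (ℚ.*-assoc (fromℤ (+ d)) (fromℤ (+ d)) w) ⟩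
          fromℤ (+ d) * (fromℤ (+ d) * w) ≡⟨ trans (cong (fromℤ (+ d) *_) dw) (sym (fromℤ-* (+ d) w′)) ⟩
          fromℤ (+ d ℤ.* w′) ∎)
        (2 ℕ.* e) refl (subst (λ j → π ℤ.^ j ∣ + d ℤ.* w′) (ℕ.*-distribˡ-+ 2 k e) π^∣)
        where
        open ≡-Reasoning
        open ℤ-Solver

    descent-ℚ : ∀ M a b → Anisotropic-mod M a b → ∀ k u w z → Divisible (M ℕ.+ 4 ℕ.* k) (quartic (fromℤ a) (fromℤ b) u w z) →
      Divisible k u × Divisible (2 ℕ.* k) w × Divisible k z
    descent-ℚ M a b aniso k u w z div =
      let d , u′ , w′ , z′ , 1≤d , du , dw , dz = common-denominator u w z
          d′ , d≡ , ℓ∤d′ = ordℕ-spec d 1≤d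
          e = ordℕ ℓ d
      in descent-cleared M a b aniso k u w z div e
           (trans (cong +_ d≡) (trans (ℤ.pos-* (ℓ ℕ.^ e) d′) (cong (ℤ._* + d′) (pos-^ e)))) (ℓ∤d′ ∘ ∣⇒∣ᵤ) du dw dz

    divisible-double : ∀ k x → Divisible (2 ℕ.* k) x → Divisible k x
    divisible-double k x (witness s m π∤s eq) = witness s (π ℤ.^ (k ℕ.+ 0) ℤ.* m) π∤s (trans eq
      (trans (cong (_* fromℤ m) (trans (cong fromℤ (π^-+ k (k ℕ.+ 0))) (fromℤ-* (π ℤ.^ k) (π ℤ.^ (k ℕ.+ 0)))))
      (trans (ℚ.*-assoc (fromℤ (π ℤ.^ k)) (fromℤ (π ℤ.^ (k ℕ.+ 0))) (fromℤ m)) (cong (fromℤ (π ℤ.^ k) *_) (sym (fromℤ-* (π ℤ.^ (k ℕ.+ 0)) m))))))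

    anisotropic-null : ∀ M a b → Anisotropic-mod M a b → ∀ u w z →
      Null′ (λ i → quartic (fromℤ a) (fromℤ b) (u i) (w i) (z i)) → Null′ u × Null′ w × Null′ z
    anisotropic-null M a b aniso u w z null =
      (λ k → proj₁ (null (M ℕ.+ 4 ℕ.* k)) , λ i i≥N → proj₁ (control k i i≥N)) ,
      (λ k → proj₁ (null (M ℕ.+ 4 ℕ.* k)) , λ i i≥N → divisible-double k (w i) (proj₁ (proj₂ (control k i i≥N)))) ,
      (λ k → proj₁ (null (M ℕ.+ 4 ℕ.* k)) , λ i i≥N → proj₂ (proj₂ (control k i i≥N)))
      where
      control : ∀ k i → i ℕ.≥ proj₁ (null (M ℕ.+ 4 ℕ.* k)) → Divisible k (u i) × Divisible (2 ℕ.* k) (w i) × Divisible k (z i)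
      control k i i≥N = descent-ℚ M a b aniso k (u i) (w i) (z i) (proj₂ (null (M ℕ.+ 4 ℕ.* k)) i i≥N)

    anisotropic-null′ : ∀ M {a b} → Anisotropic-mod M a b → ∀ u w z →
      Null (fin ℓ ℓ-prime) (λ i → quartic (fromℤ a) (fromℤ b) (u i) (w i) (z i)) →
      Null (fin ℓ ℓ-prime) u × Null (fin ℓ ℓ-prime) w × Null (fin ℓ ℓ-prime) z
    anisotropic-null′ M {a} {b} aniso u w z null =
      let u-null , w-null , z-null = anisotropic-null M a b aniso u w z (Null⇒Null′ null)
      in Null′⇒Null u-null , Null′⇒Null w-null , Null′⇒Null z-null

-- Null sequences in the completions, insolubility from anisotropy, and points built from roots.

module Completions where

  open Rationals
  open AdicValuations
  open import Data.Integer.Divisibility.Signed using (_∣_)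
  open import Data.Rational.Base using (_+_; _-_; _*_; -_; _<_)
  open import Data.Rational.Solver using (module +-*-Solver)
  open import Algebra.Definitions.RawSemiring ℚ.+-*-rawSemiring using (_^_)

  Null-cong : ∀ {v x y} → (∀ i → x i ≡ y i) → Null v x → Null v y
  Null-cong {v} x≡y null ε 0<ε = proj₁ (null ε 0<ε) , λ i i≥N → subst (λ x → ∣ x ∣[ v ] < ε) (x≡y i) (proj₂ (null ε 0<ε) i i≥N)

  x-0≡x : ∀ x → x - 0ℚ ≡ x
  x-0≡x = ℚ.+-identityʳ

  norm-positive : ∀ v {x} → x ≢ 0ℚ → 0ℚ < ∣ x ∣[ v ]
  norm-positive ∞ {x} x≢0 = ℚ.positive⁻¹ ℚ.∣ x ∣ {{ℚ.nonNeg∧nonZero⇒pos ℚ.∣ x ∣ {{ℚ.∣-∣-nonNeg x}} {{ℚ.≢-nonZero λ eq → x≢0 (ℚ.∣p∣≡0⇒p≡0 x eq)}}}}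
  -- A place holds its primality proof irrelevantly; deciding primality recovers a relevant one.
  norm-positive (fin ℓ ℓ-prime) {x} x≢0 = Adic.norm-positive ℓ (recompute (prime? ℓ) ℓ-prime) x x≢0

  norm-0 : ∀ v {x} → x ≡ 0ℚ → ∣ x ∣[ v ] ≡ 0ℚ
  norm-0 ∞ refl = refl
  norm-0 (fin ℓ ℓ-prime) {x} x≡0 = Adic.norm-0 ℓ (recompute (prime? ℓ) ℓ-prime) x x≡0

  const : ∀ v → ℚ → Completion v
  const v c = record { seq = λ _ → c ; cauchy = λ ε 0<ε → 0 , λ _ _ _ _ → subst (_< ε) (sym (norm-0 v (ℚ.+-inverseʳ c))) 0<ε }

  const-nonzero : ∀ v c → c ≢ 0ℚ → ¬ IsZero {v} (const v c)
  const-nonzero v c c≢0 zero′ with zero′ ∣ c ∣[ v ] (norm-positive v c≢0)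
  ... | N , small = ℚ.<-irrefl (cong ∣_∣[ v ] (x-0≡x c)) (small N ℕ.≤-refl)

  Null-scale : ∀ v r {x} → r ≢ 0ℚ → Null v x → Null v λ i → r * x i
  Null-scale (fin ℓ ℓ-prime) r {x} _ null = Null′⇒Null (Null′-scale r (Null⇒Null′ null))
    where open Adic ℓ (recompute (prime? ℓ) ℓ-prime)
  Null-scale ∞ r {x} r≢0 null ε 0<ε = N , λ i i≥N → subst₂ _<_ (sym (ℚ.∣p*q∣≡∣p∣*∣q∣ r (x i))) R*ε/R (ℚ.*-monoʳ-<-pos R (proj₂ (null (1/ R * ε) 0<ε/R) i i≥N))
    where
    R : ℚ
    R = ℚ.∣ r ∣
    instance
      R-positive : ℚ.Positive R
      R-positive = ℚ.positive (norm-positive ∞ {r} r≢0)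
      R-nonZero : ℚ.NonZero R
      R-nonZero = ℚ.pos⇒nonZero R
      1/R-positive : ℚ.Positive (1/ R)
      1/R-positive = ℚ.1/pos⇒pos R
    0<ε/R : 0ℚ < 1/ R * ε
    0<ε/R = subst (_< 1/ R * ε) (ℚ.*-zeroʳ (1/ R)) (ℚ.*-monoʳ-<-pos (1/ R) 0<ε)
    N : ℕ
    N = proj₁ (null (1/ R * ε) 0<ε/R)
    R*ε/R : R * (1/ R * ε) ≡ ε
    R*ε/R = trans (sym (ℚ.*-assoc R (1/ R) ε)) (trans (cong (_* ε) (ℚ.*-inverseʳ R)) (ℚ.*-identityˡ ε))

  Null-unscale : ∀ v r {x} → r ≢ 0ℚ → Null v (λ i → r * x i) → Null v x
  Null-unscale v r {x} r≢0 null = Null-cong {v} (λ i → trans (sym (ℚ.*-assoc (1/ r) r (x i))) (trans (cong (_* x i) (ℚ.*-inverseˡ r)) (ℚ.*-identityˡ (x i))))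
    (Null-scale v (1/ r) 1/r≢0 null)
    where
    instance
      r-nonZero : ℚ.NonZero r
      r-nonZero = ℚ.≢-nonZero r≢0
    1/r≢0 : 1/ r ≢ 0ℚ
    1/r≢0 eq = ℚ.1≢0 (trans (sym (ℚ.*-inverseˡ r)) (trans (cong (_* r) eq) (ℚ.*-zeroˡ r)))

  -- Stated for approximate solutions, so that insolubility follows without deciding which of
  -- u, w and z are null.
  Anisotropic : Place → ℚ → ℚ → Set
  Anisotropic v a b = ∀ u w z → Null v (λ i → quartic a b (u i) (w i) (z i)) → Null v u × Null v w × Null v z

  -- Passing from a representative a r² of a square class to a is the substitution of (r u , r w ,
  -- z) for (u , w , z), which multiplies the quartic by r².
  anisotropic⇒insoluble : ∀ v {a b a′ b′} r → r ≢ 0ℚ → a′ ≡ a * r ^ 2 → b′ * r ^ 2 ≡ b → Anisotropic v a b → ¬ Soluble a′ b′ v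
  anisotropic⇒insoluble v {a} {b} {a′} {b′} r r≢0 a′≡ b′≡ aniso (u , w , z , nontrivial , eq) =
    nontrivial (toIsZero {u} (Null-unscale v r r≢0 (proj₁ nulls)) , toIsZero {w} (Null-unscale v r r≢0 (proj₁ (proj₂ nulls))) , toIsZero {z} (proj₂ (proj₂ nulls)))
    where
    open +-*-Solver
    toIsZero : ∀ {x : Completion v} → Null v (seq x) → IsZero {v} x
    toIsZero {x} = Null-cong {v} (λ i → sym (x-0≡x (seq x i)))
    rescale : ∀ a b′ r u w z → r ^ 2 * (w ^ 2 - ((a * r ^ 2) * u ^ 4 + b′ * z ^ 4)) ≡ (r * w) ^ 2 - (a * (r * u) ^ 4 + (b′ * r ^ 2) * z ^ 4)
    rescale = solve 6 (λ a b r u w z → r :^ 2 :* (w :^ 2 :- ((a :* r :^ 2) :* u :^ 4 :+ b :* z :^ 4)) := (r :* w) :^ 2 :- (a :* (r :* u) :^ 4 :+ (b :* r :^ 2) :* z :^ 4)) refl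
    r²≢0 : r ^ 2 ≢ 0ℚ
    r²≢0 r²≡0 = r≢0 (*-cancelˡ r r≢0 (trans (cong (r *_) (sym (ℚ.*-identityʳ r))) (trans r²≡0 (sym (ℚ.*-zeroʳ r)))))
    nulls : Null v (λ i → r * seq u i) × Null v (λ i → r * seq w i) × Null v (seq z)
    nulls = aniso (λ i → r * seq u i) (λ i → r * seq w i) (seq z)
      (Null-cong {v} (λ i → trans (cong (λ a → r ^ 2 * quartic a b′ (seq u i) (seq w i) (seq z i)) a′≡)
                       (trans (rescale a b′ r (seq u i) (seq w i) (seq z i))
                       (cong (λ b → quartic a b (r * seq u i) (r * seq w i) (seq z i)) b′≡)))
        (Null-scale v (r ^ 2) r²≢0 eq))

  Root : Place → ℕ → ℚ → Set
  Root v m n = ∃[ y ] Null v (λ i → seq {v} y i ^ m - n)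

  -- Supplies points with u and z rational, so that w is the only coordinate needing a limit.
  soluble-√ : ∀ v a b {n} U Z → U ≢ 0ℚ ⊎ Z ≢ 0ℚ → a * U ^ 4 + b * Z ^ 4 ≡ n → Root v 2 n → Soluble a b v
  soluble-√ v a b U Z nonzero n≡ (y , null) = const v U , y , const v Z ,
    (λ (U-zero , _ , Z-zero) → [ (λ U≢0 → const-nonzero v U U≢0 U-zero) , (λ Z≢0 → const-nonzero v Z Z≢0 Z-zero) ]′ nonzero) ,
    Null-cong {v} (λ i → cong (λ n → seq y i ^ 2 - n) (sym n≡)) null

  soluble-√a : ∀ v a b → Root v 2 a → Soluble a b v
  soluble-√a v a b = soluble-√ v a b 1ℚ 0ℚ (inj₁ ℚ.1≢0) (lemma a b)
    where
    open +-*-Solver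
    lemma : ∀ a b → a * 1ℚ ^ 4 + b * 0ℚ ^ 4 ≡ a
    lemma = solve 2 (λ a b → a :* con 1ℚ :^ 4 :+ b :* con 0ℚ :^ 4 := a) refl

  soluble-√b : ∀ v a b → Root v 2 b → Soluble a b v
  soluble-√b v a b = soluble-√ v a b 0ℚ 1ℚ (inj₂ ℚ.1≢0) (lemma a b)
    where
    open +-*-Solver
    lemma : ∀ a b → a * 0ℚ ^ 4 + b * 1ℚ ^ 4 ≡ b
    lemma = solve 2 (λ a b → a :* con 0ℚ :^ 4 :+ b :* con 1ℚ :^ 4 := b) refl

  root-rational : ∀ v r → Root v 2 (r ^ 2)
  root-rational v r = const v r , λ ε 0<ε → 0 , λ _ _ → subst (_< ε) (sym (norm-0 v (ℚ.+-inverseʳ (r ^ 2)))) 0<ε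

  root-scale : ∀ ℓ (ℓ-prime : Prime ℓ) r n → r ≢ 0ℚ → Root (fin ℓ ℓ-prime) 2 n → Root (fin ℓ ℓ-prime) 2 (r ^ 2 * n)
  root-scale ℓ ℓ-prime r n r≢0 (y , null) = record { seq = λ i → r * seq y i ; cauchy = is-cauchy } ,
    Null-cong {fin ℓ ℓ-prime} (λ i → square r (seq y i) n) (Null-scale (fin ℓ ℓ-prime) (r * r) r²≢0 null)
    where
    open Adic ℓ ℓ-prime
    open +-*-Solver
    r²≢0 : r * r ≢ 0ℚ
    r²≢0 r²≡0 = r≢0 (*-cancelˡ r r≢0 (trans r²≡0 (sym (ℚ.*-zeroʳ r))))
    square : ∀ r y n → r * r * (y ^ 2 - n) ≡ (r * y) ^ 2 - r ^ 2 * n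
    square = solve 3 (λ r y n → r :* r :* (y :^ 2 :- n) := (r :* y) :^ 2 :- r :^ 2 :* n) refl
    difference : ∀ r x y → r * (x - y) ≡ r * x - r * y
    difference = solve 3 (λ r x y → r :* (x :- y) := r :* x :- r :* y) refl
    is-cauchy : Cauchy (fin ℓ ℓ-prime) (λ i → r * seq y i)
    is-cauchy ε 0<ε =
      let t , scale = divisible-scale r
          N , close = cauchy y (1 /ℓ^ (↧ₙ ε ℕ.+ t)) (0<1/ℓ^ (↧ₙ ε ℕ.+ t))
      in N , λ i j i≥ j≥ → divisible⇒small ε (r * seq y i - r * seq y j) 0<ε
           (subst (Divisible (↧ₙ ε)) (difference r (seq y i) (seq y j))
             (scale (↧ₙ ε) (seq y i - seq y j) (small⇒divisible (↧ₙ ε ℕ.+ t) (seq y i - seq y j) (close i j i≥ j≥))))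

  anisotropic-swap : ∀ v {a b} → Anisotropic v a b → Anisotropic v b a
  anisotropic-swap v {a} {b} aniso u w z null =
    let z-null , w-null , u-null = aniso z w u (Null-cong {v} (λ i → swap a b (u i) (w i) (z i)) null)
    in u-null , w-null , z-null
    where
    open +-*-Solver
    swap : ∀ a b u w z → quartic b a u w z ≡ quartic a b z w u
    swap = solve 5 (λ a b u w z → w :^ 2 :- (b :* u :^ 4 :+ a :* z :^ 4) := w :^ 2 :- (a :* z :^ 4 :+ b :* u :^ 4)) refl

  -- Here w and z are rational and u is the limit. This serves the place 2, where a + b ≡ 4 modulo
  -- 16 does not make a + b a square but leaves room to adjust u.
  soluble-⁴√ : ∀ v a b n W Z → a ≢ 0ℚ → Z ≢ 0ℚ → a * n ≡ W ^ 2 - b * Z ^ 4 → Root v 4 n → Soluble a b v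
  soluble-⁴√ v a b n W Z a≢0 Z≢0 an≡ (y , null) = y , const v W , const v Z , (λ (_ , _ , z-zero) → const-nonzero v Z Z≢0 z-zero) ,
    Null-cong {v} (λ i → trans (lemma a n (seq y i)) (trans (cong (_- a * seq y i ^ 4) an≡) (lemma′ a b W Z (seq y i)))) (Null-scale v (- a) -a≢0 null)
    where
    open +-*-Solver
    -a≢0 : - a ≢ 0ℚ
    -a≢0 eq = a≢0 (ℚ.neg-injective (trans eq refl))
    lemma : ∀ a n y → - a * (y ^ 4 - n) ≡ a * n - a * y ^ 4
    lemma = solve 3 (λ a n y → :- a :* (y :^ 4 :- n) := a :* n :- a :* y :^ 4) refl
    lemma′ : ∀ a b W Z y → W ^ 2 - b * Z ^ 4 - a * y ^ 4 ≡ W ^ 2 - (a * y ^ 4 + b * Z ^ 4)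
    lemma′ = solve 5 (λ a b W Z y → W :^ 2 :- b :* Z :^ 4 :- a :* y :^ 4 := W :^ 2 :- (a :* y :^ 4 :+ b :* Z :^ 4)) refl

-- Hensel lifting of square roots and of dyadic fourth roots.

module HenselLifting where

  open Rationals
  open QuadraticResidues using (∣-comb; ∣-resp; prime∣*; inverse)
  open AdicValuations
  open Completions
  open import Data.Integer.Divisibility.Signed using (_∣_; divides)
  open import Data.Integer.Solver using (module +-*-Solver)
  open import Algebra.Definitions.RawSemiring ℚ.+-*-rawSemiring using (_^_)

  module Lifting (ℓ : ℕ) (ℓ-prime : Prime ℓ) where
    open Adic ℓ ℓ-prime

    π^-mono-∣ : ∀ {j k x} → j ℕ.≤ k → π ℤ.^ k ∣ x → π ℤ.^ j ∣ x
    π^-mono-∣ {j} {k} j≤k = ∣-trans (divides (π ℤ.^ (k ℕ.∸ j)) (trans (cong (π ℤ.^_) (sym (ℕ.m∸n+n≡m j≤k))) (π^-+ (k ℕ.∸ j) j)))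

    root-of-sequence : ∀ (x : ℕ → ℤ) m n → (∀ k → π ℤ.^ k ∣ x (suc k) ℤ.- x k) → (∀ k → π ℤ.^ k ∣ x k ℤ.^ m ℤ.- n) →
      Root (fin ℓ ℓ-prime) m (fromℤ n)
    root-of-sequence x m n steps approx = record { seq = λ i → fromℤ (x i) ; cauchy = is-cauchy } , Null′⇒Null λ k → k , λ i i≥k →
      subst (Divisible k) (trans (fromℤ-- (x i ℤ.^ m) n) (cong (ℚ._- fromℤ n) (fromℤ-^ (x i) m)))
        (fromℤ-divisible (π^-mono-∣ i≥k (approx i)))
      where
      far-steps : ∀ k t → π ℤ.^ k ∣ x (t ℕ.+ k) ℤ.- x k
      far-steps k zero = divides 0ℤ (ℤ.+-inverseʳ (x k))
      far-steps k (suc t) = ∣-comb 1ℤ 1ℤ (π^-mono-∣ (ℕ.m≤n+m k t) (steps (t ℕ.+ k))) (far-steps k t) (lemma (x (suc t ℕ.+ k)) (x (t ℕ.+ k)) (x k))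
        where
        open +-*-Solver
        lemma : ∀ a b c → a ℤ.- c ≡ 1ℤ ℤ.* (a ℤ.- b) ℤ.+ 1ℤ ℤ.* (b ℤ.- c)
        lemma = solve 3 (λ a b c → a :- c := con 1ℤ :* (a :- b) :+ con 1ℤ :* (b :- c)) refl
      beyond : ∀ {k i} → i ℕ.≥ k → π ℤ.^ k ∣ x i ℤ.- x k
      beyond {k} {i} i≥k = subst (λ i → π ℤ.^ k ∣ x i ℤ.- x k) (ℕ.m∸n+n≡m i≥k) (far-steps k (i ℕ.∸ k))
      is-cauchy : Cauchy (fin ℓ ℓ-prime) (λ i → fromℤ (x i))
      is-cauchy ε 0<ε = ↧ₙ ε , λ i j i≥ j≥ → divisible⇒small ε (fromℤ (x i) ℚ.- fromℤ (x j)) 0<ε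
        (subst (Divisible (↧ₙ ε)) (fromℤ-- (x i) (x j)) (fromℤ-divisible
          (∣-comb 1ℤ (ℤ.- 1ℤ) (beyond i≥) (beyond j≥) (lemma (x i) (x j) (x (↧ₙ ε))))))
        where
        open +-*-Solver
        lemma : ∀ a b c → a ℤ.- b ≡ 1ℤ ℤ.* (a ℤ.- c) ℤ.+ (ℤ.- 1ℤ) ℤ.* (b ℤ.- c)
        lemma = solve 3 (λ a b c → a :- b := con 1ℤ :* (a :- c) :+ con (ℤ.- 1ℤ) :* (b :- c)) refl

    -- Besides the approximation `P k` carries whatever the lifting step needs, such as x being a
    -- unit.
    root-of-lifting : ∀ m n (P : ℕ → ℤ → Set) → (∀ k {x} → P k x → π ℤ.^ k ∣ x ℤ.^ m ℤ.- n) →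
      (∀ k {x} → P k x → ∃[ x′ ] P (suc k) x′ × π ℤ.^ k ∣ x′ ℤ.- x) → ∃[ x ] P 0 x → Root (fin ℓ ℓ-prime) m (fromℤ n)
    root-of-lifting m n P approx lift start =
      root-of-sequence (λ k → proj₁ (approximations k)) m n (λ k → proj₂ (proj₂ (lift k (proj₂ (approximations k))))) (λ k → approx k (proj₂ (approximations k)))
      where
      approximations : ∀ k → ∃[ x ] P k x
      approximations zero = start
      approximations (suc k) = let x′ , Px′ , _ = lift k (proj₂ (approximations k)) in x′ , Px′

  -- Newton's step x - f y for f = x² - n, with y inverse to 2 x modulo ℓ only. Each step then gains
  -- one power of ℓ, which is enough for a Cauchy sequence.
  √-odd : ∀ ℓ (ℓ-prime : Prime ℓ) → ¬ + ℓ ∣ + 2 → ∀ n x → ¬ + ℓ ∣ x → + ℓ ∣ x ℤ.* x ℤ.- n → Root (fin ℓ ℓ-prime) 2 (fromℤ n)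
  √-odd ℓ ℓ-prime ℓ∤2 n x ℓ∤x ℓ∣x²-n = root-of-lifting 2 n P (λ k (_ , π∣) → π^-mono-∣ (ℕ.n≤1+n k) π∣) lift
      (x , ℓ∤x , subst₂ _∣_ (sym (ℤ.*-identityʳ π)) (cong (λ y → x ℤ.* y ℤ.- n) (sym (ℤ.*-identityʳ x))) ℓ∣x²-n)
    where
    open Adic ℓ ℓ-prime
    open Lifting ℓ ℓ-prime
    P : ℕ → ℤ → Set
    P k x = ¬ π ∣ x × π ℤ.^ suc k ∣ x ℤ.^ 2 ℤ.- n
    lift : ∀ k {x} → P k x → ∃[ x′ ] P (suc k) x′ × π ℤ.^ k ∣ x′ ℤ.- x
    lift k {x} (π∤x , divides c eq) with inverse ℓ-prime (+ 2 ℤ.* x) (λ π∣2x → [ ℓ∤2 , π∤x ]′ (prime∣* ℓ-prime (+ 2) x π∣2x))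
    ... | y , divides e eq′ = x ℤ.- f ℤ.* y ,
        ((λ π∣x′ → π∤x (∣-resp (lemma₁ x (f ℤ.* y)) (∣m∣n⇒∣m+n π∣x′ (∣m⇒∣m*n y π∣f)))) ,
         divides (c ℤ.* c ℤ.* y ℤ.* y ℤ.* π ℤ.^ k ℤ.- c ℤ.* e) (trans (lemma₂ x f y n) (trans (cong₂ (λ f g → f ℤ.* f ℤ.* y ℤ.* y ℤ.- f ℤ.* g ℤ.+ (x ℤ.^ 2 ℤ.- n ℤ.- f)) eq″ eq′)
           (trans (cong (λ g → c ℤ.* π ℤ.^ suc k ℤ.* (c ℤ.* π ℤ.^ suc k) ℤ.* y ℤ.* y ℤ.- c ℤ.* π ℤ.^ suc k ℤ.* (e ℤ.* π) ℤ.+ g) (trans (cong (ℤ._- c ℤ.* π ℤ.^ suc k) eq) (ℤ.+-inverseʳ (c ℤ.* π ℤ.^ suc k))))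
           (lemma₃ c y e π (π ℤ.^ k)))))) ,
        divides (ℤ.- (c ℤ.* π ℤ.* y)) (trans (lemma₄ x f y) (trans (cong (λ f → ℤ.- (f ℤ.* y)) eq″) (lemma₅ c y π (π ℤ.^ k))))
      where
      open +-*-Solver
      f : ℤ
      f = x ℤ.^ 2 ℤ.- n
      eq″ : f ≡ c ℤ.* π ℤ.^ suc k
      eq″ = eq
      π∣f : π ∣ f
      π∣f = divides (c ℤ.* π ℤ.^ k) (trans eq (lemma₀ c π (π ℤ.^ k)))
        where
        lemma₀ : ∀ c p t → c ℤ.* (p ℤ.* t) ≡ c ℤ.* t ℤ.* p
        lemma₀ = solve 3 (λ c p t → c :* (p :* t) := c :* t :* p) refl
      lemma₁ : ∀ x g → x ℤ.- g ℤ.+ g ≡ x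
      lemma₁ = solve 2 (λ x g → x :- g :+ g := x) refl
      lemma₂ : ∀ x f y n → (x ℤ.- f ℤ.* y) ℤ.^ 2 ℤ.- n ≡ f ℤ.* f ℤ.* y ℤ.* y ℤ.- f ℤ.* (+ 2 ℤ.* x ℤ.* y ℤ.- 1ℤ) ℤ.+ (x ℤ.^ 2 ℤ.- n ℤ.- f)
      lemma₂ = solve 4 (λ x f y n → (x :- f :* y) :^ 2 :- n := f :* f :* y :* y :- f :* (con (+ 2) :* x :* y :- con 1ℤ) :+ (x :^ 2 :- n :- f)) refl
      lemma₃ : ∀ c y e p t → c ℤ.* (p ℤ.* t) ℤ.* (c ℤ.* (p ℤ.* t)) ℤ.* y ℤ.* y ℤ.- c ℤ.* (p ℤ.* t) ℤ.* (e ℤ.* p) ℤ.+ 0ℤ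
        ≡ (c ℤ.* c ℤ.* y ℤ.* y ℤ.* t ℤ.- c ℤ.* e) ℤ.* (p ℤ.* (p ℤ.* t))
      lemma₃ = solve 5 (λ c y e p t → c :* (p :* t) :* (c :* (p :* t)) :* y :* y :- c :* (p :* t) :* (e :* p) :+ con 0ℤ
        := (c :* c :* y :* y :* t :- c :* e) :* (p :* (p :* t))) refl
      lemma₄ : ∀ x f y → x ℤ.- f ℤ.* y ℤ.- x ≡ ℤ.- (f ℤ.* y)
      lemma₄ = solve 3 (λ x f y → x :- f :* y :- x := :- (f :* y)) refl
      lemma₅ : ∀ c y p t → ℤ.- (c ℤ.* (p ℤ.* t) ℤ.* y) ≡ ℤ.- (c ℤ.* p ℤ.* y) ℤ.* t
      lemma₅ = solve 4 (λ c y p t → :- (c :* (p :* t) :* y) := :- (c :* p :* y) :* t) refl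

  2-place : Place
  2-place = fin 2 prime[2]

  -- For x odd and x² − n = 2ᵏ⁺³ c the next approximation is x + 2ᵏ⁺² c.
  √-dyadic : ∀ n → + 8 ∣ n ℤ.- 1ℤ → Root 2-place 2 (fromℤ n)
  √-dyadic n (divides c₀ eq₀) = root-of-lifting 2 n P approx lift (1ℤ , divides 0ℤ refl , divides (ℤ.- c₀) (trans (lemma₀ n) (trans (cong ℤ.-_ eq₀) (ℤ.neg-distribˡ-* c₀ (+ 8)))))
    where
    open Adic 2 prime[2]
    open Lifting 2 prime[2]
    open +-*-Solver
    P : ℕ → ℤ → Set
    P k x = π ∣ x ℤ.- 1ℤ × + 8 ℤ.* π ℤ.^ k ∣ x ℤ.^ 2 ℤ.- n
    approx : ∀ k {x} → P k x → π ℤ.^ k ∣ x ℤ.^ 2 ℤ.- n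
    approx k (_ , div) = ∣-trans (divides (+ 8) refl) div
    lemma₀ : ∀ n → 1ℤ ℤ.^ 2 ℤ.- n ≡ ℤ.- (n ℤ.- 1ℤ)
    lemma₀ = solve 1 (λ n → con 1ℤ :^ 2 :- n := :- (n :- con 1ℤ)) refl
    lift : ∀ k {x} → P k x → ∃[ x′ ] P (suc k) x′ × π ℤ.^ k ∣ x′ ℤ.- x
    lift k {x} (divides h x≡ , divides c eq) = x ℤ.+ + 4 ℤ.* (c ℤ.* T) ,
      (divides (h ℤ.+ + 2 ℤ.* (c ℤ.* T)) (trans (lemma₁ x (c ℤ.* T)) (trans (cong (ℤ._+ + 4 ℤ.* (c ℤ.* T)) x≡) (lemma₂ h (c ℤ.* T)))) ,
       divides (c ℤ.* (h ℤ.+ 1ℤ) ℤ.+ c ℤ.* c ℤ.* T) (trans (lemma₃ x c T n) (trans (cong₂ (λ g y → g ℤ.+ (+ 8 ℤ.* (y ℤ.+ 1ℤ) ℤ.* c ℤ.* T ℤ.+ + 16 ℤ.* (c ℤ.* c) ℤ.* (T ℤ.* T))) eq x≡) (lemma₄ h c T)))) ,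
      divides (+ 4 ℤ.* c) (lemma₅ x c T)
      where
      T : ℤ
      T = π ℤ.^ k
      lemma₁ : ∀ x y → x ℤ.+ + 4 ℤ.* y ℤ.- 1ℤ ≡ x ℤ.- 1ℤ ℤ.+ + 4 ℤ.* y
      lemma₁ = solve 2 (λ x y → x :+ con (+ 4) :* y :- con 1ℤ := x :- con 1ℤ :+ con (+ 4) :* y) refl
      lemma₂ : ∀ h y → h ℤ.* + 2 ℤ.+ + 4 ℤ.* y ≡ (h ℤ.+ + 2 ℤ.* y) ℤ.* + 2
      lemma₂ = solve 2 (λ h y → h :* con (+ 2) :+ con (+ 4) :* y := (h :+ con (+ 2) :* y) :* con (+ 2)) refl
      lemma₃ : ∀ x c t n → (x ℤ.+ + 4 ℤ.* (c ℤ.* t)) ℤ.^ 2 ℤ.- n ≡ x ℤ.^ 2 ℤ.- n ℤ.+ (+ 8 ℤ.* ((x ℤ.- 1ℤ) ℤ.+ 1ℤ) ℤ.* c ℤ.* t ℤ.+ + 16 ℤ.* (c ℤ.* c) ℤ.* (t ℤ.* t))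
      lemma₃ = solve 4 (λ x c t n → (x :+ con (+ 4) :* (c :* t)) :^ 2 :- n := x :^ 2 :- n :+ (con (+ 8) :* ((x :- con 1ℤ) :+ con 1ℤ) :* c :* t :+ con (+ 16) :* (c :* c) :* (t :* t))) refl
      lemma₄ : ∀ h c t → c ℤ.* (+ 8 ℤ.* t) ℤ.+ (+ 8 ℤ.* (h ℤ.* + 2 ℤ.+ 1ℤ) ℤ.* c ℤ.* t ℤ.+ + 16 ℤ.* (c ℤ.* c) ℤ.* (t ℤ.* t)) ≡ (c ℤ.* (h ℤ.+ 1ℤ) ℤ.+ c ℤ.* c ℤ.* t) ℤ.* (+ 8 ℤ.* (+ 2 ℤ.* t))
      lemma₄ = solve 3 (λ h c t → c :* (con (+ 8) :* t) :+ (con (+ 8) :* (h :* con (+ 2) :+ con 1ℤ) :* c :* t :+ con (+ 16) :* (c :* c) :* (t :* t)) := (c :* (h :+ con 1ℤ) :+ c :* c :* t) :* (con (+ 8) :* (con (+ 2) :* t))) refl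
      lemma₅ : ∀ x c t → x ℤ.+ + 4 ℤ.* (c ℤ.* t) ℤ.- x ≡ + 4 ℤ.* c ℤ.* t
      lemma₅ = solve 3 (λ x c t → x :+ con (+ 4) :* (c :* t) :- x := con (+ 4) :* c :* t) refl

  -- For x odd and x⁴ - n = 2^(k+4) c the next approximation is x + 2^(k+2) c. The linear term of
  -- the expansion contributes 2^(k+4) c x³, and c + c x³ is even; all later terms are divisible by
  -- 2^(k+5).
  ⁴√-dyadic : ∀ n → + 16 ∣ n ℤ.- 1ℤ → Root 2-place 4 (fromℤ n)
  ⁴√-dyadic n (divides c₀ eq₀) = root-of-lifting 4 n P approx lift (1ℤ , divides 0ℤ refl , divides (ℤ.- c₀) (trans (lemma₀ n) (trans (cong ℤ.-_ eq₀) (ℤ.neg-distribˡ-* c₀ (+ 16)))))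
    where
    open Adic 2 prime[2]
    open Lifting 2 prime[2]
    open +-*-Solver
    P : ℕ → ℤ → Set
    P k x = π ∣ x ℤ.- 1ℤ × + 16 ℤ.* π ℤ.^ k ∣ x ℤ.^ 4 ℤ.- n
    approx : ∀ k {x} → P k x → π ℤ.^ k ∣ x ℤ.^ 4 ℤ.- n
    approx k (_ , div) = ∣-trans (divides (+ 16) refl) div
    lemma₀ : ∀ n → 1ℤ ℤ.^ 4 ℤ.- n ≡ ℤ.- (n ℤ.- 1ℤ)
    lemma₀ = solve 1 (λ n → con 1ℤ :^ 4 :- n := :- (n :- con 1ℤ)) refl
    lift : ∀ k {x} → P k x → ∃[ x′ ] P (suc k) x′ × π ℤ.^ k ∣ x′ ℤ.- x
    lift k {x} (divides h x≡ , divides c eq) = x ℤ.+ + 4 ℤ.* y ,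
      (divides (h ℤ.+ + 2 ℤ.* y) (trans (lemma₁ x y) (trans (cong (ℤ._+ + 4 ℤ.* y) x≡) (lemma₂ h y))) ,
       divides (c ℤ.* e ℤ.+ rest (x ℤ.- 1ℤ) c T) (trans (lemma₃ x c T n) (trans (cong (ℤ._+ (+ 16 ℤ.* (c ℤ.* T) ℤ.* x ℤ.^ 3 ℤ.+ + 32 ℤ.* T ℤ.* rest (x ℤ.- 1ℤ) c T)) eq)
         (trans (cong (λ x³ → c ℤ.* (+ 16 ℤ.* T) ℤ.+ (+ 16 ℤ.* (c ℤ.* T) ℤ.* x³ ℤ.+ + 32 ℤ.* T ℤ.* rest (x ℤ.- 1ℤ) c T)) (x³≡ x x≡)) (lemma₄ e c T (rest (x ℤ.- 1ℤ) c T)))))) ,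
      divides (+ 4 ℤ.* c) (lemma₅ x c T)
      where
      T y e : ℤ
      T = π ℤ.^ k
      y = c ℤ.* T
      -- Chosen so that x³ = 2 e - 1 when x = 2 h + 1.
      e = + 4 ℤ.* (h ℤ.* h ℤ.* h) ℤ.+ + 6 ℤ.* (h ℤ.* h) ℤ.+ + 3 ℤ.* h ℤ.+ 1ℤ
      -- The binomial terms after the linear one, divided by 32 T.
      rest : ℤ → ℤ → ℤ → ℤ
      rest x-1 c t = + 3 ℤ.* (x-1 ℤ.+ 1ℤ) ℤ.* (x-1 ℤ.+ 1ℤ) ℤ.* t ℤ.* (c ℤ.* c) ℤ.+ + 8 ℤ.* (x-1 ℤ.+ 1ℤ) ℤ.* (t ℤ.* t) ℤ.* (c ℤ.* c ℤ.* c) ℤ.+ + 8 ℤ.* (t ℤ.* t ℤ.* t) ℤ.* (c ℤ.* c ℤ.* c ℤ.* c)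
      x³≡ : ∀ x → x ℤ.- 1ℤ ≡ h ℤ.* + 2 → x ℤ.^ 3 ≡ + 2 ℤ.* e ℤ.- 1ℤ
      x³≡ x x≡ = trans (cube x) (trans (cong (λ y → (y ℤ.+ 1ℤ) ℤ.^ 3) x≡) (cube′ h))
        where
        cube : ∀ x → x ℤ.^ 3 ≡ (x ℤ.- 1ℤ ℤ.+ 1ℤ) ℤ.^ 3
        cube = solve 1 (λ x → x :^ 3 := (x :- con 1ℤ :+ con 1ℤ) :^ 3) refl
        cube′ : ∀ h → (h ℤ.* + 2 ℤ.+ 1ℤ) ℤ.^ 3 ≡ + 2 ℤ.* (+ 4 ℤ.* (h ℤ.* h ℤ.* h) ℤ.+ + 6 ℤ.* (h ℤ.* h) ℤ.+ + 3 ℤ.* h ℤ.+ 1ℤ) ℤ.- 1ℤ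
        cube′ = solve 1 (λ h → (h :* con (+ 2) :+ con 1ℤ) :^ 3 := con (+ 2) :* (con (+ 4) :* (h :* h :* h) :+ con (+ 6) :* (h :* h) :+ con (+ 3) :* h :+ con 1ℤ) :- con 1ℤ) refl
      lemma₁ : ∀ x y → x ℤ.+ + 4 ℤ.* y ℤ.- 1ℤ ≡ x ℤ.- 1ℤ ℤ.+ + 4 ℤ.* y
      lemma₁ = solve 2 (λ x y → x :+ con (+ 4) :* y :- con 1ℤ := x :- con 1ℤ :+ con (+ 4) :* y) refl
      lemma₂ : ∀ h y → h ℤ.* + 2 ℤ.+ + 4 ℤ.* y ≡ (h ℤ.+ + 2 ℤ.* y) ℤ.* + 2
      lemma₂ = solve 2 (λ h y → h :* con (+ 2) :+ con (+ 4) :* y := (h :+ con (+ 2) :* y) :* con (+ 2)) refl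
      lemma₃ : ∀ x c t n → (x ℤ.+ + 4 ℤ.* (c ℤ.* t)) ℤ.^ 4 ℤ.- n ≡ x ℤ.^ 4 ℤ.- n ℤ.+ (+ 16 ℤ.* (c ℤ.* t) ℤ.* x ℤ.^ 3 ℤ.+ + 32 ℤ.* t ℤ.* rest (x ℤ.- 1ℤ) c t)
      lemma₃ = solve 4 (λ x c t n → (x :+ con (+ 4) :* (c :* t)) :^ 4 :- n := x :^ 4 :- n :+ (con (+ 16) :* (c :* t) :* x :^ 3 :+ con (+ 32) :* t :*
        (con (+ 3) :* (x :- con 1ℤ :+ con 1ℤ) :* (x :- con 1ℤ :+ con 1ℤ) :* t :* (c :* c) :+ con (+ 8) :* (x :- con 1ℤ :+ con 1ℤ) :* (t :* t) :* (c :* c :* c) :+ con (+ 8) :* (t :* t :* t) :* (c :* c :* c :* c)))) refl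
      lemma₄ : ∀ e c t r → c ℤ.* (+ 16 ℤ.* t) ℤ.+ (+ 16 ℤ.* (c ℤ.* t) ℤ.* (+ 2 ℤ.* e ℤ.- 1ℤ) ℤ.+ + 32 ℤ.* t ℤ.* r) ≡ (c ℤ.* e ℤ.+ r) ℤ.* (+ 16 ℤ.* (+ 2 ℤ.* t))
      lemma₄ = solve 4 (λ e c t r → c :* (con (+ 16) :* t) :+ (con (+ 16) :* (c :* t) :* (con (+ 2) :* e :- con 1ℤ) :+ con (+ 32) :* t :* r) := (c :* e :+ r) :* (con (+ 16) :* (con (+ 2) :* t))) refl
      lemma₅ : ∀ x c t → x ℤ.+ + 4 ℤ.* (c ℤ.* t) ℤ.- x ≡ + 4 ℤ.* c ℤ.* t
      lemma₅ = solve 3 (λ x c t → x :+ con (+ 4) :* (c :* t) :- x := con (+ 4) :* c :* t) refl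

-- The real place: square roots by bisection and the sign obstruction.

module RealPlace where

  open Rationals
  open AdicValuations
  open Completions
  open import Data.Rational.Base using (_+_; _-_; _*_; -_; _<_; _≤_; ∣_∣)
  open import Data.Rational.Solver using (module +-*-Solver)
  open import Algebra.Definitions.RawSemiring ℚ.+-*-rawSemiring using (_^_)

  *-mono-≤-nonNeg : ∀ {a b c d} → 0ℚ ≤ a → 0ℚ ≤ d → a ≤ b → c ≤ d → a * c ≤ b * d
  *-mono-≤-nonNeg {a} {b} {c} {d} 0≤a 0≤d a≤b c≤d =
    ℚ.≤-trans (ℚ.*-monoˡ-≤-nonNeg a {{ℚ.nonNegative 0≤a}} c≤d) (ℚ.*-monoʳ-≤-nonNeg d {{ℚ.nonNegative 0≤d}} a≤b)

  0≤* : ∀ {a b} → 0ℚ ≤ a → 0ℚ ≤ b → 0ℚ ≤ a * b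
  0≤* {a} {b} 0≤a 0≤b = subst (_≤ a * b) (ℚ.*-zeroˡ 0ℚ) (*-mono-≤-nonNeg ℚ.≤-refl 0≤b 0≤a 0≤b)

  ^-nonNeg : ∀ {a} n → 0ℚ ≤ a → 0ℚ ≤ a ^ n
  ^-nonNeg zero 0≤a = ℚ.*≤* (ℤ.+≤+ z≤n)
  ^-nonNeg (suc n) 0≤a = 0≤* 0≤a (^-nonNeg n 0≤a)

  ^-mono-≤ : ∀ {a b} n → 0ℚ ≤ a → a ≤ b → a ^ n ≤ b ^ n
  ^-mono-≤ zero 0≤a a≤b = ℚ.≤-refl
  ^-mono-≤ (suc n) 0≤a a≤b = *-mono-≤-nonNeg 0≤a (^-nonNeg n (ℚ.≤-trans 0≤a a≤b)) a≤b (^-mono-≤ n 0≤a a≤b)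

  ∣^∣ : ∀ x n → ∣ x ^ n ∣ ≡ ∣ x ∣ ^ n
  ∣^∣ x zero = refl
  ∣^∣ x (suc n) = trans (ℚ.∣p*q∣≡∣p∣*∣q∣ x (x ^ n)) (cong (∣ x ∣ *_) (∣^∣ x n))

  0<^ : ∀ {a} n → 0ℚ < a → 0ℚ < a ^ n
  0<^ zero 0<a = ℚ.*<* (ℤ.+<+ (s≤s z≤n))
  0<^ {a} (suc n) 0<a = subst (_< a * a ^ n) (ℚ.*-zeroʳ a) (ℚ.*-monoʳ-<-pos a {{ℚ.positive 0<a}} (0<^ n 0<a))

  ½^-small : ∀ ε → 0ℚ < ε → ∀ k → k ℕ.≥ ↧ₙ ε → ½ ^ k < ε
  ½^-small ε 0<ε k k≥ = ℚ.*-cancelˡ-<-nonNeg (fromℤ (+ (2 ℕ.^ k))) (begin-strict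
      fromℤ (+ (2 ℕ.^ k)) * ½ ^ k ≡⟨ cancel k ⟩
      1ℚ ≤⟨ fromℤ-mono-≤ (1≤↥ ε 0<ε) ⟩
      fromℤ (↥ ε) ≡⟨ *↧≡↥ ε ⟨
      ε * fromℤ (↧ ε) <⟨ ℚ.*-monoʳ-<-pos ε {{ℚ.positive 0<ε}} (fromℤ-mono-< (ℤ.+<+ (ℕ.≤-<-trans k≥ (n<ℓ^n 2 k ℕ.≤-refl)))) ⟩
      ε * fromℤ (+ (2 ℕ.^ k)) ≡⟨ ℚ.*-comm ε (fromℤ (+ (2 ℕ.^ k))) ⟩
      fromℤ (+ (2 ℕ.^ k)) * ε ∎)
    where
    open ℚ.≤-Reasoning
    1≤↥ : ∀ ε → 0ℚ < ε → 1ℤ ℤ.≤ ↥ ε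
    1≤↥ (ℚ.mkℚ (+ zero) d c) (ℚ.*<* (ℤ.+<+ ()))
    1≤↥ (ℚ.mkℚ -[1+ n ] d c) (ℚ.*<* ())
    1≤↥ (ℚ.mkℚ (+ suc n) d c) _ = ℤ.+≤+ (s≤s z≤n)
    cancel : ∀ k → fromℤ (+ (2 ℕ.^ k)) * ½ ^ k ≡ 1ℚ
    cancel zero = refl
    cancel (suc k) = trans (cong (_* (½ * ½ ^ k)) (trans (cong fromℤ (ℤ.pos-* 2 (2 ℕ.^ k))) (fromℤ-* (+ 2) (+ (2 ℕ.^ k)))))
      (trans (lemma (fromℤ (+ (2 ℕ.^ k))) (½ ^ k)) (cancel k))
      where
      open +-*-Solver
      lemma : ∀ a b → fromℤ (+ 2) * a * (½ * b) ≡ a * b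
      lemma = solve 2 (λ a b → con (fromℤ (+ 2)) :* a :* (con ½ :* b) := a :* b) refl

  ½^-null : Null ∞ (½ ^_)
  ½^-null ε 0<ε = ↧ₙ ε , λ i i≥ → subst (_< ε) (sym (ℚ.0≤p⇒∣p∣≡p (^-nonNeg i (ℚ.*≤* (ℤ.+≤+ z≤n))))) (½^-small ε 0<ε i i≥)

  Null-≤ : ∀ {x y} → (∀ i → ∣ x i ∣ ≤ y i) → Null ∞ y → Null ∞ x
  Null-≤ {x} {y} x≤y null ε 0<ε = proj₁ (null ε 0<ε) , λ i i≥ →
    ℚ.≤-<-trans (x≤y i) (ℚ.≤-<-trans (ℚ.≤-reflexive (sym (ℚ.0≤p⇒∣p∣≡p (ℚ.≤-trans (ℚ.0≤∣p∣ (x i)) (x≤y i))))) (proj₂ (null ε 0<ε) i i≥))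

  -- Bisection of [0 , n + 1].
  √-real : ∀ n → 0ℚ ≤ n → Root ∞ 2 n
  √-real n 0≤n = record { seq = s ; cauchy = is-cauchy } , Null-≤ error (Null-scale ∞ (c + c) {λ i → width i} 2c≢0 width-null)
    where
    open ℚ.≤-Reasoning
    c : ℚ
    c = n + 1ℚ
    0<c : 0ℚ < c
    0<c = ℚ.+-mono-≤-< 0≤n (ℚ.*<* {0ℚ} {1ℚ} (ℤ.+<+ (s≤s z≤n)))
    c≢0 : c ≢ 0ℚ
    c≢0 c≡0 = ℚ.<-irrefl (sym c≡0) 0<c
    2c≢0 : c + c ≢ 0ℚ
    2c≢0 eq = ℚ.<-irrefl (sym eq) (ℚ.+-mono-< 0<c 0<c)
    width : ℕ → ℚ
    width k = c * ½ ^ k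
    width-null : Null ∞ width
    width-null = Null-scale ∞ c {½ ^_} c≢0 ½^-null
    0≤width : ∀ k → 0ℚ ≤ width k
    0≤width k = 0≤* (ℚ.<⇒≤ 0<c) (^-nonNeg k (ℚ.*≤* (ℤ.+≤+ z≤n)))
    halves : ∀ k → width (suc k) + width (suc k) ≡ width k
    halves k = lemma c (½ ^ k)
      where
      open +-*-Solver
      lemma : ∀ c h → c * (½ * h) + c * (½ * h) ≡ c * h
      lemma = solve 2 (λ c h → c :* (con ½ :* h) :+ c :* (con ½ :* h) := c :* h) refl

    record Bracket (k : ℕ) : Set where
      field
        lower : ℚ
        0≤l : 0ℚ ≤ lower
        l²≤n : lower ^ 2 ≤ n
        n≤u² : n ≤ (lower + width k) ^ 2
    open Bracket

    bisect : ∀ {k} → Bracket k → Bracket (suc k)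
    bisect {k} b with (lower b + width (suc k)) ^ 2 ℚ.≤? n
    ... | yes m²≤n = record
          { lower = lower b + width (suc k) ; 0≤l = ℚ.+-mono-≤ (0≤l b) (0≤width (suc k)) ; l²≤n = m²≤n
          ; n≤u² = subst (λ u → n ≤ u ^ 2) (sym (trans (ℚ.+-assoc (lower b) (width (suc k)) (width (suc k))) (cong (λ t → lower b + t) (halves k)))) (n≤u² b) }
    ... | no m²≰n = record { lower = lower b ; 0≤l = 0≤l b ; l²≤n = l²≤n b ; n≤u² = ℚ.<⇒≤ (ℚ.≰⇒> m²≰n) }

    bisect-lower : ∀ {k} (b : Bracket k) → lower b ≤ lower (bisect b)
    bisect-lower {k} b with (lower b + width (suc k)) ^ 2 ℚ.≤? n
    ... | yes _ = subst (_≤ lower b + width (suc k)) (ℚ.+-identityʳ (lower b)) (ℚ.+-monoʳ-≤ (lower b) (0≤width (suc k)))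
    ... | no _ = ℚ.≤-refl

    bisect-upper : ∀ {k} (b : Bracket k) → lower (bisect b) + width (suc k) ≤ lower b + width k
    bisect-upper {k} b with (lower b + width (suc k)) ^ 2 ℚ.≤? n
    ... | yes _ = ℚ.≤-reflexive (trans (ℚ.+-assoc (lower b) (width (suc k)) (width (suc k))) (cong (λ t → lower b + t) (halves k)))
    ... | no _ = ℚ.+-monoʳ-≤ (lower b) (begin
          width (suc k) ≡⟨ ℚ.+-identityʳ (width (suc k)) ⟨
          width (suc k) + 0ℚ ≤⟨ ℚ.+-monoʳ-≤ (width (suc k)) (0≤width (suc k)) ⟩
          width (suc k) + width (suc k) ≡⟨ halves k ⟩
          width k ∎)

    initial : Bracket 0
    -- The upper end n + 1 is large enough because (n + 1)² = n + (n² + n + 1).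
    initial = record { lower = 0ℚ ; 0≤l = ℚ.≤-refl ; l²≤n = 0≤n ; n≤u² = begin
      n ≡⟨ ℚ.+-identityʳ n ⟨
      n + 0ℚ ≤⟨ ℚ.+-monoʳ-≤ n (ℚ.+-mono-≤ (0≤* 0≤n 0≤n) (ℚ.+-mono-≤ 0≤n (ℚ.*≤* {0ℚ} {1ℚ} (ℤ.+≤+ z≤n)))) ⟩
      n + (n * n + (n + 1ℚ)) ≡⟨ lemma n ⟩
      (0ℚ + width 0) ^ 2 ∎ }
      where
      open +-*-Solver
      lemma : ∀ n → n + (n * n + (n + 1ℚ)) ≡ (0ℚ + (n + 1ℚ) * 1ℚ) ^ 2
      lemma = solve 1 (λ n → n :+ (n :* n :+ (n :+ con 1ℚ)) := (con 0ℚ :+ (n :+ con 1ℚ) :* con 1ℚ) :^ 2) refl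

    brackets : ∀ k → Bracket k
    brackets zero = initial
    brackets (suc k) = bisect (brackets k)

    s : ℕ → ℚ
    s k = lower (brackets k)

    s-mono : ∀ t k → s k ≤ s (t ℕ.+ k)
    s-mono zero k = ℚ.≤-refl
    s-mono (suc t) k = ℚ.≤-trans (s-mono t k) (bisect-lower (brackets (t ℕ.+ k)))

    u-mono : ∀ t k → s (t ℕ.+ k) + width (t ℕ.+ k) ≤ s k + width k
    u-mono zero k = ℚ.≤-refl
    u-mono (suc t) k = ℚ.≤-trans (bisect-upper (brackets (t ℕ.+ k))) (u-mono t k)

    within : ∀ {N i} → i ℕ.≥ N → s N ≤ s i × s i ≤ s N + width N
    within {N} {i} i≥N = subst (λ i → s N ≤ s i × s i ≤ s N + width N) (ℕ.m∸n+n≡m i≥N) (s-mono (i ℕ.∸ N) N ,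
      ℚ.≤-trans (subst (_≤ s j + width j) (ℚ.+-identityʳ (s j)) (ℚ.+-monoʳ-≤ (s j) (0≤width j))) (u-mono (i ℕ.∸ N) N))
      where
      j : ℕ
      j = i ℕ.∸ N ℕ.+ N

    ∣-∣≤ : ∀ {l w x y} → l ≤ x × x ≤ l + w → l ≤ y × y ≤ l + w → ∣ x - y ∣ ≤ w
    ∣-∣≤ {l} {w} {x} {y} (l≤x , x≤u) (l≤y , y≤u) = [ (λ eq → subst (_≤ w) (sym eq) (bound x≤u l≤y)) , (λ eq → subst (_≤ w) (sym (trans eq (lemma x y))) (bound y≤u l≤x)) ]′ (ℚ.∣p∣≡p∨∣p∣≡-p (x - y))
      where
      open +-*-Solver
      lemma : ∀ x y → - (x - y) ≡ y - x
      lemma = solve 2 (λ x y → :- (x :- y) := y :- x) refl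
      lemma′ : ∀ l w → l + w - l ≡ w
      lemma′ = solve 2 (λ l w → l :+ w :- l := w) refl
      bound : ∀ {x y} → x ≤ l + w → l ≤ y → x - y ≤ w
      bound {x} {y} x≤ l≤y = subst (x - y ≤_) (lemma′ l w) (ℚ.+-mono-≤ x≤ (ℚ.neg-antimono-≤ l≤y))

    is-cauchy : Cauchy ∞ s
    is-cauchy ε 0<ε = N , λ i j i≥ j≥ → ℚ.≤-<-trans (∣-∣≤ {s N} {width N} {s i} {s j} (within i≥) (within j≥)) width<ε
      where
      N : ℕ
      N = proj₁ (width-null ε 0<ε)
      width<ε : width N < ε
      width<ε = subst (_< ε) (ℚ.0≤p⇒∣p∣≡p (0≤width N)) (proj₂ (width-null ε 0<ε) N ℕ.≤-refl)

    error : ∀ i → ∣ s i ^ 2 - n ∣ ≤ (c + c) * width i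
    error i = begin
      ∣ S ^ 2 - n ∣ ≡⟨ ℚ.∣-p∣≡∣p∣ (S ^ 2 - n) ⟨
      ∣ - (S ^ 2 - n) ∣ ≡⟨ cong ∣_∣ (lemma (S ^ 2) n) ⟩
      ∣ n - S ^ 2 ∣ ≡⟨ ℚ.0≤p⇒∣p∣≡p (subst (_≤ n - S ^ 2) (ℚ.+-inverseʳ (S ^ 2)) (ℚ.+-monoˡ-≤ (- (S ^ 2)) (l²≤n b))) ⟩
      n - S ^ 2 ≤⟨ ℚ.+-monoˡ-≤ (- (S ^ 2)) (n≤u² b) ⟩
      (S + W) ^ 2 - S ^ 2 ≡⟨ lemma′ S W ⟩
      (S + (S + W)) * W ≤⟨ ℚ.*-monoʳ-≤-nonNeg W {{ℚ.nonNegative (0≤width i)}} (ℚ.+-mono-≤ (ℚ.≤-trans (subst (_≤ S + W) (ℚ.+-identityʳ S) (ℚ.+-monoʳ-≤ S (0≤width i))) upper) upper) ⟩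
      (c + c) * W ∎
      where
      b : Bracket i
      b = brackets i
      S W : ℚ
      S = s i
      W = width i
      upper : S + W ≤ c
      upper = ℚ.≤-trans (subst (λ i → s i + width i ≤ 0ℚ + width 0) (ℕ.+-identityʳ i) (u-mono i 0))
        (ℚ.≤-reflexive (trans (ℚ.+-identityˡ (width 0)) (ℚ.*-identityʳ c)))
      open +-*-Solver
      lemma : ∀ a n → - (a - n) ≡ n - a
      lemma = solve 2 (λ a n → :- (a :- n) := n :- a) refl
      lemma′ : ∀ S W → (S + W) ^ 2 - S ^ 2 ≡ (S + (S + W)) * W
      lemma′ = solve 2 (λ S W → (S :+ W) :^ 2 :- S :^ 2 := (S :+ (S :+ W)) :* W) refl

  0≤x² : ∀ x → 0ℚ ≤ x ^ 2
  0≤x² x = ℚ.≤-trans (^-nonNeg 2 (ℚ.0≤∣p∣ x)) (ℚ.≤-reflexive (trans (sym (∣^∣ x 2)) (trans (cong ∣_∣ (square-∣∣ x)) (∣x*x∣ x))))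
    where
    open +-*-Solver
    square-∣∣ : ∀ x → x ^ 2 ≡ x * x
    square-∣∣ = solve 1 (λ x → x :^ 2 := x :* x) refl
    ∣x*x∣ : ∀ x → ∣ x * x ∣ ≡ x ^ 2
    ∣x*x∣ x with ℚ.∣p∣≡p∨∣p∣≡-p x
    ... | inj₁ eq = trans (ℚ.∣p*q∣≡∣p∣*∣q∣ x x) (trans (cong₂ _*_ eq eq) (sym (square-∣∣ x)))
    ... | inj₂ eq = trans (ℚ.∣p*q∣≡∣p∣*∣q∣ x x) (trans (cong₂ _*_ eq eq) (lemma x))
      where
      lemma : ∀ x → - x * - x ≡ x ^ 2
      lemma = solve 1 (λ x → :- x :* :- x := x :^ 2) refl

  -- The quartic is a sum of three nonnegative terms, and coefficients at most -1 make it dominate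
  -- u⁴, w² and z⁴ separately. Negative integers satisfy this bound.
  anisotropic-real : ∀ {a b} → a ≤ - 1ℚ → b ≤ - 1ℚ → Anisotropic ∞ a b
  anisotropic-real {a} {b} a≤-1 b≤-1 u w z null =
    powers 4 {u} (λ i → ℚ.≤-trans (neg-coefficient a≤-1 (even⁴ (u i))) (ℚ.≤-trans (+-right (0≤w² i) (≤-+ˡ (0≤bz⁴ i))) (ℚ.≤-reflexive (F≡ i)))) (λ i → even⁴ (u i)) ,
    powers 2 {w} (λ i → ℚ.≤-trans (≤-+ˡ (ℚ.+-mono-≤ (0≤au⁴ i) (0≤bz⁴ i))) (ℚ.≤-reflexive (F≡ i))) (λ i → 0≤x² (w i)) ,
    powers 4 {z} (λ i → ℚ.≤-trans (neg-coefficient b≤-1 (even⁴ (z i))) (ℚ.≤-trans (+-right (0≤w² i) (+-right (0≤au⁴ i) ℚ.≤-refl)) (ℚ.≤-reflexive (F≡ i)))) (λ i → even⁴ (z i))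
    where
    open +-*-Solver
    F : ℕ → ℚ
    F i = quartic a b (u i) (w i) (z i)
    even⁴ : ∀ x → 0ℚ ≤ x ^ 4
    even⁴ x = subst (0ℚ ≤_) (lemma x) (0≤x² (x * x))
      where
      lemma : ∀ x → (x * x) ^ 2 ≡ x ^ 4
      lemma = solve 1 (λ x → (x :* x) :^ 2 := x :^ 4) refl
    neg-coefficient : ∀ {a x} → a ≤ - 1ℚ → 0ℚ ≤ x → x ≤ - a * x
    neg-coefficient {a} {x} a≤-1 0≤x = subst (_≤ - a * x) (ℚ.*-identityˡ x) (ℚ.*-monoʳ-≤-nonNeg x {{ℚ.nonNegative 0≤x}} (ℚ.neg-antimono-≤ a≤-1))
    ≤-+ˡ : ∀ {x y} → 0ℚ ≤ y → x ≤ x + y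
    ≤-+ˡ {x} {y} 0≤y = subst (_≤ x + y) (ℚ.+-identityʳ x) (ℚ.+-monoʳ-≤ x 0≤y)
    +-right : ∀ {x y z} → 0ℚ ≤ x → y ≤ z → y ≤ x + z
    +-right {x} {y} {z} 0≤x y≤z = subst (_≤ x + z) (ℚ.+-identityˡ y) (ℚ.+-mono-≤ 0≤x y≤z)
    0≤w² : ∀ i → 0ℚ ≤ w i ^ 2
    0≤w² i = 0≤x² (w i)
    0≤au⁴ : ∀ i → 0ℚ ≤ - a * u i ^ 4
    0≤au⁴ i = ℚ.≤-trans (even⁴ (u i)) (neg-coefficient a≤-1 (even⁴ (u i)))
    0≤bz⁴ : ∀ i → 0ℚ ≤ - b * z i ^ 4
    0≤bz⁴ i = ℚ.≤-trans (even⁴ (z i)) (neg-coefficient b≤-1 (even⁴ (z i)))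
    F≡ : ∀ i → w i ^ 2 + (- a * u i ^ 4 + - b * z i ^ 4) ≡ F i
    F≡ i = lemma a b (u i) (w i) (z i)
      where
      lemma : ∀ a b u w z → w ^ 2 + (- a * u ^ 4 + - b * z ^ 4) ≡ w ^ 2 - (a * u ^ 4 + b * z ^ 4)
      lemma = solve 5 (λ a b u w z → w :^ 2 :+ (:- a :* u :^ 4 :+ :- b :* z :^ 4) := w :^ 2 :- (a :* u :^ 4 :+ b :* z :^ 4)) refl
    -- If ε ≤ ∣ x ∣ then ε^m ≤ x^m ≤ F < ε^m, so no root extraction enters.
    powers : ∀ m {x : ℕ → ℚ} → (∀ i → x i ^ m ≤ F i) → (∀ i → 0ℚ ≤ x i ^ m) → Null ∞ x
    powers m {x} x^m≤F 0≤x^m ε 0<ε with null (ε ^ m) (0<^ m 0<ε)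
    ... | N , small = N , λ i i≥N → ℚ.≰⇒> λ ε≤∣x∣ → ℚ.<-irrefl refl (ℚ.<-≤-trans (small i i≥N) (begin
          ε ^ m ≤⟨ ^-mono-≤ m (ℚ.<⇒≤ 0<ε) ε≤∣x∣ ⟩
          ∣ x i ∣ ^ m ≡⟨ ∣^∣ (x i) m ⟨
          ∣ x i ^ m ∣ ≡⟨ ℚ.0≤p⇒∣p∣≡p (0≤x^m i) ⟩
          x i ^ m ≤⟨ x^m≤F i ⟩
          F i ≡⟨ ℚ.0≤p⇒∣p∣≡p (ℚ.≤-trans (0≤x^m i) (x^m≤F i)) ⟨
          ∣ F i ∣ ∎))
      where open ℚ.≤-Reasoning

-- The odd places.

module OddPlaces where

  open Rationals
  open QuadraticResidues
  open AdicValuations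
  open Completions
  open HenselLifting
  open import Data.Integer.Base using (_+_; _-_; -_; _*_; _^_)
  open import Data.Integer.Divisibility.Signed
  open import Data.Integer.Solver using () renaming (module +-*-Solver to ℤ-Solver)

  Anisotropicℤ : Place → ℤ → ℤ → Set
  Anisotropicℤ v a b = Anisotropic v (fromℤ a) (fromℤ b)

  Solubleℤ : ℤ → ℤ → Place → Set
  Solubleℤ a b v = Soluble (fromℤ a) (fromℤ b) v

  module OddLocal (ℓ h : ℕ) (ℓ-prime : Prime ℓ) (ℓ≡1+2h : ℓ ≡ suc (h ℕ.+ h)) where
    open OddPrime ℓ h ℓ-prime ℓ≡1+2h
    open Adic ℓ ℓ-prime using (π; Anisotropic-mod; anisotropic-null′; π^-nonZero)

    -- Modulo ℓ the equation is w² ≡ a u⁴, so a unit u would give a ≡ (w/u²)². Hence ℓ divides u and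
    -- w; then ℓ² divides ℓ b z⁴, so ℓ divides z; finally ℓ³ divides w², so ℓ² divides w.
    nonresidue⇒anisotropic : ∀ a b → Unit a → Unit b → isSquare ℓ a ≡ false → Anisotropicℤ (fin ℓ ℓ-prime) a (+ ℓ * b)
    nonresidue⇒anisotropic a b ℓ∤a ℓ∤b nonresidue = anisotropic-null′ 4 {a} {π * b} aniso
      where
      open ℤ-Solver
      π≢0 : ℤ.NonZero π
      π≢0 = subst ℤ.NonZero (ℤ.*-identityʳ π) (π^-nonZero 1)
      aniso : Anisotropic-mod 4 a (π * b)
      aniso u w z π⁴∣F@(divides f F≡) = π∣u , π²∣w , π∣z
        where
        π∣^ : ∀ x n → π ∣ x ^ n → π ∣ x
        π∣^ x zero π∣1 = contradiction π∣1 (prime∤1 ℓ-prime)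
        π∣^ x (suc n) π∣ = [ (λ π∣x → π∣x) , π∣^ x n ]′ (prime∣* ℓ-prime x (x ^ n) π∣)
        reduce : π ∣ w * w - a * (u * u) * (u * u)
        reduce = divides (f * π * π * π + b * z ^ 4) (trans (lemma (π * b) a u w z)
          (trans (cong (_+ π * b * z ^ 4) F≡) (lemma′ f π b z)))
          where
          lemma : ∀ c a u w z → w * w - a * (u * u) * (u * u) ≡ w ^ 2 - (a * u ^ 4 + c * z ^ 4) + c * z ^ 4
          lemma = solve 5 (λ c a u w z → w :* w :- a :* (u :* u) :* (u :* u) := w :^ 2 :- (a :* u :^ 4 :+ c :* z :^ 4) :+ c :* z :^ 4) refl
          lemma′ : ∀ f p b z → f * p ^ 4 + p * b * z ^ 4 ≡ (f * p * p * p + b * z ^ 4) * p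
          lemma′ = solve 4 (λ f p b z → f :* p :^ 4 :+ p :* b :* z :^ 4 := (f :* p :* p :* p :+ b :* z :^ 4) :* p) refl
        π∣u : π ∣ u
        π∣u with π ∣? u
        ... | yes π∣u = π∣u
        ... | no π∤u = ⊥-elim (false≢true (trans (sym nonresidue) (isSquare-true a (w * i) (∣-comb (i * i) (a * (u * u * i + 1ℤ)) reduce u²i≋1 (lemma a u w i)))))
          where
          false≢true : false ≢ true
          false≢true ()
          i : ℤ
          i = inv (u * u)
          u²i≋1 : u * u * i ≋ 1ℤ
          u²i≋1 = *-inv (u * u) (unit-* {u} π∤u π∤u)
          lemma : ∀ a u w i → w * i * (w * i) - a ≡ i * i * (w * w - a * (u * u) * (u * u)) + a * (u * u * i + 1ℤ) * (u * u * i - 1ℤ)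
          lemma = solve 4 (λ a u w i → w :* i :* (w :* i) :- a := i :* i :* (w :* w :- a :* (u :* u) :* (u :* u)) :+ a :* (u :* u :* i :+ con 1ℤ) :* (u :* u :* i :- con 1ℤ)) refl
        π∣w : π ∣ w
        π∣w = [ (λ π∣w → π∣w) , (λ π∣w → π∣w) ]′ (prime∣* ℓ-prime w w
          (∣-comb 1ℤ (a * u * (u * u)) reduce π∣u (lemma a u w)))
          where
          lemma : ∀ a u w → w * w ≡ 1ℤ * (w * w - a * (u * u) * (u * u)) + a * u * (u * u) * u
          lemma = solve 3 (λ a u w → w :* w := con 1ℤ :* (w :* w :- a :* (u :* u) :* (u :* u)) :+ a :* u :* (u :* u) :* u) refl
        π∣z : π ∣ z
        π∣z = extract π∣u π∣w
          where
          extract : π ∣ u → π ∣ w → π ∣ z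
          extract (divides u′ u≡) (divides w′ w≡) = [ (λ π∣b → contradiction π∣b ℓ∤b) , π∣^ z 4 ]′ (prime∣* ℓ-prime b (z ^ 4)
            (*-cancelˡ-∣ π {{π≢0}} (divides (w′ * w′ - a * (u′ * u′) * (u′ * u′) * (π * π) - f * (π * π)) (trans (lemma π b a u w z)
              (trans (cong₂ (λ x F → x ^ 2 - a * u ^ 4 - F) w≡ F≡) (trans (cong (λ x → (w′ * π) ^ 2 - a * x ^ 4 - f * π ^ 4) u≡) (lemma′ f a u′ w′ π)))))))
            where
            lemma : ∀ p b a u w z → p * (b * z ^ 4) ≡ w ^ 2 - a * u ^ 4 - (w ^ 2 - (a * u ^ 4 + p * b * z ^ 4))
            lemma = solve 6 (λ p b a u w z → p :* (b :* z :^ 4) := w :^ 2 :- a :* u :^ 4 :- (w :^ 2 :- (a :* u :^ 4 :+ p :* b :* z :^ 4))) refl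
            lemma′ : ∀ f a u w p → (w * p) ^ 2 - a * (u * p) ^ 4 - f * p ^ 4 ≡ (w * w - a * (u * u) * (u * u) * (p * p) - f * (p * p)) * (p * p)
            lemma′ = solve 5 (λ f a u w p → (w :* p) :^ 2 :- a :* (u :* p) :^ 4 :- f :* p :^ 4 := (w :* w :- a :* (u :* u) :* (u :* u) :* (p :* p) :- f :* (p :* p)) :* (p :* p)) refl
        π²∣w : π ^ 2 ∣ w
        π²∣w = extract π∣u π∣w π∣z
          where
          extract : π ∣ u → π ∣ w → π ∣ z → π ^ 2 ∣ w
          extract (divides u′ u≡) (divides w′ w≡) (divides z′ z≡) =
            subst (π ^ 2 ∣_) (sym w≡) (subst₂ _∣_ (cong (π *_) (sym (ℤ.*-identityʳ π))) (ℤ.*-comm π w′) (*-monoʳ-∣ π (π∣^ w′ 2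
              (*-cancelˡ-∣ (π * π) {{ℤ.i*j≢0 π π {{π≢0}} {{π≢0}}}} (divides (π * (f + a * u′ ^ 4 + π * b * z′ ^ 4)) (trans (lemma w′ π) (trans (cong (_^ 2) (sym w≡))
                (trans (lemma′ a (π * b) u w z) (trans (cong₂ (λ F x → F + (a * x ^ 4 + π * b * z ^ 4)) F≡ u≡) (trans (cong (λ x → f * π ^ 4 + (a * (u′ * π) ^ 4 + π * b * x ^ 4)) z≡) (lemma″ f a b u′ z′ π)))))))))))
            where
            lemma : ∀ w p → p * p * (w ^ 2) ≡ (w * p) ^ 2
            lemma = solve 2 (λ w p → p :* p :* (w :^ 2) := (w :* p) :^ 2) refl
            lemma′ : ∀ a c u w z → w ^ 2 ≡ w ^ 2 - (a * u ^ 4 + c * z ^ 4) + (a * u ^ 4 + c * z ^ 4)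
            lemma′ = solve 5 (λ a c u w z → w :^ 2 := w :^ 2 :- (a :* u :^ 4 :+ c :* z :^ 4) :+ (a :* u :^ 4 :+ c :* z :^ 4)) refl
            lemma″ : ∀ f a b u z p → f * p ^ 4 + (a * (u * p) ^ 4 + p * b * (z * p) ^ 4) ≡ p * (f + a * u ^ 4 + p * b * z ^ 4) * (p * p * p)
            lemma″ = solve 6 (λ f a b u z p → f :* p :^ 4 :+ (a :* (u :* p) :^ 4 :+ p :* b :* (z :* p) :^ 4) := p :* (f :+ a :* u :^ 4 :+ p :* b :* z :^ 4) :* (p :* p :* p)) refl

    residue⇒root : ∀ a → Unit a → isSquare ℓ a ≡ true → Root (fin ℓ ℓ-prime) 2 (fromℤ a)
    residue⇒root a ℓ∤a residue = let x , x²≋a = isSquare-witness residue in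
      √-odd ℓ ℓ-prime ℓ∤2 a x (λ ℓ∣x → unit-≋ {a} {x * x} (≋-sym {x * x} {a} x²≋a) ℓ∤a (∣m⇒∣m*n x ℓ∣x)) x²≋a
      where
      1≤h : ∀ h → ℓ ≡ suc (h ℕ.+ h) → 1 ℕ.≤ h
      1≤h zero ℓ≡1 = contradiction (subst (λ ℓ → + ℓ ∣ 1ℤ) (sym ℓ≡1) ∣-refl) (prime∤1 ℓ-prime)
      1≤h (suc h) _ = s≤s z≤n
      ℓ∤2 : ¬ + ℓ ∣ + 2
      ℓ∤2 ℓ∣2 with ∣small⇒0 (+ 2) (ℕ.≤-<-trans (ℕ.+-mono-≤ (1≤h h ℓ≡1+2h) (1≤h h ℓ≡1+2h)) 2h<ℓ) ℓ∣2
      ... | ()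

-- Anisotropy at 2.

module DyadicAnisotropy where

  open Rationals
  open QuadraticResidues using (∣-resp; prime∣*; prime∤1)
  open AdicValuations
  open Completions
  open HenselLifting
  open OddPlaces using (Anisotropicℤ; Solubleℤ)
  open import Data.Integer.Base using (_+_; _-_; -_; _*_; _^_)
  open import Data.Integer.Divisibility.Signed
  open import Data.Integer.Solver using () renaming (module +-*-Solver to ℤ-Solver)

  open Adic 2 prime[2] using (Anisotropic-mod; anisotropic-null′)
  open ℤ-Solver using (solve; _:=_; _:+_; _:-_; _:*_; _:^_; :-_; con)

  infixr 5 _⊞_
  infixr 6 _⊡_

  -- With `_⊡_` this lets a proof term mirror the linear combination that the accompanying ring
  -- identity simplifies.
  _⊞_ : ∀ {d x y} → d ∣ x → d ∣ y → d ∣ x + y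
  _⊞_ = ∣m∣n⇒∣m+n

  _⊡_ : ∀ {d x} c → d ∣ x → d ∣ c * x
  c ⊡ d∣x = ∣n⇒∣m*n c d∣x

  Even : ℤ → Set
  Even x = + 2 ∣ x

  -- A record, so that x can be inferred from a proof.
  record Odd (x : ℤ) : Set where
    constructor odd
    field 2∣x-1 : + 2 ∣ x - 1ℤ
  open Odd public

  even-or-odd : ∀ x → Even x ⊎ Odd x
  even-or-odd x with x %ℕ 2 | n%ℕd<d x 2 | a≡a%ℕn+[a/ℕn]*n x 2
  ... | 0 | _ | x≡ = inj₁ (divides (x /ℕ 2) (trans x≡ (ℤ.+-identityˡ _)))
  ... | 1 | _ | x≡ = inj₂ (odd (divides (x /ℕ 2) (trans (cong (_- 1ℤ) x≡) (lemma (x /ℕ 2)))))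
    where
    lemma : ∀ y → + 1 + y * + 2 - 1ℤ ≡ y * + 2
    lemma = solve 1 (λ y → con (+ 1) :+ y :* con (+ 2) :- con 1ℤ := y :* con (+ 2)) refl
  ... | suc (suc _) | s≤s (s≤s ()) | _

  odd∧even : ∀ {x} → Odd x → Even x → ⊥
  odd∧even {x} (odd 2∣x-1) even = prime∤1 prime[2] (∣-resp (lemma x) (even ⊞ (- 1ℤ) ⊡ 2∣x-1))
    where
    lemma : ∀ x → x + - 1ℤ * (x - 1ℤ) ≡ 1ℤ
    lemma = solve 1 (λ x → x :+ con (- 1ℤ) :* (x :- con 1ℤ) := con 1ℤ) refl

  even-⁴ : ∀ {x} → Even x → + 16 ∣ x ^ 4
  even-⁴ (divides k refl) = divides (k ^ 4) (lemma k)
    where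
    lemma : ∀ k → (k * + 2) ^ 4 ≡ k ^ 4 * + 16
    lemma = solve 1 (λ k → (k :* con (+ 2)) :^ 4 := k :^ 4 :* con (+ 16)) refl

  even-² : ∀ {x} → Even x → + 16 ∣ x ^ 2 ⊎ + 16 ∣ x ^ 2 - + 4
  even-² (divides k refl) with even-or-odd k
  ... | inj₁ (divides j refl) = inj₁ (divides (j ^ 2) (lemma j))
    where
    lemma : ∀ j → (j * + 2 * + 2) ^ 2 ≡ j ^ 2 * + 16
    lemma = solve 1 (λ j → (j :* con (+ 2) :* con (+ 2)) :^ 2 := j :^ 2 :* con (+ 16)) refl
  ... | inj₂ (odd (divides j k≡)) = inj₂ (divides (j * (j + 1ℤ)) (trans (lemma k) (trans (cong (λ y → + 4 * (y * (y + + 2))) k≡) (lemma′ j))))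
    where
    lemma : ∀ k → (k * + 2) ^ 2 - + 4 ≡ + 4 * ((k - 1ℤ) * (k - 1ℤ + + 2))
    lemma = solve 1 (λ k → (k :* con (+ 2)) :^ 2 :- con (+ 4) := con (+ 4) :* ((k :- con 1ℤ) :* (k :- con 1ℤ :+ con (+ 2)))) refl
    lemma′ : ∀ j → + 4 * (j * + 2 * (j * + 2 + + 2)) ≡ j * (j + 1ℤ) * + 16
    lemma′ = solve 1 (λ j → con (+ 4) :* (j :* con (+ 2) :* (j :* con (+ 2) :+ con (+ 2))) := j :* (j :+ con 1ℤ) :* con (+ 16)) refl

  odd-² : ∀ {x} → Odd x → + 8 ∣ x ^ 2 - 1ℤ
  odd-² {x} (odd (divides k x≡)) = [ even-k , odd-k ]′ (even-or-odd k)
    where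
    lemma : ∀ x → x ^ 2 - 1ℤ ≡ (x - 1ℤ) * (x - 1ℤ + + 2)
    lemma = solve 1 (λ x → x :^ 2 :- con 1ℤ := (x :- con 1ℤ) :* (x :- con 1ℤ :+ con (+ 2))) refl
    x²≡ : x ^ 2 - 1ℤ ≡ (k * + 2) * (k * + 2 + + 2)
    x²≡ = trans (lemma x) (cong (λ y → y * (y + + 2)) x≡)
    even-k : Even k → + 8 ∣ x ^ 2 - 1ℤ
    even-k (divides j k≡) = divides (j * (k + 1ℤ)) (trans x²≡ (trans (cong (λ y → (y * + 2) * (k * + 2 + + 2)) k≡) (lemma′ j k)))
      where
      lemma′ : ∀ j k → (j * + 2 * + 2) * (k * + 2 + + 2) ≡ j * (k + 1ℤ) * + 8
      lemma′ = solve 2 (λ j k → (j :* con (+ 2) :* con (+ 2)) :* (k :* con (+ 2) :+ con (+ 2)) := j :* (k :+ con 1ℤ) :* con (+ 8)) refl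
    odd-k : Odd k → + 8 ∣ x ^ 2 - 1ℤ
    odd-k (odd (divides j k≡)) = divides (k * (j + 1ℤ)) (trans x²≡ (trans (lemma′ k) (trans (cong (λ y → + 4 * (k * (y + + 2))) k≡) (lemma″ j k))))
      where
      lemma′ : ∀ k → (k * + 2) * (k * + 2 + + 2) ≡ + 4 * (k * (k - 1ℤ + + 2))
      lemma′ = solve 1 (λ k → (k :* con (+ 2)) :* (k :* con (+ 2) :+ con (+ 2)) := con (+ 4) :* (k :* (k :- con 1ℤ :+ con (+ 2)))) refl
      lemma″ : ∀ j k → + 4 * (k * (j * + 2 + + 2)) ≡ k * (j + 1ℤ) * + 8
      lemma″ = solve 2 (λ j k → con (+ 4) :* (k :* (j :* con (+ 2) :+ con (+ 2))) := k :* (j :+ con 1ℤ) :* con (+ 8)) refl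

  -- In x⁴ - 1 = (x² - 1)(x² + 1) the factors are divisible by 8 and by 2.
  odd-⁴ : ∀ {x} → Odd x → + 16 ∣ x ^ 4 - 1ℤ
  odd-⁴ {x} odd-x with odd-² odd-x
  ... | divides c x²≡ = divides (c * (c * + 4 + 1ℤ)) (trans (lemma x) (trans (cong (λ y → y * (y + + 2)) x²≡) (lemma′ c)))
    where
    lemma : ∀ x → x ^ 4 - 1ℤ ≡ (x ^ 2 - 1ℤ) * (x ^ 2 - 1ℤ + + 2)
    lemma = solve 1 (λ x → x :^ 4 :- con 1ℤ := (x :^ 2 :- con 1ℤ) :* (x :^ 2 :- con 1ℤ :+ con (+ 2))) refl
    lemma′ : ∀ c → c * + 8 * (c * + 8 + + 2) ≡ c * (c * + 4 + 1ℤ) * + 16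
    lemma′ = solve 1 (λ c → c :* con (+ 8) :* (c :* con (+ 8) :+ con (+ 2)) := c :* (c :* con (+ 4) :+ con 1ℤ) :* con (+ 16)) refl

  2∣8 : + 2 ∣ + 8
  2∣8 = divides (+ 4) refl
  2∣16 : + 2 ∣ + 16
  2∣16 = divides (+ 8) refl
  4∣16 : + 4 ∣ + 16
  4∣16 = divides (+ 4) refl
  8∣16 : + 8 ∣ + 16
  8∣16 = divides (+ 2) refl

  even-root : ∀ x → Even (x ^ 2) → Even x
  even-root x even = [ (λ e → e) , [ (λ e → e) , (λ e → contradiction e (prime∤1 prime[2])) ]′ ∘ prime∣* prime[2] x 1ℤ ]′ (prime∣* prime[2] x (x * 1ℤ) even)

  even-square : ∀ {x} → Even x → Even (x ^ 2)
  even-square {x} = ∣m⇒∣m*n (x * 1ℤ)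

  odd-square : ∀ {x} → Odd x → Odd (x ^ 2)
  odd-square odd-x = odd (∣-trans 2∣8 (odd-² odd-x))

  odd+odd : ∀ {a b} → Odd a → Odd b → Even (a + b)
  odd+odd {a} {b} (odd odd-a) (odd odd-b) = ∣-resp (lemma a b) (odd-a ⊞ odd-b ⊞ ∣-refl)
    where
    lemma : ∀ a b → a - 1ℤ + (b - 1ℤ + + 2) ≡ a + b
    lemma = solve 2 (λ a b → a :- con 1ℤ :+ (b :- con 1ℤ :+ con (+ 2)) := a :+ b) refl

  quarticᴾ : ∀ {n} (a b u w z : ℤ-Solver.Polynomial n) → ℤ-Solver.Polynomial n
  quarticᴾ a b u w z = w :^ 2 :- (a :* u :^ 4 :+ b :* z :^ 4)

  quarticℤ-swap : ∀ a b u w z → quarticℤ a b u w z ≡ quarticℤ b a z w u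
  quarticℤ-swap = solve 5 (λ a b u w z → quarticᴾ a b u w z := quarticᴾ b a z w u) refl

  -- The solubility conditions at 2 of the coefficient pairs (2 a , 2 b), (a , 4 b) and (a , 16 b)
  -- with a and b odd; the index is the square root of the ratio of the powers of 2. The conditions
  -- on a + b come from odd u and z: modulo 16 the sum has to be a value of 2 w² in `C₁`, and of w²
  -- with w even in `C₄`.
  C₁ C₂ C₄ : ℤ → ℤ → Set
  C₁ a b = + 8 ∣ a + b ⊎ + 16 ∣ a + b - + 2
  C₂ a b = + 4 ∣ a - 1ℤ ⊎ + 4 ∣ b - 1ℤ
  C₄ a b = + 8 ∣ a - 1ℤ ⊎ + 8 ∣ b - 1ℤ ⊎ + 16 ∣ a + b ⊎ + 16 ∣ a + b - + 4

  module _ {a b : ℤ} (odd-a : Odd a) (odd-b : Odd b) where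

    private
      odd-even⇒8∣ : ∀ {a b} → Odd a → ∀ u w z → + 16 ∣ quarticℤ a b u w z → Odd u → Even z → + 8 ∣ a - 1ℤ
      odd-even⇒8∣ {a} {b} odd-a u w z 16∣F odd-u even-z = [ (λ even-w → ⊥-elim (odd∧even odd-a (∣-resp (lemma a b u w z)
          (even-square even-w ⊞ (- 1ℤ) ⊡ ∣-trans 2∣16 16∣F ⊞ (- a) ⊡ ∣-trans 2∣16 (odd-⁴ odd-u) ⊞ (- b) ⊡ ∣-trans 2∣16 (even-⁴ even-z)))))
        , (λ odd-w → ∣-resp (lemma′ a b u w z)
          (odd-² odd-w ⊞ (- 1ℤ) ⊡ ∣-trans 8∣16 16∣F ⊞ (- a) ⊡ ∣-trans 8∣16 (odd-⁴ odd-u) ⊞ (- b) ⊡ ∣-trans 8∣16 (even-⁴ even-z))) ]′ (even-or-odd w)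
        where
        lemma : ∀ a b u w z → w ^ 2 + (- 1ℤ * (quarticℤ a b u w z) + (- a * (u ^ 4 - 1ℤ) + - b * z ^ 4)) ≡ a
        lemma = solve 5 (λ a b u w z → w :^ 2 :+ (con (- 1ℤ) :* (quarticᴾ a b u w z) :+ (:- a :* (u :^ 4 :- con 1ℤ) :+ :- b :* z :^ 4)) := a) refl
        lemma′ : ∀ a b u w z → w ^ 2 - 1ℤ + (- 1ℤ * (quarticℤ a b u w z) + (- a * (u ^ 4 - 1ℤ) + - b * z ^ 4)) ≡ a - 1ℤ
        lemma′ = solve 5 (λ a b u w z → w :^ 2 :- con 1ℤ :+ (con (- 1ℤ) :* (quarticᴾ a b u w z) :+ (:- a :* (u :^ 4 :- con 1ℤ) :+ :- b :* z :^ 4)) := a :- con 1ℤ) refl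

      odd-odd : ∀ u w z → + 16 ∣ quarticℤ a b u w z → Odd u → Odd z → + 16 ∣ w ^ 2 - (a + b)
      odd-odd u w z 16∣F odd-u odd-z = ∣-resp (lemma a b u w z) (16∣F ⊞ a ⊡ odd-⁴ odd-u ⊞ b ⊡ odd-⁴ odd-z)
        where
        lemma : ∀ a b u w z → quarticℤ a b u w z + (a * (u ^ 4 - 1ℤ) + b * (z ^ 4 - 1ℤ)) ≡ w ^ 2 - (a + b)
        lemma = solve 5 (λ a b u w z → quarticᴾ a b u w z :+ (a :* (u :^ 4 :- con 1ℤ) :+ b :* (z :^ 4 :- con 1ℤ)) := w :^ 2 :- (a :+ b)) refl

      -- Fourth powers are 0 or 1 modulo 16, so every other parity pattern of u and z makes a, b or
      -- a + b a square modulo 16. These are the alternatives of `C₄`.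
      even-even : ¬ C₄ a b → ∀ u w z → + 16 ∣ quarticℤ a b u w z → Even u × Even z
      even-even ¬C u w z 16∣F with even-or-odd u | even-or-odd z
      ... | inj₁ even-u | inj₁ even-z = even-u , even-z
      ... | inj₂ odd-u | inj₁ even-z = ⊥-elim (¬C (inj₁ (odd-even⇒8∣ {a} {b} odd-a u w z 16∣F odd-u even-z)))
      ... | inj₁ even-u | inj₂ odd-z = ⊥-elim (¬C (inj₂ (inj₁ (odd-even⇒8∣ {b} {a} odd-b z w u (∣-resp (quarticℤ-swap a b u w z) 16∣F) odd-z even-u))))
      ... | inj₂ odd-u | inj₂ odd-z = ⊥-elim (¬C (inj₂ (inj₂ ([ (λ even-w → [ (λ 16∣w² → inj₁ (∣-resp (lemma (w ^ 2) (a + b)) (16∣w² ⊞ (- 1ℤ) ⊡ G)))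
                                                                                  , (λ 16∣w²-4 → inj₂ (∣-resp (lemma′ (w ^ 2) (a + b)) (16∣w²-4 ⊞ (- 1ℤ) ⊡ G))) ]′ (even-² even-w))
                                                                    , (λ odd-w → ⊥-elim (odd∧even (odd-square odd-w) (∣-resp (lemma″ (w ^ 2) (a + b)) (∣-trans 2∣16 G ⊞ odd+odd odd-a odd-b)))) ]′ (even-or-odd w)))))
        where
        G : + 16 ∣ w ^ 2 - (a + b)
        G = odd-odd u w z 16∣F odd-u odd-z
        lemma : ∀ w c → w + - 1ℤ * (w - c) ≡ c
        lemma = solve 2 (λ w c → w :+ con (- 1ℤ) :* (w :- c) := c) refl
        lemma′ : ∀ w c → w - + 4 + - 1ℤ * (w - c) ≡ c - + 4
        lemma′ = solve 2 (λ w c → w :- con (+ 4) :+ con (- 1ℤ) :* (w :- c) := c :- con (+ 4)) refl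
        lemma″ : ∀ w c → w - c + c ≡ w
        lemma″ = solve 2 (λ w c → w :- c :+ c := w) refl

    -- Since 16 z⁴ = (2 z)⁴, `even-even` gives u even. Then w is even twice over, and dividing the
    -- quartic by 16 leaves the pair (a , b), for which `even-even` gives z even. The modulus 256 is
    -- the 16 used at the end times the 16 divided out.
    a,16b-anisotropic : ¬ C₄ a b → Anisotropicℤ 2-place a (+ 16 * b)
    a,16b-anisotropic ¬C = anisotropic-null′ 8 {a} {+ 16 * b} λ u w z 256∣F →
      let even-u , _ = even-even ¬C u w (z * + 2) (∣-trans (divides (+ 16) refl) (∣-resp (double a b u w z) 256∣F))
      in go u w z even-u (even-root w (∣-resp (w² a b u w z) (∣-trans (divides (+ 128) refl) 256∣F ⊞ a ⊡ ∣-trans 2∣16 (even-⁴ even-u) ⊞ b * z ^ 4 ⊡ 2∣16))) 256∣F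
      where
      double : ∀ a b u w z → w ^ 2 - (a * u ^ 4 + + 16 * b * z ^ 4) ≡ w ^ 2 - (a * u ^ 4 + b * (z * + 2) ^ 4)
      double = solve 5 (λ a b u w z → w :^ 2 :- (a :* u :^ 4 :+ con (+ 16) :* b :* z :^ 4) := w :^ 2 :- (a :* u :^ 4 :+ b :* (z :* con (+ 2)) :^ 4)) refl
      w² : ∀ a b u w z → w ^ 2 - (a * u ^ 4 + + 16 * b * z ^ 4) + (a * u ^ 4 + b * z ^ 4 * + 16) ≡ w ^ 2
      w² = solve 5 (λ a b u w z → w :^ 2 :- (a :* u :^ 4 :+ con (+ 16) :* b :* z :^ 4) :+ (a :* u :^ 4 :+ b :* z :^ 4 :* con (+ 16)) := w :^ 2) refl
      quarter : ∀ a b u w z → (w * + 2) ^ 2 - (a * (u * + 2) ^ 4 + + 16 * b * z ^ 4) ≡ + 4 * (w ^ 2 - + 4 * (a * u ^ 4 + b * z ^ 4))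
      quarter = solve 5 (λ a b u w z → (w :* con (+ 2)) :^ 2 :- (a :* (u :* con (+ 2)) :^ 4 :+ con (+ 16) :* b :* z :^ 4) := con (+ 4) :* (w :^ 2 :- con (+ 4) :* (a :* u :^ 4 :+ b :* z :^ 4))) refl
      w₁² : ∀ w c → w ^ 2 - + 4 * c + c * + 4 ≡ w ^ 2
      w₁² = solve 2 (λ w c → w :^ 2 :- con (+ 4) :* c :+ c :* con (+ 4) := w :^ 2) refl
      quarter′ : ∀ a b u w z → (w * + 2) ^ 2 - + 4 * (a * u ^ 4 + b * z ^ 4) ≡ + 4 * (quarticℤ a b u w z)
      quarter′ = solve 5 (λ a b u w z → (w :* con (+ 2)) :^ 2 :- con (+ 4) :* (a :* u :^ 4 :+ b :* z :^ 4) := con (+ 4) :* (quarticᴾ a b u w z)) refl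
      go : ∀ u w z → Even u → Even w → + 256 ∣ quarticℤ a (+ 16 * b) u w z → Even u × + 4 ∣ w × Even z
      go _ _ z (divides u refl) (divides w refl) 256∣F =
        go′ u w z (even-root w (∣-resp (w₁² w (a * u ^ 4 + b * z ^ 4)) (∣-trans (divides (+ 32) refl) 64∣ ⊞ (a * u ^ 4 + b * z ^ 4) ⊡ divides (+ 2) refl))) 64∣
        where
        64∣ : + 64 ∣ w ^ 2 - + 4 * (a * u ^ 4 + b * z ^ 4)
        64∣ = *-cancelˡ-∣ (+ 4) {+ 64} (∣-resp (quarter a b u w z) 256∣F)
        go′ : ∀ u w z → Even w → + 64 ∣ w ^ 2 - + 4 * (a * u ^ 4 + b * z ^ 4) → Even (u * + 2) × + 4 ∣ w * + 2 × Even z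
        go′ u _ z (divides w refl) 64∣ = divides u refl , divides w (ℤ.*-assoc w (+ 2) (+ 2)) ,
          proj₂ (even-even ¬C u w z (*-cancelˡ-∣ (+ 4) {+ 16} (∣-resp (quarter′ a b u w z) 64∣)))

    -- w is even, and halving leaves 2 w² ≡ a u⁴ + b z⁴ modulo 16. So u and z have equal parity;
    -- both odd is `C₁`, and both even makes the new w even as well.
    2a,2b-anisotropic : ¬ C₁ a b → Anisotropicℤ 2-place (+ 2 * a) (+ 2 * b)
    2a,2b-anisotropic ¬C = anisotropic-null′ 5 {+ 2 * a} {+ 2 * b} λ u w z 32∣F →
      go u w z (even-root w (∣-resp (w² a b u w z) (∣-trans (divides (+ 16) refl) 32∣F ⊞ (a * u ^ 4 + b * z ^ 4) ⊡ ∣-refl))) 32∣F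
      where
      w² : ∀ a b u w z → w ^ 2 - (+ 2 * a * u ^ 4 + + 2 * b * z ^ 4) + (a * u ^ 4 + b * z ^ 4) * + 2 ≡ w ^ 2
      w² = solve 5 (λ a b u w z → w :^ 2 :- (con (+ 2) :* a :* u :^ 4 :+ con (+ 2) :* b :* z :^ 4) :+ (a :* u :^ 4 :+ b :* z :^ 4) :* con (+ 2) := w :^ 2) refl
      halve : ∀ a b u w z → (w * + 2) ^ 2 - (+ 2 * a * u ^ 4 + + 2 * b * z ^ 4) ≡ + 2 * (+ 2 * w ^ 2 - (a * u ^ 4 + b * z ^ 4))
      halve = solve 5 (λ a b u w z → (w :* con (+ 2)) :^ 2 :- (con (+ 2) :* a :* u :^ 4 :+ con (+ 2) :* b :* z :^ 4) := con (+ 2) :* (con (+ 2) :* w :^ 2 :- (a :* u :^ 4 :+ b :* z :^ 4))) refl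
      swap : ∀ a b u w z → + 2 * w ^ 2 - (a * u ^ 4 + b * z ^ 4) ≡ + 2 * w ^ 2 - (b * z ^ 4 + a * u ^ 4)
      swap = solve 5 (λ a b u w z → con (+ 2) :* w :^ 2 :- (a :* u :^ 4 :+ b :* z :^ 4) := con (+ 2) :* w :^ 2 :- (b :* z :^ 4 :+ a :* u :^ 4)) refl
      mixed : ∀ {a b} → Odd a → ∀ u w z → + 16 ∣ + 2 * w ^ 2 - (a * u ^ 4 + b * z ^ 4) → Odd u → Even z → ⊥
      mixed {a} {b} odd-a u w z 16∣G odd-u even-z = odd∧even odd-a (∣-resp (lemma a b u w z)
        (w ^ 2 ⊡ ∣-refl ⊞ (- 1ℤ) ⊡ ∣-trans 2∣16 16∣G ⊞ (- a) ⊡ ∣-trans 2∣16 (odd-⁴ odd-u) ⊞ (- b) ⊡ ∣-trans 2∣16 (even-⁴ even-z)))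
        where
        lemma : ∀ a b u w z → w ^ 2 * + 2 + (- 1ℤ * (+ 2 * w ^ 2 - (a * u ^ 4 + b * z ^ 4)) + (- a * (u ^ 4 - 1ℤ) + - b * z ^ 4)) ≡ a
        lemma = solve 5 (λ a b u w z → w :^ 2 :* con (+ 2) :+ (con (- 1ℤ) :* (con (+ 2) :* w :^ 2 :- (a :* u :^ 4 :+ b :* z :^ 4)) :+ (:- a :* (u :^ 4 :- con 1ℤ) :+ :- b :* z :^ 4)) := a) refl
      both-odd : ∀ u w z → + 16 ∣ + 2 * w ^ 2 - (a * u ^ 4 + b * z ^ 4) → Odd u → Odd z → C₁ a b
      both-odd u w z 16∣G odd-u odd-z = [ (λ even-w → inj₁ (∣-resp (lemma a b u w z)
            (2w²-even even-w ⊞ (- 1ℤ) ⊡ ∣-trans 8∣16 16∣G ⊞ (- a) ⊡ ∣-trans 8∣16 (odd-⁴ odd-u) ⊞ (- b) ⊡ ∣-trans 8∣16 (odd-⁴ odd-z))))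
          , (λ odd-w → inj₂ (∣-resp (lemma′ a b u w z)
            (*-monoʳ-∣ (+ 2) (odd-² odd-w) ⊞ (- 1ℤ) ⊡ 16∣G ⊞ (- a) ⊡ odd-⁴ odd-u ⊞ (- b) ⊡ odd-⁴ odd-z))) ]′ (even-or-odd w)
        where
        2w²-even : ∀ {w} → Even w → + 8 ∣ + 2 * w ^ 2
        2w²-even (divides k refl) = divides (k ^ 2) (lemma″ k)
          where
          lemma″ : ∀ k → + 2 * (k * + 2) ^ 2 ≡ k ^ 2 * + 8
          lemma″ = solve 1 (λ k → con (+ 2) :* (k :* con (+ 2)) :^ 2 := k :^ 2 :* con (+ 8)) refl
        lemma : ∀ a b u w z → + 2 * w ^ 2 + (- 1ℤ * (+ 2 * w ^ 2 - (a * u ^ 4 + b * z ^ 4)) + (- a * (u ^ 4 - 1ℤ) + - b * (z ^ 4 - 1ℤ))) ≡ a + b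
        lemma = solve 5 (λ a b u w z → con (+ 2) :* w :^ 2 :+ (con (- 1ℤ) :* (con (+ 2) :* w :^ 2 :- (a :* u :^ 4 :+ b :* z :^ 4)) :+ (:- a :* (u :^ 4 :- con 1ℤ) :+ :- b :* (z :^ 4 :- con 1ℤ))) := a :+ b) refl
        lemma′ : ∀ a b u w z → + 2 * (w ^ 2 - 1ℤ) + (- 1ℤ * (+ 2 * w ^ 2 - (a * u ^ 4 + b * z ^ 4)) + (- a * (u ^ 4 - 1ℤ) + - b * (z ^ 4 - 1ℤ))) ≡ a + b - + 2
        lemma′ = solve 5 (λ a b u w z → con (+ 2) :* (w :^ 2 :- con 1ℤ) :+ (con (- 1ℤ) :* (con (+ 2) :* w :^ 2 :- (a :* u :^ 4 :+ b :* z :^ 4)) :+ (:- a :* (u :^ 4 :- con 1ℤ) :+ :- b :* (z :^ 4 :- con 1ℤ))) := a :+ b :- con (+ 2)) refl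
      go : ∀ u w z → Even w → + 32 ∣ quarticℤ (+ 2 * a) (+ 2 * b) u w z → Even u × + 4 ∣ w × Even z
      go u _ z (divides w refl) 32∣F = cases u w z (even-or-odd u) (even-or-odd z) (*-cancelˡ-∣ (+ 2) {+ 16} (∣-resp (halve a b u w z) 32∣F))
        where
        cases : ∀ u w z → Even u ⊎ Odd u → Even z ⊎ Odd z → + 16 ∣ + 2 * w ^ 2 - (a * u ^ 4 + b * z ^ 4) → Even u × + 4 ∣ w * + 2 × Even z
        cases u w z (inj₂ odd-u) (inj₁ even-z) 16∣G = ⊥-elim (mixed {a} {b} odd-a u w z 16∣G odd-u even-z)
        cases u w z (inj₁ even-u) (inj₂ odd-z) 16∣G = ⊥-elim (mixed {b} {a} odd-b z w u (∣-resp (swap a b u w z) 16∣G) odd-z even-u)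
        cases u w z (inj₂ odd-u) (inj₂ odd-z) 16∣G = ⊥-elim (¬C (both-odd u w z 16∣G odd-u odd-z))
        cases u w z (inj₁ even-u) (inj₁ even-z) 16∣G = even-u ,
          *-monoˡ-∣ (+ 2) (even-root w (*-cancelˡ-∣ (+ 2) {+ 2} (∣-trans 4∣16 (∣-resp (lemma a b u w z) (16∣G ⊞ a ⊡ even-⁴ even-u ⊞ b ⊡ even-⁴ even-z))))) ,
          even-z
          where
          lemma : ∀ a b u w z → + 2 * w ^ 2 - (a * u ^ 4 + b * z ^ 4) + (a * u ^ 4 + b * z ^ 4) ≡ + 2 * w ^ 2
          lemma = solve 5 (λ a b u w z → con (+ 2) :* w :^ 2 :- (a :* u :^ 4 :+ b :* z :^ 4) :+ (a :* u :^ 4 :+ b :* z :^ 4) := con (+ 2) :* w :^ 2) refl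

    -- An odd u would give w² ≡ a modulo 4. So u and w are even, and dividing by 4 leaves w² ≡ b z⁴
    -- modulo 4, where an odd z would give b ≡ 1.
    a,4b-anisotropic : ¬ C₂ a b → Anisotropicℤ 2-place a (+ 4 * b)
    a,4b-anisotropic ¬C = anisotropic-null′ 4 {a} {+ 4 * b} λ u w z 16∣F →
      let even-u = [ (λ e → e) , (λ odd-u → ⊥-elim (¬C (inj₁ (first u w z (∣-trans 4∣16 16∣F) odd-u)))) ]′ (even-or-odd u)
      in go u w z even-u (even-root w (∣-resp (w² a b u w z) (∣-trans 2∣16 16∣F ⊞ a ⊡ ∣-trans 2∣16 (even-⁴ even-u) ⊞ b * z ^ 4 ⊡ divides (+ 2) refl))) 16∣F
      where
      w² : ∀ a b u w z → w ^ 2 - (a * u ^ 4 + + 4 * b * z ^ 4) + (a * u ^ 4 + b * z ^ 4 * + 4) ≡ w ^ 2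
      w² = solve 5 (λ a b u w z → w :^ 2 :- (a :* u :^ 4 :+ con (+ 4) :* b :* z :^ 4) :+ (a :* u :^ 4 :+ b :* z :^ 4 :* con (+ 4)) := w :^ 2) refl
      unit-square : ∀ {a} w → Odd a → + 4 ∣ w ^ 2 - a → + 4 ∣ a - 1ℤ
      unit-square {a} w odd-a 4∣ = [ (λ even-w → ⊥-elim (odd∧even odd-a (∣-resp (lemma (w ^ 2) a) (even-square even-w ⊞ (- 1ℤ) ⊡ ∣-trans (divides (+ 2) refl) 4∣))))
          , (λ odd-w → ∣-resp (lemma′ (w ^ 2) a) (∣-trans (divides (+ 2) refl) (odd-² odd-w) ⊞ (- 1ℤ) ⊡ 4∣)) ]′ (even-or-odd w)
        where
        lemma : ∀ w a → w + - 1ℤ * (w - a) ≡ a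
        lemma = solve 2 (λ w a → w :+ con (- 1ℤ) :* (w :- a) := a) refl
        lemma′ : ∀ w a → w - 1ℤ + - 1ℤ * (w - a) ≡ a - 1ℤ
        lemma′ = solve 2 (λ w a → w :- con 1ℤ :+ con (- 1ℤ) :* (w :- a) := a :- con 1ℤ) refl
      first : ∀ u w z → + 4 ∣ quarticℤ a (+ 4 * b) u w z → Odd u → + 4 ∣ a - 1ℤ
      first u w z 4∣F odd-u = unit-square w odd-a (∣-resp (lemma a b u w z) (4∣F ⊞ a ⊡ ∣-trans 4∣16 (odd-⁴ odd-u) ⊞ b * z ^ 4 ⊡ ∣-refl))
        where
        lemma : ∀ a b u w z → w ^ 2 - (a * u ^ 4 + + 4 * b * z ^ 4) + (a * (u ^ 4 - 1ℤ) + b * z ^ 4 * + 4) ≡ w ^ 2 - a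
        lemma = solve 5 (λ a b u w z → w :^ 2 :- (a :* u :^ 4 :+ con (+ 4) :* b :* z :^ 4) :+ (a :* (u :^ 4 :- con 1ℤ) :+ b :* z :^ 4 :* con (+ 4)) := w :^ 2 :- a) refl
      quarter : ∀ a b u w z → (w * + 2) ^ 2 - (a * (u * + 2) ^ 4 + + 4 * b * z ^ 4) ≡ + 4 * (w ^ 2 - (+ 4 * (a * u ^ 4) + b * z ^ 4))
      quarter = solve 5 (λ a b u w z → (w :* con (+ 2)) :^ 2 :- (a :* (u :* con (+ 2)) :^ 4 :+ con (+ 4) :* b :* z :^ 4) := con (+ 4) :* (w :^ 2 :- (con (+ 4) :* (a :* u :^ 4) :+ b :* z :^ 4))) refl
      go : ∀ u w z → Even u → Even w → + 16 ∣ quarticℤ a (+ 4 * b) u w z → Even u × + 4 ∣ w × Even z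
      go _ _ z (divides u refl) (divides w refl) 16∣F = divides u refl , *-monoˡ-∣ (+ 2) (even-w even-z) , even-z
        where
        4∣G : + 4 ∣ w ^ 2 - (+ 4 * (a * u ^ 4) + b * z ^ 4)
        4∣G = *-cancelˡ-∣ (+ 4) {+ 4} (∣-resp (quarter a b u w z) 16∣F)
        even-z : Even z
        even-z = [ (λ e → e) , (λ odd-z → ⊥-elim (¬C (inj₂ (unit-square w odd-b (∣-resp (lemma a b u w z) (4∣G ⊞ a * u ^ 4 ⊡ ∣-refl ⊞ b ⊡ ∣-trans 4∣16 (odd-⁴ odd-z))))))) ]′ (even-or-odd z)
          where
          lemma : ∀ a b u w z → w ^ 2 - (+ 4 * (a * u ^ 4) + b * z ^ 4) + (a * u ^ 4 * + 4 + b * (z ^ 4 - 1ℤ)) ≡ w ^ 2 - b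
          lemma = solve 5 (λ a b u w z → w :^ 2 :- (con (+ 4) :* (a :* u :^ 4) :+ b :* z :^ 4) :+ (a :* u :^ 4 :* con (+ 4) :+ b :* (z :^ 4 :- con 1ℤ)) := w :^ 2 :- b) refl
        even-w : Even z → Even w
        even-w even-z = even-root w (∣-resp (lemma a b u w z) (∣-trans (divides (+ 2) refl) 4∣G ⊞ a * u ^ 4 ⊡ divides (+ 2) refl ⊞ b ⊡ ∣-trans 2∣16 (even-⁴ even-z)))
          where
          lemma : ∀ a b u w z → w ^ 2 - (+ 4 * (a * u ^ 4) + b * z ^ 4) + (a * u ^ 4 * + 4 + b * z ^ 4) ≡ w ^ 2
          lemma = solve 5 (λ a b u w z → w :^ 2 :- (con (+ 4) :* (a :* u :^ 4) :+ b :* z :^ 4) :+ (a :* u :^ 4 :* con (+ 4) :+ b :* z :^ 4) := w :^ 2) refl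

    -- The two terms on the right have 2-adic orders 1 and 3 modulo 4, so their sum has odd order
    -- and cannot be a square. The proof carries out this comparison modulo 16.
    2a,8b-anisotropic : Anisotropicℤ 2-place (+ 2 * a) (+ 8 * b)
    2a,8b-anisotropic = anisotropic-null′ 4 {+ 2 * a} {+ 8 * b} λ u w z 16∣F →
      step₁ u w z (even-root w (∣-resp (w² a b u w z) (∣-trans 2∣16 16∣F ⊞ (a * u ^ 4 + + 4 * b * z ^ 4) ⊡ ∣-refl))) 16∣F
      where
      odd-factor : ∀ {a} → Odd a → ∀ x → Even (a * x ^ 4) → Even x
      odd-factor {a} odd-a x even = [ (λ e → ⊥-elim (odd∧even odd-a e)) , (λ e → [ (λ e → e) , (λ odd-x → ⊥-elim (odd∧even (odd (∣-trans 2∣16 (odd-⁴ odd-x))) e)) ]′ (even-or-odd x)) ]′ (prime∣* prime[2] a (x ^ 4) even)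
      w² : ∀ a b u w z → w ^ 2 - (+ 2 * a * u ^ 4 + + 8 * b * z ^ 4) + (a * u ^ 4 + + 4 * b * z ^ 4) * + 2 ≡ w ^ 2
      w² = solve 5 (λ a b u w z → w :^ 2 :- (con (+ 2) :* a :* u :^ 4 :+ con (+ 8) :* b :* z :^ 4) :+ (a :* u :^ 4 :+ con (+ 4) :* b :* z :^ 4) :* con (+ 2) := w :^ 2) refl
      step₃ : ∀ u w z → Even w → + 4 ∣ w ^ 2 - (+ 8 * (a * u ^ 4) + + 2 * b * z ^ 4) → Even (u * + 2) × + 4 ∣ w * + 2 × Even z
      step₃ u _ z (divides w refl) 4∣ = divides u refl , divides w (ℤ.*-assoc w (+ 2) (+ 2)) ,
        odd-factor odd-b z (∣-resp (lemma′ a b u w z) ((w ^ 2 - + 2 * (a * u ^ 4)) ⊡ ∣-refl ⊞ (- 1ℤ) ⊡ *-cancelˡ-∣ (+ 2) {+ 2} (∣-resp (lemma a b u w z) 4∣)))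
        where
        lemma : ∀ a b u w z → (w * + 2) ^ 2 - (+ 8 * (a * u ^ 4) + + 2 * b * z ^ 4) ≡ + 2 * (+ 2 * w ^ 2 - (+ 4 * (a * u ^ 4) + b * z ^ 4))
        lemma = solve 5 (λ a b u w z → (w :* con (+ 2)) :^ 2 :- (con (+ 8) :* (a :* u :^ 4) :+ con (+ 2) :* b :* z :^ 4) := con (+ 2) :* (con (+ 2) :* w :^ 2 :- (con (+ 4) :* (a :* u :^ 4) :+ b :* z :^ 4))) refl
        lemma′ : ∀ a b u w z → (w ^ 2 - + 2 * (a * u ^ 4)) * + 2 + - 1ℤ * (+ 2 * w ^ 2 - (+ 4 * (a * u ^ 4) + b * z ^ 4)) ≡ b * z ^ 4
        lemma′ = solve 5 (λ a b u w z → (w :^ 2 :- con (+ 2) :* (a :* u :^ 4)) :* con (+ 2) :+ con (- 1ℤ) :* (con (+ 2) :* w :^ 2 :- (con (+ 4) :* (a :* u :^ 4) :+ b :* z :^ 4)) := b :* z :^ 4) refl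
      step₂ : ∀ u w z → Even u → + 16 ∣ quarticℤ (+ 2 * a) (+ 8 * b) u (w * + 2) z → Even u × + 4 ∣ w * + 2 × Even z
      step₂ _ w z (divides u refl) 16∣F = step₃ u w z
          (even-root w (∣-resp (lemma′ a b u w z) (∣-trans (divides (+ 2) refl) 4∣ ⊞ (+ 4 * (a * u ^ 4) + b * z ^ 4) ⊡ ∣-refl))) 4∣
        where
        lemma : ∀ a b u w z → (w * + 2) ^ 2 - (+ 2 * a * (u * + 2) ^ 4 + + 8 * b * z ^ 4) ≡ + 4 * (w ^ 2 - (+ 8 * (a * u ^ 4) + + 2 * b * z ^ 4))
        lemma = solve 5 (λ a b u w z → (w :* con (+ 2)) :^ 2 :- (con (+ 2) :* a :* (u :* con (+ 2)) :^ 4 :+ con (+ 8) :* b :* z :^ 4) := con (+ 4) :* (w :^ 2 :- (con (+ 8) :* (a :* u :^ 4) :+ con (+ 2) :* b :* z :^ 4))) refl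
        lemma′ : ∀ a b u w z → w ^ 2 - (+ 8 * (a * u ^ 4) + + 2 * b * z ^ 4) + (+ 4 * (a * u ^ 4) + b * z ^ 4) * + 2 ≡ w ^ 2
        lemma′ = solve 5 (λ a b u w z → w :^ 2 :- (con (+ 8) :* (a :* u :^ 4) :+ con (+ 2) :* b :* z :^ 4) :+ (con (+ 4) :* (a :* u :^ 4) :+ b :* z :^ 4) :* con (+ 2) := w :^ 2) refl
        4∣ : + 4 ∣ w ^ 2 - (+ 8 * (a * u ^ 4) + + 2 * b * z ^ 4)
        4∣ = *-cancelˡ-∣ (+ 4) {+ 4} (∣-resp (lemma a b u w z) 16∣F)
      step₁ : ∀ u w z → Even w → + 16 ∣ quarticℤ (+ 2 * a) (+ 8 * b) u w z → Even u × + 4 ∣ w × Even z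
      step₁ u _ z (divides w refl) 16∣F = step₂ u w z (odd-factor odd-a u (∣-resp (lemma′ a b u w z)
          ((w ^ 2 - + 2 * (b * z ^ 4)) ⊡ ∣-refl ⊞ (- 1ℤ) ⊡ *-cancelˡ-∣ (+ 2) {+ 2} (∣-resp (lemma a b u w z) (∣-trans 4∣16 16∣F))))) 16∣F
        where
        lemma : ∀ a b u w z → (w * + 2) ^ 2 - (+ 2 * a * u ^ 4 + + 8 * b * z ^ 4) ≡ + 2 * (+ 2 * w ^ 2 - (a * u ^ 4 + + 4 * (b * z ^ 4)))
        lemma = solve 5 (λ a b u w z → (w :* con (+ 2)) :^ 2 :- (con (+ 2) :* a :* u :^ 4 :+ con (+ 8) :* b :* z :^ 4) := con (+ 2) :* (con (+ 2) :* w :^ 2 :- (a :* u :^ 4 :+ con (+ 4) :* (b :* z :^ 4)))) refl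
        lemma′ : ∀ a b u w z → (w ^ 2 - + 2 * (b * z ^ 4)) * + 2 + - 1ℤ * (+ 2 * w ^ 2 - (a * u ^ 4 + + 4 * (b * z ^ 4))) ≡ a * u ^ 4
        lemma′ = solve 5 (λ a b u w z → (w :^ 2 :- con (+ 2) :* (b :* z :^ 4)) :* con (+ 2) :+ con (- 1ℤ) :* (con (+ 2) :* w :^ 2 :- (a :* u :^ 4 :+ con (+ 4) :* (b :* z :^ 4))) := a :* u :^ 4) refl

-- Solubility at 2 and invariance of the conditions modulo 16.

module DyadicSolubility where

  open Rationals
  open QuadraticResidues using (∣-resp)
  open AdicValuations
  open Completions
  open HenselLifting
  open OddPlaces using (Anisotropicℤ; Solubleℤ)
  open DyadicAnisotropy
  open import Data.Integer.Base using (_+_; _-_; -_; _*_; _^_)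
  open import Data.Integer.Divisibility.Signed
  open import Data.Integer.Solver using () renaming (module +-*-Solver to ℤ-Solver)
  open import Data.Rational.Solver using () renaming (module +-*-Solver to ℚ-Solver)
  open import Algebra.Definitions.RawSemiring ℚ.+-*-rawSemiring using () renaming (_^_ to _ℚ^_)
  open import Data.Sum.Base using (map)

  open ℤ-Solver using (solve; _:=_; _:+_; _:-_; _:*_; _:^_; :-_; con)

  odd≢0 : ∀ {a} → Odd a → fromℤ a ≢ 0ℚ
  odd≢0 odd-a a≡0 = odd∧even odd-a (subst Even (sym (fromℤ-injective {_} {0ℤ} a≡0)) (divides 0ℤ refl))

  *-≢0 : ∀ {x y} → x ≢ 0ℚ → y ≢ 0ℚ → x ℚ.* y ≢ 0ℚ
  *-≢0 {x} {y} x≢0 y≢0 xy≡0 = y≢0 (*-cancelˡ x x≢0 (trans xy≡0 (sym (ℚ.*-zeroʳ x))))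

  16/2⁴≡1 : fromℤ (+ 16) ℚ.* ½ ℚ^ 4 ≡ 1ℚ
  16/2⁴≡1 = refl

  module _ where
    open ℚ-Solver using () renaming (solve to solveℚ; _:=_ to _⟵_; _:+_ to _⊕_; _:-_ to _⊖_; _:*_ to _⊗_; _:^_ to _↑_; con to K)

    value-1-1 : ∀ A X → A ℚ.* 1ℚ ℚ^ 4 ℚ.+ X ℚ.* 1ℚ ℚ^ 4 ≡ A ℚ.+ X
    value-1-1 = solveℚ 2 (λ A X → A ⊗ K 1ℚ ↑ 4 ⊕ X ⊗ K 1ℚ ↑ 4 ⟵ A ⊕ X) refl

    value-2-1 : ∀ A B X Y T → X ≡ T ℚ^ 2 ℚ.* B → Y ≡ B ℚ.+ T ℚ^ 2 ℚ.* A → A ℚ.* T ℚ^ 4 ℚ.+ X ℚ.* 1ℚ ℚ^ 4 ≡ T ℚ^ 2 ℚ.* Y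
    value-2-1 A B _ _ T refl refl = lemma A B T
      where
      lemma : ∀ A B T → A ℚ.* T ℚ^ 4 ℚ.+ (T ℚ^ 2 ℚ.* B) ℚ.* 1ℚ ℚ^ 4 ≡ T ℚ^ 2 ℚ.* (B ℚ.+ T ℚ^ 2 ℚ.* A)
      lemma = solveℚ 3 (λ A B T → A ⊗ T ↑ 4 ⊕ (T ↑ 2 ⊗ B) ⊗ K 1ℚ ↑ 4 ⟵ T ↑ 2 ⊗ (B ⊕ T ↑ 2 ⊗ A)) refl

    value-0-½ : ∀ A B X S H → X ≡ S ℚ.* B → S ℚ.* H ℚ^ 4 ≡ 1ℚ → A ℚ.* 0ℚ ℚ^ 4 ℚ.+ X ℚ.* H ℚ^ 4 ≡ B
    value-0-½ A B _ S H refl SH⁴≡1 = trans (lemma A B S H) (trans (cong (ℚ._* B) SH⁴≡1) (ℚ.*-identityˡ B))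
      where
      lemma : ∀ A B S H → A ℚ.* 0ℚ ℚ^ 4 ℚ.+ S ℚ.* B ℚ.* H ℚ^ 4 ≡ S ℚ.* H ℚ^ 4 ℚ.* B
      lemma = solveℚ 4 (λ A B S H → A ⊗ K 0ℚ ↑ 4 ⊕ S ⊗ B ⊗ H ↑ 4 ⟵ S ⊗ H ↑ 4 ⊗ B) refl

    -- Multiplying a u⁴ = W² - b by a⁴ replaces the fraction (W² - b)/a by the integer a³ (W² - b).
    -- In exchange w is scaled by a² and z by a.
    value-⁴√ : ∀ A B W N X S H → X ≡ S ℚ.* B → S ℚ.* H ℚ^ 4 ≡ 1ℚ → N ≡ A ℚ^ 3 ℚ.* (W ℚ^ 2 ℚ.- B) →
      A ℚ.* N ≡ (W ℚ.* A ℚ^ 2) ℚ^ 2 ℚ.- X ℚ.* (H ℚ.* A) ℚ^ 4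
    value-⁴√ A B W _ _ S H refl SH⁴≡1 refl = trans
      (cong (λ y → A ℚ.* (A ℚ^ 3 ℚ.* (W ℚ^ 2 ℚ.- y))) (sym (trans (cong (ℚ._* B) SH⁴≡1) (ℚ.*-identityˡ B)))) (lemma A B W S H)
      where
      lemma : ∀ A B W S H → A ℚ.* (A ℚ^ 3 ℚ.* (W ℚ^ 2 ℚ.- S ℚ.* H ℚ^ 4 ℚ.* B)) ≡ (W ℚ.* A ℚ^ 2) ℚ^ 2 ℚ.- S ℚ.* B ℚ.* (H ℚ.* A) ℚ^ 4
      lemma = solveℚ 5 (λ A B W S H → A ⊗ (A ↑ 3 ⊗ (W ↑ 2 ⊖ S ⊗ H ↑ 4 ⊗ B)) ⟵ (W ⊗ A ↑ 2) ↑ 2 ⊖ S ⊗ B ⊗ (H ⊗ A) ↑ 4) refl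

  4≡2² : fromℤ (+ 4) ≡ fromℤ (+ 2) ℚ^ 2
  4≡2² = refl

  split-4 : ∀ {a} → + 4 ∣ a - 1ℤ → + 8 ∣ a - 1ℤ ⊎ + 8 ∣ a - + 5
  split-4 {a} (divides k eq) = map
    (λ { (divides j k≡) → divides j (trans eq (trans (cong (_* + 4) k≡) (ℤ.*-assoc j (+ 2) (+ 4)))) })
    (λ { (odd (divides j k≡)) → divides j (trans (lemma a) (trans (cong (_- + 4) eq) (trans (lemma′ k) (trans (cong (_* + 4) k≡) (ℤ.*-assoc j (+ 2) (+ 4)))))) })
    (even-or-odd k)
    where
    lemma : ∀ a → a - + 5 ≡ a - 1ℤ - + 4
    lemma = solve 1 (λ a → a :- con (+ 5) := a :- con 1ℤ :- con (+ 4)) refl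
    lemma′ : ∀ k → k * + 4 - + 4 ≡ (k - 1ℤ) * + 4
    lemma′ = solve 1 (λ k → k :* con (+ 4) :- con (+ 4) := (k :- con 1ℤ) :* con (+ 4)) refl

  module _ {a b : ℤ} (odd-a : Odd a) (odd-b : Odd b) where

    private
      A B : ℚ
      A = fromℤ a
      B = fromℤ b

      -- a⁻¹(N − b), up to the fourth power a⁴.
      fourth-root : ∀ N → + 16 ∣ N - b - a → Root 2-place 4 (fromℤ (a ^ 3 * (N - b)))
      fourth-root N 16∣ = ⁴√-dyadic (a ^ 3 * (N - b)) (∣-resp (lemma a b N) (a ^ 3 ⊡ 16∣ ⊞ odd-⁴ odd-a))
        where
        lemma : ∀ a b N → a ^ 3 * (N - b - a) + (a ^ 4 - 1ℤ) ≡ a ^ 3 * (N - b) - 1ℤ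
        lemma = solve 3 (λ a b N → a :^ 3 :* (N :- b :- a) :+ (a :^ 4 :- con 1ℤ) := a :^ 3 :* (N :- b) :- con 1ℤ) refl

      fromℤ-n : ∀ N → fromℤ (a ^ 3 * (N - b)) ≡ A ℚ^ 3 ℚ.* (fromℤ N ℚ.- B)
      fromℤ-n N = trans (fromℤ-* (a ^ 3) (N - b)) (cong₂ ℚ._*_ (fromℤ-^ a 3) (fromℤ-- N b))

    -- A W with 2 W² ≡ a + b modulo 16 is enough, and W = 1, 0, 2 realise the residues 2, 0, 8. The
    -- remaining error is absorbed by u, a fourth root of a number congruent to 1 modulo 16.
    2a,2b-soluble : C₁ a b → Solubleℤ (+ 2 * a) (+ 2 * b) 2-place
    2a,2b-soluble = from-W ∘ find-W
      where
      find-W : C₁ a b → ∃[ W ] + 16 ∣ + 2 * W ^ 2 - b - a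
      find-W (inj₂ 16∣) = 1ℤ , ∣-resp (lemma a b) ((- 1ℤ) ⊡ 16∣)
        where
        lemma : ∀ a b → - 1ℤ * (a + b - + 2) ≡ + 2 - b - a
        lemma = solve 2 (λ a b → con (- 1ℤ) :* (a :+ b :- con (+ 2)) := con (+ 2) :- b :- a) refl
      find-W (inj₁ (divides k eq)) = [ even-k , odd-k ]′ (even-or-odd k)
        where
        lemma : ∀ a b → + 0 - b - a ≡ - (a + b)
        lemma = solve 2 (λ a b → con (+ 0) :- b :- a := :- (a :+ b)) refl
        lemma₁ : ∀ j → - (j * + 2 * + 8) ≡ - j * + 16
        lemma₁ = solve 1 (λ j → :- (j :* con (+ 2) :* con (+ 8)) := :- j :* con (+ 16)) refl
        lemma₂ : ∀ a b → + 8 - b - a ≡ + 8 - (a + b)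
        lemma₂ = solve 2 (λ a b → con (+ 8) :- b :- a := con (+ 8) :- (a :+ b)) refl
        lemma₃ : ∀ k → + 8 - k * + 8 ≡ - (k - 1ℤ) * + 8
        lemma₃ = solve 1 (λ k → con (+ 8) :- k :* con (+ 8) := :- (k :- con 1ℤ) :* con (+ 8)) refl
        lemma₄ : ∀ j → - (j * + 2) * + 8 ≡ - j * + 16
        lemma₄ = solve 1 (λ j → :- (j :* con (+ 2)) :* con (+ 8) := :- j :* con (+ 16)) refl
        even-k : Even k → ∃[ W ] + 16 ∣ + 2 * W ^ 2 - b - a
        even-k (divides j k≡) = 0ℤ , divides (- j) (trans (lemma a b) (trans (cong -_ (trans eq (cong (_* + 8) k≡))) (lemma₁ j)))
        odd-k : Odd k → ∃[ W ] + 16 ∣ + 2 * W ^ 2 - b - a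
        odd-k (odd (divides j k≡)) = + 2 , divides (- j) (trans (lemma₂ a b) (trans (cong (λ y → + 8 - y) eq) (trans (lemma₃ k) (trans (cong (λ x → - x * + 8) k≡) (lemma₄ j)))))
      from-W : ∃[ W ] + 16 ∣ + 2 * W ^ 2 - b - a → Solubleℤ (+ 2 * a) (+ 2 * b) 2-place
      from-W (W , 16∣) = soluble-⁴√ 2-place (fromℤ (+ 2 * a)) (fromℤ (+ 2 * b)) (fromℤ (a ^ 3 * (+ 2 * W ^ 2 - b))) (fromℤ (+ 2 * W * a ^ 2)) A
        (subst (_≢ 0ℚ) (sym (fromℤ-* (+ 2) a)) (*-≢0 {fromℤ (+ 2)} {A} (λ ()) (odd≢0 odd-a))) (odd≢0 odd-a)
        (begin
          fromℤ (+ 2 * a) ℚ.* fromℤ (a ^ 3 * (+ 2 * W ^ 2 - b)) ≡⟨ fromℤ-* (+ 2 * a) (a ^ 3 * (+ 2 * W ^ 2 - b)) ⟨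
          fromℤ (+ 2 * a * (a ^ 3 * (+ 2 * W ^ 2 - b))) ≡⟨ cong fromℤ (lemma a b W) ⟩
          fromℤ ((+ 2 * W * a ^ 2) ^ 2 - + 2 * b * a ^ 4) ≡⟨ trans (fromℤ-- ((+ 2 * W * a ^ 2) ^ 2) (+ 2 * b * a ^ 4)) (cong₂ ℚ._-_ (fromℤ-^ (+ 2 * W * a ^ 2) 2) (trans (fromℤ-* (+ 2 * b) (a ^ 4)) (cong (fromℤ (+ 2 * b) ℚ.*_) (fromℤ-^ a 4)))) ⟩
          fromℤ (+ 2 * W * a ^ 2) ℚ^ 2 ℚ.- fromℤ (+ 2 * b) ℚ.* A ℚ^ 4 ∎)
        (fourth-root (+ 2 * W ^ 2) 16∣)
        where
        open ≡-Reasoning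
        lemma : ∀ a b W → + 2 * a * (a ^ 3 * (+ 2 * W ^ 2 - b)) ≡ (+ 2 * W * a ^ 2) ^ 2 - + 2 * b * a ^ 4
        lemma = solve 3 (λ a b W → con (+ 2) :* a :* (a :^ 3 :* (con (+ 2) :* W :^ 2 :- b)) := (con (+ 2) :* W :* a :^ 2) :^ 2 :- con (+ 2) :* b :* a :^ 4) refl

    -- If a or b is 1 modulo 8, one coefficient is a square. If a ≡ 5 modulo 8, the value a + 4 b at
    -- (u , z) = (1 , 1) is 1 modulo 8; if b ≡ 5, the value at (2 , 1) is 4 (b + 4 a).
    a,4b-soluble : C₂ a b → Solubleℤ a (+ 4 * b) 2-place
    a,4b-soluble = [ (λ 4∣a-1 → [ a≡1 , a≡5 ]′ (split-4 {a} 4∣a-1)) , (λ 4∣b-1 → [ b≡1 , b≡5 ]′ (split-4 {b} 4∣b-1)) ]′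
      where
      lemma : ∀ a b → a - + 5 + (+ 4 * (b - 1ℤ) + + 8) ≡ a + + 4 * b - 1ℤ
      lemma = solve 2 (λ a b → a :- con (+ 5) :+ (con (+ 4) :* (b :- con 1ℤ) :+ con (+ 8)) := a :+ con (+ 4) :* b :- con 1ℤ) refl
      X 2ℚ : ℚ
      X = fromℤ (+ 4 * b)
      2ℚ = fromℤ (+ 2)
      X≡ : X ≡ 2ℚ ℚ^ 2 ℚ.* B
      X≡ = trans (fromℤ-* (+ 4) b) (cong (ℚ._* B) 4≡2²)
      a≡1 : + 8 ∣ a - 1ℤ → Soluble A X 2-place
      a≡1 8∣ = soluble-√a 2-place A X (√-dyadic a 8∣)
      a≡5 : + 8 ∣ a - + 5 → Soluble A X 2-place
      a≡5 8∣ = soluble-√ 2-place A X 1ℚ 1ℚ (inj₁ ℚ.1≢0) (trans (value-1-1 A X) (sym (fromℤ-+ a (+ 4 * b))))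
        (√-dyadic (a + + 4 * b) (∣-resp (lemma a b) (8∣ ⊞ *-monoʳ-∣ (+ 4) (2∣x-1 odd-b) ⊞ ∣-refl)))
      b≡1 : + 8 ∣ b - 1ℤ → Soluble A X 2-place
      b≡1 8∣ = soluble-√b 2-place A X (subst (Root 2-place 2) (sym X≡) (root-scale 2 prime[2] 2ℚ B (λ ()) (√-dyadic b 8∣)))
      b≡5 : + 8 ∣ b - + 5 → Soluble A X 2-place
      b≡5 8∣ = soluble-√ 2-place A X 2ℚ 1ℚ (inj₂ ℚ.1≢0)
        (value-2-1 A B X (fromℤ (b + + 4 * a)) 2ℚ X≡ (trans (fromℤ-+ b (+ 4 * a)) (cong (λ t → B ℚ.+ t) (trans (fromℤ-* (+ 4) a) (cong (ℚ._* A) 4≡2²)))))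
        (root-scale 2 prime[2] 2ℚ (fromℤ (b + + 4 * a)) (λ ()) (√-dyadic (b + + 4 * a) (∣-resp (lemma b a) (8∣ ⊞ *-monoʳ-∣ (+ 4) (2∣x-1 odd-a) ⊞ ∣-refl))))

    -- At z = ½ the second term is b. So a or b is itself a square, or u is found as a fourth root
    -- of (W² - b)/a, up to fourth powers, with W = 0 or 2.
    a,16b-soluble : C₄ a b → Solubleℤ a (+ 16 * b) 2-place
    a,16b-soluble (inj₁ 8∣a-1) = soluble-√a 2-place A (fromℤ (+ 16 * b)) (√-dyadic a 8∣a-1)
    a,16b-soluble (inj₂ (inj₁ 8∣b-1)) = soluble-√ 2-place A (fromℤ (+ 16 * b)) 0ℚ ½ (inj₂ λ ())
        (value-0-½ A B (fromℤ (+ 16 * b)) (fromℤ (+ 16)) ½ (fromℤ-* (+ 16) b) 16/2⁴≡1) (√-dyadic b 8∣b-1)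
    a,16b-soluble (inj₂ (inj₂ 16∣)) = [ (λ 16∣a+b → from-W 0ℤ (∣-resp (lemma a b) ((- 1ℤ) ⊡ 16∣a+b))) , (λ 16∣a+b-4 → from-W (+ 2) (∣-resp (lemma′ a b) ((- 1ℤ) ⊡ 16∣a+b-4))) ]′ 16∣
      where
      lemma : ∀ a b → - 1ℤ * (a + b) ≡ 0ℤ - b - a
      lemma = solve 2 (λ a b → con (- 1ℤ) :* (a :+ b) := con 0ℤ :- b :- a) refl
      lemma′ : ∀ a b → - 1ℤ * (a + b - + 4) ≡ + 4 - b - a
      lemma′ = solve 2 (λ a b → con (- 1ℤ) :* (a :+ b :- con (+ 4)) := con (+ 4) :- b :- a) refl
      from-W : ∀ W → + 16 ∣ W ^ 2 - b - a → Solubleℤ a (+ 16 * b) 2-place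
      from-W W 16∣ = soluble-⁴√ 2-place A (fromℤ (+ 16 * b)) (fromℤ (a ^ 3 * (W ^ 2 - b))) (fromℤ W ℚ.* A ℚ^ 2) (½ ℚ.* A)
        (odd≢0 odd-a) (*-≢0 {½} {A} (λ ()) (odd≢0 odd-a))
        (value-⁴√ A B (fromℤ W) (fromℤ (a ^ 3 * (W ^ 2 - b))) (fromℤ (+ 16 * b)) (fromℤ (+ 16)) ½ (fromℤ-* (+ 16) b) 16/2⁴≡1
          (trans (fromℤ-n (W ^ 2)) (cong (λ y → A ℚ^ 3 ℚ.* (y ℚ.- B)) (fromℤ-^ W 2))))
        (fourth-root (W ^ 2) 16∣)

  C₁? : ∀ a b → Dec (C₁ a b)
  C₁? a b = (+ 8 ∣? a + b) ⊎-dec (+ 16 ∣? a + b - + 2)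

  C₂? : ∀ a b → Dec (C₂ a b)
  C₂? a b = (+ 4 ∣? a - 1ℤ) ⊎-dec (+ 4 ∣? b - 1ℤ)

  C₄? : ∀ a b → Dec (C₄ a b)
  C₄? a b = (+ 8 ∣? a - 1ℤ) ⊎-dec ((+ 8 ∣? b - 1ℤ) ⊎-dec ((+ 16 ∣? a + b) ⊎-dec (+ 16 ∣? a + b - + 4)))

  infix 4 _≈₁₆_

  _≈₁₆_ : ℤ → ℤ → Set
  a ≈₁₆ b = + 16 ∣ a - b

  ≈₁₆-sym : ∀ a b → a ≈₁₆ b → b ≈₁₆ a
  ≈₁₆-sym a b p = ∣-resp (lemma a b) ((- 1ℤ) ⊡ p)
    where
    lemma : ∀ a b → - 1ℤ * (a - b) ≡ b - a
    lemma = solve 2 (λ a b → con (- 1ℤ) :* (a :- b) := b :- a) refl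

  ≈₁₆-+ : ∀ a a′ b b′ → a ≈₁₆ a′ → b ≈₁₆ b′ → a + b ≈₁₆ a′ + b′
  ≈₁₆-+ a a′ b b′ p q = ∣-resp (lemma a a′ b b′) (p ⊞ q)
    where
    lemma : ∀ a a′ b b′ → a - a′ + (b - b′) ≡ a + b - (a′ + b′)
    lemma = solve 4 (λ a a′ b b′ → a :- a′ :+ (b :- b′) := a :+ b :- (a′ :+ b′)) refl

  ≈₁₆-neg : ∀ a a′ → a ≈₁₆ a′ → - a ≈₁₆ - a′
  ≈₁₆-neg a a′ p = ∣-resp (lemma a a′) ((- 1ℤ) ⊡ p)
    where
    lemma : ∀ a b → - 1ℤ * (a - b) ≡ - a - (- b)
    lemma = solve 2 (λ a b → con (- 1ℤ) :* (a :- b) := :- a :- (:- b)) refl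

  ≈₁₆-* : ∀ a a′ b b′ → a ≈₁₆ a′ → b ≈₁₆ b′ → a * b ≈₁₆ a′ * b′
  ≈₁₆-* a a′ b b′ p q = ∣-resp (lemma a a′ b b′) (b ⊡ p ⊞ a′ ⊡ q)
    where
    lemma : ∀ a a′ b b′ → b * (a - a′) + a′ * (b - b′) ≡ a * b - a′ * b′
    lemma = solve 4 (λ a a′ b b′ → b :* (a :- a′) :+ a′ :* (b :- b′) := a :* b :- a′ :* b′) refl

  ≈₁₆-refl : ∀ a → a ≈₁₆ a
  ≈₁₆-refl a = divides 0ℤ (ℤ.+-inverseʳ a)

  ∣-≈₁₆ : ∀ {d} → d ∣ + 16 → ∀ a b → a ≈₁₆ b → d ∣ a → d ∣ b
  ∣-≈₁₆ d∣16 a b p d∣a = ∣-resp (lemma a b) (d∣a ⊞ (- 1ℤ) ⊡ ∣-trans d∣16 p)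
    where
    lemma : ∀ a b → a + - 1ℤ * (a - b) ≡ b
    lemma = solve 2 (λ a b → a :+ con (- 1ℤ) :* (a :- b) := b) refl

  module _ (a a′ b b′ : ℤ) (p : a ≈₁₆ a′) (q : b ≈₁₆ b′) where
    private
      shift : ∀ {x x′} → x ≈₁₆ x′ → ∀ c → x - c ≈₁₆ x′ - c
      shift {x} {x′} p c = ≈₁₆-+ x x′ (- c) (- c) p (≈₁₆-refl (- c))
      p+q : a + b ≈₁₆ a′ + b′
      p+q = ≈₁₆-+ a a′ b b′ p q

    C₁-≈₁₆ : C₁ a b → C₁ a′ b′
    C₁-≈₁₆ = map (∣-≈₁₆ 8∣16 (a + b) (a′ + b′) p+q) (∣-≈₁₆ ∣-refl (a + b - + 2) (a′ + b′ - + 2) (shift {a + b} {a′ + b′} p+q (+ 2)))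

    C₂-≈₁₆ : C₂ a b → C₂ a′ b′
    C₂-≈₁₆ = map (∣-≈₁₆ 4∣16 (a - 1ℤ) (a′ - 1ℤ) (shift {a} {a′} p 1ℤ)) (∣-≈₁₆ 4∣16 (b - 1ℤ) (b′ - 1ℤ) (shift {b} {b′} q 1ℤ))

    C₄-≈₁₆ : C₄ a b → C₄ a′ b′
    C₄-≈₁₆ = map (∣-≈₁₆ 8∣16 (a - 1ℤ) (a′ - 1ℤ) (shift {a} {a′} p 1ℤ)) (map (∣-≈₁₆ 8∣16 (b - 1ℤ) (b′ - 1ℤ) (shift {b} {b′} q 1ℤ))
      (map (∣-≈₁₆ ∣-refl (a + b) (a′ + b′) p+q) (∣-≈₁₆ ∣-refl (a + b - + 4) (a′ + b′ - + 4) (shift {a + b} {a′ + b′} p+q (+ 4)))))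

-- Local and global dichotomies for the six torsors.

module TorsorDichotomies where

  open Rationals
  open QuadraticResidues
  open SupplementaryLaws
  open AdicValuations
  open Completions
  open HenselLifting
  open OddPlaces
  open DyadicAnisotropy
  open DyadicSolubility
  open RealPlace
  open import Data.Integer.Base using (_+_; _-_; -_; _*_)
  open import Data.Integer.Divisibility.Signed
  open import Data.Integer.Solver using () renaming (module +-*-Solver to ℤ-Solver)
  open import Data.Rational.Solver using () renaming (module +-*-Solver to ℚ-Solver)
  open import Algebra.Definitions.RawSemiring ℚ.+-*-rawSemiring using () renaming (_^_ to _ℚ^_)

  -- Multiplying w² = b u⁴ + s²a z⁴ by s² exchanges the coefficients up to fourth powers.
  anisotropic-dual : ∀ v {a b s} → s ≢ 0ℚ → Anisotropic v a (s ℚ^ 2 ℚ.* b) → Anisotropic v b (s ℚ^ 2 ℚ.* a)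
  anisotropic-dual v {a} {b} {s} s≢0 aniso u w z null =
    let u-null , sw-null , sz-null = anisotropic-swap v {a} {s ℚ^ 2 ℚ.* b} aniso u (λ i → s ℚ.* w i) (λ i → s ℚ.* z i)
          (Null-cong {v} (λ i → identity a b s (u i) (w i) (z i)) (Null-scale v (s ℚ.* s) (*-≢0 {s} {s} s≢0 s≢0) null))
    in u-null , Null-unscale v s s≢0 sw-null , Null-unscale v s s≢0 sz-null
    where
    open ℚ-Solver
    identity : ∀ a b s u w z → s ℚ.* s ℚ.* quartic b (s ℚ^ 2 ℚ.* a) u w z ≡ quartic (s ℚ^ 2 ℚ.* b) a u (s ℚ.* w) (s ℚ.* z)
    identity = solve 6 (λ a b s u w z → s :* s :* (w :^ 2 :- (b :* u :^ 4 :+ s :^ 2 :* a :* z :^ 4)) := (s :* w) :^ 2 :- (s :^ 2 :* b :* u :^ 4 :+ a :* (s :* z) :^ 4)) refl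

  -- The negative half is the strong form of insolubility, the input of `anisotropic⇒insoluble`.
  LocalDichotomy : Place → ℤ → ℤ → Bool → Set
  LocalDichotomy v a b c = (c ≡ true → Solubleℤ a b v) × (c ≡ false → Anisotropicℤ v a b)

  by-Dec : ∀ {C : Set} v a b → (C? : Dec C) → (C → Solubleℤ a b v) → (¬ C → Anisotropicℤ v a b) → LocalDichotomy v a b (does C?)
  by-Dec v a b (yes c) sol aniso = (λ _ → sol c) , λ ()
  by-Dec v a b (no ¬c) sol aniso = (λ ()) , λ _ → aniso ¬c

  local-swap : ∀ v a b c → LocalDichotomy v a b c → LocalDichotomy v b a c
  local-swap v a b c (sol , aniso) = swap-soluble ∘ sol , anisotropic-swap v {fromℤ a} {fromℤ b} ∘ aniso
    where
    open ℚ-Solver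
    swap : ∀ a b u w z → w ℚ^ 2 ℚ.- (a ℚ.* u ℚ^ 4 ℚ.+ b ℚ.* z ℚ^ 4) ≡ w ℚ^ 2 ℚ.- (b ℚ.* z ℚ^ 4 ℚ.+ a ℚ.* u ℚ^ 4)
    swap = solve 5 (λ a b u w z → w :^ 2 :- (a :* u :^ 4 :+ b :* z :^ 4) := w :^ 2 :- (b :* z :^ 4 :+ a :* u :^ 4)) refl
    swap-soluble : Solubleℤ a b v → Solubleℤ b a v
    swap-soluble (u , w , z , nontrivial , eq) = z , w , u , (λ (z-zero , w-zero , u-zero) → nontrivial (u-zero , w-zero , z-zero)) ,
      Null-cong {v} (λ i → swap (fromℤ a) (fromℤ b) (seq u i) (seq w i) (seq z i)) eq

  module OddDichotomy (ℓ : ℕ) (ℓ-prime : Prime ℓ) (2∤ℓ : ¬ 2 ℕ.∣ ℓ) where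
    open OddPrime ℓ ⌊ ℓ /2⌋ ℓ-prime (odd≡1+2⌊/2⌋ ℓ 2∤ℓ) using (Unit)
    open OddLocal ℓ ⌊ ℓ /2⌋ ℓ-prime (odd≡1+2⌊/2⌋ ℓ 2∤ℓ)

    -- The unit coefficient decides: a square root of a gives the point (1 , √a , 0), and a
    -- nonresidue excludes all points.
    odd-dichotomy : ∀ a b {b′} → Unit a → Unit b → b′ ≡ + ℓ * b → LocalDichotomy (fin ℓ ℓ-prime) a b′ (isSquare ℓ a)
    odd-dichotomy a b ℓ∤a ℓ∤b refl =
      (λ residue → soluble-√a (fin ℓ ℓ-prime) (fromℤ a) (fromℤ (+ ℓ * b)) (residue⇒root a ℓ∤a residue)) ,
      nonresidue⇒anisotropic a b ℓ∤a ℓ∤b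

  module Forms (p q : ℕ) (p-prime : Prime p) (q-prime : Prime q) (2∤p : ¬ 2 ℕ.∣ p) (2∤q : ¬ 2 ℕ.∣ q) (p≢q : p ≢ q) where
    open TwoIsogeny p q p-prime q-prime using (S)

    P Q : ℤ
    P = + p
    Q = + q

    module ℓ=p = OddDichotomy p p-prime 2∤p
    module ℓ=q = OddDichotomy q q-prime 2∤q
    module U (ℓ : ℕ) (ℓ-prime : Prime ℓ) (2∤ℓ : ¬ 2 ℕ.∣ ℓ) where
      open Supplements ℓ ℓ-prime 2∤ℓ public
      unit-1 : Unit 1ℤ
      unit-1 = prime∤1 ℓ-prime
      unit-2 : Unit (+ 2)
      unit-2 ℓ∣2 = 2∤ℓ (ℕ.∣-reflexive (sym (prime∣prime ℓ-prime prime[2] (∣⇒∣ᵤ ℓ∣2))))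
      unit-4 : Unit (+ 4)
      unit-4 = unit-* {+ 2} {+ 2} unit-2 unit-2
      unit-16 : Unit (+ 16)
      unit-16 = unit-* {+ 4} {+ 4} unit-4 unit-4

    module Up = U p p-prime 2∤p
    module Uq = U q q-prime 2∤q

    p∤q : Up.Unit Q
    p∤q p∣q = p≢q (prime∣prime p-prime q-prime (∣⇒∣ᵤ p∣q))

    q∤p : Uq.Unit P
    q∤p q∣p = p≢q (sym (prime∣prime q-prime p-prime (∣⇒∣ᵤ q∣p)))

    odd-prime : ∀ ℓ → ¬ 2 ℕ.∣ ℓ → Odd (+ ℓ)
    odd-prime ℓ 2∤ℓ = [ (λ even → contradiction (∣⇒∣ᵤ even) 2∤ℓ) , (λ odd-ℓ → odd-ℓ) ]′ (even-or-odd (+ ℓ))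

    odd-neg : ∀ {a} → Odd a → Odd (- a)
    odd-neg {a} odd-a = [ (λ even → contradiction (subst Even (ℤ.neg-involutive a) (∣m⇒∣-m even)) (odd∧even odd-a)) , (λ o → o) ]′ (even-or-odd (- a))

    odd-* : ∀ {a b} → Odd a → Odd b → Odd (a * b)
    odd-* {a} {b} odd-a odd-b = [ (λ even → contradiction (prime∣* prime[2] a b even) [ odd∧even odd-a , odd∧even odd-b ]′) , (λ o → o) ]′ (even-or-odd (a * b))

    odd-1 : Odd 1ℤ
    odd-1 = odd (divides 0ℤ refl)
    odd-P : Odd P
    odd-P = odd-prime p 2∤p
    odd-Q : Odd Q
    odd-Q = odd-prime q 2∤q

    Dichotomy : ℤ → ℤ → Bool → Set
    Dichotomy a b c = (c ≡ true → ∀ {v} → v ∈ S → Solubleℤ a b v) × (c ≡ false → ∃[ v ] v ∈ S × Anisotropicℤ v a b)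

    p-place q-place : Place
    p-place = fin p p-prime
    q-place = fin q q-prime

    -- Real solubility enters as a plain hypothesis because each of the six torsors has a positive
    -- coefficient.
    combine : ∀ a b {x y z} → Solubleℤ a b ∞ → LocalDichotomy 2-place a b x → LocalDichotomy p-place a b y → LocalDichotomy q-place a b z →
      Dichotomy a b (x ∧ (y ∧ z))
    combine a b {x} {y} {z} real dyadic at-p at-q = all-soluble x y z (proj₁ dyadic) (proj₁ at-p) (proj₁ at-q) , obstruction x y z (proj₂ dyadic) (proj₂ at-p) (proj₂ at-q)
      where
      all-soluble : ∀ x y z → (x ≡ true → Solubleℤ a b 2-place) → (y ≡ true → Solubleℤ a b p-place) → (z ≡ true → Solubleℤ a b q-place) →
        x ∧ (y ∧ z) ≡ true → ∀ {v} → v ∈ S → Solubleℤ a b v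
      all-soluble true true true s₂ sₚ s_q refl (here refl) = real
      all-soluble true true true s₂ sₚ s_q refl (there (here refl)) = s₂ refl
      all-soluble true true true s₂ sₚ s_q refl (there (there (here refl))) = sₚ refl
      all-soluble true true true s₂ sₚ s_q refl (there (there (there (here refl)))) = s_q refl
      obstruction : ∀ x y z → (x ≡ false → Anisotropicℤ 2-place a b) → (y ≡ false → Anisotropicℤ p-place a b) → (z ≡ false → Anisotropicℤ q-place a b) →
        x ∧ (y ∧ z) ≡ false → ∃[ v ] v ∈ S × Anisotropicℤ v a b
      obstruction false y z a₂ aₚ a_q refl = 2-place , there (here refl) , a₂ refl
      obstruction true false z a₂ aₚ a_q refl = p-place , there (there (here refl)) , aₚ refl
      obstruction true true false a₂ aₚ a_q refl = q-place , there (there (there (here refl))) , a_q refl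

    √-natural : ∀ n → Root ∞ 2 (fromℤ (+ n))
    √-natural n = √-real (fromℤ (+ n)) (fromℤ-mono-≤ (ℤ.+≤+ z≤n))

    √-product : ∀ m n → Root ∞ 2 (fromℤ (+ m * + n))
    √-product m n = subst (λ k → Root ∞ 2 (fromℤ k)) (ℤ.pos-* m n) (√-natural (m ℕ.* n))

    open ℤ-Solver

    form-2 : Dichotomy (+ 2) (+ 2 * (P * Q)) (does (C₁? 1ℤ (P * Q)) ∧ (isSquare p (+ 2) ∧ isSquare q (+ 2)))
    form-2 = combine (+ 2) (+ 2 * (P * Q)) (soluble-√a ∞ (fromℤ (+ 2)) (fromℤ (+ 2 * (P * Q))) (√-natural 2))
      (by-Dec 2-place (+ 2) (+ 2 * (P * Q)) (C₁? 1ℤ (P * Q)) (2a,2b-soluble odd-1 (odd-* odd-P odd-Q)) (2a,2b-anisotropic odd-1 (odd-* odd-P odd-Q)))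
      (ℓ=p.odd-dichotomy (+ 2) (+ 2 * Q) Up.unit-2 (Up.unit-* {+ 2} Up.unit-2 p∤q) (lemma P Q))
      (ℓ=q.odd-dichotomy (+ 2) (+ 2 * P) Uq.unit-2 (Uq.unit-* {+ 2} Uq.unit-2 q∤p) (lemma′ P Q))
      where
      lemma : ∀ P Q → + 2 * (P * Q) ≡ P * (+ 2 * Q)
      lemma = solve 2 (λ P Q → con (+ 2) :* (P :* Q) := P :* (con (+ 2) :* Q)) refl
      lemma′ : ∀ P Q → + 2 * (P * Q) ≡ Q * (+ 2 * P)
      lemma′ = solve 2 (λ P Q → con (+ 2) :* (P :* Q) := Q :* (con (+ 2) :* P)) refl

    -- At p it is the first coefficient that is divisible by p, so the odd criterion is applied to
    -- the exchanged pair and tests 4 q.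
    form-p : Dichotomy P (+ 4 * Q) (does (C₂? P Q) ∧ (isSquare p (+ 4 * Q) ∧ isSquare q P))
    form-p = combine P (+ 4 * Q) (soluble-√a ∞ (fromℤ P) (fromℤ (+ 4 * Q)) (√-natural p))
      (by-Dec 2-place P (+ 4 * Q) (C₂? P Q) (a,4b-soluble odd-P odd-Q) (a,4b-anisotropic odd-P odd-Q))
      (local-swap p-place (+ 4 * Q) P _ (ℓ=p.odd-dichotomy (+ 4 * Q) 1ℤ (Up.unit-* {+ 4} Up.unit-4 p∤q) Up.unit-1 (sym (ℤ.*-identityʳ P))))
      (ℓ=q.odd-dichotomy P (+ 4) q∤p Uq.unit-4 (ℤ.*-comm (+ 4) Q))

    form-2p : Dichotomy (+ 2 * P) (+ 2 * Q) (does (C₁? P Q) ∧ (isSquare p (+ 2 * Q) ∧ isSquare q (+ 2 * P)))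
    form-2p = combine (+ 2 * P) (+ 2 * Q) (soluble-√a ∞ (fromℤ (+ 2 * P)) (fromℤ (+ 2 * Q)) (√-product 2 p))
      (by-Dec 2-place (+ 2 * P) (+ 2 * Q) (C₁? P Q) (2a,2b-soluble odd-P odd-Q) (2a,2b-anisotropic odd-P odd-Q))
      (local-swap p-place (+ 2 * Q) (+ 2 * P) _ (ℓ=p.odd-dichotomy (+ 2 * Q) (+ 2) (Up.unit-* {+ 2} Up.unit-2 p∤q) Up.unit-2 (ℤ.*-comm (+ 2) P)))
      (ℓ=q.odd-dichotomy (+ 2 * P) (+ 2) (Uq.unit-* {+ 2} Uq.unit-2 q∤p) Uq.unit-2 (ℤ.*-comm (+ 2) Q))

    form-−1 : Dichotomy (- 1ℤ) (+ 16 * (P * Q)) (does (C₄? (- 1ℤ) (P * Q)) ∧ (isSquare p (- 1ℤ) ∧ isSquare q (- 1ℤ)))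
    form-−1 = combine (- 1ℤ) (+ 16 * (P * Q))
      (soluble-√b ∞ (fromℤ (- 1ℤ)) (fromℤ (+ 16 * (P * Q))) (subst (λ k → Root ∞ 2 (fromℤ (+ 16 * k))) (ℤ.pos-* p q) (√-product 16 (p ℕ.* q))))
      (by-Dec 2-place (- 1ℤ) (+ 16 * (P * Q)) (C₄? (- 1ℤ) (P * Q)) (a,16b-soluble (odd-neg odd-1) (odd-* odd-P odd-Q)) (a,16b-anisotropic (odd-neg odd-1) (odd-* odd-P odd-Q)))
      (ℓ=p.odd-dichotomy (- 1ℤ) (+ 16 * Q) (Up.unit-neg {1ℤ} Up.unit-1) (Up.unit-* {+ 16} Up.unit-16 p∤q) (lemma P Q))
      (ℓ=q.odd-dichotomy (- 1ℤ) (+ 16 * P) (Uq.unit-neg {1ℤ} Uq.unit-1) (Uq.unit-* {+ 16} Uq.unit-16 q∤p) (lemma′ P Q))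
      where
      lemma : ∀ P Q → + 16 * (P * Q) ≡ P * (+ 16 * Q)
      lemma = solve 2 (λ P Q → con (+ 16) :* (P :* Q) := P :* (con (+ 16) :* Q)) refl
      lemma′ : ∀ P Q → + 16 * (P * Q) ≡ Q * (+ 16 * P)
      lemma′ = solve 2 (λ P Q → con (+ 16) :* (P :* Q) := Q :* (con (+ 16) :* P)) refl

    form-+p : Dichotomy P (+ 16 * - Q) (does (C₄? P (- Q)) ∧ (isSquare p (+ 16 * - Q) ∧ isSquare q P))
    form-+p = combine P (+ 16 * - Q) (soluble-√a ∞ (fromℤ P) (fromℤ (+ 16 * - Q)) (√-natural p))
      (by-Dec 2-place P (+ 16 * - Q) (C₄? P (- Q)) (a,16b-soluble odd-P (odd-neg odd-Q)) (a,16b-anisotropic odd-P (odd-neg odd-Q)))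
      (local-swap p-place (+ 16 * - Q) P _ (ℓ=p.odd-dichotomy (+ 16 * - Q) 1ℤ (Up.unit-* {+ 16} Up.unit-16 (Up.unit-neg {Q} p∤q)) Up.unit-1 (sym (ℤ.*-identityʳ P))))
      (ℓ=q.odd-dichotomy P (- + 16) q∤p (Uq.unit-neg {+ 16} Uq.unit-16) (lemma Q))
      where
      lemma : ∀ Q → + 16 * - Q ≡ Q * (- + 16)
      lemma = solve 1 (λ Q → con (+ 16) :* :- Q := Q :* con (- + 16)) refl

    form-−p : Dichotomy (- P) (+ 16 * Q) (does (C₄? (- P) Q) ∧ (isSquare p (+ 16 * Q) ∧ isSquare q (- P)))
    form-−p = combine (- P) (+ 16 * Q) (soluble-√b ∞ (fromℤ (- P)) (fromℤ (+ 16 * Q)) (√-product 16 q))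
      (by-Dec 2-place (- P) (+ 16 * Q) (C₄? (- P) Q) (a,16b-soluble (odd-neg odd-P) odd-Q) (a,16b-anisotropic (odd-neg odd-P) odd-Q))
      (local-swap p-place (+ 16 * Q) (- P) _ (ℓ=p.odd-dichotomy (+ 16 * Q) (- 1ℤ) (Up.unit-* {+ 16} Up.unit-16 p∤q) (Up.unit-neg {1ℤ} Up.unit-1) (lemma P)))
      (ℓ=q.odd-dichotomy (- P) (+ 16) (Uq.unit-neg {P} q∤p) Uq.unit-16 (ℤ.*-comm (+ 16) Q))
      where
      lemma : ∀ P → - P ≡ P * - 1ℤ
      lemma = solve 1 (λ P → :- P := P :* con (- 1ℤ)) refl

-- Comparison of the conditions with the solubility criteria modulo 16.

module ResidueTable where

  open QuadraticResidues using (∣-resp)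
  open SupplementaryLaws using (minusOneSquare; twoSquare; odd≡1+2⌊/2⌋)
  open DyadicAnisotropy
  open DyadicSolubility
  open import Data.Integer.Base using (_+_; _-_; -_; _*_)
  open import Data.Integer.Divisibility.Signed

  -- The four conditions of the theorem, with χ = true for (p/q) = 1.
  Conditions : ℤ → ℤ → Bool → Set
  Conditions x y χ =
      (x ≡[mod 4 ] + 1 × y ≡[mod 4 ] + 1 × x * y ≡[mod 16 ] + 13 × χ ≡ false)
    ⊎ (x ≢[mod 4 ] y × x * y ≡[mod 8 ] + 3 × χ ≡ false)
    ⊎ (x ≡[mod 4 ] y × y ≡[mod 4 ] + 3 × χ ≡ true × y ≡[mod 8 ] + 3 × ((x - y ≡[mod 16 ] + 8) ⊎ (x - y ≡[mod 16 ] + 12)))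
    ⊎ (x ≡[mod 4 ] y × y ≡[mod 4 ] + 3 × χ ≡ false × x ≡[mod 8 ] + 3 × ((y - x ≡[mod 16 ] + 8) ⊎ (y - x ≡[mod 16 ] + 12)))

  Conditions? : ∀ x y χ → Dec (Conditions x y χ)
  Conditions? x y χ =
      (mod? 4 (x - + 1) ×-dec (mod? 4 (y - + 1) ×-dec (mod? 16 (x * y - + 13) ×-dec (χ Bool.≟ false))))
    ⊎-dec ((¬? (mod? 4 (x - y)) ×-dec (mod? 8 (x * y - + 3) ×-dec (χ Bool.≟ false)))
    ⊎-dec ((mod? 4 (x - y) ×-dec (mod? 4 (y - + 3) ×-dec ((χ Bool.≟ true) ×-dec (mod? 8 (y - + 3) ×-dec (mod? 16 (x - y - + 8) ⊎-dec mod? 16 (x - y - + 12))))))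
    ⊎-dec (mod? 4 (x - y) ×-dec (mod? 4 (y - + 3) ×-dec ((χ Bool.≟ false) ×-dec (mod? 8 (x - + 3) ×-dec (mod? 16 (y - x - + 8) ⊎-dec mod? 16 (y - x - + 12))))))))
    where
    mod? : ∀ m z → Dec (+ m ∣ᵤ.∣ z)
    mod? m z = m ℕ.∣? ℤ.∣ z ∣

  module _ (x x′ y y′ : ℤ) (x≈ : x ≈₁₆ x′) (y≈ : y ≈₁₆ y′) where
    private
      transfer : ∀ {m} → + m ∣ + 16 → ∀ a a′ → a ≈₁₆ a′ → + m ∣ᵤ.∣ a → + m ∣ᵤ.∣ a′
      transfer m∣16 a a′ a≈ m∣a = ∣⇒∣ᵤ (∣-≈₁₆ m∣16 a a′ a≈ (∣ᵤ⇒∣ m∣a))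

      minus : ∀ a a′ b b′ → a ≈₁₆ a′ → b ≈₁₆ b′ → a - b ≈₁₆ a′ - b′
      minus a a′ b b′ a≈ b≈ = ≈₁₆-+ a a′ (- b) (- b′) a≈ (≈₁₆-neg b b′ b≈)

      minus-const : ∀ a a′ c → a ≈₁₆ a′ → a - c ≈₁₆ a′ - c
      minus-const a a′ c a≈ = minus a a′ c c a≈ (≈₁₆-refl c)

      xy≈ : x * y ≈₁₆ x′ * y′
      xy≈ = ≈₁₆-* x x′ y y′ x≈ y≈

      x-y≈ : x - y ≈₁₆ x′ - y′
      x-y≈ = minus x x′ y y′ x≈ y≈

      y-x≈ : y - x ≈₁₆ y′ - x′
      y-x≈ = minus y y′ x x′ y≈ x≈

    Conditions-≈₁₆ : ∀ {χ} → Conditions x y χ → Conditions x′ y′ χ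
    Conditions-≈₁₆ = Sum.map
      (Product.map (transfer 4∣16 (x - + 1) (x′ - + 1) (minus-const x x′ (+ 1) x≈)) (Product.map (transfer 4∣16 (y - + 1) (y′ - + 1) (minus-const y y′ (+ 1) y≈))
        (Product.map (transfer ∣-refl (x * y - + 13) (x′ * y′ - + 13) (minus-const (x * y) (x′ * y′) (+ 13) xy≈)) id)))
      (Sum.map
        (Product.map (λ x≢y → x≢y ∘ transfer 4∣16 (x′ - y′) (x - y) (≈₁₆-sym (x - y) (x′ - y′) x-y≈))
          (Product.map (transfer 8∣16 (x * y - + 3) (x′ * y′ - + 3) (minus-const (x * y) (x′ * y′) (+ 3) xy≈)) id))
        (Sum.map
          (Product.map x≡y (Product.map y≡3 (Product.map id (Product.map (transfer 8∣16 (y - + 3) (y′ - + 3) (minus-const y y′ (+ 3) y≈))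
            (Sum.map (transfer ∣-refl (x - y - + 8) (x′ - y′ - + 8) (minus-const (x - y) (x′ - y′) (+ 8) x-y≈)) (transfer ∣-refl (x - y - + 12) (x′ - y′ - + 12) (minus-const (x - y) (x′ - y′) (+ 12) x-y≈)))))))
          (Product.map x≡y (Product.map y≡3 (Product.map id (Product.map (transfer 8∣16 (x - + 3) (x′ - + 3) (minus-const x x′ (+ 3) x≈))
            (Sum.map (transfer ∣-refl (y - x - + 8) (y′ - x′ - + 8) (minus-const (y - x) (y′ - x′) (+ 8) y-x≈)) (transfer ∣-refl (y - x - + 12) (y′ - x′ - + 12) (minus-const (y - x) (y′ - x′) (+ 12) y-x≈)))))))))
      where
      x≡y : + 4 ∣ᵤ.∣ (x - y) → + 4 ∣ᵤ.∣ (x′ - y′)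
      x≡y = transfer 4∣16 (x - y) (x′ - y′) x-y≈
      y≡3 : + 4 ∣ᵤ.∣ (y - + 3) → + 4 ∣ᵤ.∣ (y′ - + 3)
      y≡3 = transfer 4∣16 (y - + 3) (y′ - + 3) (minus-const y y′ (+ 3) y≈)

  -- r and s are the residues of p and q modulo 16.
  module Flags (r s : ℕ) (χ : Bool) where
    -- The symbol (q/p), obtained from χ = (p/q) by reciprocity.
    χ′ : Bool
    χ′ = χ xor (not (minusOneSquare r) ∧ not (minusOneSquare s))

    -- The criteria of the `form-` dichotomies in terms of r, s and χ. A product of two symbols is
    -- `not (x xor y)`, and the factors 4 and 16 are dropped as squares.
    flag-2 flag-p flag-2p flag-−1 flag-+p flag-−p any-flag : Bool
    flag-2 = does (C₁? 1ℤ (+ r * + s)) ∧ (twoSquare r ∧ twoSquare s)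
    flag-p = does (C₂? (+ r) (+ s)) ∧ (χ′ ∧ χ)
    flag-2p = does (C₁? (+ r) (+ s)) ∧ (not (twoSquare r xor χ′) ∧ not (twoSquare s xor χ))
    flag-−1 = does (C₄? (- 1ℤ) (+ r * + s)) ∧ (minusOneSquare r ∧ minusOneSquare s)
    flag-+p = does (C₄? (+ r) (- + s)) ∧ (not (χ′ xor minusOneSquare r) ∧ χ)
    flag-−p = does (C₄? (- + r) (+ s)) ∧ (χ′ ∧ not (χ xor minusOneSquare s))
    any-flag = flag-2 ∨ flag-p ∨ flag-2p ∨ flag-−1 ∨ flag-+p ∨ flag-−p

  open Flags using (any-flag)

  private
    -- The indices enumerate the odd residues 2 i + 1 and 2 j + 1, so that 8 by 8 cases for each χ
    -- settle the comparison by evaluation.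
    Agreement : Bool → Fin 8 → Fin 8 → Set
    Agreement χ i j = let r = suc (toℕ i ℕ.+ toℕ i); s = suc (toℕ j ℕ.+ toℕ j) in
      does (Conditions? (+ r) (+ s) χ) ≡ not (any-flag r s χ)

    agreement? : ∀ χ i j → Dec (Agreement χ i j)
    agreement? χ i j = _ Bool.≟ _

    agreement : ∀ χ i j → Agreement χ i j
    agreement false = from-yes (all? λ i → all? λ j → agreement? false i j)
    agreement true = from-yes (all? λ i → all? λ j → agreement? true i j)

  Conditions⇔no-flag : ∀ r s χ → ¬ 2 ℕ.∣ r → ¬ 2 ℕ.∣ s → r ℕ.< 16 → s ℕ.< 16 →
    does (Conditions? (+ r) (+ s) χ) ≡ not (any-flag r s χ)
  Conditions⇔no-flag r s χ 2∤r 2∤s r<16 s<16 =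
    subst₂ (λ r s → does (Conditions? (+ r) (+ s) χ) ≡ not (any-flag r s χ)) (index r 2∤r r<16) (index s 2∤s s<16)
      (agreement χ (fromℕ< (half< r r<16)) (fromℕ< (half< s s<16)))
    where
    half< : ∀ r → r ℕ.< 16 → ⌊ r /2⌋ ℕ.< 8
    half< r r<16 = s≤s (ℕ.⌊n/2⌋-mono (ℕ.s≤s⁻¹ r<16))
    index : ∀ r → ¬ 2 ℕ.∣ r → (r<16 : r ℕ.< 16) → suc (toℕ (fromℕ< (half< r r<16)) ℕ.+ toℕ (fromℕ< (half< r r<16))) ≡ r
    index r 2∤r r<16 = trans (cong (λ k → suc (k ℕ.+ k)) (toℕ-fromℕ< (half< r r<16))) (sym (odd≡1+2⌊/2⌋ r 2∤r))

-- Square classes unramified outside 2, p and q.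

module SquareClasses where

  open Rationals
  open AdicValuations
  open QuadraticResidues using (prime∣prime)
  open import Data.List.Base using ([]; _∷_)
  open import Data.List.Relation.Unary.All using ([]; _∷_)
  open import Data.Nat.Base using (_≤_; _*_; _+_; _^_)
  open import Data.Nat.Divisibility using (_∣_; divides)
  open import Data.Nat.Solver using () renaming (module +-*-Solver to ℕ-Solver)
  open import Data.Integer.Solver using () renaming (module +-*-Solver to ℤ-Solver)
  open import Data.Rational.Solver using () renaming (module +-*-Solver to ℚ-Solver)
  open import Algebra.Definitions.RawSemiring ℚ.+-*-rawSemiring using () renaming (_^_ to _ℚ^_)

  module Ord (ℓ : ℕ) (ℓ-prime : Prime ℓ) where
    open Adic ℓ ℓ-prime

    ordℕ-* : ∀ m n → 1 ≤ m → 1 ≤ n → ordℕ ℓ (m * n) ≡ ordℕ ℓ m + ordℕ ℓ n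
    ordℕ-* m n 1≤m 1≤n =
      let m′ , m≡ , ℓ∤m′ = ordℕ-spec m 1≤m
          n′ , n≡ , ℓ∤n′ = ordℕ-spec n 1≤n
          a = ordℕ ℓ m
          b = ordℕ ℓ n
      in trans (cong (ordℕ ℓ) (trans (cong₂ _*_ m≡ n≡) (trans (lemma (ℓ ^ a) m′ (ℓ ^ b) n′) (cong (_* (m′ * n′)) (sym (ℕ.^-distribˡ-+-* ℓ a b))))))
           (ordℕ-unique (a + b) (m′ * n′) (∤-* ℓ∤m′ ℓ∤n′))
      where
      open ℕ-Solver
      lemma : ∀ a b c d → a * b * (c * d) ≡ a * c * (b * d)
      lemma = solve 4 (λ a b c d → a :* b :* (c :* d) := a :* c :* (b :* d)) refl

    ordℕ-∤ : ∀ n → ¬ ℓ ∣ n → ordℕ ℓ n ≡ 0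
    ordℕ-∤ n ℓ∤n = trans (cong (ordℕ ℓ) (sym (ℕ.*-identityˡ n))) (ordℕ-unique 0 n ℓ∤n)

    ordℕ-exact : ∀ n → ¬ ℓ ∣ n → ordℕ ℓ (ℓ * n) ≡ 1
    ordℕ-exact n ℓ∤n = trans (cong (λ ℓ¹ → ordℕ ℓ (ℓ¹ * n)) (sym (ℕ.*-identityʳ ℓ))) (ordℕ-unique 1 n ℓ∤n)

    ordℕ-1 : ordℕ ℓ 1 ≡ 0
    ordℕ-1 = ordℕ-∤ 1 λ ℓ∣1 → ℕ.nonTrivial⇒≢1 {{prime⇒nonTrivial ℓ-prime}} (∣1⇒≡1 ℓ∣1)

    -- Cleared of denominators, d = e r² reads ↥d (↧r)² = e (↥r)² ↧d. Comparing orders gives A - D -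
    -- E = 2 (C - B).
    ord-parity : ∀ d e r → d ≢ 0ℚ → d ≡ fromℤ e ℚ.* r ℚ^ 2 → ord ℓ d ≡[mod 2 ] + ordℕ ℓ ℤ.∣ e ∣
    ord-parity d e r d≢0 d≡ = ∣⇒∣ᵤ (Signed.divides (+ C ℤ.- + B) (begin
        (+ A ℤ.- + D) ℤ.- + E ≡⟨ lemma (+ A) (+ D) (+ E) (+ B) ⟩
        (+ A ℤ.+ (+ B ℤ.+ + B)) ℤ.- (+ B ℤ.+ + B) ℤ.- + D ℤ.- + E ≡⟨ cong (λ t → t ℤ.- (+ B ℤ.+ + B) ℤ.- + D ℤ.- + E) (cong +_ ords) ⟩
        (+ E ℤ.+ (+ C ℤ.+ + C) ℤ.+ + D) ℤ.- (+ B ℤ.+ + B) ℤ.- + D ℤ.- + E ≡⟨ lemma′ (+ B) (+ C) (+ D) (+ E) ⟩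
        (+ C ℤ.- + B) ℤ.* + 2 ∎))
      where
      open ≡-Reasoning
      A B C D E : ℕ
      A = ordℕ ℓ ℤ.∣ ↥ d ∣
      B = ordℕ ℓ (↧ₙ r)
      C = ordℕ ℓ ℤ.∣ ↥ r ∣
      D = ordℕ ℓ (↧ₙ d)
      E = ordℕ ℓ ℤ.∣ e ∣
      lemma : ∀ A D E B → (A ℤ.- D) ℤ.- E ≡ (A ℤ.+ (B ℤ.+ B)) ℤ.- (B ℤ.+ B) ℤ.- D ℤ.- E
      lemma = solve 4 (λ A D E B → (A :- D) :- E := (A :+ (B :+ B)) :- (B :+ B) :- D :- E) refl where open ℤ-Solver
      lemma′ : ∀ B C D E → (E ℤ.+ (C ℤ.+ C) ℤ.+ D) ℤ.- (B ℤ.+ B) ℤ.- D ℤ.- E ≡ (C ℤ.- B) ℤ.* + 2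
      lemma′ = solve 4 (λ B C D E → (E :+ (C :+ C) :+ D) :- (B :+ B) :- D :- E := (C :- B) :* con (+ 2)) refl where open ℤ-Solver
      crossℤ : ↥ d ℤ.* (↧ r ℤ.* ↧ r) ≡ e ℤ.* (↥ r ℤ.* ↥ r) ℤ.* ↧ d
      crossℤ = fromℤ-injective (begin
        fromℤ (↥ d ℤ.* (↧ r ℤ.* ↧ r)) ≡⟨ trans (fromℤ-* (↥ d) (↧ r ℤ.* ↧ r)) (cong (fromℤ (↥ d) ℚ.*_) (fromℤ-* (↧ r) (↧ r))) ⟩
        fromℤ (↥ d) ℚ.* (fromℤ (↧ r) ℚ.* fromℤ (↧ r)) ≡⟨ cong (ℚ._* (fromℤ (↧ r) ℚ.* fromℤ (↧ r))) (sym (*↧≡↥ d)) ⟩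
        d ℚ.* fromℤ (↧ d) ℚ.* (fromℤ (↧ r) ℚ.* fromℤ (↧ r)) ≡⟨ cong (λ d′ → d′ ℚ.* fromℤ (↧ d) ℚ.* (fromℤ (↧ r) ℚ.* fromℤ (↧ r))) d≡ ⟩
        fromℤ e ℚ.* r ℚ^ 2 ℚ.* fromℤ (↧ d) ℚ.* (fromℤ (↧ r) ℚ.* fromℤ (↧ r)) ≡⟨ regroup (fromℤ e) r (fromℤ (↧ d)) (fromℤ (↧ r)) ⟩
        fromℤ e ℚ.* (r ℚ.* fromℤ (↧ r) ℚ.* (r ℚ.* fromℤ (↧ r))) ℚ.* fromℤ (↧ d) ≡⟨ cong (λ y → fromℤ e ℚ.* (y ℚ.* y) ℚ.* fromℤ (↧ d)) (*↧≡↥ r) ⟩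
        fromℤ e ℚ.* (fromℤ (↥ r) ℚ.* fromℤ (↥ r)) ℚ.* fromℤ (↧ d) ≡⟨ cong (ℚ._* fromℤ (↧ d)) (trans (cong (fromℤ e ℚ.*_) (sym (fromℤ-* (↥ r) (↥ r)))) (sym (fromℤ-* e (↥ r ℤ.* ↥ r)))) ⟩
        fromℤ (e ℤ.* (↥ r ℤ.* ↥ r)) ℚ.* fromℤ (↧ d) ≡⟨ fromℤ-* (e ℤ.* (↥ r ℤ.* ↥ r)) (↧ d) ⟨
        fromℤ (e ℤ.* (↥ r ℤ.* ↥ r) ℤ.* ↧ d) ∎)
        where
        open ℚ-Solver
        regroup : ∀ e r D R → e ℚ.* r ℚ^ 2 ℚ.* D ℚ.* (R ℚ.* R) ≡ e ℚ.* (r ℚ.* R ℚ.* (r ℚ.* R)) ℚ.* D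
        regroup = solve 4 (λ e r D R → e :* r :^ 2 :* D :* (R :* R) := e :* (r :* R :* (r :* R)) :* D) refl
      cross : ℤ.∣ ↥ d ∣ * (↧ₙ r * ↧ₙ r) ≡ ℤ.∣ e ∣ * (ℤ.∣ ↥ r ∣ * ℤ.∣ ↥ r ∣) * ↧ₙ d
      cross = trans (sym (trans (ℤ.abs-* (↥ d) (↧ r ℤ.* ↧ r)) (cong (ℤ.∣ ↥ d ∣ *_) (ℤ.abs-* (↧ r) (↧ r)))))
        (trans (cong ℤ.∣_∣ crossℤ) (trans (ℤ.abs-* (e ℤ.* (↥ r ℤ.* ↥ r)) (↧ d)) (cong (_* ↧ₙ d) (trans (ℤ.abs-* e (↥ r ℤ.* ↥ r)) (cong (ℤ.∣ e ∣ *_) (ℤ.abs-* (↥ r) (↥ r)))))))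
      1≤*⁻ˡ : ∀ m n → 1 ≤ m * n → 1 ≤ m
      1≤*⁻ˡ (suc m) n _ = s≤s z≤n
      1≤*⁻ʳ : ∀ m n → 1 ≤ m * n → 1 ≤ n
      1≤*⁻ʳ m n 1≤mn = 1≤*⁻ˡ n m (subst (1 ≤_) (ℕ.*-comm m n) 1≤mn)
      1≤lhs : 1 ≤ ℤ.∣ ↥ d ∣ * (↧ₙ r * ↧ₙ r)
      1≤lhs = ℕ.*-mono-≤ (1≤∣↥∣ d d≢0) (ℕ.*-mono-≤ {1} {↧ₙ r} {1} {↧ₙ r} (s≤s z≤n) (s≤s z≤n))
      -- That e and r are nonzero is inherited from the nonzero left side of `cross`.
      1≤er² : 1 ≤ ℤ.∣ e ∣ * (ℤ.∣ ↥ r ∣ * ℤ.∣ ↥ r ∣)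
      1≤er² = 1≤*⁻ˡ _ (↧ₙ d) (subst (1 ≤_) cross 1≤lhs)
      1≤r² : 1 ≤ ℤ.∣ ↥ r ∣ * ℤ.∣ ↥ r ∣
      1≤r² = 1≤*⁻ʳ ℤ.∣ e ∣ _ 1≤er²
      1≤r : 1 ≤ ℤ.∣ ↥ r ∣
      1≤r = 1≤*⁻ˡ ℤ.∣ ↥ r ∣ ℤ.∣ ↥ r ∣ 1≤r²
      ords : A + (B + B) ≡ E + (C + C) + D
      ords = begin
        A + (B + B) ≡⟨ cong (λ t → A + t) (ordℕ-* (↧ₙ r) (↧ₙ r) (s≤s z≤n) (s≤s z≤n)) ⟨
        A + ordℕ ℓ (↧ₙ r * ↧ₙ r) ≡⟨ ordℕ-* ℤ.∣ ↥ d ∣ (↧ₙ r * ↧ₙ r) (1≤∣↥∣ d d≢0) (ℕ.*-mono-≤ {1} {↧ₙ r} {1} {↧ₙ r} (s≤s z≤n) (s≤s z≤n)) ⟨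
        ordℕ ℓ (ℤ.∣ ↥ d ∣ * (↧ₙ r * ↧ₙ r)) ≡⟨ cong (ordℕ ℓ) cross ⟩
        ordℕ ℓ (ℤ.∣ e ∣ * (ℤ.∣ ↥ r ∣ * ℤ.∣ ↥ r ∣) * ↧ₙ d) ≡⟨ ordℕ-* (ℤ.∣ e ∣ * (ℤ.∣ ↥ r ∣ * ℤ.∣ ↥ r ∣)) (↧ₙ d) 1≤er² (s≤s z≤n) ⟩
        ordℕ ℓ (ℤ.∣ e ∣ * (ℤ.∣ ↥ r ∣ * ℤ.∣ ↥ r ∣)) + D ≡⟨ cong (_+ D) (ordℕ-* ℤ.∣ e ∣ (ℤ.∣ ↥ r ∣ * ℤ.∣ ↥ r ∣) (1≤*⁻ˡ ℤ.∣ e ∣ _ 1≤er²) 1≤r²) ⟩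
        E + ordℕ ℓ (ℤ.∣ ↥ r ∣ * ℤ.∣ ↥ r ∣) + D ≡⟨ cong (λ c → E + c + D) (ordℕ-* ℤ.∣ ↥ r ∣ ℤ.∣ ↥ r ∣ 1≤r 1≤r) ⟩
        E + (C + C) + D ∎

  even-+⁻ : ∀ {a b} → 2 ∣ a + a + b → 2 ∣ b
  even-+⁻ {a} {b} 2∣ = ∣m+n∣m⇒∣n 2∣ (divides a (trans (cong (λ t → a + t) (sym (ℕ.+-identityʳ a))) (ℕ.*-comm 2 a)))

  module Classification (p q : ℕ) (p-prime : Prime p) (q-prime : Prime q) where
    open TwoIsogeny p q p-prime q-prime using (S; ℚ⟨S,2⟩)

    EvenOutside : ℕ → Set
    EvenOutside n = ∀ ℓ → Prime ℓ → ℓ ≢ 2 → ℓ ≢ p → ℓ ≢ q → 2 ∣ ordℕ ℓ n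

    Decomposition : ℕ → Set
    Decomposition n = ∃[ i ] ∃[ j ] ∃[ k ] ∃[ r ] n ≡ 2 ^ i * p ^ j * q ^ k * (r * r)

    remove-factor : ∀ s → Prime s → s ≡ 2 ⊎ s ≡ p ⊎ s ≡ q → ∀ m → 1 ≤ m → EvenOutside (s * m) → EvenOutside m
    remove-factor s s-prime s∈ m 1≤m even ℓ ℓ-prime ℓ≢2 ℓ≢p ℓ≢q = subst (2 ∣_)
      (trans (ordℕ-* s m (ℕ.<⇒≤ (ℕ.nonTrivial⇒n>1 s {{prime⇒nonTrivial s-prime}})) 1≤m) (cong (_+ ordℕ ℓ m) (ordℕ-∤ s ℓ∤s)))
      (even ℓ ℓ-prime ℓ≢2 ℓ≢p ℓ≢q)
      where
      open Ord ℓ ℓ-prime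
      ℓ∤s : ¬ ℓ ∣ s
      ℓ∤s ℓ∣s with prime∣prime ℓ-prime s-prime ℓ∣s
      ... | refl = [ ℓ≢2 , [ ℓ≢p , ℓ≢q ]′ ]′ s∈

    prime-factor : ∀ n → 1 ≤ n → n ≡ 1 ⊎ ∃[ ℓ ] ∃[ m ] Prime ℓ × n ≡ ℓ * m
    prime-factor n 1≤n with factorise n {{ℕ.>-nonZero 1≤n}}
    ... | record { factors = [] ; isFactorisation = n≡ ; factorsPrime = [] } = inj₁ n≡
    ... | record { factors = ℓ ∷ ℓs ; isFactorisation = n≡ ; factorsPrime = ℓ-prime ∷ _ } = inj₂ (ℓ , _ , ℓ-prime , n≡)

    -- Prime factors are removed one at a time. A factor 2, p or q goes into the exponents; any
    -- other ℓ has even order, so it occurs twice and is moved into the square.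
    decompose : ∀ fuel n → n ≤ fuel → 1 ≤ n → EvenOutside n → Decomposition n
    decompose zero n n≤0 1≤n even = contradiction (ℕ.≤-trans 1≤n n≤0) λ ()
    decompose (suc fuel) n n≤ 1≤n even = case prime-factor n 1≤n of λ where
        (inj₁ n≡1) → 0 , 0 , 0 , 1 , n≡1
        (inj₂ (ℓ , m , ℓ-prime , n≡)) → step ℓ m ℓ-prime n≡ (ℓ ℕ.≟ 2) (ℓ ℕ.≟ p) (ℓ ℕ.≟ q)
      where
      open ℕ-Solver
      smaller : ∀ ℓ m → Prime ℓ → n ≡ ℓ * m → m ≤ fuel × 1 ≤ m
      smaller ℓ zero ℓ-prime n≡ = contradiction (subst (1 ≤_) (trans n≡ (ℕ.*-zeroʳ ℓ)) 1≤n) λ ()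
      smaller ℓ (suc m) ℓ-prime n≡ = ℕ.s≤s⁻¹ (ℕ.≤-trans (subst (suc (suc m) ≤_) (trans (ℕ.*-comm (suc m) ℓ) (sym n≡)) (ℕ.m<m*n (suc m) ℓ (ℕ.nonTrivial⇒n>1 ℓ {{prime⇒nonTrivial ℓ-prime}}))) n≤) , s≤s z≤n
      recurse : ∀ ℓ m → Prime ℓ → n ≡ ℓ * m → ℓ ≡ 2 ⊎ ℓ ≡ p ⊎ ℓ ≡ q → Decomposition m
      recurse ℓ m ℓ-prime n≡ ℓ∈ = let m≤ , 1≤m = smaller ℓ m ℓ-prime n≡ in
        decompose fuel m m≤ 1≤m (remove-factor ℓ ℓ-prime ℓ∈ m 1≤m (subst EvenOutside n≡ even))
      step : ∀ ℓ m → Prime ℓ → n ≡ ℓ * m → Dec (ℓ ≡ 2) → Dec (ℓ ≡ p) → Dec (ℓ ≡ q) → Decomposition n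
      step ℓ m ℓ-prime n≡ (yes refl) _ _ = let i , j , k , r , m≡ = recurse 2 m ℓ-prime n≡ (inj₁ refl) in
        suc i , j , k , r , trans n≡ (trans (cong (2 *_) m≡) (lemma 2 (2 ^ i) (p ^ j) (q ^ k) (r * r)))
        where
        lemma : ∀ t x y z w → t * (x * y * z * w) ≡ t * x * y * z * w
        lemma = solve 5 (λ t x y z w → t :* (x :* y :* z :* w) := t :* x :* y :* z :* w) refl
      step ℓ m ℓ-prime n≡ (no _) (yes refl) _ = let i , j , k , r , m≡ = recurse p m ℓ-prime n≡ (inj₂ (inj₁ refl)) in
        i , suc j , k , r , trans n≡ (trans (cong (p *_) m≡) (lemma p (2 ^ i) (p ^ j) (q ^ k) (r * r)))
        where
        lemma : ∀ t x y z w → t * (x * y * z * w) ≡ x * (t * y) * z * w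
        lemma = solve 5 (λ t x y z w → t :* (x :* y :* z :* w) := x :* (t :* y) :* z :* w) refl
      step ℓ m ℓ-prime n≡ (no _) (no _) (yes refl) = let i , j , k , r , m≡ = recurse q m ℓ-prime n≡ (inj₂ (inj₂ refl)) in
        i , j , suc k , r , trans n≡ (trans (cong (q *_) m≡) (lemma q (2 ^ i) (p ^ j) (q ^ k) (r * r)))
        where
        lemma : ∀ t x y z w → t * (x * y * z * w) ≡ x * y * (t * z) * w
        lemma = solve 5 (λ t x y z w → t :* (x :* y :* z :* w) := x :* y :* (t :* z) :* w) refl
      step ℓ m ℓ-prime n≡ (no ℓ≢2) (no ℓ≢p) (no ℓ≢q) = square (prime-divides (ordℕ ℓ m) refl)
        where
        open Adic ℓ ℓ-prime using (ordℕ-spec)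
        open Ord ℓ ℓ-prime
        1≤m : 1 ≤ m
        1≤m = proj₂ (smaller ℓ m ℓ-prime n≡)
        1≤ℓ : 1 ≤ ℓ
        1≤ℓ = ℕ.<⇒≤ (ℕ.nonTrivial⇒n>1 ℓ {{prime⇒nonTrivial ℓ-prime}})
        ordℓ≡1 : ordℕ ℓ ℓ ≡ 1
        ordℓ≡1 = trans (cong (ordℕ ℓ) (sym (ℕ.*-identityʳ ℓ))) (ordℕ-exact 1 λ ℓ∣1 → ℕ.nonTrivial⇒≢1 {{prime⇒nonTrivial ℓ-prime}} (∣1⇒≡1 ℓ∣1))
        2∣1+ord : 2 ∣ 1 + ordℕ ℓ m
        2∣1+ord = subst (2 ∣_) (trans (cong (ordℕ ℓ) n≡) (trans (ordℕ-* ℓ m 1≤ℓ 1≤m) (cong (_+ ordℕ ℓ m) ordℓ≡1))) (even ℓ ℓ-prime ℓ≢2 ℓ≢p ℓ≢q)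
        prime-divides : ∀ o → o ≡ ordℕ ℓ m → ℓ ∣ m
        -- Order 0 of m would make the order of n equal to 1, which is odd.
        prime-divides zero o≡ = contradiction (∣⇒≤ (subst (λ o → 2 ∣ 1 + o) (sym o≡) 2∣1+ord)) λ { (s≤s ()) }
        prime-divides (suc o) o≡ = let m′ , m≡ , _ = ordℕ-spec m 1≤m in
          divides (ℓ ^ o * m′) (trans m≡ (trans (cong (λ o → ℓ ^ o * m′) (sym o≡)) (trans (ℕ.*-assoc ℓ (ℓ ^ o) m′) (ℕ.*-comm ℓ (ℓ ^ o * m′)))))
        square : ℓ ∣ m → Decomposition n
        square (divides m′ m≡) = let i , j , k , r , m′≡ = decompose fuel m′ (ℕ.≤-trans m′≤m (proj₁ (smaller ℓ m ℓ-prime n≡))) 1≤m′ even′ in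
            i , j , k , ℓ * r , trans n≡ (trans (cong (ℓ *_) m≡) (trans (cong (λ y → ℓ * (y * ℓ)) m′≡) (lemma ℓ (2 ^ i) (p ^ j) (q ^ k) r)))
          where
          lemma : ∀ t x y z r → t * (x * y * z * (r * r) * t) ≡ x * y * z * (t * r * (t * r))
          lemma = solve 5 (λ t x y z r → t :* (x :* y :* z :* (r :* r) :* t) := x :* y :* z :* (t :* r :* (t :* r))) refl
          1≤m′ : 1 ≤ m′
          1≤m′ = ℕ.n≢0⇒n>0 λ m′≡0 → ℕ.<⇒≢ 1≤m (sym (trans m≡ (cong (_* ℓ) m′≡0)))
          m′≤m : m′ ≤ m
          m′≤m = subst (m′ ≤_) (sym m≡) (ℕ.m≤m*n m′ ℓ {{prime⇒nonZero ℓ-prime}})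
          n≡ℓℓm′ : n ≡ ℓ * ℓ * m′
          n≡ℓℓm′ = trans n≡ (trans (cong (ℓ *_) (trans m≡ (ℕ.*-comm m′ ℓ))) (sym (ℕ.*-assoc ℓ ℓ m′)))
          even′ : EvenOutside m′
          even′ ℓ′ ℓ′-prime ℓ′≢2 ℓ′≢p ℓ′≢q = even-+⁻ {ordℕ ℓ′ ℓ} (subst (2 ∣_)
              (trans (cong (ordℕ ℓ′) n≡ℓℓm′) (trans (Ord.ordℕ-* ℓ′ ℓ′-prime (ℓ * ℓ) m′ (ℕ.*-mono-≤ 1≤ℓ 1≤ℓ) 1≤m′) (cong (_+ ordℕ ℓ′ m′) (Ord.ordℕ-* ℓ′ ℓ′-prime ℓ ℓ 1≤ℓ 1≤ℓ))))
              (even ℓ′ ℓ′-prime ℓ′≢2 ℓ′≢p ℓ′≢q))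

    data Representative : ℕ → Set where
      rep-1 : Representative 1
      rep-2 : Representative 2
      rep-p : Representative p
      rep-q : Representative q
      rep-2p : Representative (2 * p)
      rep-2q : Representative (2 * q)
      rep-pq : Representative (p * q)
      rep-2pq : Representative (2 * (p * q))

    power-parity : ∀ x i → ∃[ y ] (x ^ i ≡ y * y ⊎ x ^ i ≡ x * (y * y))
    power-parity x zero = 1 , inj₁ refl
    power-parity x (suc zero) = 1 , inj₂ refl
    power-parity x (suc (suc i)) with power-parity x i
    ... | y , inj₁ eq = x * y , inj₁ (trans (cong (λ t → x * (x * t)) eq) (lemma x y))
      where
      open ℕ-Solver
      lemma : ∀ x y → x * (x * (y * y)) ≡ x * y * (x * y)
      lemma = solve 2 (λ x y → x :* (x :* (y :* y)) := x :* y :* (x :* y)) refl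
    ... | y , inj₂ eq = x * y , inj₂ (trans (cong (λ t → x * (x * t)) eq) (lemma x y))
      where
      open ℕ-Solver
      lemma : ∀ x y → x * (x * (x * (y * y))) ≡ x * (x * y * (x * y))
      lemma = solve 2 (λ x y → x :* (x :* (x :* (y :* y))) := x :* (x :* y :* (x :* y))) refl

    representative : ∀ {n} → Decomposition n → ∃[ e ] ∃[ r ] Representative e × n ≡ e * (r * r)
    representative {n} (i , j , k , r , n≡) = go (power-parity 2 i) (power-parity p j) (power-parity q k)
      where
      open ℕ-Solver
      Parity : ℕ → ℕ → Set
      Parity x i = ∃[ y ] (x ^ i ≡ y * y ⊎ x ^ i ≡ x * (y * y))
      n≡′ : ∀ {a b c} → 2 ^ i ≡ a → p ^ j ≡ b → q ^ k ≡ c → n ≡ a * b * c * (r * r)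
      n≡′ refl refl refl = n≡
      go : Parity 2 i → Parity p j → Parity q k → ∃[ e ] ∃[ r ] Representative e × n ≡ e * (r * r)
      go (x , inj₁ a) (y , inj₁ b) (z , inj₁ c) = 1 , x * y * z * r , rep-1 , trans (n≡′ a b c) (lemma x y z r)
        where
        lemma : ∀ x y z r → x * x * (y * y) * (z * z) * (r * r) ≡ 1 * (x * y * z * r * (x * y * z * r))
        lemma = solve 4 (λ x y z r → x :* x :* (y :* y) :* (z :* z) :* (r :* r) := con 1 :* (x :* y :* z :* r :* (x :* y :* z :* r))) refl
      go (x , inj₂ a) (y , inj₁ b) (z , inj₁ c) = 2 , x * y * z * r , rep-2 , trans (n≡′ a b c) (lemma x y z r)
        where
        lemma : ∀ x y z r → 2 * (x * x) * (y * y) * (z * z) * (r * r) ≡ 2 * (x * y * z * r * (x * y * z * r))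
        lemma = solve 4 (λ x y z r → con 2 :* (x :* x) :* (y :* y) :* (z :* z) :* (r :* r) := con 2 :* (x :* y :* z :* r :* (x :* y :* z :* r))) refl
      go (x , inj₁ a) (y , inj₂ b) (z , inj₁ c) = p , x * y * z * r , rep-p , trans (n≡′ a b c) (lemma p x y z r)
        where
        lemma : ∀ p x y z r → x * x * (p * (y * y)) * (z * z) * (r * r) ≡ p * (x * y * z * r * (x * y * z * r))
        lemma = solve 5 (λ p x y z r → x :* x :* (p :* (y :* y)) :* (z :* z) :* (r :* r) := p :* (x :* y :* z :* r :* (x :* y :* z :* r))) refl
      go (x , inj₁ a) (y , inj₁ b) (z , inj₂ c) = q , x * y * z * r , rep-q , trans (n≡′ a b c) (lemma q x y z r)
        where
        lemma : ∀ q x y z r → x * x * (y * y) * (q * (z * z)) * (r * r) ≡ q * (x * y * z * r * (x * y * z * r))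
        lemma = solve 5 (λ q x y z r → x :* x :* (y :* y) :* (q :* (z :* z)) :* (r :* r) := q :* (x :* y :* z :* r :* (x :* y :* z :* r))) refl
      go (x , inj₂ a) (y , inj₂ b) (z , inj₁ c) = 2 * p , x * y * z * r , rep-2p , trans (n≡′ a b c) (lemma p x y z r)
        where
        lemma : ∀ p x y z r → 2 * (x * x) * (p * (y * y)) * (z * z) * (r * r) ≡ 2 * p * (x * y * z * r * (x * y * z * r))
        lemma = solve 5 (λ p x y z r → con 2 :* (x :* x) :* (p :* (y :* y)) :* (z :* z) :* (r :* r) := con 2 :* p :* (x :* y :* z :* r :* (x :* y :* z :* r))) refl
      go (x , inj₂ a) (y , inj₁ b) (z , inj₂ c) = 2 * q , x * y * z * r , rep-2q , trans (n≡′ a b c) (lemma q x y z r)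
        where
        lemma : ∀ q x y z r → 2 * (x * x) * (y * y) * (q * (z * z)) * (r * r) ≡ 2 * q * (x * y * z * r * (x * y * z * r))
        lemma = solve 5 (λ q x y z r → con 2 :* (x :* x) :* (y :* y) :* (q :* (z :* z)) :* (r :* r) := con 2 :* q :* (x :* y :* z :* r :* (x :* y :* z :* r))) refl
      go (x , inj₁ a) (y , inj₂ b) (z , inj₂ c) = p * q , x * y * z * r , rep-pq , trans (n≡′ a b c) (lemma p q x y z r)
        where
        lemma : ∀ p q x y z r → x * x * (p * (y * y)) * (q * (z * z)) * (r * r) ≡ p * q * (x * y * z * r * (x * y * z * r))
        lemma = solve 6 (λ p q x y z r → x :* x :* (p :* (y :* y)) :* (q :* (z :* z)) :* (r :* r) := p :* q :* (x :* y :* z :* r :* (x :* y :* z :* r))) refl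
      go (x , inj₂ a) (y , inj₂ b) (z , inj₂ c) = 2 * (p * q) , x * y * z * r , rep-2pq , trans (n≡′ a b c) (lemma p q x y z r)
        where
        lemma : ∀ p q x y z r → 2 * (x * x) * (p * (y * y)) * (q * (z * z)) * (r * r) ≡ 2 * (p * q) * (x * y * z * r * (x * y * z * r))
        lemma = solve 6 (λ p q x y z r → con 2 :* (x :* x) :* (p :* (y :* y)) :* (q :* (z :* z)) :* (r :* r) := con 2 :* (p :* q) :* (x :* y :* z :* r :* (x :* y :* z :* r))) refl

    ∉S : ∀ {ℓ} (ℓ-prime : Prime ℓ) → ℓ ≢ 2 → ℓ ≢ p → ℓ ≢ q → fin ℓ ℓ-prime ∉ S
    ∉S ℓ-prime ℓ≢2 ℓ≢p ℓ≢q (there (here refl)) = ℓ≢2 refl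
    ∉S ℓ-prime ℓ≢2 ℓ≢p ℓ≢q (there (there (here refl))) = ℓ≢p refl
    ∉S ℓ-prime ℓ≢2 ℓ≢p ℓ≢q (there (there (there (here refl)))) = ℓ≢q refl

    -- The class of a fraction n/m is that of the integer n m. Its orders have the parity of those
    -- of n/m, since a sum and a difference agree modulo 2, and n m = ± e r² gives d = ± e (r/m)².
    classify : ∀ (d : ℚ*) → ℚ⟨S,2⟩ d → ∃[ e ] Representative e ×
      ∃[ r ] (value d ≡ fromℤ (+ e) ℚ.* value r ℚ^ 2 ⊎ value d ≡ fromℤ (ℤ.- + e) ℚ.* value r ℚ^ 2)
    classify (mkℚ* d {{d-nonZero}}) d∈ = from-representative (representative (decompose N N ℕ.≤-refl 1≤N even))
      where
      d≢0 : d ≢ 0ℚ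
      d≢0 refl = contradiction-irr d-nonZero
        where
        contradiction-irr : .(ℚ.NonZero 0ℚ) → ⊥
        contradiction-irr ()
      N : ℕ
      N = ℤ.∣ ↥ d ∣ * ↧ₙ d
      1≤↥ : 1 ≤ ℤ.∣ ↥ d ∣
      1≤↥ = Adic.1≤∣↥∣ 2 prime[2] d d≢0
      1≤N : 1 ≤ N
      1≤N = ℕ.*-mono-≤ {1} {ℤ.∣ ↥ d ∣} {1} {↧ₙ d} 1≤↥ (s≤s z≤n)
      even : EvenOutside N
      even ℓ ℓ-prime ℓ≢2 ℓ≢p ℓ≢q = subst (2 ∣_) (sym (Ord.ordℕ-* ℓ ℓ-prime ℤ.∣ ↥ d ∣ (↧ₙ d) 1≤↥ (s≤s z≤n)))
        (∣⇒∣ᵤ (Signed.∣m+n∣m⇒∣n {+ 2} {+ D ℤ.* -[1+ 1 ]} {+ (A + D)} (subst (Signed._∣_ (+ 2)) (lemma (+ A) (+ D)) (∣ᵤ⇒∣ (d∈ ℓ ℓ-prime (∉S ℓ-prime ℓ≢2 ℓ≢p ℓ≢q)))) (Signed.∣n⇒∣m*n (+ D) (Signed.divides -[1+ 0 ] refl))))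
        where
        A D : ℕ
        A = ordℕ ℓ ℤ.∣ ↥ d ∣
        D = ordℕ ℓ (↧ₙ d)
        open ℤ-Solver
        lemma : ∀ A D → A ℤ.- D ℤ.- + 0 ≡ D ℤ.* -[1+ 1 ] ℤ.+ (A ℤ.+ D)
        lemma = solve 2 (λ A D → A :- D :- con (+ 0) := D :* con -[1+ 1 ] :+ (A :+ D)) refl
      from-representative : ∃[ e ] ∃[ r ] Representative e × N ≡ e * (r * r) →
        ∃[ e ] Representative e × ∃[ r ] (d ≡ fromℤ (+ e) ℚ.* value r ℚ^ 2 ⊎ d ≡ fromℤ (ℤ.- + e) ℚ.* value r ℚ^ 2)
      from-representative (e , r , rep , N≡) = e , rep , mkℚ* ρ {{ℚ.≢-nonZero ρ≢0}} , signs (↥ d) refl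
        where
        δ : ℚ
        δ = fromℤ (↧ d)
        δ≢0 : δ ≢ 0ℚ
        δ≢0 ()
        instance
          δ-nonZero : ℚ.NonZero δ
          δ-nonZero = ℚ.≢-nonZero δ≢0
        ρ : ℚ
        ρ = fromℤ (+ r) ℚ.* ℚ.1/ δ
        ρδ : ρ ℚ.* δ ≡ fromℤ (+ r)
        ρδ = trans (ℚ.*-assoc (fromℤ (+ r)) (ℚ.1/ δ) δ) (trans (cong (fromℤ (+ r) ℚ.*_) (ℚ.*-inverseˡ δ)) (ℚ.*-identityʳ (fromℤ (+ r))))
        ρ≢0 : ρ ≢ 0ℚ
        ρ≢0 ρ≡0 = ℕ.<⇒≢ 1≤N (sym (trans N≡ (trans (cong (λ r → e * (r * r)) r≡0) (ℕ.*-zeroʳ e))))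
          where
          r≡0 : r ≡ 0
          r≡0 = ℤ.+-injective (fromℤ-injective {+ r} {0ℤ} (trans (sym ρδ) (trans (cong (ℚ._* δ) ρ≡0) (ℚ.*-zeroˡ δ))))
        open ℚ-Solver
        regroup : ∀ e ρ δ → e ℚ.* (ρ ℚ.* δ ℚ.* (ρ ℚ.* δ)) ≡ δ ℚ.* δ ℚ.* (e ℚ.* ρ ℚ^ 2)
        regroup = solve 3 (λ e ρ δ → e :* (ρ :* δ :* (ρ :* δ)) := δ :* δ :* (e :* ρ :^ 2)) refl
        regroup′ : ∀ d δ → δ ℚ.* δ ℚ.* d ≡ d ℚ.* δ ℚ.* δ
        regroup′ = solve 2 (λ d δ → δ :* δ :* d := d :* δ :* δ) refl
        δ²≢0 : δ ℚ.* δ ≢ 0ℚ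
        δ²≢0 δ²≡0 = δ≢0 (*-cancelˡ δ δ≢0 (trans δ²≡0 (sym (ℚ.*-zeroʳ δ))))
        conclude : ∀ ε → ↥ d ℤ.* ↧ d ≡ ε ℤ.* (+ r ℤ.* + r) → d ≡ fromℤ ε ℚ.* ρ ℚ^ 2
        conclude ε eq = *-cancelˡ (δ ℚ.* δ) δ²≢0 (begin
          δ ℚ.* δ ℚ.* d ≡⟨ regroup′ d δ ⟩
          d ℚ.* δ ℚ.* δ ≡⟨ cong (ℚ._* δ) (*↧≡↥ d) ⟩
          fromℤ (↥ d) ℚ.* δ ≡⟨ fromℤ-* (↥ d) (↧ d) ⟨
          fromℤ (↥ d ℤ.* ↧ d) ≡⟨ cong fromℤ eq ⟩
          fromℤ (ε ℤ.* (+ r ℤ.* + r)) ≡⟨ trans (fromℤ-* ε (+ r ℤ.* + r)) (cong (fromℤ ε ℚ.*_) (fromℤ-* (+ r) (+ r))) ⟩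
          fromℤ ε ℚ.* (fromℤ (+ r) ℚ.* fromℤ (+ r)) ≡⟨ cong (λ y → fromℤ ε ℚ.* (y ℚ.* y)) (sym ρδ) ⟩
          fromℤ ε ℚ.* (ρ ℚ.* δ ℚ.* (ρ ℚ.* δ)) ≡⟨ regroup (fromℤ ε) ρ δ ⟩
          δ ℚ.* δ ℚ.* (fromℤ ε ℚ.* ρ ℚ^ 2) ∎)
          where open ≡-Reasoning
        N≡ℤ : + N ≡ + e ℤ.* (+ r ℤ.* + r)
        N≡ℤ = trans (cong +_ N≡) (trans (ℤ.pos-* e (r * r)) (cong (+ e ℤ.*_) (ℤ.pos-* r r)))
        signs : ∀ n → n ≡ ↥ d → d ≡ fromℤ (+ e) ℚ.* ρ ℚ^ 2 ⊎ d ≡ fromℤ (ℤ.- + e) ℚ.* ρ ℚ^ 2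
        signs (+ n) n≡ = inj₁ (conclude (+ e) (trans (cong (ℤ._* ↧ d) (sym n≡))
          (trans (sym (ℤ.pos-* n (↧ₙ d))) (trans (cong (λ z → + (ℤ.∣ z ∣ * ↧ₙ d)) n≡) N≡ℤ))))
        signs -[1+ n ] n≡ = inj₂ (conclude (ℤ.- + e) (trans (cong (ℤ._* ↧ d) (sym n≡))
          (trans (sym (ℤ.neg-distribˡ-* (+ suc n) (↧ d))) (trans (cong ℤ.-_ (trans (sym (ℤ.pos-* (suc n) (↧ₙ d))) (trans (cong (λ z → + (ℤ.∣ z ∣ * ↧ₙ d)) n≡) N≡ℤ)))
          (ℤ.neg-distribˡ-* (+ e) (+ r ℤ.* + r))))))

-- The two Selmer sets and the equivalence.

module SelmerSets where

  open Rationals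
  open QuadraticResidues
  open SupplementaryLaws
  open AdicValuations
  open Completions
  open HenselLifting
  open OddPlaces
  open RealPlace using (0≤x²; anisotropic-real)
  open DyadicAnisotropy
  open DyadicSolubility
  open TorsorDichotomies
  open ResidueTable
  open SquareClasses
  open import Data.Nat.Solver using () renaming (module +-*-Solver to ℕ-Solver)
  open import Data.Integer.Base using (_+_; _-_; -_; _*_)
  open import Data.Integer.Divisibility.Signed using (divides)
  open import Data.Integer.Solver using () renaming (module +-*-Solver to ℤ-Solver)
  open import Data.Rational.Solver using () renaming (module +-*-Solver to ℚ-Solver)
  open import Algebra.Definitions.RawSemiring ℚ.+-*-rawSemiring using () renaming (_^_ to _ℚ^_)
  open import Function.Bundles using (module Equivalence)

  legendre-isSquare : ∀ a {ℓ} → ¬ ℓ ℕ.∣ ℤ.∣ a ∣ → legendre a ℓ ≡ (if isSquare ℓ a then + 1 else -[1+ 0 ])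
  legendre-isSquare a {ℓ} ℓ∤a = cong (λ b → if b then + 0 else if isSquare ℓ a then + 1 else -[1+ 0 ]) (dec-false (ℓ ℕ.∣? ℤ.∣ a ∣) ℓ∤a)

  ≡1⇔true : ∀ c → (if c then + 1 else -[1+ 0 ]) ≡ + 1 ⇔ c ≡ true
  ≡1⇔true true = mk⇔ (λ _ → refl) (λ _ → refl)
  ≡1⇔true false = mk⇔ (λ ()) (λ ())

  ≡−1⇔false : ∀ c → (if c then + 1 else -[1+ 0 ]) ≡ - (+ 1) ⇔ c ≡ false
  ≡−1⇔false true = mk⇔ (λ ()) (λ ())
  ≡−1⇔false false = mk⇔ (λ _ → refl) (λ _ → refl)

  %16-≈₁₆ : ∀ n → + n ≈₁₆ + (n ℕ.% 16)
  %16-≈₁₆ n = divides (+ (n ℕ./ 16)) (trans (cong (λ m → + m - + (n ℕ.% 16)) (m≡m%n+[m/n]*n n 16))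
    (trans (lemma (+ (n ℕ.% 16)) (+ (n ℕ./ 16 ℕ.* 16))) (ℤ.pos-* (n ℕ./ 16) 16)))
    where
    open ℤ-Solver
    lemma : ∀ a b → a + b - a ≡ b
    lemma = solve 2 (λ a b → a :+ b :- a := b) refl

  ℚ*-≢0 : ∀ (d : ℚ*) → value d ≢ 0ℚ
  ℚ*-≢0 (mkℚ* d {{d-nonZero}}) refl = absurd d-nonZero
    where
    absurd : .(ℚ.NonZero 0ℚ) → ⊥
    absurd ()

  ÷-* : ∀ x (d : ℚ) .{{_ : ℚ.NonZero d}} → (x ℚ.÷ d) ℚ.* d ≡ x
  ÷-* x d = trans (ℚ.*-assoc x (ℚ.1/ d) d) (trans (cong (x ℚ.*_) (ℚ.*-inverseˡ d)) (ℚ.*-identityʳ x))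

  module Theorem (p q : ℕ) (p-prime : Prime p) (q-prime : Prime q) (2∤p : ¬ 2 ℕ.∣ p) (2∤q : ¬ 2 ℕ.∣ q) (p≢q : p ≢ q) where
    open TwoIsogeny p q p-prime q-prime
    open Forms p q p-prime q-prime 2∤p 2∤q p≢q
    open Classification p q p-prime q-prime

    χ : Bool
    χ = isSquare q P

    r s : ℕ
    r = p ℕ.% 16
    s = q ℕ.% 16

    module F = Flags r s χ

    P≈ : P ≈₁₆ + r
    P≈ = %16-≈₁₆ p
    Q≈ : Q ≈₁₆ + s
    Q≈ = %16-≈₁₆ q
    ≈P : + r ≈₁₆ P
    ≈P = ≈₁₆-sym P (+ r) P≈
    ≈Q : + s ≈₁₆ Q
    ≈Q = ≈₁₆-sym Q (+ s) Q≈
    PQ≈ : P * Q ≈₁₆ + r * + s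
    PQ≈ = ≈₁₆-* P (+ r) Q (+ s) P≈ Q≈
    ≈PQ : + r * + s ≈₁₆ P * Q
    ≈PQ = ≈₁₆-sym (P * Q) (+ r * + s) PQ≈

    p-mod-q : isSquare p Q ≡ F.χ′
    p-mod-q = trans (lemma (isSquare p Q) χ) (cong (χ xor_) (quadratic-reciprocity p-prime q-prime 2∤p 2∤q p≢q))
      where
      lemma : ∀ a b → a ≡ b xor (a xor b)
      lemma false false = refl
      lemma false true = refl
      lemma true false = refl
      lemma true true = refl

    square-factor : ∀ {c a b} → c ≡ true → not (c xor (isSquare a b)) ≡ isSquare a b
    square-factor {a = a} {b} refl = Bool.not-involutive (isSquare a b)

    p-mod-4q : isSquare p (+ 4 * Q) ≡ F.χ′
    p-mod-4q = trans (Up.isSquare-* (+ 4) Q Up.unit-4 p∤q) (trans (square-factor {a = p} {Q} (Up.isSquare-true (+ 4) (+ 2) (divides 0ℤ refl))) p-mod-q)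

    p-mod-16· : ∀ a → Up.Unit a → isSquare p (+ 16 * a) ≡ isSquare p a
    p-mod-16· a p∤a = trans (Up.isSquare-* (+ 16) a Up.unit-16 p∤a) (square-factor {a = p} {a} (Up.isSquare-true (+ 16) (+ 4) (divides 0ℤ refl)))

    not-cong : ∀ {a b c d} → a ≡ b → c ≡ d → not (a xor c) ≡ not (b xor d)
    not-cong = cong₂ λ a c → not (a xor c)

    flag-2≡ : does (C₁? 1ℤ (P * Q)) ∧ (isSquare p (+ 2) ∧ isSquare q (+ 2)) ≡ F.flag-2
    flag-2≡ = cong₂ _∧_ (does-⇔ (mk⇔ (C₁-≈₁₆ 1ℤ 1ℤ (P * Q) (+ r * + s) (≈₁₆-refl 1ℤ) PQ≈) (C₁-≈₁₆ 1ℤ 1ℤ (+ r * + s) (P * Q) (≈₁₆-refl 1ℤ) ≈PQ)) (C₁? 1ℤ (P * Q)) (C₁? 1ℤ (+ r * + s)))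
      (cong₂ _∧_ Up.second-supplement Uq.second-supplement)

    flag-p≡ : does (C₂? P Q) ∧ (isSquare p (+ 4 * Q) ∧ isSquare q P) ≡ F.flag-p
    flag-p≡ = cong₂ _∧_ (does-⇔ (mk⇔ (C₂-≈₁₆ P (+ r) Q (+ s) P≈ Q≈) (C₂-≈₁₆ (+ r) P (+ s) Q ≈P ≈Q)) (C₂? P Q) (C₂? (+ r) (+ s)))
      (cong (_∧ χ) p-mod-4q)

    flag-2p≡ : does (C₁? P Q) ∧ (isSquare p (+ 2 * Q) ∧ isSquare q (+ 2 * P)) ≡ F.flag-2p
    flag-2p≡ = cong₂ _∧_ (does-⇔ (mk⇔ (C₁-≈₁₆ P (+ r) Q (+ s) P≈ Q≈) (C₁-≈₁₆ (+ r) P (+ s) Q ≈P ≈Q)) (C₁? P Q) (C₁? (+ r) (+ s)))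
      (cong₂ _∧_ (trans (Up.isSquare-* (+ 2) Q Up.unit-2 p∤q) (not-cong Up.second-supplement p-mod-q))
                 (trans (Uq.isSquare-* (+ 2) P Uq.unit-2 q∤p) (not-cong Uq.second-supplement refl)))

    flag-−1≡ : does (C₄? (- 1ℤ) (P * Q)) ∧ (isSquare p (- 1ℤ) ∧ isSquare q (- 1ℤ)) ≡ F.flag-−1
    flag-−1≡ = cong₂ _∧_ (does-⇔ (mk⇔ (C₄-≈₁₆ (- 1ℤ) (- 1ℤ) (P * Q) (+ r * + s) (≈₁₆-refl (- 1ℤ)) PQ≈) (C₄-≈₁₆ (- 1ℤ) (- 1ℤ) (+ r * + s) (P * Q) (≈₁₆-refl (- 1ℤ)) ≈PQ)) (C₄? (- 1ℤ) (P * Q)) (C₄? (- 1ℤ) (+ r * + s)))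
      (cong₂ _∧_ Up.first-supplement Uq.first-supplement)

    flag-+p≡ : does (C₄? P (- Q)) ∧ (isSquare p (+ 16 * - Q) ∧ isSquare q P) ≡ F.flag-+p
    flag-+p≡ = cong₂ _∧_ (does-⇔ (mk⇔ (C₄-≈₁₆ P (+ r) (- Q) (- + s) P≈ (≈₁₆-neg Q (+ s) Q≈)) (C₄-≈₁₆ (+ r) P (- + s) (- Q) ≈P (≈₁₆-neg (+ s) Q ≈Q))) (C₄? P (- Q)) (C₄? (+ r) (- + s)))
      (cong (_∧ χ) (trans (p-mod-16· (- Q) (Up.unit-neg {Q} p∤q)) (trans (Up.isSquare-neg Q p∤q) (not-cong p-mod-q Up.first-supplement))))

    flag-−p≡ : does (C₄? (- P) Q) ∧ (isSquare p (+ 16 * Q) ∧ isSquare q (- P)) ≡ F.flag-−p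
    flag-−p≡ = cong₂ _∧_ (does-⇔ (mk⇔ (C₄-≈₁₆ (- P) (- + r) Q (+ s) (≈₁₆-neg P (+ r) P≈) Q≈) (C₄-≈₁₆ (- + r) (- P) (+ s) Q (≈₁₆-neg (+ r) P ≈P) ≈Q)) (C₄? (- P) Q) (C₄? (- + r) (+ s)))
      (cong₂ _∧_ (trans (p-mod-16· Q p∤q) p-mod-q) (trans (Uq.isSquare-neg P q∤p) (not-cong {χ} refl Uq.first-supplement)))

    2∤%16 : ∀ n → ¬ 2 ℕ.∣ n → ¬ 2 ℕ.∣ n ℕ.% 16
    2∤%16 n 2∤n 2∣r = 2∤n (subst (2 ℕ.∣_) (sym (m≡m%n+[m/n]*n n 16)) (ℕ.∣m∣n⇒∣m+n 2∣r (ℕ.∣n⇒∣m*n (n ℕ./ 16) (ℕ.divides 8 refl))))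

    conditions⇔no-flag : does (Conditions? P Q χ) ≡ not F.any-flag
    conditions⇔no-flag = trans
      (does-⇔ (mk⇔ (Conditions-≈₁₆ P (+ r) Q (+ s) P≈ Q≈) (Conditions-≈₁₆ (+ r) P (+ s) Q ≈P ≈Q)) (Conditions? P Q χ) (Conditions? (+ r) (+ s) χ))
      (Conditions⇔no-flag r s χ (2∤%16 p 2∤p) (2∤%16 q 2∤q) (m%n<n p 16) (m%n<n q 16))

    -- For d = e ρ² and c = e b the coefficient c/d is b/ρ². This links the torsor of an arbitrary d
    -- to the integral torsor of its representative e.
    quotient : ∀ c e b ρ (d : ℚ) .{{_ : ℚ.NonZero d}} → d ≢ 0ℚ → d ≡ fromℤ e ℚ.* ρ ℚ^ 2 → c ≡ e * b → (fromℤ c ℚ.÷ d) ℚ.* ρ ℚ^ 2 ≡ fromℤ b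
    quotient c e b ρ d d≢0 d≡ c≡ = *-cancelˡ (fromℤ e) e≢0 (begin
      fromℤ e ℚ.* ((fromℤ c ℚ.÷ d) ℚ.* ρ ℚ^ 2) ≡⟨ lemma (fromℤ e) (fromℤ c ℚ.÷ d) ρ ⟩
      (fromℤ c ℚ.÷ d) ℚ.* (fromℤ e ℚ.* ρ ℚ^ 2) ≡⟨ cong ((fromℤ c ℚ.÷ d) ℚ.*_) d≡ ⟨
      (fromℤ c ℚ.÷ d) ℚ.* d ≡⟨ ÷-* (fromℤ c) d ⟩
      fromℤ c ≡⟨ trans (cong fromℤ c≡) (fromℤ-* e b) ⟩
      fromℤ e ℚ.* fromℤ b ∎)
      where
      open ≡-Reasoning
      open ℚ-Solver
      lemma : ∀ e x ρ → e ℚ.* (x ℚ.* ρ ℚ^ 2) ≡ x ℚ.* (e ℚ.* ρ ℚ^ 2)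
      lemma = solve 3 (λ e x ρ → e :* (x :* ρ :^ 2) := x :* (e :* ρ :^ 2)) refl
      e≢0 : fromℤ e ≢ 0ℚ
      e≢0 e≡0 = d≢0 (trans d≡ (trans (cong (ℚ._* ρ ℚ^ 2) e≡0) (ℚ.*-zeroˡ (ρ ℚ^ 2))))

    not-selmer : ∀ c e b (d : ℚ*) (ρ : ℚ*) → SelmerSet c d → value d ≡ fromℤ e ℚ.* value ρ ℚ^ 2 → c ≡ e * b →
      ¬ (∃[ v ] v ∈ S × Anisotropicℤ v e b)
    not-selmer c e b d@(mkℚ* δ) ρ (_ , soluble) d≡ c≡ (v , v∈S , aniso) =
      anisotropic⇒insoluble v {fromℤ e} {fromℤ b} {δ} {fromℤ c ℚ.÷ δ} (value ρ) (ℚ*-≢0 ρ) d≡ (quotient c e b (value ρ) δ (ℚ*-≢0 d) d≡ c≡) aniso (soluble v∈S)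

    -- A prime outside S does not divide e, so d has the parity of order 0 there.
    unramified : ∀ (d : ℚ*) e ρ → value d ≡ fromℤ e ℚ.* ρ ℚ^ 2 → ℤ.∣ e ∣ ℕ.∣ 2 ℕ.* (p ℕ.* q) → ℚ⟨S,2⟩ d
    unramified d e ρ d≡ e∣2pq ℓ ℓ-prime ∉S = subst (λ o → ord ℓ (value d) ≡[mod 2 ] + o) (ordℕ-∤ ℤ.∣ e ∣ ℓ∤e) (ord-parity (value d) e ρ (ℚ*-≢0 d) d≡)
      where
      open Ord ℓ ℓ-prime
      ℓ∤e : ¬ ℓ ℕ.∣ ℤ.∣ e ∣
      ℓ∤e ℓ∣e = [ excluded prime[2] (λ { refl → ∉S (there (here refl)) }) , [ excluded p-prime (λ { refl → ∉S (there (there (here refl))) }) , excluded q-prime (λ { refl → ∉S (there (there (there (here refl)))) }) ]′ ∘ euclidsLemma p q ℓ-prime ]′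
        (euclidsLemma 2 (p ℕ.* q) ℓ-prime (ℕ.∣-trans ℓ∣e e∣2pq))
        where
        excluded : ∀ {t} → Prime t → ℓ ≢ t → ¬ ℓ ℕ.∣ t
        excluded t-prime ℓ≢t ℓ∣t = ℓ≢t (prime∣prime ℓ-prime t-prime ℓ∣t)

    selmer : ∀ c e b {{e≢0 : ℚ.NonZero (fromℤ e)}} → c ≡ e * b → ℤ.∣ e ∣ ℕ.∣ 2 ℕ.* (p ℕ.* q) →
      (∀ {v} → v ∈ S → Solubleℤ e b v) → SelmerSet c (mkℚ* (fromℤ e))
    selmer c e b c≡ e∣2pq soluble = unramified (mkℚ* (fromℤ e)) e 1ℚ (sym (trans (cong (fromℤ e ℚ.*_) 1²≡1) (ℚ.*-identityʳ (fromℤ e)))) e∣2pq ,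
      λ {v} v∈S → subst (λ b → Soluble (fromℤ e) b v) (sym c÷e≡b) (soluble v∈S)
      where
      1²≡1 : 1ℚ ℚ^ 2 ≡ 1ℚ
      1²≡1 = refl
      c÷e≡b : fromℤ c ℚ.÷ fromℤ e ≡ fromℤ b
      c÷e≡b = trans (sym (trans (cong ((fromℤ c ℚ.÷ fromℤ e) ℚ.*_) 1²≡1) (ℚ.*-identityʳ (fromℤ c ℚ.÷ fromℤ e))))
        (quotient c e b 1ℚ (fromℤ e) (ℚ*-≢0 (mkℚ* (fromℤ e))) (sym (trans (cong (fromℤ e ℚ.*_) 1²≡1) (ℚ.*-identityʳ (fromℤ e)))) c≡)

    -- When d = ρ² there is the rational point (1 , ρ , 0).
    selmer-1 : ∀ c d → d ∼ 1* → SelmerSet c d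
    selmer-1 c d@(mkℚ* δ) (ρ , d≡) = unramified d (+ 1) (value ρ) d≡ (ℕ.1∣ _) ,
      λ {v} _ → soluble-√ v δ (fromℤ c ℚ.÷ δ) 1ℚ 0ℚ (inj₁ ℚ.1≢0) (trans (lemma δ (fromℤ c ℚ.÷ δ)) (trans d≡ (ℚ.*-identityˡ (value ρ ℚ^ 2)))) (root-rational v (value ρ))
      where
      open ℚ-Solver
      lemma : ∀ a b → a ℚ.* 1ℚ ℚ^ 4 ℚ.+ b ℚ.* 0ℚ ℚ^ 4 ≡ a
      lemma = solve 2 (λ a b → a :* con 1ℚ :^ 4 :+ b :* con 0ℚ :^ 4 := a) refl

    -- If the second coefficient is a square t², then (0 , tρ , ρ) is a rational point.
    selmer-square : ∀ c e b t (d : ℚ*) (ρ : ℚ*) → c ≡ e * b → fromℤ b ≡ t ℚ^ 2 → ℤ.∣ e ∣ ℕ.∣ 2 ℕ.* (p ℕ.* q) →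
      value d ≡ fromℤ e ℚ.* value ρ ℚ^ 2 → SelmerSet c d
    selmer-square c e b t d@(mkℚ* δ) ρ c≡ b≡ e∣2pq d≡ = unramified d e (value ρ) d≡ e∣2pq ,
      λ {v} _ → soluble-√ v δ (fromℤ c ℚ.÷ δ) 0ℚ (value ρ) (inj₂ (ℚ*-≢0 ρ))
        (trans (lemma δ (fromℤ c ℚ.÷ δ) (value ρ)) (trans (cong (ℚ._* value ρ ℚ^ 2) (trans (quotient c e b (value ρ) δ (ℚ*-≢0 d) d≡ c≡) b≡)) (lemma′ t (value ρ))))
        (root-rational v (t ℚ.* value ρ))
      where
      open ℚ-Solver
      lemma : ∀ a b ρ → a ℚ.* 0ℚ ℚ^ 4 ℚ.+ b ℚ.* ρ ℚ^ 4 ≡ b ℚ.* ρ ℚ^ 2 ℚ.* ρ ℚ^ 2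
      lemma = solve 3 (λ a b ρ → a :* con 0ℚ :^ 4 :+ b :* ρ :^ 4 := b :* ρ :^ 2 :* ρ :^ 2) refl
      lemma′ : ∀ t ρ → t ℚ^ 2 ℚ.* ρ ℚ^ 2 ≡ (t ℚ.* ρ) ℚ^ 2
      lemma′ = solve 2 (λ t ρ → t :^ 2 :* ρ :^ 2 := (t :* ρ) :^ 2) refl

    cφ cφ̂ : ℤ
    cφ = + 4 * pq
    cφ̂ = - (+ 16 * pq)

    pq∣2pq : ℤ.∣ pq ∣ ℕ.∣ 2 ℕ.* (p ℕ.* q)
    pq∣2pq = subst (ℕ._∣ 2 ℕ.* (p ℕ.* q)) (sym (ℤ.abs-* P Q)) (ℕ.n∣m*n 2)

    module _ where
      open ℤ-Solver

      ⊇φ : ∀ {d} → ｛ 1* , pq* ｝ d → Selmer-φ d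
      ⊇φ {d} (inj₁ d∼1) = selmer-1 cφ d d∼1
      ⊇φ {d} (inj₂ (ρ , d≡)) = selmer-square cφ pq (+ 4) (fromℤ (+ 2)) d ρ (ℤ.*-comm (+ 4) pq) refl pq∣2pq d≡

      ⊇φ̂ : ∀ {d} → ｛ 1* , -pq* ｝ d → Selmer-φ̂ d
      ⊇φ̂ {d} (inj₁ d∼1) = selmer-1 cφ̂ d d∼1
      ⊇φ̂ {d} (inj₂ (ρ , d≡)) = selmer-square cφ̂ (- pq) (+ 16) (fromℤ (+ 4)) d ρ (lemma pq) refl (subst (ℕ._∣ 2 ℕ.* (p ℕ.* q)) (sym (ℤ.∣-i∣≡∣i∣ pq)) pq∣2pq) d≡
        where
        lemma : ∀ x → - (+ 16 * x) ≡ - x * + 16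
        lemma = solve 1 (λ x → :- (con (+ 16) :* x) := :- x :* con (+ 16)) refl

    Obstructed : ℤ → ℤ → Set
    Obstructed a b = ∃[ v ] v ∈ S × Anisotropicℤ v a b

    obstructed-swap : ∀ {a b} → Obstructed a b → Obstructed b a
    obstructed-swap {a} {b} (v , v∈S , aniso) = v , v∈S , anisotropic-swap v {fromℤ a} {fromℤ b} aniso

    -- Carries an obstruction to the partner class where the coefficients are exchanged only up to a
    -- power of 2: t = 4 for p and q in the case of φ, t = 16 for the pairs of φ̂.
    obstructed-dual : ∀ {a b} s t → fromℤ t ≡ fromℤ s ℚ^ 2 → fromℤ s ≢ 0ℚ → Obstructed a (t * b) → Obstructed b (t * a)
    obstructed-dual {a} {b} s t t≡s² s≢0 (v , v∈S , aniso) = v , v∈S ,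
      subst (Anisotropic v (fromℤ b)) (sym (scaled a)) (anisotropic-dual v {fromℤ a} {fromℤ b} {fromℤ s} s≢0 (subst (Anisotropic v (fromℤ a)) (scaled b) aniso))
      where
      scaled : ∀ x → fromℤ (t * x) ≡ fromℤ s ℚ^ 2 ℚ.* fromℤ x
      scaled x = trans (fromℤ-* t x) (cong (ℚ._* fromℤ x) t≡s²)

    16≡4² : fromℤ (+ 16) ≡ fromℤ (+ 4) ℚ^ 2
    16≡4² = refl

    -- The cofactor in 2 p q is what exhibits both coefficients of a negative class as negative
    -- integers.
    cofactor : ∀ {e} → Representative e → ∃[ f ] 1 ℕ.≤ f × 2 ℕ.* (p ℕ.* q) ≡ e ℕ.* f
    cofactor = λ where
        rep-1 → 2 ℕ.* (p ℕ.* q) , positive 2 (p ℕ.* q) (s≤s z≤n) 1≤pq , sym (ℕ.*-identityˡ (2 ℕ.* (p ℕ.* q)))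
        rep-2 → p ℕ.* q , 1≤pq , refl
        rep-p → 2 ℕ.* q , positive 2 q (s≤s z≤n) 1≤q , lemma₁ p q
        rep-q → 2 ℕ.* p , positive 2 p (s≤s z≤n) 1≤p , lemma₂ p q
        rep-2p → q , 1≤q , sym (ℕ.*-assoc 2 p q)
        rep-2q → p , 1≤p , lemma₃ p q
        rep-pq → 2 , s≤s z≤n , ℕ.*-comm 2 (p ℕ.* q)
        rep-2pq → 1 , s≤s z≤n , sym (ℕ.*-identityʳ (2 ℕ.* (p ℕ.* q)))
      where
      positive : ∀ m n → 1 ℕ.≤ m → 1 ℕ.≤ n → 1 ℕ.≤ m ℕ.* n
      positive m n = ℕ.*-mono-≤ {1} {m} {1} {n}
      1≤p : 1 ℕ.≤ p
      1≤p = ℕ.>-nonZero⁻¹ p {{prime⇒nonZero p-prime}}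
      1≤q : 1 ℕ.≤ q
      1≤q = ℕ.>-nonZero⁻¹ q {{prime⇒nonZero q-prime}}
      1≤pq : 1 ℕ.≤ p ℕ.* q
      1≤pq = positive p q 1≤p 1≤q
      open ℕ-Solver
      lemma₁ : ∀ p q → 2 ℕ.* (p ℕ.* q) ≡ p ℕ.* (2 ℕ.* q)
      lemma₁ = solve 2 (λ p q → con 2 :* (p :* q) := p :* (con 2 :* q)) refl
      lemma₂ : ∀ p q → 2 ℕ.* (p ℕ.* q) ≡ q ℕ.* (2 ℕ.* p)
      lemma₂ = solve 2 (λ p q → con 2 :* (p :* q) := q :* (con 2 :* p)) refl
      lemma₃ : ∀ p q → 2 ℕ.* (p ℕ.* q) ≡ 2 ℕ.* q ℕ.* p
      lemma₃ = solve 2 (λ p q → con 2 :* (p :* q) := con 2 :* q :* p) refl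

    representative-positive : ∀ {e} → Representative e → 1 ℕ.≤ e
    representative-positive {e} rep with cofactor rep
    ... | f , 1≤f , 2pq≡ef = ℕ.n≢0⇒n>0 λ { refl → case-zero 2pq≡ef }
      where
      case-zero : 2 ℕ.* (p ℕ.* q) ≡ 0 → ⊥
      case-zero eq = ℕ.≢-nonZero⁻¹ (2 ℕ.* (p ℕ.* q)) {{ℕ.m*n≢0 2 (p ℕ.* q) {{_}} {{ℕ.m*n≢0 p q {{prime⇒nonZero p-prime}} {{prime⇒nonZero q-prime}}}}}} eq

    negative-obstructed : ∀ e f → 1 ℕ.≤ e → 1 ℕ.≤ f → Obstructed (- + e) (- + f)
    negative-obstructed e f 1≤e 1≤f = ∞ , here refl , anisotropic-real (≤-1 e 1≤e) (≤-1 f 1≤f)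
      where
      ≤-1 : ∀ n → 1 ℕ.≤ n → fromℤ (- + n) ℚ.≤ ℚ.- 1ℚ
      ≤-1 (suc n) _ = fromℤ-mono-≤ { -[1+ n ]} { -[1+ 0 ]} (ℤ.-≤- z≤n)

    even-obstructed : ∀ x y → Odd x → Odd y → Obstructed (+ 2 * x) (+ 8 * y)
    even-obstructed x y odd-x odd-y = 2-place , there (here refl) , 2a,8b-anisotropic odd-x odd-y

    relabel : ∀ {d e e′} ρ → e ≡ e′ → d ≡ fromℤ e ℚ.* ρ ℚ^ 2 → d ≡ fromℤ e′ ℚ.* ρ ℚ^ 2
    relabel ρ refl d≡ = d≡

    module Insoluble (no-flag : F.any-flag ≡ false) where
      ∨-false : ∀ {a b} → a ∨ b ≡ false → a ≡ false × b ≡ false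
      ∨-false {false} eq = refl , eq

      obstructed-2 : Obstructed (+ 2) (+ 2 * (P * Q))
      obstructed-2 = proj₂ form-2 (trans flag-2≡ (proj₁ (∨-false no-flag)))
      no-flag₁ = proj₂ (∨-false {F.flag-2} no-flag)
      obstructed-p : Obstructed P (+ 4 * Q)
      obstructed-p = proj₂ form-p (trans flag-p≡ (proj₁ (∨-false no-flag₁)))
      no-flag₂ = proj₂ (∨-false {F.flag-p} no-flag₁)
      obstructed-2p : Obstructed (+ 2 * P) (+ 2 * Q)
      obstructed-2p = proj₂ form-2p (trans flag-2p≡ (proj₁ (∨-false no-flag₂)))
      no-flag₃ = proj₂ (∨-false {F.flag-2p} no-flag₂)
      obstructed-−1 : Obstructed (- 1ℤ) (+ 16 * (P * Q))
      obstructed-−1 = proj₂ form-−1 (trans flag-−1≡ (proj₁ (∨-false no-flag₃)))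
      no-flag₄ = proj₂ (∨-false {F.flag-−1} no-flag₃)
      obstructed-+p : Obstructed P (+ 16 * - Q)
      obstructed-+p = proj₂ form-+p (trans flag-+p≡ (proj₁ (∨-false no-flag₄)))
      obstructed-−p : Obstructed (- P) (+ 16 * Q)
      obstructed-−p = proj₂ form-−p (trans flag-−p≡ (proj₂ (∨-false {F.flag-+p} no-flag₄)))

      open ℤ-Solver

      +pq : + (p ℕ.* q) ≡ P * Q
      +pq = ℤ.pos-* p q
      +2p : + (2 ℕ.* p) ≡ + 2 * P
      +2p = ℤ.pos-* 2 p
      +2q : + (2 ℕ.* q) ≡ + 2 * Q
      +2q = ℤ.pos-* 2 q
      +2pq : + (2 ℕ.* (p ℕ.* q)) ≡ + 2 * (P * Q)
      +2pq = trans (ℤ.pos-* 2 (p ℕ.* q)) (cong (+ 2 *_) +pq)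

      ⊆φ : ∀ {d} → Selmer-φ d → ｛ 1* , pq* ｝ d
      ⊆φ {d} d∈ = by-class (classify d (unramified-part d d∈))
        where
        unramified-part : ∀ d → Selmer-φ d → ℚ⟨S,2⟩ d
        unramified-part (mkℚ* _) = proj₁
        refute : ∀ {A : Set} e b {e′} ρ → e′ ≡ e → value d ≡ fromℤ e′ ℚ.* value ρ ℚ^ 2 → cφ ≡ e * b → Obstructed e b → A
        refute e b ρ e′≡e d≡ c≡ obstructed = ⊥-elim (not-selmer cφ e b d ρ d∈ (relabel (value ρ) e′≡e d≡) c≡ obstructed)
        lemma-2 : ∀ P Q → + 4 * (P * Q) ≡ + 2 * (+ 2 * (P * Q))
        lemma-2 = solve 2 (λ P Q → con (+ 4) :* (P :* Q) := con (+ 2) :* (con (+ 2) :* (P :* Q))) refl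
        lemma-2pq : ∀ P Q → + 4 * (P * Q) ≡ + 2 * (P * Q) * + 2
        lemma-2pq = solve 2 (λ P Q → con (+ 4) :* (P :* Q) := con (+ 2) :* (P :* Q) :* con (+ 2)) refl
        lemma-p : ∀ P Q → + 4 * (P * Q) ≡ P * (+ 4 * Q)
        lemma-p = solve 2 (λ P Q → con (+ 4) :* (P :* Q) := P :* (con (+ 4) :* Q)) refl
        lemma-q : ∀ P Q → + 4 * (P * Q) ≡ Q * (+ 4 * P)
        lemma-q = solve 2 (λ P Q → con (+ 4) :* (P :* Q) := Q :* (con (+ 4) :* P)) refl
        lemma-2p : ∀ P Q → + 4 * (P * Q) ≡ + 2 * P * (+ 2 * Q)
        lemma-2p = solve 2 (λ P Q → con (+ 4) :* (P :* Q) := con (+ 2) :* P :* (con (+ 2) :* Q)) refl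
        lemma-2q : ∀ P Q → + 4 * (P * Q) ≡ + 2 * Q * (+ 2 * P)
        lemma-2q = solve 2 (λ P Q → con (+ 4) :* (P :* Q) := con (+ 2) :* Q :* (con (+ 2) :* P)) refl
        negative : ∀ {e} → Representative e → ∃[ f ] 1 ℕ.≤ f × 2 ℕ.* (p ℕ.* q) ≡ e ℕ.* f → ∀ ρ → value d ≡ fromℤ (- + e) ℚ.* value ρ ℚ^ 2 → ｛ 1* , pq* ｝ d
        negative {e} rep (f , 1≤f , 2pq≡ef) ρ d≡ = refute (- + e) (- + (2 ℕ.* f)) ρ refl d≡
          (trans (lemma₁ P Q) (trans (cong (+ 2 *_) (trans (sym +2pq) (trans (cong +_ 2pq≡ef) (ℤ.pos-* e f)))) (trans (lemma₂ (+ e) (+ f)) (cong (λ y → - + e * - y) (sym (ℤ.pos-* 2 f))))))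
          (negative-obstructed e (2 ℕ.* f) (representative-positive rep) (ℕ.≤-trans 1≤f (ℕ.m≤m+n f (f ℕ.+ 0))))
          where
          lemma₁ : ∀ P Q → + 4 * (P * Q) ≡ + 2 * (+ 2 * (P * Q))
          lemma₁ = lemma-2
          lemma₂ : ∀ e f → + 2 * (e * f) ≡ - e * - (+ 2 * f)
          lemma₂ = solve 2 (λ e f → con (+ 2) :* (e :* f) := :- e :* :- (con (+ 2) :* f)) refl
        by-class : ∃[ e ] Representative e × ∃[ ρ ] (value d ≡ fromℤ (+ e) ℚ.* value ρ ℚ^ 2 ⊎ value d ≡ fromℤ (- + e) ℚ.* value ρ ℚ^ 2) → ｛ 1* , pq* ｝ d
        by-class (e , rep , ρ , inj₂ d≡) = negative rep (cofactor rep) ρ d≡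
        by-class (_ , rep-1 , ρ , inj₁ d≡) = inj₁ (ρ , d≡)
        by-class (_ , rep-pq , ρ , inj₁ d≡) = inj₂ (ρ , relabel (value ρ) +pq d≡)
        by-class (_ , rep-2 , ρ , inj₁ d≡) = refute (+ 2) (+ 2 * (P * Q)) ρ refl d≡ (lemma-2 P Q) obstructed-2
        by-class (_ , rep-2pq , ρ , inj₁ d≡) = refute (+ 2 * (P * Q)) (+ 2) ρ +2pq d≡ (lemma-2pq P Q) (obstructed-swap obstructed-2)
        by-class (_ , rep-p , ρ , inj₁ d≡) = refute P (+ 4 * Q) ρ refl d≡ (lemma-p P Q) obstructed-p
        by-class (_ , rep-q , ρ , inj₁ d≡) = refute Q (+ 4 * P) ρ refl d≡ (lemma-q P Q) (obstructed-dual {P} {Q} (+ 2) (+ 4) 4≡2² (λ ()) obstructed-p)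
        by-class (_ , rep-2p , ρ , inj₁ d≡) = refute (+ 2 * P) (+ 2 * Q) ρ +2p d≡ (lemma-2p P Q) obstructed-2p
        by-class (_ , rep-2q , ρ , inj₁ d≡) = refute (+ 2 * Q) (+ 2 * P) ρ +2q d≡ (lemma-2q P Q) (obstructed-swap obstructed-2p)

      -- The eight even classes fail at 2. The odd ones other than 1 and -pq share obstructions in
      -- pairs: -1 with pq, p with -q, and -p with q.
      ⊆φ̂ : ∀ {d} → Selmer-φ̂ d → ｛ 1* , -pq* ｝ d
      ⊆φ̂ {d} d∈ = by-class (classify d (unramified-part d d∈))
        where
        unramified-part : ∀ d → Selmer-φ̂ d → ℚ⟨S,2⟩ d
        unramified-part (mkℚ* _) = proj₁
        refute : ∀ {A : Set} e b {e′} ρ → e′ ≡ e → value d ≡ fromℤ e′ ℚ.* value ρ ℚ^ 2 → cφ̂ ≡ e * b → Obstructed e b → A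
        refute e b ρ e′≡e d≡ c≡ obstructed = ⊥-elim (not-selmer cφ̂ e b d ρ d∈ (relabel (value ρ) e′≡e d≡) c≡ obstructed)
        refute-even : ∀ {A : Set} x y {e′} ρ → e′ ≡ + 2 * x → value d ≡ fromℤ e′ ℚ.* value ρ ℚ^ 2 → - (P * Q) ≡ x * y → Odd x → Odd y → A
        refute-even x y ρ e′≡ d≡ xy≡ odd-x odd-y = refute (+ 2 * x) (+ 8 * y) ρ e′≡ d≡
          (trans (lemma (P * Q)) (trans (cong (+ 16 *_) xy≡) (lemma′ x y))) (even-obstructed x y odd-x odd-y)
          where
          lemma : ∀ n → - (+ 16 * n) ≡ + 16 * - n
          lemma = solve 1 (λ n → :- (con (+ 16) :* n) := con (+ 16) :* :- n) refl
          lemma′ : ∀ x y → + 16 * (x * y) ≡ + 2 * x * (+ 8 * y)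
          lemma′ = solve 2 (λ x y → con (+ 16) :* (x :* y) := con (+ 2) :* x :* (con (+ 8) :* y)) refl
        odd-PQ : Odd (P * Q)
        odd-PQ = odd-* odd-P odd-Q
        neg-2· : ∀ x → - (+ 2 * x) ≡ + 2 * - x
        neg-2· = solve 1 (λ x → :- (con (+ 2) :* x) := con (+ 2) :* :- x) refl
        1·- : ∀ x → - x ≡ 1ℤ * - x
        1·- = solve 1 (λ x → :- x := con 1ℤ :* :- x) refl
        -1· : ∀ x → - x ≡ - 1ℤ * x
        -1· = solve 1 (λ x → :- x := con (- 1ℤ) :* x) refl
        ·-1 : ∀ x → - x ≡ x * - 1ℤ
        ·-1 = solve 1 (λ x → :- x := x :* con (- 1ℤ)) refl
        -·1 : ∀ x → - x ≡ - x * 1ℤ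
        -·1 = solve 1 (λ x → :- x := :- x :* con 1ℤ) refl
        pq₁ : ∀ P Q → - (P * Q) ≡ P * - Q
        pq₁ = solve 2 (λ P Q → :- (P :* Q) := P :* :- Q) refl
        pq₂ : ∀ P Q → - (P * Q) ≡ - P * Q
        pq₂ = solve 2 (λ P Q → :- (P :* Q) := :- P :* Q) refl
        pq₃ : ∀ P Q → - (P * Q) ≡ Q * - P
        pq₃ = solve 2 (λ P Q → :- (P :* Q) := Q :* :- P) refl
        pq₄ : ∀ P Q → - (P * Q) ≡ - Q * P
        pq₄ = solve 2 (λ P Q → :- (P :* Q) := :- Q :* P) refl
        lemma-−1 : ∀ n → - (+ 16 * n) ≡ - 1ℤ * (+ 16 * n)
        lemma-−1 = solve 1 (λ n → :- (con (+ 16) :* n) := con (- 1ℤ) :* (con (+ 16) :* n)) refl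
        lemma-pq : ∀ n → - (+ 16 * n) ≡ n * (+ 16 * - 1ℤ)
        lemma-pq = solve 1 (λ n → :- (con (+ 16) :* n) := n :* (con (+ 16) :* con (- 1ℤ))) refl
        lemma₁ : ∀ x y → - (+ 16 * (x * y)) ≡ x * (+ 16 * - y)
        lemma₁ = solve 2 (λ x y → :- (con (+ 16) :* (x :* y)) := x :* (con (+ 16) :* :- y)) refl
        lemma₂ : ∀ x y → - (+ 16 * (x * y)) ≡ - x * (+ 16 * y)
        lemma₂ = solve 2 (λ x y → :- (con (+ 16) :* (x :* y)) := :- x :* (con (+ 16) :* y)) refl
        lemma₃ : ∀ x y → - (+ 16 * (x * y)) ≡ y * (+ 16 * - x)
        lemma₃ = solve 2 (λ x y → :- (con (+ 16) :* (x :* y)) := y :* (con (+ 16) :* :- x)) refl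
        lemma₄ : ∀ x y → - (+ 16 * (x * y)) ≡ - y * (+ 16 * x)
        lemma₄ = solve 2 (λ x y → :- (con (+ 16) :* (x :* y)) := :- y :* (con (+ 16) :* x)) refl
        dual : ∀ {a b} → Obstructed a (+ 16 * b) → Obstructed b (+ 16 * a)
        dual {a} {b} = obstructed-dual {a} {b} (+ 4) (+ 16) 16≡4² λ ()
        by-class : ∃[ e ] Representative e × ∃[ ρ ] (value d ≡ fromℤ (+ e) ℚ.* value ρ ℚ^ 2 ⊎ value d ≡ fromℤ (- + e) ℚ.* value ρ ℚ^ 2) → ｛ 1* , -pq* ｝ d
        by-class (_ , rep-1 , ρ , inj₁ d≡) = inj₁ (ρ , d≡)
        by-class (_ , rep-pq , ρ , inj₂ d≡) = inj₂ (ρ , relabel (value ρ) (cong -_ +pq) d≡)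
        by-class (_ , rep-1 , ρ , inj₂ d≡) = refute (- 1ℤ) (+ 16 * (P * Q)) ρ refl d≡ (lemma-−1 (P * Q)) obstructed-−1
        by-class (_ , rep-pq , ρ , inj₁ d≡) = refute (P * Q) (+ 16 * - 1ℤ) ρ +pq d≡ (lemma-pq (P * Q)) (dual { - 1ℤ} {P * Q} obstructed-−1)
        by-class (_ , rep-p , ρ , inj₁ d≡) = refute P (+ 16 * - Q) ρ refl d≡ (lemma₁ P Q) obstructed-+p
        by-class (_ , rep-p , ρ , inj₂ d≡) = refute (- P) (+ 16 * Q) ρ refl d≡ (lemma₂ P Q) obstructed-−p
        by-class (_ , rep-q , ρ , inj₁ d≡) = refute Q (+ 16 * - P) ρ refl d≡ (lemma₃ P Q) (dual { - P} {Q} obstructed-−p)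
        by-class (_ , rep-q , ρ , inj₂ d≡) = refute (- Q) (+ 16 * P) ρ refl d≡ (lemma₄ P Q) (dual {P} { - Q} obstructed-+p)
        by-class (_ , rep-2 , ρ , inj₁ d≡) = refute-even 1ℤ (- (P * Q)) ρ refl d≡ (1·- (P * Q)) odd-1 (odd-neg odd-PQ)
        by-class (_ , rep-2 , ρ , inj₂ d≡) = refute-even (- 1ℤ) (P * Q) ρ refl d≡ (-1· (P * Q)) (odd-neg odd-1) odd-PQ
        by-class (_ , rep-2pq , ρ , inj₁ d≡) = refute-even (P * Q) (- 1ℤ) ρ +2pq d≡ (·-1 (P * Q)) odd-PQ (odd-neg odd-1)
        by-class (_ , rep-2pq , ρ , inj₂ d≡) = refute-even (- (P * Q)) 1ℤ ρ (trans (cong -_ +2pq) (neg-2· (P * Q))) d≡ (-·1 (P * Q)) (odd-neg odd-PQ) odd-1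
        by-class (_ , rep-2p , ρ , inj₁ d≡) = refute-even P (- Q) ρ +2p d≡ (pq₁ P Q) odd-P (odd-neg odd-Q)
        by-class (_ , rep-2p , ρ , inj₂ d≡) = refute-even (- P) Q ρ (trans (cong -_ +2p) (neg-2· P)) d≡ (pq₂ P Q) (odd-neg odd-P) odd-Q
        by-class (_ , rep-2q , ρ , inj₁ d≡) = refute-even Q (- P) ρ +2q d≡ (pq₃ P Q) odd-Q (odd-neg odd-P)
        by-class (_ , rep-2q , ρ , inj₂ d≡) = refute-even (- Q) P ρ (trans (cong -_ +2q) (neg-2· Q)) d≡ (pq₄ P Q) (odd-neg odd-Q) odd-P

    -- An equation e = e′ ρ² forces the orders at ℓ to agree modulo 2. Only the orders 0 and 1 are
    -- considered, as e and e′ will be divisors of the squarefree number 2 p q.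
    parity-clash : ∀ {ℓ} → Prime ℓ → ∀ e e′ ρ → fromℤ e ≢ 0ℚ → fromℤ e ≡ fromℤ e′ ℚ.* ρ ℚ^ 2 →
      ordℕ ℓ ℤ.∣ e ∣ ≡ 1 × ordℕ ℓ ℤ.∣ e′ ∣ ≡ 0 ⊎ ordℕ ℓ ℤ.∣ e ∣ ≡ 0 × ordℕ ℓ ℤ.∣ e′ ∣ ≡ 1 → ⊥
    parity-clash {ℓ} ℓ-prime e e′ ρ e≢0 e≡ orders = clash orders
      (subst (λ o → + ordℕ ℓ ℤ.∣ e ∣ - + o ≡[mod 2 ] + ordℕ ℓ ℤ.∣ e′ ∣) ordℕ-1 (ord-parity (fromℤ e) e′ ρ e≢0 e≡))
      where
      open Ord ℓ ℓ-prime
      2∤1 : ¬ 2 ℕ.∣ 1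
      2∤1 2∣1 with () ← ℕ.∣1⇒≡1 2∣1
      clash : ∀ {m n} → m ≡ 1 × n ≡ 0 ⊎ m ≡ 0 × n ≡ 1 → ¬ (+ m - + 0 ≡[mod 2 ] + n)
      clash (inj₁ (refl , refl)) = 2∤1
      clash (inj₂ (refl , refl)) = 2∤1

    module Orders where
      open Ord

      ∤-primes : ∀ {ℓ t} → Prime ℓ → Prime t → ℓ ≢ t → ¬ ℓ ℕ.∣ t
      ∤-primes ℓ-prime t-prime ℓ≢t ℓ∣t = ℓ≢t (prime∣prime ℓ-prime t-prime ℓ∣t)

      ord-self : ∀ {ℓ} (ℓ-prime : Prime ℓ) → ordℕ ℓ ℓ ≡ 1
      ord-self {ℓ} ℓ-prime = trans (cong (ordℕ ℓ) (sym (ℕ.*-identityʳ ℓ))) (ordℕ-exact ℓ ℓ-prime 1 λ ℓ∣1 → ℕ.nonTrivial⇒≢1 {{prime⇒nonTrivial ℓ-prime}} (ℕ.∣1⇒≡1 ℓ∣1))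

      ord₂-2 : ordℕ 2 2 ≡ 1
      ord₂-2 = ord-self prime[2]
      ord₂-1 : ordℕ 2 1 ≡ 0
      ord₂-1 = ordℕ-1 2 prime[2]
      ord₂-pq : ordℕ 2 ℤ.∣ pq ∣ ≡ 0
      ord₂-pq = ordℕ-∤ 2 prime[2] ℤ.∣ pq ∣ λ 2∣pq → [ 2∤p , 2∤q ]′ (euclidsLemma p q prime[2] (subst (2 ℕ.∣_) (ℤ.abs-* P Q) 2∣pq))
      ord₂-2p : ordℕ 2 ℤ.∣ + 2 * P ∣ ≡ 1
      ord₂-2p = trans (cong (ordℕ 2) (ℤ.abs-* (+ 2) P)) (ordℕ-exact 2 prime[2] p 2∤p)
      ordₚ-p : ordℕ p p ≡ 1
      ordₚ-p = ord-self p-prime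
      ordₚ-1 : ordℕ p 1 ≡ 0
      ordₚ-1 = ordℕ-1 p p-prime
      ordₚ-pq : ordℕ p ℤ.∣ pq ∣ ≡ 1
      ordₚ-pq = trans (cong (ordℕ p) (ℤ.abs-* P Q)) (ordℕ-exact p p-prime q (∤-primes p-prime q-prime p≢q))
      ord_q-p : ordℕ q p ≡ 0
      ord_q-p = ordℕ-∤ q q-prime p (∤-primes q-prime p-prime (≢-sym p≢q))
      ord_q-pq : ordℕ q ℤ.∣ pq ∣ ≡ 1
      ord_q-pq = trans (cong (ordℕ q) (trans (ℤ.abs-* P Q) (ℕ.*-comm p q))) (ordℕ-exact q q-prime p (∤-primes q-prime p-prime (≢-sym p≢q)))
      neg-pq : ∀ {ℓ} → ordℕ ℓ ℤ.∣ pq ∣ ≡ 1 → ordℕ ℓ ℤ.∣ - pq ∣ ≡ 1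
      neg-pq {ℓ} eq = trans (cong (ordℕ ℓ) (ℤ.∣-i∣≡∣i∣ pq)) eq
      neg-p : ∀ {ℓ n} → ordℕ ℓ p ≡ n → ordℕ ℓ ℤ.∣ - P ∣ ≡ n
      neg-p {ℓ} eq = trans (cong (ordℕ ℓ) (ℤ.∣-i∣≡∣i∣ P)) eq

    module Soluble-classes
      (φ⊆ : ∀ {d} → Selmer-φ d → ｛ 1* , pq* ｝ d) (φ̂⊆ : ∀ {d} → Selmer-φ̂ d → ｛ 1* , -pq* ｝ d) where
      open Orders
      open ℤ-Solver

      P≢0 : fromℤ P ≢ 0ℚ
      P≢0 = odd≢0 odd-P
      -P≢0 : fromℤ (- P) ≢ 0ℚ
      -P≢0 = odd≢0 (odd-neg odd-P)
      2≢0 : fromℤ (+ 2) ≢ 0ℚ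
      2≢0 ()
      2P≢0 : fromℤ (+ 2 * P) ≢ 0ℚ
      2P≢0 eq = *-≢0 {fromℤ (+ 2)} {fromℤ P} 2≢0 P≢0 (trans (sym (fromℤ-* (+ 2) P)) eq)

      excluded : ∀ c e b (T : ℚ* → Set) → (∀ {d} → SelmerSet c d → T d) → (e≢0 : fromℤ e ≢ 0ℚ) → c ≡ e * b → ℤ.∣ e ∣ ℕ.∣ 2 ℕ.* (p ℕ.* q) →
        (∀ {v} → v ∈ S → Solubleℤ e b v) → T (mkℚ* (fromℤ e) {{ℚ.≢-nonZero e≢0}})
      excluded c e b T ⊆T e≢0 c≡ e∣2pq soluble = ⊆T (selmer c e b {{ℚ.≢-nonZero e≢0}} c≡ e∣2pq soluble)

      p∣2pq : p ℕ.∣ 2 ℕ.* (p ℕ.* q)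
      p∣2pq = ℕ.∣-trans (ℕ.m∣m*n q) (ℕ.n∣m*n 2)

      2p∣2pq : 2 ℕ.* p ℕ.∣ 2 ℕ.* (p ℕ.* q)
      2p∣2pq = ℕ.divides q (trans (sym (ℕ.*-assoc 2 p q)) (ℕ.*-comm (2 ℕ.* p) q))

      -- Otherwise 2 would lie in the class of 1 or of pq, but its order at 2 is odd and theirs is
      -- even.
      2-excluded : ¬ (∀ {v} → v ∈ S → Solubleℤ (+ 2) (+ 2 * (P * Q)) v)
      2-excluded soluble = [ (λ (ρ , eq) → parity-clash prime[2] (+ 2) (+ 1) (value ρ) 2≢0 eq (inj₁ (ord₂-2 , ord₂-1)))
          , (λ (ρ , eq) → parity-clash prime[2] (+ 2) pq (value ρ) 2≢0 eq (inj₁ (ord₂-2 , ord₂-pq))) ]′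
          (excluded cφ (+ 2) (+ 2 * (P * Q)) ｛ 1* , pq* ｝ φ⊆ 2≢0 (lemma (P * Q)) (ℕ.m∣m*n (p ℕ.* q)) soluble)
        where
        lemma : ∀ n → + 4 * n ≡ + 2 * (+ 2 * n)
        lemma = solve 1 (λ n → con (+ 4) :* n := con (+ 2) :* (con (+ 2) :* n)) refl

      -- The order at p separates p from 1, and the order at q separates it from pq.
      p-excluded : ¬ (∀ {v} → v ∈ S → Solubleℤ P (+ 4 * Q) v)
      p-excluded soluble = [ (λ (ρ , eq) → parity-clash p-prime P (+ 1) (value ρ) P≢0 eq (inj₁ (ordₚ-p , ordₚ-1)))
          , (λ (ρ , eq) → parity-clash q-prime P pq (value ρ) P≢0 eq (inj₂ (ord_q-p , ord_q-pq))) ]′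
          (excluded cφ P (+ 4 * Q) ｛ 1* , pq* ｝ φ⊆ P≢0 (lemma P Q) p∣2pq soluble)
        where
        lemma : ∀ P Q → + 4 * (P * Q) ≡ P * (+ 4 * Q)
        lemma = solve 2 (λ P Q → con (+ 4) :* (P :* Q) := P :* (con (+ 4) :* Q)) refl

      2p-excluded : ¬ (∀ {v} → v ∈ S → Solubleℤ (+ 2 * P) (+ 2 * Q) v)
      2p-excluded soluble = [ (λ (ρ , eq) → parity-clash prime[2] (+ 2 * P) (+ 1) (value ρ) 2P≢0 eq (inj₁ (ord₂-2p , ord₂-1)))
          , (λ (ρ , eq) → parity-clash prime[2] (+ 2 * P) pq (value ρ) 2P≢0 eq (inj₁ (ord₂-2p , ord₂-pq))) ]′
          (excluded cφ (+ 2 * P) (+ 2 * Q) ｛ 1* , pq* ｝ φ⊆ 2P≢0 (lemma P Q) (subst (ℕ._∣ 2 ℕ.* (p ℕ.* q)) (sym (ℤ.abs-* (+ 2) P)) 2p∣2pq) soluble)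
        where
        lemma : ∀ P Q → + 4 * (P * Q) ≡ + 2 * P * (+ 2 * Q)
        lemma = solve 2 (λ P Q → con (+ 4) :* (P :* Q) := con (+ 2) :* P :* (con (+ 2) :* Q)) refl

      -- All orders of -1 and 1 agree, so the sign has to decide between them; from -pq the order at
      -- p separates -1.
      −1-excluded : ¬ (∀ {v} → v ∈ S → Solubleℤ (- 1ℤ) (+ 16 * (P * Q)) v)
      −1-excluded soluble = [ (λ (ρ , eq) → negative-square (subst (0ℚ ℚ.≤_) (sym (trans eq (ℚ.*-identityˡ (value ρ ℚ^ 2)))) (0≤x² (value ρ))))
          , (λ (ρ , eq) → parity-clash p-prime (- 1ℤ) (- pq) (value ρ) (λ ()) eq (inj₂ (ordₚ-1 , neg-pq {p} ordₚ-pq))) ]′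
          (excluded cφ̂ (- 1ℤ) (+ 16 * (P * Q)) ｛ 1* , -pq* ｝ φ̂⊆ (λ ()) (lemma (P * Q)) (ℕ.1∣ _) soluble)
        where
        lemma : ∀ n → - (+ 16 * n) ≡ - 1ℤ * (+ 16 * n)
        lemma = solve 1 (λ n → :- (con (+ 16) :* n) := con (- 1ℤ) :* (con (+ 16) :* n)) refl
        negative-square : ¬ 0ℚ ℚ.≤ fromℤ (- 1ℤ)
        negative-square (ℚ.*≤* ())

      +p-excluded : ¬ (∀ {v} → v ∈ S → Solubleℤ P (+ 16 * - Q) v)
      +p-excluded soluble = [ (λ (ρ , eq) → parity-clash p-prime P (+ 1) (value ρ) P≢0 eq (inj₁ (ordₚ-p , ordₚ-1)))
          , (λ (ρ , eq) → parity-clash q-prime P (- pq) (value ρ) P≢0 eq (inj₂ (ord_q-p , neg-pq {q} ord_q-pq))) ]′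
          (excluded cφ̂ P (+ 16 * - Q) ｛ 1* , -pq* ｝ φ̂⊆ P≢0 (lemma P Q) p∣2pq soluble)
        where
        lemma : ∀ x y → - (+ 16 * (x * y)) ≡ x * (+ 16 * - y)
        lemma = solve 2 (λ x y → :- (con (+ 16) :* (x :* y)) := x :* (con (+ 16) :* :- y)) refl

      −p-excluded : ¬ (∀ {v} → v ∈ S → Solubleℤ (- P) (+ 16 * Q) v)
      −p-excluded soluble = [ (λ (ρ , eq) → parity-clash p-prime (- P) (+ 1) (value ρ) -P≢0 eq (inj₁ (neg-p {p} ordₚ-p , ordₚ-1)))
          , (λ (ρ , eq) → parity-clash q-prime (- P) (- pq) (value ρ) -P≢0 eq (inj₂ (neg-p {q} ord_q-p , neg-pq {q} ord_q-pq))) ]′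
          (excluded cφ̂ (- P) (+ 16 * Q) ｛ 1* , -pq* ｝ φ̂⊆ -P≢0 (lemma P Q) (subst (ℕ._∣ 2 ℕ.* (p ℕ.* q)) (sym (ℤ.∣-i∣≡∣i∣ P)) p∣2pq) soluble)
        where
        lemma : ∀ x y → - (+ 16 * (x * y)) ≡ - x * (+ 16 * y)
        lemma = solve 2 (λ x y → :- (con (+ 16) :* (x :* y)) := :- x :* (con (+ 16) :* y)) refl

      no-flag : F.any-flag ≡ false
      no-flag = all-false
        (unflagged flag-2≡ (proj₁ form-2) 2-excluded) (unflagged flag-p≡ (proj₁ form-p) p-excluded) (unflagged flag-2p≡ (proj₁ form-2p) 2p-excluded)
        (unflagged flag-−1≡ (proj₁ form-−1) −1-excluded) (unflagged flag-+p≡ (proj₁ form-+p) +p-excluded) (unflagged flag-−p≡ (proj₁ form-−p) −p-excluded)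
        where
        unflagged : ∀ {a b c f} → c ≡ f → (c ≡ true → ∀ {v} → v ∈ S → Solubleℤ a b v) → ¬ (∀ {v} → v ∈ S → Solubleℤ a b v) → f ≡ false
        unflagged {f = false} _ _ _ = refl
        unflagged {f = true} c≡f soluble excluded = ⊥-elim (excluded (soluble c≡f))
        all-false : ∀ {a b c d e f} → a ≡ false → b ≡ false → c ≡ false → d ≡ false → e ≡ false → f ≡ false → a ∨ b ∨ c ∨ d ∨ e ∨ f ≡ false
        all-false refl refl refl refl refl refl = refl

    -- Turns the Boolean equality supplied by the residue table into an equivalence of propositions.
    decided : ∀ {A : Set} (A? : Dec A) {f} → does A? ≡ not f → A ⇔ f ≡ false
    decided (yes a) {false} eq = mk⇔ (λ _ → refl) (λ _ → a)
    decided (no ¬a) {true} eq = mk⇔ (λ a → contradiction a ¬a) (λ ())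

    theorem : (Selmer-φ ≐ ｛ 1* , pq* ｝ × Selmer-φ̂ ≐ ｛ 1* , -pq* ｝) ⇔ Conditions P Q χ
    theorem = mk⇔
      (λ ((φ⊆ , _) , (φ̂⊆ , _)) → Equivalence.from Conditions⇔ (Soluble-classes.no-flag (λ {d} → φ⊆ {d}) (λ {d} → φ̂⊆ {d})))
      (λ conditions → let open Insoluble (Equivalence.to Conditions⇔ conditions) in ((λ {d} → ⊆φ {d}) , λ {d} → ⊇φ {d}) , ((λ {d} → ⊆φ̂ {d}) , λ {d} → ⊇φ̂ {d}))
      where
      Conditions⇔ : Conditions P Q χ ⇔ F.any-flag ≡ false
      Conditions⇔ = decided (Conditions? P Q χ) conditions⇔no-flag

-- Passage from the Boolean residue symbol to the Legendre symbol.

open import Defs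
open import Data.Integer.Base using (+_; -_; _-_)
open import Data.Nat.Base using (ℕ)
open import Data.Nat.Divisibility using (_∤_)
open import Data.Nat.Primality using (Prime)
open import Data.Product.Base using (_×_)
open import Data.Sum.Base using (_⊎_)
open import Function.Bundles using (_⇔_)
open import Relation.Binary.PropositionalEquality using (_≡_; _≢_)
open import Relation.Unary using (_≐_)
open import Data.Bool.Base using (true; false; if_then_else_)
open import Data.Integer.Base using (-[1+_])
open import Data.Product.Base using (_,_)
import Data.Sum.Base as Sum
open import Function.Base using (_∘_)
open import Function.Bundles using (mk⇔; module Equivalence)
open import Relation.Binary.PropositionalEquality using (sym; trans)

open ResidueTable using (Conditions)
open SelmerSets
open QuadraticResidues using (isSquare; prime∣prime)

theorem1p1 : ∀ (p q : ℕ) (p-prime : Prime p) (q-prime : Prime q) →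
    2 ∤ p → 2 ∤ q → p ≢ q →
    let open TwoIsogeny p q p-prime q-prime in
    (Selmer-φ ≐ ｛ 1* , pq* ｝ × Selmer-φ̂ ≐ ｛ 1* , -pq* ｝)
    ⇔
    ( (+ p ≡[mod 4 ] + 1 × + q ≡[mod 4 ] + 1
    × pq ≡[mod 16 ] + 13 × legendre (+ p) q ≡ - (+ 1))
    ⊎ (+ p ≢[mod 4 ] + q × pq ≡[mod 8 ] + 3 × legendre (+ p) q ≡ - (+ 1))
    ⊎ (+ p ≡[mod 4 ] + q × + q ≡[mod 4 ] + 3 × legendre (+ p) q ≡ + 1
    × + q ≡[mod 8 ] + 3
    × ((+ p - + q ≡[mod 16 ] + 8) ⊎ (+ p - + q ≡[mod 16 ] + 12)))
    ⊎ (+ p ≡[mod 4 ] + q × + q ≡[mod 4 ] + 3 × legendre (+ p) q ≡ - (+ 1)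
    × + p ≡[mod 8 ] + 3
    × ((+ q - + p ≡[mod 16 ] + 8) ⊎ (+ q - + p ≡[mod 16 ] + 12))))
theorem1p1 p q p-prime q-prime 2∤p 2∤q p≢q = mk⇔
    (from-χ ∘ Equivalence.to theorem)
    (Equivalence.from theorem ∘ to-χ)
  where
  open Theorem p q p-prime q-prime 2∤p 2∤q p≢q using (χ; theorem)
  legendre≡ : legendre (+ p) q ≡ (if χ then + 1 else -[1+ 0 ])
  legendre≡ = legendre-isSquare (+ p) λ q∣p → p≢q (sym (prime∣prime q-prime p-prime q∣p))
  +1⇒ : legendre (+ p) q ≡ + 1 → χ ≡ true
  +1⇒ eq = Equivalence.to (≡1⇔true χ) (trans (sym legendre≡) eq)
  ⇒+1 : χ ≡ true → legendre (+ p) q ≡ + 1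
  ⇒+1 eq = trans legendre≡ (Equivalence.from (≡1⇔true χ) eq)
  −1⇒ : legendre (+ p) q ≡ - (+ 1) → χ ≡ false
  −1⇒ eq = Equivalence.to (≡−1⇔false χ) (trans (sym legendre≡) eq)
  ⇒−1 : χ ≡ false → legendre (+ p) q ≡ - (+ 1)
  ⇒−1 eq = trans legendre≡ (Equivalence.from (≡−1⇔false χ) eq)
  from-χ : Conditions (+ p) (+ q) χ → _
  from-χ = Sum.map (λ (a , b , c , l) → a , b , c , ⇒−1 l) (Sum.map (λ (a , b , l) → a , b , ⇒−1 l)
    (Sum.map (λ (a , b , l , c) → a , b , ⇒+1 l , c) (λ (a , b , l , c) → a , b , ⇒−1 l , c)))
  to-χ : _ → Conditions (+ p) (+ q) χ
  to-χ = Sum.map (λ (a , b , c , l) → a , b , c , −1⇒ l) (Sum.map (λ (a , b , l) → a , b , −1⇒ l)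
    (Sum.map (λ (a , b , l , c) → a , b , +1⇒ l , c) (λ (a , b , l , c) → a , b , −1⇒ l , c)))
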